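{- The number of non-isomorphic degree $8$ maximal arcs of proper Mathon type in $\mathrm{PG}(2,2^7)$ is equal to $201$; two of them are Singer $8$-arcs and $199$ of them are normal $8$-arcs.
   Context: Let $q=2^h$, $\mathrm{Tr}$ the absolute trace $\mathrm{GF}(q)\to\mathrm{GF}(2)$. A maximal arc of degree $d$ in $\mathrm{PG}(2,q)$ is a non-empty proper point set meeting every line in $0$ or $d$ points. For $\alpha,\beta\in\mathrm{GF}(q)$ with $\mathrm{Tr}(\alpha\beta)=1$ and $\lambda\in\mathrm{GF}(q)^*$ let $F_{\alpha,\beta,\lambda}=\{(x,y,z):\alpha x^2+xy+\beta y^2+\lambda z^2=0\}$. For $\lambda\ne\lambda'$ define $F_{\alpha,\beta,\lambda}\oplus F_{\alpha',\beta',\lambda'}=F_{\alpha'',\beta'',\lambda+\lambda'}$ with $\alpha''=(\alpha\lambda+\alpha'\lambda')/(\lambda+\lambda')$, $\beta''=(\beta\lambda+\beta'\lambda')/(\lambda+\lambda')$. If a set $\mathcal{C}$ of such conics is closed under $\oplus$ (of distinct members), the union of its conics with $(0,0,1)$ is a maximal arc of degree $|\mathcal{C}|+1$; any image of such an arc under a collineation is a maximal arc of Mathon type. It is of Denniston type if it is an image of one whose conics are all of the form $F_{\alpha,1,\lambda}$ for a fixed $\alpha$ with $\mathrm{Tr}(\alpha)=1$; it is of proper Mathon type if it is of Mathon type but not of Denniston type. Arcs are isomorphic if some element of $\mathrm{P\Gamma L}(3,q)$ maps one onto the other, and the automorphism group of an arc is its stabilizer in $\mathrm{P\Gamma L}(3,q)$.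 A Singer $8$-arc is a degree $8$ maximal arc of proper Mathon type in $\mathrm{PG}(2,2^7)$ whose automorphism group has order $14$; a normal $8$-arc is one whose automorphism group has order $2$. -}

module Defs where

open import Algebra.Bundles using (CommutativeRing; RawRing)
open import Algebra.Morphism.Structures using (module RingMorphisms)
open import Algebra.Structures using (IsCommutativeRing)
open import Data.Fin.Base using (Fin; toℕ)
open import Data.Nat.Base as ℕ using (ℕ)
open import Data.Product.Base using (Σ; ∃; _×_; _,_; proj₁; proj₂)
open import Data.Sum.Base using (_⊎_)
open import Data.Vec.Base using (Vec; []; _∷_; map; zipWith; replicate)
open import Function.Base using (_on_)
open import Function.Bundles using (_↔_; _⇔_)
open import Function.Definitions using (Bijective; Congruent)
open import Level using (Level; 0ℓ; _⊔_)
open import Relation.Binary.Core using (Rel)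
open import Relation.Binary.Definitions using (_Respects_)
open import Relation.Binary.PropositionalEquality
  using (_≡_; _≢_; refl; sym; trans; cong; cong₂)
open import Relation.Nullary.Negation using (¬_)
open import Relation.Unary using (Pred; _∈_; _∉_; _∩_; _∪_; _≐_)

private
  variable
    a ℓ : Level

-- `A` has exactly `n` elements up to `_~_`: there are `n` pairwise unrelated
-- elements such that every element is related to one of them.
HasCard : {A : Set a} → Rel A ℓ → ℕ → Set (a ⊔ ℓ)
HasCard {A = A} _~_ n = ∃ λ (rep : Fin n → A) → Bijective _≡_ _~_ rep

record FiniteField (q : ℕ) : Set₁ where
  infixl 6 _+_
  infixl 7 _*_
  infix  8 -_
  infix  9 _⁻¹
  field
    Carrier           : Set
    _+_ _*_           : Carrier → Carrier → Carrier
    -_                : Carrier → Carrier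
    0# 1#             : Carrier
    isCommutativeRing : IsCommutativeRing _≡_ _+_ _*_ -_ 0# 1#
    1≢0               : 1# ≢ 0#
    -- The value of 0# ⁻¹ is left unspecified.
    _⁻¹               : Carrier → Carrier
    *-inverseʳ        : ∀ x → x ≢ 0# → x * x ⁻¹ ≡ 1#
    finite            : Carrier ↔ Fin q

  commutativeRing : CommutativeRing 0ℓ 0ℓ
  commutativeRing = record { isCommutativeRing = isCommutativeRing }

module Plane (h : ℕ) (F : FiniteField (2 ℕ.^ h)) where

  open FiniteField F using (Carrier; _⁻¹; 1≢0; commutativeRing)
  open CommutativeRing commutativeRing
    using (_+_; _*_; 0#; 1#; rawRing; zeroˡ)
  open import Algebra.Definitions.RawSemiring
    (RawRing.rawSemiring rawRing) using (_^_; sum)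
  open RingMorphisms rawRing rawRing using (IsRingIsomorphism)

  Tr : Carrier → Carrier
  Tr x = sum {n = h} λ i → x ^ (2 ℕ.^ toℕ i)

  V : Set
  V = Vec Carrier 3

  infixl 6 _+ᵥ_
  infixr 7 _·_

  0ᵥ : V
  0ᵥ = replicate 3 0#

  _+ᵥ_ : V → V → V
  _+ᵥ_ = zipWith _+_

  _·_ : Carrier → V → V
  c · v = map (c *_) v

  -- Homogeneous coordinates; points are compared by `_∼_`, never by `_≡_`.
  Point : Set
  Point = ∃ λ (v : V) → v ≢ 0ᵥ

  infix 4 _∼_
  _∼_ : Rel Point 0ℓ
  (v , _) ∼ (w , _) = ∃ λ c → c ≢ 0# × w ≡ c · v

  PointSet : Set₁
  PointSet = Pred Point 0ℓ

  Line : Set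
  Line = ∃ λ (l : V) → l ≢ 0ᵥ

  pointsOn : Line → PointSet
  pointsOn (a ∷ b ∷ c ∷ [] , _) (x ∷ y ∷ z ∷ [] , _) =
    a * x + b * y + c * z ≡ 0#

  HasSize : PointSet → ℕ → Set
  HasSize S n = HasCard {A = ∃ S} (_∼_ on proj₁) n

  image : (Point → Point) → PointSet → PointSet
  image f S Q = ∃ λ P → P ∈ S × f P ∼ Q

  record Collineation : Set where
    field
      to         : Point → Point
      congruent  : Congruent _∼_ _∼_ to
      bijective  : Bijective _∼_ _∼_ to
      mapsLines  : ∀ l → ∃ λ l′ → pointsOn l′ ≐ image to (pointsOn l)

  record ΓL : Set where
    field
      to             : V → V
      σ              : Carrier → Carrier
      σ-automorphism : IsRingIsomorphism σ
      additive       : ∀ u v → to (u +ᵥ v) ≡ to u +ᵥ to v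
      semilinear     : ∀ c v → to (c · v) ≡ σ c · to v
      bijective      : Bijective _≡_ _≡_ to

    private
      0·v : ∀ {n} (v : Vec Carrier n) → map (0# *_) v ≡ replicate n 0#
      0·v []      = refl
      0·v (x ∷ v) = cong₂ _∷_ (zeroˡ x) (0·v v)

      to-0ᵥ : to 0ᵥ ≡ 0ᵥ
      to-0ᵥ = trans (cong to (sym (0·v 0ᵥ)))
             (trans (semilinear 0# 0ᵥ)
             (trans (cong (_· to 0ᵥ) (IsRingIsomorphism.0#-homo σ-automorphism))
                    (0·v (to 0ᵥ))))

    act : Point → Point
    act (v , v≢0) = to v , λ tv≡0 → v≢0 (proj₁ bijective (trans tv≡0 (sym to-0ᵥ)))

  -- PΓL(3,q) is ΓL taken up to this relation.
  infix 4 _≈ₚ_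
  _≈ₚ_ : Rel ΓL 0ℓ
  g ≈ₚ g′ = ∃ λ c → c ≢ 0# × (∀ v → ΓL.to g′ v ≡ c · ΓL.to g v)

  record MaximalArc (d : ℕ) : Set₁ where
    field
      points   : PointSet
      respects : points Respects _∼_
      nonEmpty : ∃ λ P → P ∈ points
      proper   : ∃ λ P → P ∉ points
      meets    : ∀ l → HasSize (points ∩ pointsOn l) 0 ⊎ HasSize (points ∩ pointsOn l) d

  -- The triple (α , β , λ), with μ standing for λ.
  record Conic : Set where
    constructor conic
    field
      α β μ : Carrier

  open Conic

  Admissible : Pred Conic 0ℓ
  Admissible F = Tr (α F * β F) ≡ 1# × μ F ≢ 0#

  conicPoints : Conic → PointSet
  conicPoints (conic α β μ) (x ∷ y ∷ z ∷ [] , _) =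
    α * x ^ 2 + x * y + β * y ^ 2 + μ * z ^ 2 ≡ 0#

  -- Only meaningful when μ F ≢ μ F′.
  infixl 6 _⊕_
  _⊕_ : Conic → Conic → Conic
  F ⊕ F′ = conic ((α F * μ F + α F′ * μ F′) * (μ F + μ F′) ⁻¹)
                 ((β F * μ F + β F′ * μ F′) * (μ F + μ F′) ⁻¹)
                 (μ F + μ F′)

  record IsClosed (C : Pred Conic 0ℓ) : Set where
    field
      admissible : ∀ {F} → F ∈ C → F ∈ Admissible
      composable : ∀ {F F′} → F ∈ C → F′ ∈ C → F ≢ F′ → μ F ≢ μ F′
      closed     : ∀ {F F′} → F ∈ C → F′ ∈ C → F ≢ F′ → F ⊕ F′ ∈ C

  nucleus : Point
  nucleus = 0# ∷ 0# ∷ 1# ∷ [] , λ { eq → 1≢0 (cong third eq) }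
    where
    third : V → Carrier
    third (_ ∷ _ ∷ z ∷ []) = z

  arcOf : Pred Conic 0ℓ → PointSet
  arcOf C = (nucleus ∼_) ∪ λ P → ∃ λ F → F ∈ C × P ∈ conicPoints F

  IsMathonType : PointSet → Set₁
  IsMathonType K = ∃ λ C → IsClosed C ×
    ∃ λ φ → K ≐ image (Collineation.to φ) (arcOf C)

  IsDennistonType : PointSet → Set₁
  IsDennistonType K = ∃ λ C → IsClosed C ×
    (∃ λ α₀ → Tr α₀ ≡ 1# × (∀ {F} → F ∈ C → α F ≡ α₀ × β F ≡ 1#)) ×
    ∃ λ φ → K ≐ image (Collineation.to φ) (arcOf C)

  IsProperMathonType : PointSet → Set₁
  IsProperMathonType K = IsMathonType K × ¬ IsDennistonType K

  ProperMathonArc : ℕ → Set₁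
  ProperMathonArc d = Σ (MaximalArc d) λ K → IsProperMathonType (MaximalArc.points K)

  pointsOf : ∀ {d} → ProperMathonArc d → PointSet
  pointsOf (K , _) = MaximalArc.points K

  infix 4 _≅_
  _≅_ : ∀ {d} → Rel (ProperMathonArc d) 0ℓ
  K ≅ K′ = ∃ λ g → pointsOf K′ ≐ image (ΓL.act g) (pointsOf K)

  Stabilizer : PointSet → Set
  Stabilizer K = ∃ λ g → K ≐ image (ΓL.act g) K

  AutOrder : PointSet → ℕ → Set
  AutOrder K n = HasCard {A = Stabilizer K} (_≈ₚ_ on proj₁) n

module _ (F : FiniteField (2 ℕ.^ 7)) where
  open Plane 7 F

  Singer8Arc : Set₁
  Singer8Arc = Σ (ProperMathonArc 8) λ K → AutOrder (pointsOf K) 14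

  Normal8Arc : Set₁
  Normal8Arc = Σ (ProperMathonArc 8) λ K → AutOrder (pointsOf K) 2

{-# OPTIONS --safe #-}
module Submission where

open import Algebra.Bundles using (CommutativeRing; RawRing)
open import Algebra.Morphism.Structures using (module RingMorphisms)
import Algebra.Properties.CommutativeMonoid.Sum as CommutativeMonoidSum
import Algebra.Properties.Group as GroupProperties
import Algebra.Properties.Semiring.Exp as SemiringExp
import Algebra.Properties.Semiring.Mult as SemiringMult
import Algebra.Solver.Ring as RingSolver
open import Algebra.Solver.Ring.AlmostCommutativeRing using (_-Raw-AlmostCommutative⟶_; fromCommutativeRing)
open import Data.Bool.Base using (Bool; _xor_; _∧_; _∨_; false; if_then_else_; not; true)
open import Data.Bool.ListAction using (all; and; any; or)
import Data.Bool.Properties as Bool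
open import Data.Fin.Base as Fin using (Fin; suc; toℕ; zero)
open import Data.Fin.Permutation as Perm using (Permutation′)
import Data.Fin.Properties as Fin
open import Data.List.Base as List using (List; _++_)
open import Data.List.Membership.Propositional using (_∈_)
import Data.List.Membership.Propositional.Properties as List
import Data.List.Properties as List
open import Data.List.Relation.Unary.All as All using (All)
import Data.List.Relation.Unary.All.Properties as All
open import Data.List.Relation.Unary.Any using (here; there)
open import Data.List.Relation.Unary.Unique.Propositional using (Unique)
import Data.List.Relation.Unary.Unique.Propositional.Properties as Unique
open import Data.Nat.Base as ℕ using (_≡ᵇ_; suc; s≤s; zero; z≤n; ℕ)
open import Data.Nat.DivMod using (_%_; _/_)
import Data.Nat.ListAction as ℕ
import Data.Nat.Properties as ℕ
open import Data.Product.Base using (_,_; _×_; proj₁; proj₂; uncurry; ∃; ∃₂)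
open import Data.Sum.Base using ([_,_]′; _⊎_; inj₁; inj₂)
open import Data.Unit.Base using (tt; ⊤)
open import Data.Vec.Base as Vec using (Vec; []; _∷_; lookup)
import Data.Vec.Properties as Vec
open import Defs
open import Function.Base using (_on_; _∘_; id)
open import Function.Bundles using (Inverse)
open import Level using (0ℓ)
open import Relation.Binary.Core using (Rel)
open import Relation.Binary.Definitions using (DecidableEquality)
open import Relation.Binary.PropositionalEquality
open import Relation.Nullary using (Dec; contradiction; does; no; yes; ¬_)
open import Relation.Nullary.Decidable using (_→-dec_; dec⇒maybe; from-yes; map′; toWitness; ¬?)
open import Relation.Unary using (Pred; _∩_; _≐_)
open ≡-Reasoning

-- Under `⊕` the three quantities `μ`, `αμ` and `βμ` of a conic simply add. For an arc of degree 8
-- the seven parameters `μ` are therefore the nonzero elements of a 3-dimensional GF(2)-subspace `W`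
-- of GF(128), and `αμ` and `βμ` are GF(2)-linear functions of `μ`. Interpolation writes these as
-- linearized polynomials, so that `α` and `β` have the shape `p₀ + p₁ μ + p₂ μ³`. Linear maps that
-- fix the nucleus remove the linear terms. If both cubic coefficients vanish, what remains is a
-- pencil with constant `α` and `β = 1`, which is of Denniston type. Otherwise the conics can be
-- brought to the form `(1 + μ³ , 1 , μ)`, with `μ` in a multiple of `W` (module `Cubic`). The trace
-- condition then says that this subspace is totally isotropic for the alternating form Tr(x²y +
-- xy²).
--
-- Conversely, every totally isotropic 3-space gives a maximal arc (`cubicMaximalArc`). A line
-- through the nucleus is tangent to all seven conics. On any other line the conic with parameter
-- `l` has two points or none, and isotropy makes the deciding trace a linear functional of `l`;
-- hence the line meets either no conic or exactly four of them.
--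
-- By the fundamental theorem of projective geometry every collineation is semilinear, and the field
-- automorphisms are the powers of Frobenius (`fundamental-theorem`, `endomorphism-frobenius`). A
-- semilinear map between two of these cubic arcs sends each conic to a conic of the target, because
-- a conic has too many points to be covered by four from each conic of the target together with the
-- nucleus (`conic-image`). The coefficients of the image conics are polynomials of degree three in
-- the parameter, and comparing them at four parameters leaves, up to a scalar, only a Frobenius
-- power followed by `(x , y , z) ↦ (x , y + εx , z)` with `ε` in GF(2) (`isomorphism-normal-form`).
-- The same comparison excludes a pencil with constant `α`, so cubic arcs are never of Denniston
-- type (`no-constant-source`).
--
-- Isomorphism classes thus correspond to the Frobenius orbits on the totally isotropic 3-subspaces
-- of GF(128), and the automorphism group has order twice that of the stabilizer of the subspace in
-- the Frobenius group of order 7. These orbits are found by computation. The conjugates of a root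
-- of X⁷ + X⁶ + X⁴ + X + 1 form a self-dual normal basis, in which the trace form is the dot product
-- and squaring is a cyclic shift. A search over all echelon bases shows that every totally
-- isotropic 3-space is a shift of one of 201 listed spaces (`complete`), and a comparison within
-- the list shows that its entries lie in different orbits (`clash-free-table`). Two entries are
-- fixed by the shift and give groups of order 14; the other 199 are moved by every nontrivial shift
-- and give groups of order 2.

injective⇒surjective : ∀ {n} (f : Fin n → Fin n) → (∀ {i j} → f i ≡ f j → i ≡ j) → ∀ k → ∃ λ i → f i ≡ k

injective⇒surjective {zero} f inj ()
injective⇒surjective {suc n} f inj k with Fin.any? (λ i → f i Fin.≟ k)
... | yes p = p
-- A missed value `k` could be punched out of the range, giving an injection of `Fin (suc n)` into
-- `Fin n`.
... | no ¬p = contradiction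
  (Fin.injective⇒≤ {f = λ i → Fin.punchOut {i = k} {j = f i} (λ eq → ¬p (i , sym eq))}
    (λ {i} {j} eq → inj (Fin.punchOut-injective {i = k} {j = f i} {k = f j} _ _ eq)))
  ℕ.1+n≰n

-- Finite fields: decidability, characteristic and Fermat's theorem.

module FiniteFieldProperties {q : ℕ} (F : FiniteField q) where
  open import Data.List.Base using ([]; _∷_)
  open import Data.List.Relation.Unary.AllPairs using ([]; _∷_)
  open import Data.List.Relation.Unary.All using ([]; _∷_)
  open FiniteField F public using (Carrier; _⁻¹; 1≢0; *-inverseʳ; finite; commutativeRing)
  open CommutativeRing commutativeRing public
    using (_+_; _*_; -_; 0#; 1#; rawRing; zeroˡ; zeroʳ; +-assoc; +-comm; *-assoc; *-comm;
           +-identityˡ; +-identityʳ; *-identityˡ; *-identityʳ; distribˡ; distribʳ;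
           -‿inverseˡ; -‿inverseʳ; +-commutativeMonoid; *-commutativeMonoid; +-group)
  open import Algebra.Definitions.RawSemiring (RawRing.rawSemiring rawRing) public using (_^_) renaming (_×_ to _•_)

  fromIndex : Fin q → Carrier
  fromIndex = Inverse.from finite

  toIndex : Carrier → Fin q
  toIndex = Inverse.to finite

  from-to : ∀ x → fromIndex (toIndex x) ≡ x
  from-to x = Inverse.strictlyInverseʳ finite x

  to-from : ∀ i → toIndex (fromIndex i) ≡ i
  to-from i = Inverse.strictlyInverseˡ finite i

  toIndex-injective : ∀ {x y} → toIndex x ≡ toIndex y → x ≡ y
  toIndex-injective {x} {y} p = trans (sym (from-to x)) (trans (cong fromIndex p) (from-to y))

  infix 4 _≟_
  _≟_ : DecidableEquality Carrier
  x ≟ y with toIndex x Fin.≟ toIndex y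
  ... | yes p = yes (toIndex-injective p)
  ... | no ¬p = no λ eq → ¬p (cong toIndex eq)

  permutation : (f g : Carrier → Carrier) → (∀ x → f (g x) ≡ x) → (∀ x → g (f x) ≡ x) → Permutation′ q
  permutation f g fg gf = Perm.permutation (toIndex ∘ f ∘ fromIndex) (toIndex ∘ g ∘ fromIndex)
    (λ i → trans (cong (toIndex ∘ f) (from-to _)) (trans (cong toIndex (fg _)) (to-from i)))
    (λ i → trans (cong (toIndex ∘ g) (from-to _)) (trans (cong toIndex (gf _)) (to-from i)))

  *-cancelˡ-≢0 : ∀ {x y z} → x ≢ 0# → x * y ≡ x * z → y ≡ z
  *-cancelˡ-≢0 {x} {y} {z} x≢0 eq = begin
    y               ≡⟨ lemma y ⟨
    x ⁻¹ * (x * y)  ≡⟨ cong (x ⁻¹ *_) eq ⟩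
    x ⁻¹ * (x * z)  ≡⟨ lemma z ⟩
    z               ∎
    where
    lemma : ∀ w → x ⁻¹ * (x * w) ≡ w
    lemma w = begin
      x ⁻¹ * (x * w)  ≡⟨ *-assoc _ _ _ ⟨
      x ⁻¹ * x * w    ≡⟨ cong (_* w) (trans (*-comm _ _) (*-inverseʳ x x≢0)) ⟩
      1# * w          ≡⟨ *-identityˡ w ⟩
      w               ∎

  *-≢0 : ∀ {x y} → x ≢ 0# → y ≢ 0# → x * y ≢ 0#
  *-≢0 x≢0 y≢0 eq = y≢0 (*-cancelˡ-≢0 x≢0 (trans eq (sym (zeroʳ _))))

  zero-product : ∀ {x y} → x * y ≡ 0# → x ≢ 0# → y ≡ 0#
  zero-product eq x≢0 = *-cancelˡ-≢0 x≢0 (trans eq (sym (zeroʳ _)))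

  opaque
    exists? : {P : Carrier → Set} → (∀ x → Dec (P x)) → Dec (∃ P)
    exists? {P} P? with Fin.any? (P? ∘ fromIndex)
    ... | yes (i , p) = yes (fromIndex i , p)
    ... | no ¬p       = no λ (x , p) → ¬p (toIndex x , subst P (sym (from-to x)) p)

    elements : List Carrier
    elements = List.map fromIndex (List.allFin q)

    elements-unique : Unique elements
    elements-unique = Unique.map⁺ (λ {i} {j} eq → trans (sym (to-from i)) (trans (cong toIndex eq) (to-from j)))
      (Unique.allFin⁺ q)

    length-elements : List.length elements ≡ q
    length-elements = trans (List.length-map fromIndex (List.allFin q)) (List.length-tabulate id)

  injection⇒surjection : {A : Set} (a : Fin q → A) (f : A → Carrier) → (∀ {i j} → a i ≡ a j → i ≡ j) →
                         (∀ {x y} → f x ≡ f y → x ≡ y) → ∀ y → ∃ λ x → f x ≡ y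
  injection⇒surjection a f a-inj f-inj y =
    let (i , eq) = injective⇒surjective (toIndex ∘ f ∘ a) (λ eq → a-inj (f-inj (toIndex-injective eq))) (toIndex y)
    in a i , toIndex-injective eq

  module _ where
    open CommutativeMonoidSum +-commutativeMonoid

    -- Adding 1 permutes the field.
    q•1≡0 : q • 1# ≡ 0#
    q•1≡0 = GroupProperties.identityʳ-unique +-group (sum fromIndex) (q • 1#) (begin
      sum fromIndex + q • 1#                 ≡⟨ cong (sum fromIndex +_) (sum-replicate q) ⟨
      sum fromIndex + sum {q} (λ _ → 1#)     ≡⟨ ∑-distrib-+ fromIndex (λ _ → 1#) ⟨
      sum (λ i → fromIndex i + 1#)           ≡⟨ sum-cong-≗ (λ i → from-to (fromIndex i + 1#)) ⟨
      sum (λ i → fromIndex (toIndex (fromIndex i + 1#))) ≡⟨ sum-permute fromIndex π ⟨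
      sum fromIndex ∎)
      where
      π = permutation (_+ 1#) (_+ - 1#)
           (λ x → trans (+-assoc _ _ _) (trans (cong (x +_) (-‿inverseˡ 1#)) (+-identityʳ x)))
           (λ x → trans (+-assoc _ _ _) (trans (cong (x +_) (-‿inverseʳ 1#)) (+-identityʳ x)))

  module _ (a : Carrier) (a≢0 : a ≢ 0#) where
    open CommutativeMonoidSum *-commutativeMonoid renaming (sum to ∏)

    private
      -- Products run over all indices, zero included, so each constant factor `a` is split into
      -- `off₀ a`, carried by the nonzero elements, and `at₀ a`, carried by zero. The latter
      -- supplies the extra factor that makes the result `a ^ q ≡ a`.
      off₀ at₀ : Carrier → Carrier → Carrier
      off₀ c x with x ≟ 0#
      ... | yes _ = 1#
      ... | no  _ = c
      at₀ c x with x ≟ 0#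
      ... | yes _ = c
      ... | no  _ = 1#

      nz : Carrier → Carrier
      nz x = off₀ x x

      nz≢0 : ∀ x → nz x ≢ 0#
      nz≢0 x with x ≟ 0#
      ... | yes _ = 1≢0
      ... | no x≢0 = x≢0

      ∏≢0 : ∀ {n} (f : Fin n → Carrier) → (∀ i → f i ≢ 0#) → ∏ f ≢ 0#
      ∏≢0 {zero}  f _ = 1≢0
      ∏≢0 {suc n} f h = *-≢0 (h zero) (∏≢0 (f ∘ suc) (h ∘ suc))

      nz-* : ∀ x → nz (a * x) ≡ nz x * off₀ a x
      nz-* x with x ≟ 0# | a * x ≟ 0#
      ... | yes _ | yes _ = sym (*-identityˡ 1#)
      ... | no _ | no _ = *-comm a x
      ... | yes refl | no ax≢0 = contradiction (zeroʳ a) ax≢0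
      ... | no x≢0 | yes ax≡0 = contradiction (zero-product ax≡0 a≢0) x≢0

      off-at : ∀ x → off₀ a x * at₀ a x ≡ a
      off-at x with x ≟ 0#
      ... | yes _ = *-identityˡ a
      ... | no _ = *-identityʳ a

      at-≢ : ∀ x → x ≢ 0# → at₀ a x ≡ 1#
      at-≢ x h with x ≟ 0#
      ... | yes p = contradiction p h
      ... | no _ = refl

      at-0 : at₀ a 0# ≡ a
      at-0 with 0# ≟ 0#
      ... | yes p = refl
      ... | no h = contradiction refl h

      ∏-1 : ∀ {n} (f : Fin n → Carrier) → (∀ i → f i ≡ 1#) → ∏ f ≡ 1#
      ∏-1 {zero} f _ = refl
      ∏-1 {suc n} f h = trans (cong₂ _*_ (h zero) (∏-1 (f ∘ suc) (h ∘ suc))) (*-identityˡ 1#)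

      ∏-single : ∀ {n} (f : Fin n → Carrier) i → (∀ j → j ≢ i → f j ≡ 1#) → ∏ f ≡ f i
      ∏-single f zero h = trans (cong (f zero *_) (∏-1 (f ∘ suc) (λ i → h (suc i) λ ()))) (*-identityʳ _)
      ∏-single f (suc i) h = trans (cong₂ _*_ (h zero λ ()) (∏-single (f ∘ suc) i (λ j j≢i → h (suc j) (j≢i ∘ Fin.suc-injective)))) (*-identityˡ _)

      ∏-off : ∏ (λ i → off₀ a (fromIndex i)) ≡ 1#
      ∏-off = *-cancelˡ-≢0 (∏≢0 (nz ∘ fromIndex) (nz≢0 ∘ fromIndex)) (begin
        ∏ (nz ∘ fromIndex) * ∏ (λ i → off₀ a (fromIndex i)) ≡⟨ ∑-distrib-+ (nz ∘ fromIndex) _ ⟨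
        ∏ (λ i → nz (fromIndex i) * off₀ a (fromIndex i)) ≡⟨ sum-cong-≗ (λ i → trans (cong nz (from-to _)) (nz-* (fromIndex i))) ⟨
        ∏ (λ i → nz (fromIndex (toIndex (a * fromIndex i)))) ≡⟨ sum-permute (nz ∘ fromIndex) π ⟨
        ∏ (nz ∘ fromIndex) ≡⟨ *-identityʳ _ ⟨
        ∏ (nz ∘ fromIndex) * 1# ∎)
        where
        cancel : ∀ b c → b * c ≡ 1# → ∀ x → b * (c * x) ≡ x
        cancel b c bc x = trans (sym (*-assoc _ _ _)) (trans (cong (_* x) bc) (*-identityˡ x))
        π = permutation (a *_) (a ⁻¹ *_) (cancel a (a ⁻¹) (*-inverseʳ a a≢0))
              (cancel (a ⁻¹) a (trans (*-comm _ _) (*-inverseʳ a a≢0)))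

      ∏-at : ∏ (λ i → at₀ a (fromIndex i)) ≡ a
      ∏-at = begin
        ∏ (λ i → at₀ a (fromIndex i)) ≡⟨ ∏-single _ (toIndex 0#) (λ j j≢ → at-≢ _ λ eq → j≢ (trans (sym (to-from j)) (cong toIndex eq))) ⟩
        at₀ a (fromIndex (toIndex 0#)) ≡⟨ cong (at₀ a) (from-to 0#) ⟩
        at₀ a 0# ≡⟨ at-0 ⟩
        a ∎

    -- Multiplication by a permutes the nonzero elements; their product is compared with its image.
    fermat-≢0 : a ^ q ≡ a
    fermat-≢0 = begin
      a ^ q ≡⟨ sum-replicate q ⟨
      ∏ {q} (λ _ → a) ≡⟨ sum-cong-≗ (λ i → off-at (fromIndex i)) ⟨
      ∏ (λ i → off₀ a (fromIndex i) * at₀ a (fromIndex i)) ≡⟨ ∑-distrib-+ (λ i → off₀ a (fromIndex i)) _ ⟩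
      ∏ (λ i → off₀ a (fromIndex i)) * ∏ (λ i → at₀ a (fromIndex i)) ≡⟨ cong₂ _*_ ∏-off ∏-at ⟩
      1# * a ≡⟨ *-identityˡ a ⟩
      a ∎

-- Vectors and subspaces over GF(2).

module BinaryVectors where
  open import Data.List.Base using ([]; _∷_)

  every : ∀ n → (Vec Bool n → Bool) → Bool
  every zero    p = p []
  every (suc n) p = every n (p ∘ (true ∷_)) ∧ every n (p ∘ (false ∷_))

  ∧-elim : ∀ {a b} → a ∧ b ≡ true → a ≡ true × b ≡ true
  ∧-elim {true} eq = refl , eq

  every-sound : ∀ n p → every n p ≡ true → ∀ v → p v ≡ true
  every-sound zero p eq [] = eq
  every-sound (suc n) p eq (true ∷ v)  = every-sound n _ (proj₁ (∧-elim eq)) v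
  every-sound (suc n) p eq (false ∷ v) = every-sound n _ (proj₂ (∧-elim {every n (p ∘ (true ∷_))} eq)) v

  fromFin : ∀ n → Fin (2 ℕ.^ n) → Vec Bool n
  fromFin zero    _ = []
  fromFin (suc n) i = let (a , j) = Fin.remQuot {2} (2 ℕ.^ n) i in does (a Fin.≟ zero) ∷ fromFin n j

  fromFin-injective : ∀ n {i j} → fromFin n i ≡ fromFin n j → i ≡ j
  fromFin-injective zero {zero} {zero} _ = refl
  fromFin-injective (suc n) {i} {j} eq = begin
    i                                                           ≡⟨ Fin.combine-remQuot {2} (2 ℕ.^ n) i ⟨
    uncurry (Fin.combine {2}) (Fin.remQuot {2} (2 ℕ.^ n) i)     ≡⟨ cong (uncurry (Fin.combine {2})) (cong₂ _,_
      (≟0-injective (proj₁ (Fin.remQuot {2} (2 ℕ.^ n) i)) (proj₁ (Fin.remQuot {2} (2 ℕ.^ n) j)) (Vec.∷-injectiveˡ eq))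
      (fromFin-injective n (Vec.∷-injectiveʳ eq))) ⟩
    uncurry (Fin.combine {2}) (Fin.remQuot {2} (2 ℕ.^ n) j)     ≡⟨ Fin.combine-remQuot {2} (2 ℕ.^ n) j ⟩
    j                                                           ∎
    where
    ≟0-injective : ∀ (a b : Fin 2) → does (a Fin.≟ zero) ≡ does (b Fin.≟ zero) → a ≡ b
    ≟0-injective zero       zero       _ = refl
    ≟0-injective (suc zero) (suc zero) _ = refl

  infixl 6 _⊞_
  _⊞_ : ∀ {n} → Vec Bool n → Vec Bool n → Vec Bool n
  _⊞_ = Vec.zipWith _xor_

  dot : ∀ {n} → Vec Bool n → Vec Bool n → Bool
  dot []      []      = false
  dot (a ∷ u) (b ∷ v) = (a ∧ b) xor dot u v

  -- On coordinates in a normal basis, squaring is a cyclic shift.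
  rot : Vec Bool 7 → Vec Bool 7
  rot (a ∷ b ∷ c ∷ d ∷ e ∷ f ∷ g ∷ []) = g ∷ a ∷ b ∷ c ∷ d ∷ e ∷ f ∷ []

  rot^ : ℕ → Vec Bool 7 → Vec Bool 7
  rot^ zero    v = v
  rot^ (suc k) v = rot (rot^ k v)

  unit : ∀ {n} → Fin n → Vec Bool n
  unit i = Vec.tabulate λ j → does (i Fin.≟ j)

  every-dec : ∀ n {P : Vec Bool n → Set} → (∀ v → Dec (P v)) → Dec (∀ v → P v)
  every-dec zero P? with P? []
  ... | yes p = yes λ { [] → p }
  ... | no ¬p = no λ f → ¬p (f [])
  every-dec (suc n) P? with every-dec n (P? ∘ (true ∷_)) | every-dec n (P? ∘ (false ∷_))
  ... | yes p | yes q = yes λ { (true ∷ v) → p v ; (false ∷ v) → q v }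
  ... | no ¬p | _     = no λ f → ¬p (f ∘ (true ∷_))
  ... | yes _ | no ¬q = no λ f → ¬q (f ∘ (false ∷_))

  opaque
    dot-unit : ∀ (v : Vec Bool 7) (i : Fin 7) → dot v (unit i) ≡ lookup v i
    dot-unit = from-yes (every-dec 7 λ v → Fin.all? λ i → dot v (unit i) Bool.≟ lookup v i)

    -- The self-dual normal bases generators are the cyclic shifts of a single vector.
    conjugates : ∀ v → dot v v ≡ true → dot v (rot v) ≡ false → dot v (rot^ 2 v) ≡ false → dot v (rot^ 3 v) ≡ false →
                 ∃ λ (k : Fin 7) → v ≡ rot^ (toℕ k) (unit zero)
    conjugates = from-yes (every-dec 7 λ v → (dot v v Bool.≟ true) →-dec ((dot v (rot v) Bool.≟ false) →-dec
      ((dot v (rot^ 2 v) Bool.≟ false) →-dec ((dot v (rot^ 3 v) Bool.≟ false) →-dec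
      Fin.any? λ (k : Fin 7) → Vec.≡-dec Bool._≟_ v (rot^ (toℕ k) (unit zero))))))

  module _ where
    ⊞-comm : ∀ {n} (u v : Vec Bool n) → u ⊞ v ≡ v ⊞ u
    ⊞-comm = Vec.zipWith-comm Bool.xor-comm

    ⊞-assoc : ∀ {n} (u v w : Vec Bool n) → u ⊞ v ⊞ w ≡ u ⊞ (v ⊞ w)
    ⊞-assoc = Vec.zipWith-assoc Bool.xor-assoc

    0ⱽ : ∀ {n} → Vec Bool n
    0ⱽ = Vec.replicate _ false

    ⊞-identityˡ : ∀ {n} (v : Vec Bool n) → 0ⱽ ⊞ v ≡ v
    ⊞-identityˡ = Vec.zipWith-identityˡ Bool.xor-identityˡ

    ⊞-identityʳ : ∀ {n} (v : Vec Bool n) → v ⊞ 0ⱽ ≡ v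
    ⊞-identityʳ = Vec.zipWith-identityʳ Bool.xor-identityʳ

    ⊞-self : ∀ {n} (v : Vec Bool n) → v ⊞ v ≡ 0ⱽ
    ⊞-self []      = refl
    ⊞-self (a ∷ v) = cong₂ _∷_ (Bool.xor-same a) (⊞-self v)

  combine : ∀ {n k} → Vec Bool k → Vec (Vec Bool n) k → Vec Bool n
  combine []          []       = 0ⱽ
  combine (true ∷ s)  (v ∷ vs) = v ⊞ combine s vs
  combine (false ∷ s) (v ∷ vs) = combine s vs

  combine-0 : ∀ {n k} (vs : Vec (Vec Bool n) k) → combine 0ⱽ vs ≡ 0ⱽ
  combine-0 []       = refl
  combine-0 (v ∷ vs) = combine-0 vs

  combine-⊞ : ∀ {n k} (s t : Vec Bool k) (vs : Vec (Vec Bool n) k) → combine (s ⊞ t) vs ≡ combine s vs ⊞ combine t vs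
  combine-⊞ [] [] [] = sym (⊞-identityˡ 0ⱽ)
  combine-⊞ (true ∷ s) (true ∷ t) (v ∷ vs) = begin
    combine (s ⊞ t) vs                                ≡⟨ combine-⊞ s t vs ⟩
    combine s vs ⊞ combine t vs                       ≡⟨ cong (_⊞ combine t vs) (trans (cong (_⊞ combine s vs) (⊞-self v)) (⊞-identityˡ _)) ⟨
    v ⊞ v ⊞ combine s vs ⊞ combine t vs               ≡⟨ cong (_⊞ combine t vs) (trans (⊞-assoc v v _) (trans (cong (v ⊞_) (⊞-comm v _)) (sym (⊞-assoc v _ v)))) ⟩
    v ⊞ combine s vs ⊞ v ⊞ combine t vs               ≡⟨ ⊞-assoc _ v _ ⟩
    v ⊞ combine s vs ⊞ (v ⊞ combine t vs)             ∎
  combine-⊞ (true ∷ s) (false ∷ t) (v ∷ vs) = trans (cong (v ⊞_) (combine-⊞ s t vs)) (sym (⊞-assoc v _ _))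
  combine-⊞ (false ∷ s) (true ∷ t) (v ∷ vs) = begin
    v ⊞ combine (s ⊞ t) vs                   ≡⟨ cong (v ⊞_) (combine-⊞ s t vs) ⟩
    v ⊞ (combine s vs ⊞ combine t vs)        ≡⟨ ⊞-assoc v _ _ ⟨
    v ⊞ combine s vs ⊞ combine t vs          ≡⟨ cong (_⊞ combine t vs) (⊞-comm v _) ⟩
    combine s vs ⊞ v ⊞ combine t vs          ≡⟨ ⊞-assoc _ v _ ⟩
    combine s vs ⊞ (v ⊞ combine t vs)        ∎
  combine-⊞ (false ∷ s) (false ∷ t) (v ∷ vs) = combine-⊞ s t vs

  Independent : ∀ {n k} → Vec (Vec Bool n) k → Set
  Independent vs = ∀ s → combine s vs ≡ 0ⱽ → s ≡ 0ⱽ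

  ⊞≡0⇒≡ : ∀ {n} {u v : Vec Bool n} → u ⊞ v ≡ 0ⱽ → u ≡ v
  ⊞≡0⇒≡ {u = u} {v} eq = begin
    u               ≡⟨ ⊞-identityʳ u ⟨
    u ⊞ 0ⱽ          ≡⟨ cong (u ⊞_) (⊞-self v) ⟨
    u ⊞ (v ⊞ v)     ≡⟨ ⊞-assoc u v v ⟨
    u ⊞ v ⊞ v       ≡⟨ cong (_⊞ v) eq ⟩
    0ⱽ ⊞ v          ≡⟨ ⊞-identityˡ v ⟩
    v               ∎

  combine-injective : ∀ {n k} {vs : Vec (Vec Bool n) k} → Independent vs → ∀ {s t} → combine s vs ≡ combine t vs → s ≡ t
  combine-injective {vs = vs} ind {s} {t} eq = ⊞≡0⇒≡ (ind (s ⊞ t)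
    (trans (combine-⊞ s t vs) (trans (cong (_⊞ combine t vs) eq) (⊞-self _))))

  infix 4 _∈⟨_⟩ _⊑_
  _∈⟨_⟩ : ∀ {n k} → Vec Bool n → Vec (Vec Bool n) k → Set
  v ∈⟨ vs ⟩ = ∃ λ s → combine s vs ≡ v

  -- Inclusion of spans. Subspaces are handled throughout by generating vectors, and equality of
  -- subspaces by two such inclusions.
  _⊑_ : ∀ {n j k} → Vec (Vec Bool n) j → Vec (Vec Bool n) k → Set
  us ⊑ vs = ∀ s → combine s us ∈⟨ vs ⟩

  ⊑-[] : ∀ {n k} {vs : Vec (Vec Bool n) k} → [] ⊑ vs
  ⊑-[] {vs = vs} [] = 0ⱽ , combine-0 vs

  ⊑-∷ : ∀ {n j k} {u : Vec Bool n} {us : Vec (Vec Bool n) j} {vs : Vec (Vec Bool n) k} →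
        u ∈⟨ vs ⟩ → us ⊑ vs → u ∷ us ⊑ vs
  ⊑-∷ _ us⊑ (false ∷ s) = us⊑ s
  ⊑-∷ {vs = vs} (t , eq) us⊑ (true ∷ s) = let (r , eq′) = us⊑ s in
    t ⊞ r , trans (combine-⊞ t r vs) (cong₂ _⊞_ eq eq′)

  ⊑-trans : ∀ {n i j k} {us : Vec (Vec Bool n) i} {vs : Vec (Vec Bool n) j} {ws : Vec (Vec Bool n) k} →
            us ⊑ vs → vs ⊑ ws → us ⊑ ws
  ⊑-trans us⊑vs vs⊑ws s = let (t , p) = us⊑vs s ; (r , q) = vs⊑ws t in r , trans q p

  ∈-head : ∀ {n k} {v : Vec Bool n} {vs : Vec (Vec Bool n) k} → v ∈⟨ v ∷ vs ⟩
  ∈-head {v = v} {vs} = true ∷ 0ⱽ , trans (cong (v ⊞_) (combine-0 vs)) (⊞-identityʳ v)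

  ⊑-tail : ∀ {n j k} {us : Vec (Vec Bool n) j} {v : Vec Bool n} {vs : Vec (Vec Bool n) k} → us ⊑ vs → us ⊑ v ∷ vs
  ⊑-tail us⊑vs s = let (t , eq) = us⊑vs s in false ∷ t , eq

  ∈-tail : ∀ {n k} {u v : Vec Bool n} {vs : Vec (Vec Bool n) k} → u ∈⟨ vs ⟩ → u ∈⟨ v ∷ vs ⟩
  ∈-tail (s , eq) = false ∷ s , eq

  ∈-⊑ : ∀ {n j k} {u : Vec Bool n} {us : Vec (Vec Bool n) j} {vs : Vec (Vec Bool n) k} → u ∈⟨ us ⟩ → us ⊑ vs → u ∈⟨ vs ⟩
  ∈-⊑ (s , eq) us⊑vs = let (t , p) = us⊑vs s in t , trans p eq

  ⊑-refl : ∀ {n k} {vs : Vec (Vec Bool n) k} → vs ⊑ vs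
  ⊑-refl s = s , refl

  ∈-⊞ : ∀ {n k} {u v : Vec Bool n} {vs : Vec (Vec Bool n) k} → u ∈⟨ vs ⟩ → v ∈⟨ vs ⟩ → u ⊞ v ∈⟨ vs ⟩
  ∈-⊞ {vs = vs} (s , p) (t , q) = s ⊞ t , trans (combine-⊞ s t vs) (cong₂ _⊞_ p q)

  pad : ∀ {n k} → Vec (Vec Bool n) k → Vec (Vec Bool (suc n)) k
  pad = Vec.map (false ∷_)

  combine-pad : ∀ {n k} s (vs : Vec (Vec Bool n) k) → combine s (pad vs) ≡ false ∷ combine s vs
  combine-pad []          []       = refl
  combine-pad (true ∷ s)  (v ∷ vs) = cong ((false ∷ v) ⊞_) (combine-pad s vs)
  combine-pad (false ∷ s) (v ∷ vs) = combine-pad s vs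

  pad-⊑ : ∀ {n j k} {us : Vec (Vec Bool n) j} {vs : Vec (Vec Bool n) k} → us ⊑ vs → pad us ⊑ pad vs
  pad-⊑ {us = us} {vs} us⊑vs s = let (t , eq) = us⊑vs s in
    t , trans (combine-pad t vs) (trans (cong (false ∷_) eq) (sym (combine-pad s us)))

  -- Row echelon form in which the entries above a pivot are left arbitrary. A subspace may have
  -- several such bases; the search needs at least one.
  data Echelon : ∀ {n k} → Vec (Vec Bool n) k → Set where
    empty : ∀ {n} → Echelon {n} []
    skip  : ∀ {n k} {vs : Vec (Vec Bool n) (suc k)} → Echelon vs → Echelon (pad vs)
    pivot : ∀ {n k} {vs : Vec (Vec Bool n) k} w → Echelon vs → Echelon ((true ∷ w) ∷ pad vs)

  -- One step of Gaussian elimination on the first coordinate: at most one vector starting with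
  -- `true` is kept, and the others are cleared by addition.
  sift : ∀ {n k} (us : Vec (Vec Bool (suc n)) k) →
         (∃ λ vs → us ≡ pad vs) ⊎
         (∃ λ j → suc j ≡ k × ∃₂ λ w (vs : Vec (Vec Bool n) j) → us ⊑ (true ∷ w) ∷ pad vs × (true ∷ w) ∷ pad vs ⊑ us)
  sift [] = inj₁ ([] , refl)
  sift ((false ∷ u) ∷ us) with sift us
  ... | inj₁ (vs , eq) = inj₁ (u ∷ vs , cong ((false ∷ u) ∷_) eq)
  ... | inj₂ (j , refl , w , vs , p , q) = inj₂ (suc j , refl , w , u ∷ vs ,
    ⊑-∷ (∈-tail ∈-head) (⊑-trans p (⊑-∷ ∈-head (⊑-tail (⊑-tail ⊑-refl)))) ,
    ⊑-∷ (∈-tail (∈-⊑ ∈-head q)) (⊑-∷ ∈-head (⊑-tail (⊑-trans (⊑-tail ⊑-refl) q))))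
  sift ((true ∷ u) ∷ us) with sift us
  ... | inj₁ (vs , refl) = inj₂ (_ , refl , u , vs , ⊑-refl , ⊑-refl)
  ... | inj₂ (j , refl , w , vs , p , q) = inj₂ (suc j , refl , u , (u ⊞ w) ∷ vs ,
    ⊑-∷ ∈-head (⊑-trans p (⊑-∷ (subst (_∈⟨ (true ∷ u) ∷ pad ((u ⊞ w) ∷ vs) ⟩) (cong (true ∷_) u⊞u⊞w) (∈-⊞ {u = true ∷ u} ∈-head (∈-tail ∈-head))) (⊑-tail (⊑-tail ⊑-refl)))) ,
    ⊑-∷ ∈-head (⊑-∷ (∈-⊞ {u = true ∷ u} {v = true ∷ w} ∈-head (∈-tail (∈-⊑ ∈-head q))) (⊑-tail (⊑-trans (⊑-tail ⊑-refl) q))))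
    where
    u⊞u⊞w : u ⊞ (u ⊞ w) ≡ w
    u⊞u⊞w = trans (sym (⊞-assoc u u w)) (trans (cong (_⊞ w) (⊞-self u)) (⊞-identityˡ w))

  gauss : ∀ n {k} (us : Vec (Vec Bool n) k) →
          ∃ λ j → j ℕ.≤ k × ∃ λ (vs : Vec (Vec Bool n) j) → Echelon vs × us ⊑ vs × vs ⊑ us
  gauss zero us = 0 , z≤n , [] , empty , (λ s → [] , all-equal _ _) , ⊑-[]
    where
    all-equal : (u v : Vec Bool 0) → u ≡ v
    all-equal [] [] = refl
  gauss (suc n) us with sift us
  ... | inj₁ (ws , refl) with gauss n ws
  ...   | zero  , j≤k , [] , e , p , q = 0 , j≤k , [] , empty , pad-⊑ p , ⊑-[]
  ...   | suc j , j≤k , vs , e , p , q = suc j , j≤k , pad vs , skip e , pad-⊑ p , pad-⊑ q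
  gauss (suc n) us | inj₂ (_ , refl , w , ws , p , q) with gauss n ws
  ... | j , j≤k , vs , e , p′ , q′ = suc j , s≤s j≤k , (true ∷ w) ∷ pad vs , pivot w e ,
    ⊑-trans p (⊑-∷ ∈-head (⊑-tail (pad-⊑ p′))) , ⊑-trans (⊑-∷ ∈-head (⊑-tail (pad-⊑ q′))) q

  toFin : ∀ {n} → Vec Bool n → Fin (2 ℕ.^ n)
  toFin []              = zero
  toFin {suc n} (b ∷ v) = Fin.combine {2} (if b then zero else suc zero) (toFin v)

  toFin-injective : ∀ {n} {u v : Vec Bool n} → toFin u ≡ toFin v → u ≡ v
  toFin-injective {u = []} {[]} _ = refl
  toFin-injective {suc n} {u = a ∷ u} {b ∷ v} eq with Fin.combine-injective {2} _ (toFin u) _ (toFin v) eq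
  ... | p , q = cong₂ _∷_ (bool a b p) (toFin-injective q)
    where
    bool : ∀ a b → (if a then zero {1} else suc zero) ≡ (if b then zero else suc zero) → a ≡ b
    bool true  true  _ = refl
    bool false false _ = refl
    bool true  false ()
    bool false true  ()

  -- Counting in place of an exchange argument: the `2^j` combinations of `us` are distinct and each
  -- is determined by one of the `2^k` coefficient vectors of `vs`.
  independent-⊑⇒≤ : ∀ {n j k} {us : Vec (Vec Bool n) j} {vs : Vec (Vec Bool n) k} → Independent us → us ⊑ vs → j ℕ.≤ k
  independent-⊑⇒≤ {j = j} {k} {us} {vs} ind us⊑vs = 2^-cancel-≤ (Fin.injective⇒≤ {f = toFin ∘ proj₁ ∘ us⊑vs ∘ fromFin j}
    λ {x} {y} eq → fromFin-injective j (combine-injective ind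
      (trans (sym (proj₂ (us⊑vs (fromFin j x)))) (trans (cong (λ t → combine t vs) (toFin-injective {u = proj₁ (us⊑vs (fromFin j x))} {proj₁ (us⊑vs (fromFin j y))} eq)) (proj₂ (us⊑vs (fromFin j y)))))))
    where
    2^-cancel-≤ : 2 ℕ.^ j ℕ.≤ 2 ℕ.^ k → j ℕ.≤ k
    2^-cancel-≤ le with j ℕ.≤? k
    ... | yes p = p
    ... | no ¬p = contradiction (ℕ.^-monoʳ-< 2 (s≤s (s≤s z≤n)) (ℕ.≰⇒> ¬p)) (ℕ.≤⇒≯ le)

  echelon-basis : ∀ {n k} (us : Vec (Vec Bool n) k) → Independent us →
                  ∃ λ (vs : Vec (Vec Bool n) k) → Echelon vs × us ⊑ vs × vs ⊑ us
  echelon-basis {n} us ind with gauss n us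
  ... | j , j≤k , vs , ech , us⊑vs , vs⊑us with ℕ.≤-antisym j≤k (independent-⊑⇒≤ ind us⊑vs)
  ...   | refl = vs , ech , us⊑vs , vs⊑us

  -- In normal-basis coordinates this is the alternating form Tr(x²y + xy²).
  symplectic : Vec Bool 7 → Vec Bool 7 → Bool
  symplectic u v = dot (rot u) v xor dot u (rot v)

  infix 6 _≡ⱽ_
  _≡ⱽ_ : ∀ {n} → Vec Bool n → Vec Bool n → Bool
  []          ≡ⱽ []          = true
  (true ∷ u)  ≡ⱽ (true ∷ v)  = u ≡ⱽ v
  (false ∷ u) ≡ⱽ (false ∷ v) = u ≡ⱽ v
  _           ≡ⱽ _           = false

  ≡ⱽ-sound : ∀ {n} (u v : Vec Bool n) → u ≡ⱽ v ≡ true → u ≡ v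
  ≡ⱽ-sound [] [] _ = refl
  ≡ⱽ-sound (true ∷ u) (true ∷ v) eq = cong (true ∷_) (≡ⱽ-sound u v eq)
  ≡ⱽ-sound (false ∷ u) (false ∷ v) eq = cong (false ∷_) (≡ⱽ-sound u v eq)

  ≡ⱽ-refl : ∀ {n} (v : Vec Bool n) → v ≡ⱽ v ≡ true
  ≡ⱽ-refl [] = refl
  ≡ⱽ-refl (true ∷ v) = ≡ⱽ-refl v
  ≡ⱽ-refl (false ∷ v) = ≡ⱽ-refl v

  member : ∀ {n} → Vec Bool n → List (Vec Bool n) → Bool
  member v []       = false
  member v (u ∷ us) = v ≡ⱽ u ∨ member v us

  member-sound : ∀ {n} (v : Vec Bool n) us → member v us ≡ true → v ∈ us
  member-sound v (u ∷ us) eq with v ≡ⱽ u in p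
  ... | true  = here (≡ⱽ-sound v u p)
  ... | false = there (member-sound v us eq)

  member-complete : ∀ {n} {v : Vec Bool n} {us} → v ∈ us → member v us ≡ true
  member-complete {v = v} (here refl) rewrite ≡ⱽ-refl v = refl
  member-complete {v = v} {u ∷ us} (there p) = trans (cong (v ≡ⱽ u ∨_) (member-complete p)) (Bool.∨-zeroʳ _)

  -- Shares the evaluation of the list vs.
  double : ∀ {n} → Vec Bool n → List (Vec Bool n) → List (Vec Bool n)
  double v vs = vs ++ List.map (v ⊞_) vs

  span : ∀ {n k} → Vec (Vec Bool n) k → List (Vec Bool n)
  span []       = 0ⱽ ∷ []
  span (v ∷ vs) = double v (span vs)

  span-complete : ∀ {n k} s (vs : Vec (Vec Bool n) k) → combine s vs ∈ span vs
  span-complete []          []       = here refl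
  span-complete (true ∷ s)  (v ∷ vs) = List.∈-++⁺ʳ (span vs) (List.∈-map⁺ (v ⊞_) (span-complete s vs))
  span-complete (false ∷ s) (v ∷ vs) = List.∈-++⁺ˡ (span-complete s vs)

  span-sound : ∀ {n k} {v : Vec Bool n} (vs : Vec (Vec Bool n) k) → v ∈ span vs → v ∈⟨ vs ⟩
  span-sound [] (here refl) = [] , refl
  span-sound (u ∷ vs) v∈ with List.∈-++⁻ (span vs) v∈
  ... | inj₁ v∈vs = ∈-tail (span-sound vs v∈vs)
  ... | inj₂ v∈ with List.∈-map⁻ (u ⊞_) v∈
  ...   | w , w∈ , refl = let (s , eq) = span-sound vs w∈ in true ∷ s , cong (u ⊞_) eq

  members : ∀ {n k} → Vec (Vec Bool n) k → List (Vec Bool n) → Bool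
  members []       vs = true
  members (u ∷ us) vs = member u vs ∧ members us vs

  members-sound : ∀ {n j k} (us : Vec (Vec Bool n) j) (vs : Vec (Vec Bool n) k) → members us (span vs) ≡ true → us ⊑ vs
  members-sound []       vs _  = ⊑-[]
  members-sound (u ∷ us) vs eq = let (p , q) = ∧-elim eq in
    ⊑-∷ (span-sound vs (member-sound u (span vs) p)) (members-sound us vs q)

  members-complete : ∀ {n j k} {us : Vec (Vec Bool n) j} {vs : Vec (Vec Bool n) k} → us ⊑ vs → members us (span vs) ≡ true
  members-complete {us = []} us⊑vs = refl
  members-complete {us = u ∷ us} {vs} us⊑vs = cong₂ _∧_
    (member-complete (let (s , eq) = ∈-⊑ {us = u ∷ us} ∈-head us⊑vs in subst (_∈ span vs) eq (span-complete s vs)))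
    (members-complete {us = us} (⊑-trans (⊑-tail ⊑-refl) us⊑vs))

  vectors : ∀ n → List (Vec Bool n)
  vectors zero    = [] ∷ []
  vectors (suc n) = List.map (true ∷_) (vectors n) ++ List.map (false ∷_) (vectors n)

  vectors-complete : ∀ n v → v ∈ vectors n
  vectors-complete zero    []          = here refl
  vectors-complete (suc n) (true ∷ v)  = List.∈-++⁺ˡ (List.∈-map⁺ (true ∷_) (vectors-complete n v))
  vectors-complete (suc n) (false ∷ v) = List.∈-++⁺ʳ (List.map (true ∷_) (vectors n)) (List.∈-map⁺ (false ∷_) (vectors-complete n v))

  -- Exhaustive search for isotropic 3-spaces up to cyclic shift.

  Triple : Set
  Triple = Vec (Vec Bool 7) 3

  rotᵗ : ℕ → Triple → Triple
  rotᵗ k = Vec.map (rot^ k)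

  any-map-sound : ∀ {A B : Set} (p : B → Bool) (f : A → B) xs → any p (List.map f xs) ≡ true →
                  ∃ λ x → x ∈ xs × p (f x) ≡ true
  any-map-sound p f (x ∷ xs) eq with p (f x) in px
  ... | true  = x , here refl , px
  ... | false = let (y , y∈ , py) = any-map-sound p f xs eq in y , there y∈ , py

  bits : ∀ n → ℕ → Vec Bool n
  bits zero    _ = []
  bits (suc n) m = (m % 2 ≡ᵇ 1) ∷ bits n (m / 2)

  code : ∀ {n} → Vec Bool n → ℕ
  code []          = 0
  code (true ∷ v)  = suc (2 ℕ.* code v)
  code (false ∷ v) = 2 ℕ.* code v

  Memo : ℕ → Set
  Memo zero    = ℕ
  Memo (suc n) = Memo n × Memo n

  memo : ∀ n → (Vec Bool n → ℕ) → Memo n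
  memo zero    f = f []
  memo (suc n) f = memo n (f ∘ (true ∷_)) , memo n (f ∘ (false ∷_))

  recall : ∀ {n} → Memo n → Vec Bool n → ℕ
  recall m       []          = m
  recall (l , r) (true ∷ v)  = recall l v
  recall (l , r) (false ∷ v) = recall r v

  -- A shift-invariant hash; it only guides the search, so nothing about it is needed.
  necklace : Vec Bool 7 → ℕ
  necklace v = cube (List.foldr ℕ._⊓_ 127 (List.map (λ k → code (rot^ k v)) (List.upTo 7)))
    where
    cube : ℕ → ℕ
    cube m = m ℕ.* m ℕ.* m

  hash : Memo 7 → List (Vec Bool 7) → ℕ
  hash m s = ℕ.sum (List.map (recall m) s)

  Entry : Set
  Entry = ℕ × List (Triple × List (Vec Bool 7))

  -- The table of hashes and spans is built once and shared by all lookups.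

  module Identify {n} (reps : Fin n → Triple) where

    shifted : Fin n → ℕ → Triple × List (Vec Bool 7)
    shifted i k = with-span (rotᵗ k (reps i))
      where
      with-span : Triple → Triple × List (Vec Bool 7)
      with-span t = t , span t

    entry : Memo 7 → Fin n → Entry
    entry m i = hash m (span (reps i)) , List.map (shifted i) (List.upTo 7)

    same-span : Triple → List (Vec Bool 7) → Triple × List (Vec Bool 7) → Bool
    same-span t s (t′ , s′) = members t s′ ∧ members t′ s

    matches : ℕ → Triple → List (Vec Bool 7) → Entry → Bool
    matches h t s (h′ , shifts) = (h ≡ᵇ h′) ∧ any (same-span t s) shifts

    any-match : List Entry → ℕ → Triple → List (Vec Bool 7) → Bool
    any-match table h t s = any (matches h t s) table

    search : Memo 7 → List Entry → Triple → List (Vec Bool 7) → Bool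
    search m table t s = any-match table (hash m s) t s

    identify : Memo 7 → List Entry → List (Vec Bool 7) → Bool
    -- The search pushes rows onto the front of a list, so they arrive in reverse order.
    identify m table (r₃ ∷ r₂ ∷ r₁ ∷ []) = search m table (r₁ ∷ r₂ ∷ r₃ ∷ []) (span (r₁ ∷ r₂ ∷ r₃ ∷ []))
    -- A default value: the search started with three rows to choose always ends with three.
    identify m table _ = true

    search-sound : ∀ m t → search m (List.map (entry m) (List.allFin n)) t (span t) ≡ true →
                   ∃₂ λ i k → k ℕ.< 7 × t ⊑ rotᵗ k (reps i) × rotᵗ k (reps i) ⊑ t
    search-sound m t eq =
      let i , _ , p = any-map-sound (matches (hash m (span t)) t (span t)) (entry m) (List.allFin n) eq
          k , k∈ , q = any-map-sound (same-span t (span t)) (shifted i) (List.upTo 7)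
                         (proj₂ (∧-elim {hash m (span t) ≡ᵇ hash m (span (reps i))} p))
          q₁ , q₂ = ∧-elim {members t (span (rotᵗ k (reps i)))} q
      in i , k , List.∈-upTo⁻ k∈ , members-sound t (rotᵗ k (reps i)) q₁ , members-sound (rotᵗ k (reps i)) t q₂

  orthogonal : Vec Bool 7 → List (Vec Bool 7) → Bool
  orthogonal r rows = all (λ r′ → not (symplectic r r′)) rows

  module Enumerate (final : List (Vec Bool 7) → Bool) where
    -- A backtracking search over echelon forms. There remain `k` rows to choose with pivots in the
    -- last `n` coordinates, and `e` pads such a row with the leading zeros already fixed. A row
    -- that is not orthogonal to the earlier ones is discarded at once. With no coordinate left for
    -- a pivot there is nothing to check.
    enumerate : ∀ n (k : ℕ) → (Vec Bool n → Vec Bool 7) → List (Vec Bool 7) → Bool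
    extend : ∀ n (k : ℕ) → (Vec Bool (suc n) → Vec Bool 7) → List (Vec Bool 7) → Vec Bool 7 → Bool
    enumerate n       zero    e rows = final rows
    enumerate zero    (suc k) e rows = true
    enumerate (suc n) (suc k) e rows =
      enumerate n (suc k) (e ∘ (false ∷_)) rows ∧ every n (λ w → extend n k e rows (e (true ∷ w)))
    extend n k e rows r = if orthogonal r rows then enumerate n k (e ∘ (false ∷_)) (r ∷ rows) else true

    Orthogonal : ∀ {k} → List (Vec Bool 7) → Vec (Vec Bool 7) k → Set
    Orthogonal rows []       = ⊤
    Orthogonal rows (r ∷ rs) = orthogonal r rows ≡ true × Orthogonal (r ∷ rows) rs

    push : ∀ {k} → Vec (Vec Bool 7) k → List (Vec Bool 7) → List (Vec Bool 7)
    push []       rows = rows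
    push (r ∷ rs) rows = push rs (r ∷ rows)

    -- The constructors of `Echelon` are the branches of the search: `skip` passes over a
    -- coordinate, `pivot` selects the row with tail `w`, and orthogonality ensures that the row was
    -- not discarded.
    enumerate-sound : ∀ n (k : ℕ) e rows → enumerate n k e rows ≡ true → ∀ {vs : Vec (Vec Bool n) k} → Echelon vs →
                      Orthogonal rows (Vec.map e vs) → final (push (Vec.map e vs) rows) ≡ true
    enumerate-sound n zero e rows eq empty _ = eq
    enumerate-sound (suc n) (suc k) e rows eq (skip {vs = vs} ech) orth
      rewrite sym (Vec.map-∘ e (false ∷_) vs) =
      enumerate-sound n (suc k) (e ∘ (false ∷_)) rows (proj₁ (∧-elim eq)) ech orth
    enumerate-sound (suc n) (suc k) e rows eq (pivot {vs = vs} w ech) (orth , orths)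
      rewrite sym (Vec.map-∘ e (false ∷_) vs) =
      enumerate-sound n k (e ∘ (false ∷_)) (e (true ∷ w) ∷ rows)
        (trans (sym (cong (if_then enumerate n k (e ∘ (false ∷_)) (e (true ∷ w) ∷ rows) else true) orth))
          (every-sound n _ (proj₂ (∧-elim {enumerate n (suc k) (e ∘ (false ∷_)) rows} eq)) w)) ech orths

    -- A record, because comparing two applications of enumerate would run them.
    record Exhausted (n k : ℕ) (e : Vec Bool n → Vec Bool 7) : Set where
      constructor exhausted
      field result : enumerate n k e [] ≡ true

    exhausted-sound : ∀ {n k e} → Exhausted n k e → ∀ {vs : Vec (Vec Bool n) k} → Echelon vs →
                      Orthogonal [] (Vec.map e vs) → final (push (Vec.map e vs) []) ≡ true
    exhausted-sound (exhausted eq) = enumerate-sound _ _ _ [] eq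

  Isotropic : ∀ {k} → Vec (Vec Bool 7) k → Set
  Isotropic t = ∀ r s → symplectic (combine r t) (combine s t) ≡ false

  isotropic-⊑ : ∀ {j k} {t : Vec (Vec Bool 7) j} {u : Vec (Vec Bool 7) k} → t ⊑ u → Isotropic u → Isotropic t
  isotropic-⊑ t⊑u iso r s = let (r′ , p) = t⊑u r ; (s′ , q) = t⊑u s in
    trans (sym (cong₂ symplectic p q)) (iso r′ s′)

  Complete : ∀ {n} → (Fin n → Triple) → Memo 7 → Set
  Complete {n} reps m = Enumerate.Exhausted (identify m (List.map (entry m) (List.allFin n))) 7 3 id
    where open Identify reps

  module Classify {n} (reps : Fin n → Triple) (m : Memo 7) (complete : Complete reps m) where
    open Identify reps

    classify-echelon : ∀ (t : Triple) → Echelon t → Isotropic t →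
                       ∃₂ λ i k → k ℕ.< 7 × t ⊑ rotᵗ k (reps i) × rotᵗ k (reps i) ⊑ t
    classify-echelon t@(r₁ ∷ r₂ ∷ r₃ ∷ []) ech iso = search-sound m t
      (exhausted-sound complete ech
        (refl , cong (λ b → not b ∧ true) (orth e₂ e₁) , cong₂ (λ b c → not b ∧ (not c ∧ true)) (orth e₃ e₂) (orth e₃ e₁) , tt))
      where
      open Enumerate (identify m (List.map (entry m) (List.allFin n)))
      e₁ : r₁ ∈⟨ t ⟩
      e₁ = ∈-head
      e₂ : r₂ ∈⟨ t ⟩
      e₂ = ∈-tail ∈-head
      e₃ : r₃ ∈⟨ t ⟩
      e₃ = ∈-tail (∈-tail ∈-head)
      orth : ∀ {u v} → u ∈⟨ t ⟩ → v ∈⟨ t ⟩ → symplectic u v ≡ false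
      orth (r , p) (s , q) = trans (sym (cong₂ symplectic p q)) (iso r s)

    -- The subspace is replaced by an echelon basis, and that basis is among those which the
    -- exhausted search has matched with a shift of a representative.
    classify : ∀ (t : Triple) → Independent t → Isotropic t →
               ∃₂ λ i k → k ℕ.< 7 × t ⊑ rotᵗ k (reps i) × rotᵗ k (reps i) ⊑ t
    classify t ind iso =
      let vs , ech , t⊑vs , vs⊑t = echelon-basis t ind
          i , k , k<7 , p , q = classify-echelon vs ech (isotropic-⊑ vs⊑t iso)
      in i , k , k<7 , ⊑-trans t⊑vs p , ⊑-trans q vs⊑t

  fromFin-surjective : ∀ n v → ∃ λ i → fromFin n i ≡ v
  fromFin-surjective n v =
    let i , eq = injective⇒surjective (toFin ∘ fromFin n)
                   (λ {i} {j} eq → fromFin-injective n (toFin-injective {n} {fromFin n i} {fromFin n j} eq)) (toFin v)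
    in i , toFin-injective {n} {fromFin n i} {v} eq

  infix 4 _≟ⱽ_
  _≟ⱽ_ : ∀ {n} (u v : Vec Bool n) → Dec (u ≡ v)
  _≟ⱽ_ = Vec.≡-dec Bool._≟_

  hasCard : ∀ {a ℓ} {A : Set a} {_~_ : Rel A ℓ} n (rep : Vec Bool n → A) → (∀ {u v} → rep u ~ rep v → u ≡ v) →
            (∀ a → ∃ λ v → rep v ~ a) → HasCard _~_ (2 ℕ.^ n)
  hasCard {_~_ = _~_} n rep inj surj = rep ∘ fromFin n , (λ eq → fromFin-injective n (inj eq)) , λ a →
    let v , v~a = surj a ; i , eq = fromFin-surjective n v in i , λ { refl → subst (λ v → rep v ~ a) (sym eq) v~a }

  -- The vectors s with w · s = 1 for a given nonzero w.
  solution : Vec Bool 3 → Vec Bool 2 → Vec Bool 3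
  solution (true ∷ b ∷ c ∷ [])      (j ∷ k ∷ []) = not ((b ∧ j) xor (c ∧ k)) ∷ j ∷ k ∷ []
  solution (false ∷ true ∷ c ∷ [])  (j ∷ k ∷ []) = j ∷ not (c ∧ k) ∷ k ∷ []
  solution (false ∷ false ∷ _ ∷ []) (j ∷ k ∷ []) = j ∷ k ∷ true ∷ []

  opaque
    solution-dot : ∀ w → w ≢ 0ⱽ → ∀ u → dot w (solution w u) ≡ true
    solution-dot = from-yes (every-dec 3 λ w → ¬? (w ≟ⱽ 0ⱽ) →-dec every-dec 2 λ u → dot w (solution w u) Bool.≟ true)

    solution-injective : ∀ w u v → solution w u ≡ solution w v → u ≡ v
    solution-injective = from-yes (every-dec 3 λ w → every-dec 2 λ u → every-dec 2 λ v → (solution w u ≟ⱽ solution w v) →-dec (u ≟ⱽ v))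

    solution-complete : ∀ w s → dot w s ≡ true → ∃ λ u → solution w u ≡ s
    solution-complete (true ∷ b ∷ c ∷ []) (i ∷ j ∷ k ∷ []) eq = j ∷ k ∷ [] , cong (_∷ _) (lemma i (b ∧ j) (c ∧ k) eq)
      where
      lemma : ∀ i x y → i xor (x xor (y xor false)) ≡ true → not (x xor y) ≡ i
      lemma = λ { true true true _ → refl ; true false false _ → refl ; false true false _ → refl ; false false true _ → refl }
    solution-complete (false ∷ true ∷ c ∷ []) (i ∷ j ∷ k ∷ []) eq = i ∷ k ∷ [] , cong (λ j → i ∷ j ∷ k ∷ []) (lemma j (c ∧ k) eq)
      where
      lemma : ∀ i x → i xor (x xor false) ≡ true → not x ≡ i
      lemma = λ { true false _ → refl ; false true _ → refl }
    solution-complete (false ∷ false ∷ true ∷ []) (i ∷ j ∷ true ∷ []) eq = i ∷ j ∷ [] , refl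
    solution-complete (false ∷ false ∷ false ∷ []) (i ∷ j ∷ k ∷ []) ()

  -- Both lists have `k` vectors, so on coefficient vectors the inclusion is an injection of a
  -- finite set into itself, hence surjective.
  ⊑-reverse : ∀ {n k} {us vs : Vec (Vec Bool n) k} → Independent us → us ⊑ vs → vs ⊑ us
  ⊑-reverse {k = k} {us} {vs} ind us⊑vs s =
    let i , eq = injective⇒surjective f f-injective (toFin s)
    in fromFin k i , trans (sym (proj₂ (us⊑vs (fromFin k i)))) (cong (λ s → combine s vs) (toFin-injective {k} {g (fromFin k i)} {s} eq))
    where
    g : Vec Bool k → Vec Bool k
    g s = proj₁ (us⊑vs s)
    f : Fin (2 ℕ.^ k) → Fin (2 ℕ.^ k)
    f = toFin ∘ g ∘ fromFin k
    f-injective : ∀ {i j} → f i ≡ f j → i ≡ j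
    f-injective {i} {j} eq = fromFin-injective k (combine-injective ind (trans (sym (proj₂ (us⊑vs (fromFin k i))))
      (trans (cong (λ s → combine s vs) (toFin-injective {k} {g (fromFin k i)} {g (fromFin k j)} eq)) (proj₂ (us⊑vs (fromFin k j))))))

open BinaryVectors

module Arcs (𝔽 : FiniteField (2 ℕ.^ 7)) where
  private
    module PG = Plane 7 𝔽

  -- The field with 128 elements: Frobenius and trace.

  module Field where
    open FiniteFieldProperties 𝔽 public
    private
      module R = CommutativeRing commutativeRing
    open PG public using (Tr)

    private
      2^k•1≢0 : 2 • 1# ≢ 0# → ∀ k → (2 ℕ.^ k) • 1# ≢ 0#
      2^k•1≢0 h zero eq = 1≢0 (trans (sym (+-identityʳ 1#)) eq)
      2^k•1≢0 h (suc k) eq = *-≢0 h (2^k•1≢0 h k) (trans (sym (SemiringMult.×1-homo-* R.semiring 2 (2 ℕ.^ k))) eq)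

    -- The multiple `2^7 · 1` vanishes by `q•1≡0`, and it is the seventh power of `2 · 1` in a
    -- field.
    1+1≡0 : 1# + 1# ≡ 0#
    1+1≡0 with 1# + 1# ≟ 0#
    ... | yes eq = eq
    ... | no ≢0 = contradiction q•1≡0 (2^k•1≢0 (λ eq → ≢0 (trans (cong (1# +_) (sym (+-identityʳ 1#))) eq)) 7)

    x+x≡0 : ∀ x → x + x ≡ 0#
    x+x≡0 x = begin
      x + x              ≡⟨ cong₂ _+_ (*-identityʳ x) (*-identityʳ x) ⟨
      x * 1# + x * 1#    ≡⟨ distribˡ x 1# 1# ⟨
      x * (1# + 1#)      ≡⟨ cong (x *_) 1+1≡0 ⟩
      x * 0#             ≡⟨ zeroʳ x ⟩
      0#                 ∎

    x+y≡0⇒x≡y : ∀ {x y} → x + y ≡ 0# → x ≡ y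
    x+y≡0⇒x≡y {x} {y} eq = begin
      x            ≡⟨ +-identityʳ x ⟨
      x + 0#       ≡⟨ cong (x +_) (x+x≡0 y) ⟨
      x + (y + y)  ≡⟨ +-assoc x y y ⟨
      x + y + y    ≡⟨ cong (_+ y) eq ⟩
      0# + y       ≡⟨ +-identityˡ y ⟩
      y            ∎

    x≡y⇒x+y≡0 : ∀ {x y} → x ≡ y → x + y ≡ 0#
    x≡y⇒x+y≡0 refl = x+x≡0 _

    -x≡x : ∀ x → - x ≡ x
    -x≡x x = x+y≡0⇒x≡y (-‿inverseˡ x)

    bit : Bool → Carrier
    bit true  = 1#
    bit false = 0#

    private
      -- Coefficients for the ring solver. Taking them in GF(2) lets it cancel `x + x`, so
      -- identities valid only in characteristic two are proved by normalization.
      𝔽₂ : RawRing 0ℓ 0ℓ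
      𝔽₂ = record { Carrier = Bool ; _≈_ = _≡_ ; _+_ = _xor_ ; _*_ = _∧_ ; -_ = id ; 0# = false ; 1# = true }

    bit-+ : ∀ a b → bit (a xor b) ≡ bit a + bit b
    bit-+ true true = sym 1+1≡0
    bit-+ true false = sym (+-identityʳ 1#)
    bit-+ false b = sym (+-identityˡ _)

    bit-* : ∀ a b → bit (a ∧ b) ≡ bit a * bit b
    bit-* true b = sym (*-identityˡ _)
    bit-* false b = sym (zeroˡ _)

    private
      𝔽₂→F : 𝔽₂ -Raw-AlmostCommutative⟶ fromCommutativeRing commutativeRing
      𝔽₂→F = record
        { ⟦_⟧ = bit ; +-homo = bit-+ ; *-homo = bit-* ; -‿homo = λ a → sym (-x≡x (bit a))
        ; 0-homo = refl ; 1-homo = refl }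

    bit-injective : ∀ {a b} → bit a ≡ bit b → a ≡ b
    bit-injective {true}  {true}  _  = refl
    bit-injective {false} {false} _  = refl
    bit-injective {true}  {false} eq = contradiction eq 1≢0
    bit-injective {false} {true}  eq = contradiction (sym eq) 1≢0

    open RingSolver 𝔽₂ (fromCommutativeRing commutativeRing) 𝔽₂→F
      (λ a b → dec⇒maybe (map′ (cong bit) bit-injective (a Bool.≟ b))) public
      using (solve; _:=_; _:+_; _:*_; con; Polynomial)
    infix 9 _²
    _² : Carrier → Carrier
    x ² = x * x

    ²-+ : ∀ x y → (x + y) ² ≡ x ² + y ²
    ²-+ = solve 2 (λ x y → (x :+ y) :* (x :+ y) := x :* x :+ y :* y) refl

    ²-* : ∀ x y → (x * y) ² ≡ x ² * y ²
    ²-* = solve 2 (λ x y → (x :* y) :* (x :* y) := (x :* x) :* (y :* y)) refl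

    square-zero : ∀ {x} → x ² ≡ 0# → x ≡ 0#
    square-zero {x} eq with x ≟ 0#
    ... | yes p = p
    ... | no x≢0 = zero-product eq x≢0

    ²-injective : ∀ {x y} → x ² ≡ y ² → x ≡ y
    ²-injective {x} {y} eq = x+y≡0⇒x≡y (square-zero (trans (²-+ x y) (x≡y⇒x+y≡0 eq)))

    -- φ^ k is the k-th power of the Frobenius automorphism.
    φ^ : ℕ → Carrier → Carrier
    φ^ zero    x = x
    φ^ (suc k) x = φ^ k x ²

    φ^-+ : ∀ k x y → φ^ k (x + y) ≡ φ^ k x + φ^ k y
    φ^-+ zero    x y = refl
    φ^-+ (suc k) x y = trans (cong _² (φ^-+ k x y)) (²-+ _ _)

    φ^-* : ∀ k x y → φ^ k (x * y) ≡ φ^ k x * φ^ k y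
    φ^-* zero    x y = refl
    φ^-* (suc k) x y = trans (cong _² (φ^-* k x y)) (²-* _ _)

    φ^-0 : ∀ k → φ^ k 0# ≡ 0#
    φ^-0 zero    = refl
    φ^-0 (suc k) = trans (cong _² (φ^-0 k)) (zeroˡ 0#)

    φ^-1 : ∀ k → φ^ k 1# ≡ 1#
    φ^-1 zero    = refl
    φ^-1 (suc k) = trans (cong _² (φ^-1 k)) (*-identityˡ 1#)

    φ^-∘ : ∀ k l x → φ^ (k ℕ.+ l) x ≡ φ^ k (φ^ l x)
    φ^-∘ zero    l x = refl
    φ^-∘ (suc k) l x = cong _² (φ^-∘ k l x)

    ^-2^ : ∀ k x → x ^ (2 ℕ.^ k) ≡ φ^ k x
    ^-2^ zero x = *-identityʳ x
    ^-2^ (suc k) x = begin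
      x ^ (2 ℕ.^ k ℕ.+ (2 ℕ.^ k ℕ.+ 0))       ≡⟨ SemiringExp.^-homo-* R.semiring x (2 ℕ.^ k) _ ⟩
      x ^ (2 ℕ.^ k) * x ^ (2 ℕ.^ k ℕ.+ 0)     ≡⟨ cong (λ n → x ^ (2 ℕ.^ k) * x ^ n) (ℕ.+-identityʳ (2 ℕ.^ k)) ⟩
      x ^ (2 ℕ.^ k) * x ^ (2 ℕ.^ k)           ≡⟨ cong _² (^-2^ k x) ⟩
      φ^ k x ² ∎

    φ^-7 : ∀ x → φ^ 7 x ≡ x
    φ^-7 x with x ≟ 0#
    ... | yes refl = φ^-0 7
    ... | no x≢0   = trans (sym (^-2^ 7 x)) (fermat-≢0 x x≢0)

    φ^-injective : ∀ k {x y} → φ^ k x ≡ φ^ k y → x ≡ y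
    φ^-injective zero    eq = eq
    φ^-injective (suc k) eq = φ^-injective k (²-injective eq)

    opaque
      -- Since `φ^ 7` is the identity, `φ^ 6` inverts squaring.
      √ : Carrier → Carrier
      √ = φ^ 6

      √-² : ∀ x → √ x ² ≡ x
      √-² = φ^-7

    √-0 : √ 0# ≡ 0#
    √-0 = square-zero (√-² 0#)

    √-≢0 : ∀ {x} → x ≢ 0# → √ x ≢ 0#
    √-≢0 {x} x≢0 eq = x≢0 (trans (sym (√-² x)) (trans (cong _² eq) (zeroˡ 0#)))

    √-+ : ∀ x y → √ (x + y) ≡ √ x + √ y
    √-+ x y = ²-injective (trans (√-² _) (trans (sym (cong₂ _+_ (√-² x) (√-² y))) (sym (²-+ _ _))))

    √-* : ∀ x y → √ (x * y) ≡ √ x * √ y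
    √-* x y = ²-injective (trans (√-² _) (trans (sym (cong₂ _*_ (√-² x) (√-² y))) (sym (²-* _ _))))

    -- The exponent 106 = 64 + 32 + 8 + 2 is the inverse of 6 modulo 127.
    sixth-root : ∀ x → ∃ λ e → (e * e * e) ² ≡ x
    sixth-root x = e , (begin
      (e * e * e) ²
        ≡⟨ solve 4 (λ a b c d → let e = a :* b :* c :* d in (e :* e :* e) :* (e :* e :* e) :=
             ((a :* a) :* (b :* b) :* (c :* c) :* (d :* d)) :*
             (((a :* a) :* (a :* a)) :* ((b :* b) :* (b :* b)) :* ((c :* c) :* (c :* c)) :* ((d :* d) :* (d :* d))))
           refl (φ^ 6 x) (φ^ 5 x) (φ^ 3 x) (φ^ 1 x) ⟩
      (φ^ 7 x * φ^ 6 x * φ^ 4 x * φ^ 2 x) * (φ^ 7 x ² * φ^ 7 x * φ^ 5 x * φ^ 3 x)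
        ≡⟨ cong (λ y → (y * φ^ 6 x * φ^ 4 x * φ^ 2 x) * (y ² * y * φ^ 5 x * φ^ 3 x)) (φ^-7 x) ⟩
      (x * φ^ 6 x * φ^ 4 x * φ^ 2 x) * (φ^ 1 x * x * φ^ 5 x * φ^ 3 x)
        ≡⟨ solve 7 (λ x₀ x₁ x₂ x₃ x₄ x₅ x₆ → (x₀ :* x₆ :* x₄ :* x₂) :* (x₁ :* x₀ :* x₅ :* x₃) :=
                      x₀ :* x₀ :* x₁ :* x₂ :* x₃ :* x₄ :* x₅ :* x₆)
           refl x (φ^ 1 x) (φ^ 2 x) (φ^ 3 x) (φ^ 4 x) (φ^ 5 x) (φ^ 6 x) ⟩
      φ^ 7 x
        ≡⟨ φ^-7 x ⟩
      x ∎)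
      where
      e = φ^ 6 x * φ^ 5 x * φ^ 3 x * φ^ 1 x

    -- From `x³ = 1` follows `φ^ 2 x ≡ x`, hence `φ^ 6 x ≡ x`, and then `φ^ 7 x ≡ x` reads
    -- `x ² ≡ x`. In other words, 3 is prime to 127.
    cube≡1 : ∀ {x} → x * x * x ≡ 1# → x ≡ 1#
    cube≡1 {x} eq = *-cancelˡ-≢0 x≢0 (begin
      φ^ 1 x              ≡⟨ cong _² (trans (cong (φ^ 4) fixed) (trans (cong (φ^ 2) fixed) fixed)) ⟨
      φ^ 7 x              ≡⟨ φ^-7 x ⟩
      x                   ≡⟨ *-identityʳ x ⟨
      x * 1#              ∎)
      where
      x≢0 : x ≢ 0#
      x≢0 refl = 1≢0 (trans (sym eq) (zeroʳ _))

      fixed : φ^ 2 x ≡ x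
      fixed = trans (solve 1 (λ x → (x :* x) :* (x :* x) := x :* x :* x :* x) refl x)
                    (trans (cong (_* x) eq) (*-identityˡ x))

    opaque
      tr : Carrier → Carrier
      tr x = φ^ 0 x + (φ^ 1 x + (φ^ 2 x + (φ^ 3 x + (φ^ 4 x + (φ^ 5 x + φ^ 6 x)))))

      Tr≡tr : ∀ x → Tr x ≡ tr x
      Tr≡tr x = trans (CommutativeMonoidSum.sum-cong-≗ +-commutativeMonoid {7} (λ i → ^-2^ (toℕ i) x))
        (cong (λ y → φ^ 0 x + (φ^ 1 x + (φ^ 2 x + (φ^ 3 x + (φ^ 4 x + (φ^ 5 x + y)))))) (+-identityʳ (φ^ 6 x)))

      tr-+ : ∀ x y → tr (x + y) ≡ tr x + tr y
      tr-+ x y = begin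
        tr (x + y)
          ≡⟨ cong₂ _+_ (φ^-+ 0 x y) (cong₂ _+_ (φ^-+ 1 x y) (cong₂ _+_ (φ^-+ 2 x y) (cong₂ _+_ (φ^-+ 3 x y)
               (cong₂ _+_ (φ^-+ 4 x y) (cong₂ _+_ (φ^-+ 5 x y) (φ^-+ 6 x y)))))) ⟩
        _ ≡⟨ solve 14 (λ a b c d e f g a′ b′ c′ d′ e′ f′ g′ →
               (a :+ a′) :+ ((b :+ b′) :+ ((c :+ c′) :+ ((d :+ d′) :+ ((e :+ e′) :+ ((f :+ f′) :+ (g :+ g′)))))) :=
               (a :+ (b :+ (c :+ (d :+ (e :+ (f :+ g)))))) :+ (a′ :+ (b′ :+ (c′ :+ (d′ :+ (e′ :+ (f′ :+ g′)))))))
             refl (φ^ 0 x) (φ^ 1 x) (φ^ 2 x) (φ^ 3 x) (φ^ 4 x) (φ^ 5 x) (φ^ 6 x)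
                  (φ^ 0 y) (φ^ 1 y) (φ^ 2 y) (φ^ 3 y) (φ^ 4 y) (φ^ 5 y) (φ^ 6 y) ⟩
        tr x + tr y ∎

      tr-² : ∀ x → tr (x ²) ≡ tr x
      tr-² x = begin
        tr (x ²)
          ≡⟨ cong₂ _+_ (lemma 0) (cong₂ _+_ (lemma 1) (cong₂ _+_ (lemma 2) (cong₂ _+_ (lemma 3)
               (cong₂ _+_ (lemma 4) (cong₂ _+_ (lemma 5) (trans (lemma 6) (φ^-7 x))))))) ⟩
        _ ≡⟨ solve 7 (λ a b c d e f g → b :+ (c :+ (d :+ (e :+ (f :+ (g :+ a))))) := a :+ (b :+ (c :+ (d :+ (e :+ (f :+ g))))))
             refl (φ^ 0 x) (φ^ 1 x) (φ^ 2 x) (φ^ 3 x) (φ^ 4 x) (φ^ 5 x) (φ^ 6 x) ⟩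
        tr x ∎
        where
        lemma : ∀ k → φ^ k (x ²) ≡ φ^ (suc k) x
        lemma k = φ^-* k x x

      tr-²-out : ∀ x → tr x ² ≡ tr x
      tr-²-out x = trans
        (solve 7 (λ a b c d e f g → let s = a :+ (b :+ (c :+ (d :+ (e :+ (f :+ g))))) in s :* s :=
           a :* a :+ (b :* b :+ (c :* c :+ (d :* d :+ (e :* e :+ (f :* f :+ g :* g))))))
         refl (φ^ 0 x) (φ^ 1 x) (φ^ 2 x) (φ^ 3 x) (φ^ 4 x) (φ^ 5 x) (φ^ 6 x))
        (trans (cong (λ y → φ^ 1 x + (φ^ 2 x + (φ^ 3 x + (φ^ 4 x + (φ^ 5 x + (φ^ 6 x + y)))))) (φ^-7 x))
        (solve 7 (λ a b c d e f g → b :+ (c :+ (d :+ (e :+ (f :+ (g :+ a))))) := a :+ (b :+ (c :+ (d :+ (e :+ (f :+ g))))))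
             refl (φ^ 0 x) (φ^ 1 x) (φ^ 2 x) (φ^ 3 x) (φ^ 4 x) (φ^ 5 x) (φ^ 6 x)))

      tr-1 : tr 1# ≡ 1#
      tr-1 = trans (cong₂ _+_ (φ^-1 0) (cong₂ _+_ (φ^-1 1) (cong₂ _+_ (φ^-1 2) (cong₂ _+_ (φ^-1 3)
               (cong₂ _+_ (φ^-1 4) (cong₂ _+_ (φ^-1 5) (φ^-1 6)))))))
             (solve 0 (let I = con true in I :+ (I :+ (I :+ (I :+ (I :+ (I :+ I))))) := I) refl)

      -- In odd degree the half-trace solves t² + t = x.
      artin-schreier : ∀ x → ∃ λ t → t ² + t ≡ x + tr x
      artin-schreier x = φ^ 0 x + φ^ 2 x + φ^ 4 x + φ^ 6 x , (begin
        (φ^ 0 x + φ^ 2 x + φ^ 4 x + φ^ 6 x) ² + (φ^ 0 x + φ^ 2 x + φ^ 4 x + φ^ 6 x)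
          ≡⟨ solve 4 (λ a c e g → (a :+ c :+ e :+ g) :* (a :+ c :+ e :+ g) :+ (a :+ c :+ e :+ g)
                       := (a :* a :+ c :* c :+ e :* e :+ g :* g) :+ (a :+ c :+ e :+ g)) refl (φ^ 0 x) (φ^ 2 x) (φ^ 4 x) (φ^ 6 x) ⟩
        (φ^ 1 x + φ^ 3 x + φ^ 5 x + φ^ 7 x) + (φ^ 0 x + φ^ 2 x + φ^ 4 x + φ^ 6 x)
          ≡⟨ cong (λ y → (φ^ 1 x + φ^ 3 x + φ^ 5 x + y) + (φ^ 0 x + φ^ 2 x + φ^ 4 x + φ^ 6 x)) (φ^-7 x) ⟩
        (φ^ 1 x + φ^ 3 x + φ^ 5 x + x) + (φ^ 0 x + φ^ 2 x + φ^ 4 x + φ^ 6 x)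
          ≡⟨ solve 7 (λ a b c d e f g → (b :+ d :+ f :+ a) :+ (a :+ c :+ e :+ g) := a :+ (a :+ (b :+ (c :+ (d :+ (e :+ (f :+ g)))))))
             refl (φ^ 0 x) (φ^ 1 x) (φ^ 2 x) (φ^ 3 x) (φ^ 4 x) (φ^ 5 x) (φ^ 6 x) ⟩
        x + tr x ∎)

    tr-0 : tr 0# ≡ 0#
    tr-0 = trans (cong tr (sym (x+x≡0 0#))) (trans (tr-+ 0# 0#) (x+x≡0 _))

    x²≡x : ∀ {x} → x ² ≡ x → x ≡ 0# ⊎ x ≡ 1#
    x²≡x {x} eq with x ≟ 0#
    ... | yes p  = inj₁ p
    ... | no x≢0 = inj₂ (*-cancelˡ-≢0 x≢0 (trans eq (sym (*-identityʳ x))))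

    tr-values : ∀ x → tr x ≡ 0# ⊎ tr x ≡ 1#
    tr-values x = x²≡x (tr-²-out x)

  -- Roots of polynomials and a self-dual normal basis.

  module Polynomials where
    open import Data.List.Base using ([]; _∷_)
    open import Data.List.Relation.Unary.AllPairs using ([]; _∷_)
    open import Data.List.Relation.Unary.All using ([]; _∷_)
    open Field

    eval : ∀ {n} → Vec Carrier n → Carrier → Carrier
    eval []       x = 0#
    eval (c ∷ cs) x = c + x * eval cs x

    -- Synthetic division by `x + r`: the coefficients of the quotient are the Horner values at `r`
    -- of the tails of the polynomial.
    divide : ∀ {n} → Vec Carrier (suc n) → Carrier → Vec Carrier n
    divide (c ∷ [])     r = []
    divide (c ∷ d ∷ ds) r = eval (d ∷ ds) r ∷ divide (d ∷ ds) r

    eval-divide : ∀ {n} (cs : Vec Carrier (suc n)) r x → eval cs x ≡ eval cs r + (x + r) * eval (divide cs r) x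
    eval-divide (c ∷ []) r x =
      solve 3 (λ c r x → c :+ x :* con false := c :+ r :* con false :+ (x :+ r) :* con false) refl c r x
    eval-divide (c ∷ ds@(_ ∷ _)) r x = trans (cong (λ y → c + x * y) (eval-divide ds r x))
      (solve 5 (λ c r x d q → c :+ x :* (d :+ (x :+ r) :* q) := c :+ r :* d :+ (x :+ r) :* (d :+ x :* q))
        refl c r x (eval ds r) (eval (divide ds r) x))

    eval-0 : ∀ n x → eval (Vec.replicate n 0#) x ≡ 0#
    eval-0 zero    x = refl
    eval-0 (suc n) x = trans (+-identityˡ _) (trans (cong (x *_) (eval-0 n x)) (zeroʳ x))

    divide≡0 : ∀ {n} (cs : Vec Carrier (suc n)) r → eval cs r ≡ 0# → divide cs r ≡ Vec.replicate n 0# →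
               cs ≡ Vec.replicate (suc n) 0#
    divide≡0 (c ∷ []) r p _ = cong (_∷ []) (trans (solve 2 (λ c r → c := c :+ r :* con false) refl c r) p)
    divide≡0 (c ∷ ds@(_ ∷ _)) r p q = cong₂ _∷_
      (trans (solve 2 (λ c r → c := c :+ r :* con false) refl c r) (trans (cong (λ y → c + r * y) (sym ds[r]≡0)) p))
      (divide≡0 ds r ds[r]≡0 (Vec.∷-injectiveʳ q))
      where
      ds[r]≡0 : eval ds r ≡ 0#
      ds[r]≡0 = Vec.∷-injectiveˡ q

    -- A vector of `n` coefficients is a polynomial of degree below `n`; each root is split off by
    -- `divide`, and a field has no zero divisors.
    too-many-roots : ∀ {n} (cs : Vec Carrier n) {xs} → Unique xs → All (λ x → eval cs x ≡ 0#) xs →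
                     n ℕ.≤ List.length xs → cs ≡ Vec.replicate n 0#
    too-many-roots [] _ _ _ = refl
    too-many-roots cs@(_ ∷ _) {r ∷ xs} (r≢ ∷ u) (p ∷ ps) (s≤s n≤) =
      divide≡0 cs r p (too-many-roots (divide cs r) u (All.zipWith step (r≢ , ps)) n≤)
      where
      step : ∀ {x} → r ≢ x × eval cs x ≡ 0# → eval (divide cs r) x ≡ 0#
      step {x} (r≢x , q) = zero-product
        (trans (sym (+-identityˡ _)) (trans (cong (_+ (x + r) * eval (divide cs r) x) (sym p)) (trans (sym (eval-divide cs r x)) q)))
        (λ x+r≡0 → r≢x (sym (x+y≡0⇒x≡y x+r≡0)))

    ⟦_⟧ : List Bool → Carrier → Carrier
    ⟦ p ⟧ = eval (Vec.map bit (Vec.fromList p))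

    private
      infixl 6 _⊕_
      infixl 7 _⊗_
      _⊕_ _⊗_ : List Bool → List Bool → List Bool
      []      ⊕ q       = q
      (a ∷ p) ⊕ []      = a ∷ p
      (a ∷ p) ⊕ (b ∷ q) = (a xor b) ∷ (p ⊕ q)
      []          ⊗ q = []
      (true ∷ p)  ⊗ q = q ⊕ (false ∷ p ⊗ q)
      (false ∷ p) ⊗ q = false ∷ p ⊗ q

      ⊕-homo : ∀ p q x → ⟦ p ⊕ q ⟧ x ≡ ⟦ p ⟧ x + ⟦ q ⟧ x
      ⊕-homo []      q       x = sym (+-identityˡ _)
      ⊕-homo (a ∷ p) []      x = sym (+-identityʳ _)
      ⊕-homo (a ∷ p) (b ∷ q) x = trans (cong₂ (λ y z → y + x * z) (bit-+ a b) (⊕-homo p q x))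
        (solve 5 (λ a b x p q → a :+ b :+ x :* (p :+ q) := a :+ x :* p :+ (b :+ x :* q)) refl (bit a) (bit b) x (⟦ p ⟧ x) (⟦ q ⟧ x))

      ⊗-homo : ∀ p q x → ⟦ p ⊗ q ⟧ x ≡ ⟦ p ⟧ x * ⟦ q ⟧ x
      ⊗-homo []          q x = sym (zeroˡ _)
      ⊗-homo (true ∷ p)  q x = trans (⊕-homo q (false ∷ p ⊗ q) x) (trans (cong (λ y → ⟦ q ⟧ x + (0# + x * y)) (⊗-homo p q x))
        (solve 3 (λ x p q → q :+ (con false :+ x :* (p :* q)) := (con true :+ x :* p) :* q) refl x (⟦ p ⟧ x) (⟦ q ⟧ x)))
      ⊗-homo (false ∷ p) q x = trans (cong (λ y → 0# + x * y) (⊗-homo p q x))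
        (solve 3 (λ x p q → con false :+ x :* (p :* q) := (con false :+ x :* p) :* q) refl x (⟦ p ⟧ x) (⟦ q ⟧ x))

      shift : ∀ k p x → ⟦ List.replicate k false ++ p ⟧ x ≡ x ^ k * ⟦ p ⟧ x
      shift zero    p x = sym (*-identityˡ _)
      shift (suc k) p x = trans (+-identityˡ _) (trans (cong (x *_) (shift k p x)) (sym (*-assoc x _ _)))

      I O : Bool
      I = true
      O = false

      -- X⁷ + X⁶ + X⁴ + X + 1 is the minimal polynomial of a generator of the self-dual normal basis,
      -- and the cofactor below is its quotient into X¹²⁸ + X.
      minimal cofactor : List Bool
      minimal = I ∷ I ∷ O ∷ O ∷ I ∷ O ∷ I ∷ I ∷ []
      cofactor =
           O ∷ I ∷ I ∷ I ∷ I ∷ O ∷ I ∷ I ∷ O ∷ O ∷ I ∷ I ∷ O ∷ O ∷ O ∷ I ∷ O ∷ O ∷ I ∷ O ∷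
           O ∷ I ∷ I ∷ I ∷ O ∷ O ∷ I ∷ I ∷ I ∷ I ∷ I ∷ O ∷ O ∷ I ∷ O ∷ O ∷ O ∷ O ∷ O ∷ I ∷
           O ∷ O ∷ O ∷ I ∷ I ∷ O ∷ I ∷ O ∷ I ∷ O ∷ I ∷ O ∷ O ∷ I ∷ I ∷ O ∷ I ∷ I ∷ O ∷ I ∷
           O ∷ O ∷ I ∷ O ∷ I ∷ O ∷ O ∷ O ∷ O ∷ I ∷ O ∷ I ∷ I ∷ O ∷ O ∷ O ∷ O ∷ I ∷ I ∷ O ∷
           O ∷ I ∷ O ∷ I ∷ I ∷ I ∷ I ∷ I ∷ I ∷ I ∷ O ∷ I ∷ O ∷ I ∷ I ∷ O ∷ I ∷ I ∷ I ∷ O ∷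
           I ∷ I ∷ I ∷ I ∷ O ∷ O ∷ O ∷ I ∷ I ∷ I ∷ O ∷ I ∷ O ∷ O ∷ O ∷ I ∷ O ∷ I ∷ O ∷ I ∷
           I ∷ I ∷ []

      minimal-divides : minimal ⊗ cofactor ≡ (O ∷ I ∷ []) ⊕ (List.replicate (2 ℕ.^ 7) false ++ I ∷ [])
      minimal-divides = refl

      minimal*cofactor : ∀ x → ⟦ minimal ⟧ x * ⟦ cofactor ⟧ x ≡ 0#
      minimal*cofactor x = begin
        ⟦ minimal ⟧ x * ⟦ cofactor ⟧ x  ≡⟨ ⊗-homo minimal cofactor x ⟨
        ⟦ minimal ⊗ cofactor ⟧ x        ≡⟨ cong (λ p → ⟦ p ⟧ x) minimal-divides ⟩
        ⟦ (O ∷ I ∷ []) ⊕ (List.replicate (2 ℕ.^ 7) false ++ I ∷ []) ⟧ x ≡⟨ ⊕-homo (O ∷ I ∷ []) (List.replicate (2 ℕ.^ 7) false ++ I ∷ []) x ⟩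
        ⟦ O ∷ I ∷ [] ⟧ x + ⟦ List.replicate (2 ℕ.^ 7) false ++ I ∷ [] ⟧ x
          ≡⟨ cong (⟦ O ∷ I ∷ [] ⟧ x +_) (trans (shift (2 ℕ.^ 7) (I ∷ []) x) (cong (_* ⟦ I ∷ [] ⟧ x) (trans (^-2^ 7 x) (φ^-7 x)))) ⟩
        ⟦ O ∷ I ∷ [] ⟧ x + x * ⟦ I ∷ [] ⟧ x
          ≡⟨ solve 1 (λ x → con false :+ x :* (con true :+ x :* con false) :+ x :* (con true :+ x :* con false) := con false) refl x ⟩
        0# ∎

      nonzero : ∀ p → or p ≡ true → Vec.map bit (Vec.fromList p) ≢ Vec.replicate (List.length p) 0#
      nonzero (true ∷ p)  _   eq = 1≢0 (Vec.∷-injectiveˡ eq)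
      nonzero (false ∷ p) p≢0 eq = nonzero p p≢0 (Vec.∷-injectiveʳ eq)

      -- If `p` had no root, `c` would vanish at all 128 elements although it has at most 128
      -- coefficients.
      factor-root : ∀ p c → or c ≡ true → List.length c ℕ.≤ 2 ℕ.^ 7 → (∀ x → ⟦ p ⟧ x * ⟦ c ⟧ x ≡ 0#) →
                    ∃ λ x → ⟦ p ⟧ x ≡ 0#
      factor-root p c c≢0 len pc≡0 with exists? (λ x → ⟦ p ⟧ x ≟ 0#)
      ... | yes root = root
      ... | no ¬root = contradiction
        (too-many-roots (Vec.map bit (Vec.fromList c)) elements-unique
          (All.universal (λ x → zero-product (pc≡0 x) (λ p[x]≡0 → ¬root (x , p[x]≡0))) elements)
          (subst (List.length c ℕ.≤_) (sym length-elements) len))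
        (nonzero c c≢0)

      minimal-root : ∃ λ x → ⟦ minimal ⟧ x ≡ 0#
      minimal-root = factor-root minimal cofactor refl (ℕ.m≤m+n 122 6) minimal*cofactor

    opaque
      θ : Carrier
      θ = proj₁ minimal-root

      minimal[θ]≡0 : ⟦ minimal ⟧ θ ≡ 0#
      minimal[θ]≡0 = proj₂ minimal-root

    private
      -- Coordinates in the powers of `θ`. They turn the Gram matrix of the conjugates of `θ` in an
      -- abstract field into a computation with bits.
      ⟦_⟧ᵥ : ∀ {n} → Vec Bool n → Carrier
      ⟦ v ⟧ᵥ = eval (Vec.map bit v) θ

      -- Multiplication by `θ` on the power basis, with `θ⁷` replaced by `θ⁶ + θ⁴ + θ + 1`.
      times-θ : Vec Bool 7 → Vec Bool 7
      times-θ (a ∷ b ∷ c ∷ d ∷ e ∷ f ∷ g ∷ []) = g ∷ (a xor g) ∷ b ∷ c ∷ (d xor g) ∷ e ∷ (f xor g) ∷ []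

      times-θ-homo : ∀ v → ⟦ times-θ v ⟧ᵥ ≡ θ * ⟦ v ⟧ᵥ
      times-θ-homo v@(a ∷ b ∷ c ∷ d ∷ e ∷ f ∷ g ∷ []) = begin
        ⟦ times-θ v ⟧ᵥ ≡⟨ cong₂ (λ y z → bit g + θ * (y + θ * (bit b + θ * (bit c + θ * (z + θ * (bit e + θ * (bit (f xor g) + θ * 0#))))))) (bit-+ a g) (bit-+ d g) ⟩
        _ ≡⟨ cong (λ z → bit g + θ * (bit a + bit g + θ * (bit b + θ * (bit c + θ * (bit d + bit g + θ * (bit e + θ * (z + θ * 0#))))))) (bit-+ f g) ⟩
        _ ≡⟨ solve 8 (λ x a b c d e f g → g :+ x :* (a :+ g :+ x :* (b :+ x :* (c :+ x :* (d :+ g :+ x :* (e :+ x :* (f :+ g :+ x :* con O))))))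
               := x :* (a :+ x :* (b :+ x :* (c :+ x :* (d :+ x :* (e :+ x :* (f :+ x :* (g :+ x :* con O)))))))
                :+ g :* (con I :+ x :* (con I :+ x :* (con O :+ x :* (con O :+ x :* (con I :+ x :* (con O :+ x :* (con I :+ x :* (con I :+ x :* con O)))))))))
             refl θ (bit a) (bit b) (bit c) (bit d) (bit e) (bit f) (bit g) ⟩
        θ * ⟦ v ⟧ᵥ + bit g * ⟦ minimal ⟧ θ ≡⟨ cong (λ y → θ * ⟦ v ⟧ᵥ + bit g * y) minimal[θ]≡0 ⟩
        θ * ⟦ v ⟧ᵥ + bit g * 0# ≡⟨ trans (cong (θ * ⟦ v ⟧ᵥ +_) (zeroʳ _)) (+-identityʳ _) ⟩
        θ * ⟦ v ⟧ᵥ ∎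

      ⊞-homo : ∀ {n} (u v : Vec Bool n) → ⟦ u ⊞ v ⟧ᵥ ≡ ⟦ u ⟧ᵥ + ⟦ v ⟧ᵥ
      ⊞-homo [] [] = sym (+-identityˡ 0#)
      ⊞-homo (a ∷ u) (b ∷ v) = trans (cong₂ (λ y z → y + θ * z) (bit-+ a b) (⊞-homo u v))
        (solve 5 (λ a b x p q → a :+ b :+ x :* (p :+ q) := a :+ x :* p :+ (b :+ x :* q)) refl (bit a) (bit b) θ ⟦ u ⟧ᵥ ⟦ v ⟧ᵥ)

      infixl 7 _⊠_
      _⊠_ : ∀ {n} → Vec Bool n → Vec Bool 7 → Vec Bool 7
      []      ⊠ v = Vec.replicate 7 false
      (a ∷ u) ⊠ v = (if a then v else Vec.replicate 7 false) ⊞ times-θ (u ⊠ v)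

      if-homo : ∀ a v → ⟦ if a then v else Vec.replicate 7 false ⟧ᵥ ≡ bit a * ⟦ v ⟧ᵥ
      if-homo true  v = sym (*-identityˡ _)
      if-homo false v = trans (eval-0 7 θ) (sym (zeroˡ _))

      ⊠-homo : ∀ {n} (u : Vec Bool n) v → ⟦ u ⊠ v ⟧ᵥ ≡ ⟦ u ⟧ᵥ * ⟦ v ⟧ᵥ
      ⊠-homo []      v = trans (eval-0 7 θ) (sym (zeroˡ _))
      ⊠-homo (a ∷ u) v = trans (⊞-homo (if a then v else Vec.replicate 7 false) (times-θ (u ⊠ v)))
        (trans (cong₂ _+_ (if-homo a v) (trans (times-θ-homo (u ⊠ v)) (cong (θ *_) (⊠-homo u v))))
        (solve 4 (λ a x u v → a :* v :+ x :* (u :* v) := (a :+ x :* u) :* v) refl (bit a) θ ⟦ u ⟧ᵥ ⟦ v ⟧ᵥ))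

      square^ : ℕ → Vec Bool 7 → Vec Bool 7
      square^ zero    v = v
      square^ (suc k) v = square^ k v ⊠ square^ k v

      square^-homo : ∀ k v → ⟦ square^ k v ⟧ᵥ ≡ φ^ k ⟦ v ⟧ᵥ
      square^-homo zero    v = refl
      square^-homo (suc k) v = trans (⊠-homo (square^ k v) (square^ k v)) (cong _² (square^-homo k v))

      trace : Vec Bool 7 → Vec Bool 7
      trace v = square^ 0 v ⊞ (square^ 1 v ⊞ (square^ 2 v ⊞ (square^ 3 v ⊞ (square^ 4 v ⊞ (square^ 5 v ⊞ square^ 6 v)))))

      opaque
        unfolding tr
        trace-homo : ∀ v → ⟦ trace v ⟧ᵥ ≡ tr ⟦ v ⟧ᵥ
        trace-homo v = plus 0 _ (plus 1 _ (plus 2 _ (plus 3 _ (plus 4 _ (plus 5 _ (square^-homo 6 v))))))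
          where
          plus : ∀ k (w : Vec Bool 7) {x} → ⟦ w ⟧ᵥ ≡ x → ⟦ square^ k v ⊞ w ⟧ᵥ ≡ φ^ k ⟦ v ⟧ᵥ + x
          plus k w eq = trans (⊞-homo (square^ k v) w) (cong₂ _+_ (square^-homo k v) eq)

      θᵥ : Vec Bool 7
      θᵥ = unit (suc zero)

      ⟦θᵥ⟧ : ⟦ θᵥ ⟧ᵥ ≡ θ
      ⟦θᵥ⟧ = solve 1 (λ x → con O :+ x :* (con I :+ x :* (con O :+ x :* (con O :+ x :* (con O :+ x :* (con O :+ x :* (con O :+ x :* con O)))))) := x) refl θ

      gram-table : ∀ (i j : Fin 7) → trace (square^ (toℕ i) θᵥ ⊠ square^ (toℕ j) θᵥ) ≡ does (i Fin.≟ j) ∷ Vec.replicate 6 false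
      gram-table = toWitness {a? = Fin.all? λ i → Fin.all? λ j → Vec.≡-dec Bool._≟_
        (trace (square^ (toℕ i) θᵥ ⊠ square^ (toℕ j) θᵥ)) (does (i Fin.≟ j) ∷ Vec.replicate 6 false)} _

    -- The conjugates of θ form a self-dual basis.
    gram : ∀ (i j : Fin 7) → tr (φ^ (toℕ i) θ * φ^ (toℕ j) θ) ≡ bit (does (i Fin.≟ j))
    gram i j = begin
      tr (φ^ (toℕ i) θ * φ^ (toℕ j) θ)
        ≡⟨ cong₂ (λ x y → tr (x * y)) (lemma i) (lemma j) ⟨
      tr (⟦ square^ (toℕ i) θᵥ ⟧ᵥ * ⟦ square^ (toℕ j) θᵥ ⟧ᵥ)
        ≡⟨ cong tr (⊠-homo (square^ (toℕ i) θᵥ) (square^ (toℕ j) θᵥ)) ⟨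
      tr ⟦ square^ (toℕ i) θᵥ ⊠ square^ (toℕ j) θᵥ ⟧ᵥ
        ≡⟨ trace-homo (square^ (toℕ i) θᵥ ⊠ square^ (toℕ j) θᵥ) ⟨
      ⟦ trace (square^ (toℕ i) θᵥ ⊠ square^ (toℕ j) θᵥ) ⟧ᵥ
        ≡⟨ cong (⟦_⟧ᵥ {7}) (gram-table i j) ⟩
      bit (does (i Fin.≟ j)) + θ * ⟦ Vec.replicate 6 false ⟧ᵥ
        ≡⟨ trans (cong (λ y → bit (does (i Fin.≟ j)) + θ * y) (eval-0 6 θ)) (trans (cong (bit (does (i Fin.≟ j)) +_) (zeroʳ θ)) (+-identityʳ _)) ⟩
      bit (does (i Fin.≟ j)) ∎
      where
      lemma : ∀ (i : Fin 7) → ⟦ square^ (toℕ i) θᵥ ⟧ᵥ ≡ φ^ (toℕ i) θ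
      lemma i = trans (square^-homo (toℕ i) θᵥ) (cong (φ^ (toℕ i)) ⟦θᵥ⟧)

  -- Normal-basis coordinates and the automorphisms of the field.

  module NormalBasis where
    open Field
    open Polynomials using (θ; gram)

    lin : ∀ {n} → Vec Bool n → Vec Carrier n → Carrier
    lin []      []       = 0#
    lin (b ∷ v) (x ∷ xs) = bit b * x + lin v xs

    lin-⊞ : ∀ {n} (u v : Vec Bool n) xs → lin (u ⊞ v) xs ≡ lin u xs + lin v xs
    lin-⊞ [] [] [] = sym (+-identityˡ 0#)
    lin-⊞ (a ∷ u) (b ∷ v) (x ∷ xs) = trans (cong₂ (λ y z → y * x + z) (bit-+ a b) (lin-⊞ u v xs))
      (solve 5 (λ a b x p q → (a :+ b) :* x :+ (p :+ q) := a :* x :+ p :+ (b :* x :+ q)) refl (bit a) (bit b) x (lin u xs) (lin v xs))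

    -- The action of an additive map that commutes with multiplication by 0 and 1.
    lin-map : ∀ (f : Carrier → Carrier) → (∀ x y → f (x + y) ≡ f x + f y) → f 0# ≡ 0# →
              ∀ {n} (v : Vec Bool n) xs → f (lin v xs) ≡ lin v (Vec.map f xs)
    lin-map f f-+ f-0 [] [] = f-0
    lin-map f f-+ f-0 (b ∷ v) (x ∷ xs) = trans (f-+ _ _) (cong₂ _+_ (scale b) (lin-map f f-+ f-0 v xs))
      where
      scale : ∀ b → f (bit b * x) ≡ bit b * f x
      scale true  = trans (cong f (*-identityˡ x)) (sym (*-identityˡ _))
      scale false = trans (cong f (zeroˡ x)) (trans f-0 (sym (zeroˡ _)))

    lin-dot : ∀ {n} (u v : Vec Bool n) → lin u (Vec.map bit v) ≡ bit (dot u v)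
    lin-dot [] [] = refl
    lin-dot (a ∷ u) (b ∷ v) = trans (cong₂ _+_ (sym (bit-* a b)) (lin-dot u v)) (sym (bit-+ (a ∧ b) (dot u v)))

    basis : Vec Carrier 7
    basis = Vec.tabulate λ i → φ^ (toℕ i) θ

    opaque
      elem : Vec Bool 7 → Carrier
      elem v = lin v basis

      elem≡lin : ∀ v → elem v ≡ lin v basis
      elem≡lin v = refl

      elem-⊞ : ∀ u v → elem (u ⊞ v) ≡ elem u + elem v
      elem-⊞ u v = lin-⊞ u v basis

      -- Self-duality of the basis: the trace pairing with a basis element reads off its
      -- coefficient.
      coordinates : ∀ v (j : Fin 7) → tr (elem v * φ^ (toℕ j) θ) ≡ bit (lookup v j)
      coordinates v j = begin
        tr (lin v basis * φ^ (toℕ j) θ)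
          ≡⟨ lin-map (λ x → tr (x * φ^ (toℕ j) θ)) (λ x y → trans (cong tr (distribʳ _ x y)) (tr-+ _ _)) (trans (cong tr (zeroˡ _)) tr-0) v basis ⟩
        lin v (Vec.map (λ x → tr (x * φ^ (toℕ j) θ)) basis)
          ≡⟨ cong (lin v) (trans (sym (Vec.tabulate-∘ (λ x → tr (x * φ^ (toℕ j) θ)) (λ i → φ^ (toℕ i) θ)))
               (trans (Vec.tabulate-cong λ i → trans (cong tr (*-comm _ _)) (gram j i))
               (Vec.tabulate-∘ bit (λ i → does (j Fin.≟ i))))) ⟩
        lin v (Vec.map bit (unit j))
          ≡⟨ lin-dot v (unit j) ⟩
        bit (dot v (unit j))
          ≡⟨ cong bit (dot-unit v j) ⟩
        bit (lookup v j) ∎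

      trace-form : ∀ u v → tr (elem u * elem v) ≡ bit (dot u v)
      trace-form u v = begin
        tr (lin u basis * elem v)
          ≡⟨ lin-map (λ x → tr (x * elem v)) (λ x y → trans (cong tr (distribʳ _ x y)) (tr-+ _ _)) (trans (cong tr (zeroˡ _)) tr-0) u basis ⟩
        lin u (Vec.map (λ x → tr (x * elem v)) basis)
          ≡⟨ cong (lin u) (trans (sym (Vec.tabulate-∘ (λ x → tr (x * elem v)) (λ i → φ^ (toℕ i) θ)))
               (trans (Vec.tabulate-cong λ i → trans (cong tr (*-comm _ _)) (coordinates v i))
               (trans (Vec.tabulate-∘ bit (lookup v)) (cong (Vec.map bit) (Vec.tabulate∘lookup v))))) ⟩
        lin u (Vec.map bit v)
          ≡⟨ lin-dot u v ⟩
        bit (dot u v) ∎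

      elem-rot : ∀ v → elem (rot v) ≡ elem v ²
      elem-rot v@(a ∷ b ∷ c ∷ d ∷ e ∷ f ∷ g ∷ []) = sym (begin
        lin v basis ²
          ≡⟨ lin-map _² ²-+ (zeroˡ 0#) v basis ⟩
        lin v (Vec.map _² basis)
          ≡⟨ cong (λ y → bit a * φ^ 1 θ + (bit b * φ^ 2 θ + (bit c * φ^ 3 θ + (bit d * φ^ 4 θ + (bit e * φ^ 5 θ + (bit f * φ^ 6 θ + (bit g * y + 0#))))))) (φ^-7 θ) ⟩
        _ ≡⟨ solve 14 (λ a b c d e f g t₀ t₁ t₂ t₃ t₄ t₅ t₆ →
               a :* t₁ :+ (b :* t₂ :+ (c :* t₃ :+ (d :* t₄ :+ (e :* t₅ :+ (f :* t₆ :+ (g :* t₀ :+ con false)))))) :=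
               g :* t₀ :+ (a :* t₁ :+ (b :* t₂ :+ (c :* t₃ :+ (d :* t₄ :+ (e :* t₅ :+ (f :* t₆ :+ con false)))))))
             refl (bit a) (bit b) (bit c) (bit d) (bit e) (bit f) (bit g) θ (φ^ 1 θ) (φ^ 2 θ) (φ^ 3 θ) (φ^ 4 θ) (φ^ 5 θ) (φ^ 6 θ) ⟩
        lin (rot v) basis ∎)

      elem-unit : elem (unit zero) ≡ θ
      elem-unit = solve 7 (λ t₀ t₁ t₂ t₃ t₄ t₅ t₆ →
               con true :* t₀ :+ (con false :* t₁ :+ (con false :* t₂ :+ (con false :* t₃ :+ (con false :* t₄ :+ (con false :* t₅ :+ (con false :* t₆ :+ con false)))))) := t₀)
             refl θ (φ^ 1 θ) (φ^ 2 θ) (φ^ 3 θ) (φ^ 4 θ) (φ^ 5 θ) (φ^ 6 θ)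

    elem-injective : ∀ {u v} → elem u ≡ elem v → u ≡ v
    elem-injective {u} {v} eq = trans (sym (Vec.tabulate∘lookup u)) (trans (Vec.tabulate-cong λ i →
      bit-injective {lookup u i} {lookup v i} (trans (sym (coordinates u i)) (trans (cong (λ x → tr (x * φ^ (toℕ i) θ)) eq) (coordinates v i))))
      (Vec.tabulate∘lookup v))

    opaque
      elem-surjective : ∀ x → ∃ λ v → elem v ≡ x
      elem-surjective = injection⇒surjection (fromFin 7) elem (fromFin-injective 7) elem-injective

    elem-rot^ : ∀ k v → elem (rot^ k v) ≡ φ^ k (elem v)
    elem-rot^ zero    v = refl
    elem-rot^ (suc k) v = trans (elem-rot (rot^ k v)) (cong _² (elem-rot^ k v))

    module _ (σ : Carrier → Carrier) (σ-+ : ∀ x y → σ (x + y) ≡ σ x + σ y)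
             (σ-* : ∀ x y → σ (x * y) ≡ σ x * σ y) (σ-0 : σ 0# ≡ 0#) (σ-1 : σ 1# ≡ 1#) where
      private
        σ-φ^ : ∀ k x → σ (φ^ k x) ≡ φ^ k (σ x)
        σ-φ^ zero    x = refl
        σ-φ^ (suc k) x = trans (σ-* _ _) (cong _² (σ-φ^ k x))

        opaque
          unfolding tr
          σ-tr : ∀ x → σ (tr x) ≡ tr (σ x)
          σ-tr x = plus 0 (plus 1 (plus 2 (plus 3 (plus 4 (plus 5 (σ-φ^ 6 x))))))
            where
            plus : ∀ k {y z} → σ y ≡ z → σ (φ^ k x + y) ≡ φ^ k (σ x) + z
            plus k eq = trans (σ-+ _ _) (cong₂ _+_ (σ-φ^ k x) eq)

        σ-bit : ∀ b → σ (bit b) ≡ bit b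
        σ-bit true  = σ-1
        σ-bit false = σ-0

      -- An endomorphism commutes with squaring and with the trace, so `σ θ` again generates a
      -- self-dual normal basis. By `conjugates` the coordinate vector of such a generator is a
      -- shift of the first unit vector, so `σ θ` is a conjugate of `θ`; the conjugates of `θ` span
      -- the field, so this determines `σ`.
      endomorphism-frobenius : ∃ λ (k : Fin 7) → ∀ x → σ x ≡ φ^ (toℕ k) x
      endomorphism-frobenius with elem-surjective (σ θ)
      ... | w , elem[w]≡σθ = k , λ x → let (v , eq) = elem-surjective x in begin
        σ x ≡⟨ cong σ eq ⟨
        σ (elem v) ≡⟨ cong σ (elem≡lin v) ⟩
        σ (lin v basis) ≡⟨ lin-map σ σ-+ σ-0 v basis ⟩
        lin v (Vec.map σ basis) ≡⟨ cong (lin v) σ-basis ⟩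
        lin v (Vec.map (φ^ (toℕ k)) basis) ≡⟨ lin-map (φ^ (toℕ k)) (φ^-+ (toℕ k)) (φ^-0 (toℕ k)) v basis ⟨
        φ^ (toℕ k) (lin v basis) ≡⟨ cong (φ^ (toℕ k)) (trans (sym (elem≡lin v)) eq) ⟩
        φ^ (toℕ k) x ∎
        where
        σ-gram : ∀ (j : Fin 7) → dot w (rot^ (toℕ j) w) ≡ does (zero {6} Fin.≟ j)
        σ-gram j = bit-injective {dot w (rot^ (toℕ j) w)} {does (zero {6} Fin.≟ j)} (begin
          bit (dot w (rot^ (toℕ j) w)) ≡⟨ trace-form w (rot^ (toℕ j) w) ⟨
          tr (elem w * elem (rot^ (toℕ j) w)) ≡⟨ cong (λ x → tr (elem w * x)) (elem-rot^ (toℕ j) w) ⟩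
          tr (elem w * φ^ (toℕ j) (elem w)) ≡⟨ cong (λ x → tr (x * φ^ (toℕ j) x)) elem[w]≡σθ ⟩
          tr (σ θ * φ^ (toℕ j) (σ θ)) ≡⟨ cong (λ x → tr (σ θ * x)) (σ-φ^ (toℕ j) θ) ⟨
          tr (σ θ * σ (φ^ (toℕ j) θ)) ≡⟨ cong tr (σ-* θ (φ^ (toℕ j) θ)) ⟨
          tr (σ (θ * φ^ (toℕ j) θ)) ≡⟨ σ-tr _ ⟨
          σ (tr (θ * φ^ (toℕ j) θ)) ≡⟨ cong σ (gram zero j) ⟩
          σ (bit (does (zero {6} Fin.≟ j))) ≡⟨ σ-bit (does (zero {6} Fin.≟ j)) ⟩
          bit (does (zero {6} Fin.≟ j)) ∎)

        w-conjugate : ∃ λ (k : Fin 7) → w ≡ rot^ (toℕ k) (unit zero)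
        w-conjugate = conjugates w (σ-gram zero) (σ-gram (suc zero)) (σ-gram (suc (suc zero))) (σ-gram (suc (suc (suc zero))))

        k = proj₁ w-conjugate

        σθ : σ θ ≡ φ^ (toℕ k) θ
        σθ = begin
          σ θ ≡⟨ elem[w]≡σθ ⟨
          elem w ≡⟨ cong elem (proj₂ w-conjugate) ⟩
          elem (rot^ (toℕ k) (unit zero)) ≡⟨ elem-rot^ (toℕ k) (unit zero) ⟩
          φ^ (toℕ k) (elem (unit zero)) ≡⟨ cong (φ^ (toℕ k)) elem-unit ⟩
          φ^ (toℕ k) θ ∎

        σ-basis : Vec.map σ basis ≡ Vec.map (φ^ (toℕ k)) basis
        σ-basis = trans (sym (Vec.tabulate-∘ σ (λ i → φ^ (toℕ i) θ))) (trans (Vec.tabulate-cong λ i → begin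
            σ (φ^ (toℕ i) θ)              ≡⟨ σ-φ^ (toℕ i) θ ⟩
            φ^ (toℕ i) (σ θ)              ≡⟨ cong (φ^ (toℕ i)) σθ ⟩
            φ^ (toℕ i) (φ^ (toℕ k) θ)     ≡⟨ φ^-∘ (toℕ i) (toℕ k) θ ⟨
            φ^ (toℕ i ℕ.+ toℕ k) θ        ≡⟨ cong (λ n → φ^ n θ) (ℕ.+-comm (toℕ i) (toℕ k)) ⟩
            φ^ (toℕ k ℕ.+ toℕ i) θ        ≡⟨ φ^-∘ (toℕ k) (toℕ i) θ ⟩
            φ^ (toℕ k) (φ^ (toℕ i) θ)     ∎)
          (Vec.tabulate-∘ (φ^ (toℕ k)) (λ i → φ^ (toℕ i) θ)))

  -- Points, semilinear maps and collineations.

  module Geometry where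
    open Field
    open PG hiding (Tr)
    open RingMorphisms rawRing rawRing using (IsRingIsomorphism)

    vec≡ : ∀ {a b c a′ b′ c′ : Carrier} → a ≡ a′ → b ≡ b′ → c ≡ c′ → (a ∷ b ∷ c ∷ []) ≡ (a′ ∷ b′ ∷ c′ ∷ [])
    vec≡ refl refl refl = refl

    coords : ∀ {a b c a′ b′ c′ : Carrier} → (a ∷ b ∷ c ∷ []) ≡ (a′ ∷ b′ ∷ c′ ∷ []) → a ≡ a′ × b ≡ b′ × c ≡ c′
    coords refl = refl , refl , refl

    ⁻¹-≢0 : ∀ {x} → x ≢ 0# → x ⁻¹ ≢ 0#
    ⁻¹-≢0 {x} x≢0 eq = 1≢0 (trans (sym (*-inverseʳ x x≢0)) (trans (cong (x *_) eq) (zeroʳ x)))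

    *-inverseˡ : ∀ x → x ≢ 0# → x ⁻¹ * x ≡ 1#
    *-inverseˡ x x≢0 = trans (*-comm _ _) (*-inverseʳ x x≢0)

    ·-assoc : ∀ c d (v : V) → c · (d · v) ≡ (c * d) · v
    ·-assoc c d (x ∷ y ∷ z ∷ []) = vec≡ (sym (*-assoc c d x)) (sym (*-assoc c d y)) (sym (*-assoc c d z))

    1·v : ∀ v → 1# · v ≡ v
    1·v (x ∷ y ∷ z ∷ []) = vec≡ (*-identityˡ x) (*-identityˡ y) (*-identityˡ z)

    c·0 : ∀ c → c · 0ᵥ ≡ 0ᵥ
    c·0 c = vec≡ (zeroʳ c) (zeroʳ c) (zeroʳ c)

    ·-cancel : ∀ {c} v w → c ≢ 0# → w ≡ c · v → v ≡ c ⁻¹ · w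
    ·-cancel {c} v w c≢0 refl = sym (trans (·-assoc (c ⁻¹) c v) (trans (cong (_· v) (*-inverseˡ c c≢0)) (1·v v)))

    ∼-refl : ∀ P → P ∼ P
    ∼-refl (v , _) = 1# , 1≢0 , sym (1·v v)

    ∼-sym : ∀ P Q → P ∼ Q → Q ∼ P
    ∼-sym (v , _) (w , _) (c , c≢0 , eq) = c ⁻¹ , ⁻¹-≢0 c≢0 , ·-cancel v w c≢0 eq

    ∼-trans : ∀ P Q R → P ∼ Q → Q ∼ R → P ∼ R
    ∼-trans (u , _) _ _ (c , c≢0 , p) (d , d≢0 , q) = d * c , *-≢0 d≢0 c≢0 , trans q (trans (cong (d ·_) p) (·-assoc d c u))

    same-vector : ∀ P Q → proj₁ P ≡ proj₁ Q → P ∼ Q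
    same-vector (v , _) _ eq = 1# , 1≢0 , trans (sym eq) (sym (1·v v))

    ≐-refl : ∀ {S : PointSet} → S ≐ S
    ≐-refl = (λ p → p) , (λ p → p)

    ≐-sym : ∀ {S T : PointSet} → S ≐ T → T ≐ S
    ≐-sym (p , q) = (λ {x} → q {x}) , (λ {x} → p {x})

    ≐-trans : ∀ {S T U : PointSet} → S ≐ T → T ≐ U → S ≐ U
    ≐-trans (p , q) (r , s) = (λ {x} x∈ → r {x} (p {x} x∈)) , (λ {x} x∈ → q {x} (s {x} x∈))

    image-mono : ∀ {f g} {S T : PointSet} → (∀ P → g P ∼ f P) → S ≐ T → image f S ≐ image g T
    image-mono {f} {g} g∼f (p , q) =
      (λ {Q} (P , P∈ , eq) → P , p {P} P∈ , ∼-trans (g P) (f P) Q (g∼f P) eq) ,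
      (λ {Q} (P , P∈ , eq) → P , q {P} P∈ , ∼-trans (f P) (g P) Q (∼-sym (g P) (f P) (g∼f P)) eq)

    image-∘ : ∀ {f g h} {S : PointSet} → (∀ {P Q} → P ∼ Q → f P ∼ f Q) → (∀ P → h P ∼ f (g P)) → image h S ≐ image f (image g S)
    image-∘ {f} {g} {h} f-cong h∼ =
      (λ {Q} (P , P∈ , eq) → g P , (P , P∈ , ∼-refl (g P)) , ∼-trans (f (g P)) (h P) Q (∼-sym (h P) (f (g P)) (h∼ P)) eq) ,
      (λ {Q} (R , (P , P∈ , eq) , eq′) → P , P∈ , ∼-trans (h P) (f (g P)) Q (h∼ P) (∼-trans (f (g P)) (f R) Q (f-cong {g P} {R} eq) eq′))

    -- A pair of mutually inverse maps induces equal images in both directions.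
    image-flip : ∀ {f g} {S T : PointSet} → (∀ {P Q} → P ∼ Q → g P ∼ g Q) → (∀ P → g (f P) ∼ P) → (∀ P → f (g P) ∼ P) →
                 (∀ {P Q} → P ∼ Q → S P → S Q) → T ≐ image f S → S ≐ image g T
    image-flip {f} {g} g-cong gf fg resp (p , q) =
      (λ {P} P∈ → f P , q {f P} (P , P∈ , ∼-refl (f P)) , gf P) ,
      (λ {P} (Q , Q∈ , gQ∼P) → let (R , R∈ , fR∼Q) = p {Q} Q∈ in
        resp {R} {P} (∼-trans R (g (f R)) P (∼-sym (g (f R)) R (gf R)) (∼-trans (g (f R)) (g Q) P (g-cong {f R} {Q} fR∼Q) gQ∼P)) R∈)

    image-resp : ∀ {f} {S : PointSet} → ∀ {P Q} → P ∼ Q → image f S P → image f S Q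
    image-resp {f} {P = P} {Q} P∼Q (R , R∈ , eq) = R , R∈ , ∼-trans (f R) P Q eq P∼Q

    isRingIsomorphism : ∀ {σ τ : Carrier → Carrier} → (∀ x y → σ (x + y) ≡ σ x + σ y) → (∀ x y → σ (x * y) ≡ σ x * σ y) →
                        σ 1# ≡ 1# → (∀ x → σ (τ x) ≡ x) → (∀ x → τ (σ x) ≡ x) → IsRingIsomorphism σ
    isRingIsomorphism {σ} {τ} +-homo *-homo 1-homo στ τσ = record
      { isRingMonomorphism = record
        { isRingHomomorphism = record
          { isSemiringHomomorphism = record
            { isNearSemiringHomomorphism = record
              { +-isMonoidHomomorphism = record
                { isMagmaHomomorphism = record { isRelHomomorphism = record { cong = cong σ } ; homo = +-homo }
                ; ε-homo = trans (cong σ (sym (x+x≡0 0#))) (trans (+-homo 0# 0#) (x+x≡0 _)) }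
              ; *-homo = *-homo }
            ; 1#-homo = 1-homo }
          ; -‿homo = λ x → trans (cong σ (-x≡x x)) (sym (-x≡x (σ x))) }
        ; injective = λ {x} {y} eq → trans (sym (τσ x)) (trans (cong τ eq) (τσ y)) }
      ; surjective = λ y → τ y , λ { refl → στ y } }

    module Act (g : ΓL) where
      open ΓL g
      open IsRingIsomorphism σ-automorphism public using (+-homo; *-homo; 0#-homo; 1#-homo)

      to⁻¹ : V → V
      to⁻¹ v = proj₁ (proj₂ bijective v)

      to-to⁻¹ : ∀ v → to (to⁻¹ v) ≡ v
      to-to⁻¹ v = proj₂ (proj₂ bijective v) refl

      to⁻¹-to : ∀ v → to⁻¹ (to v) ≡ v
      to⁻¹-to v = proj₁ bijective (to-to⁻¹ (to v))

      frobenius : ∃ λ (k : Fin 7) → ∀ x → σ x ≡ φ^ (toℕ k) x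
      frobenius = NormalBasis.endomorphism-frobenius σ +-homo *-homo 0#-homo 1#-homo

      σ-≢0 : ∀ {c} → c ≢ 0# → σ c ≢ 0#
      σ-≢0 {c} c≢0 eq = c≢0 (φ^-injective (toℕ k) (trans (sym (σ≡ c)) (trans eq (sym (φ^-0 (toℕ k))))))
        where
        k = proj₁ frobenius
        σ≡ = proj₂ frobenius

      act-cong : ∀ {P Q} → P ∼ Q → act P ∼ act Q
      act-cong {v , _} (c , c≢0 , eq) = σ c , σ-≢0 c≢0 , trans (cong to eq) (semilinear c v)

    infixr 9 _∘ᴳ_
    _∘ᴳ_ : ΓL → ΓL → ΓL
    g ∘ᴳ h = record
      { to = ΓL.to g ∘ ΓL.to h
      ; σ = ΓL.σ g ∘ ΓL.σ h
      ; σ-automorphism = isRingIsomorphism {τ = h.τ ∘ g.τ}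
          (λ x y → trans (cong (ΓL.σ g) (h.+-homo x y)) (g.+-homo _ _))
          (λ x y → trans (cong (ΓL.σ g) (h.*-homo x y)) (g.*-homo _ _))
          (trans (cong (ΓL.σ g) h.1#-homo) g.1#-homo)
          (λ x → trans (cong (ΓL.σ g) (h.στ (g.τ x))) (g.στ x))
          (λ x → trans (cong h.τ (g.τσ (ΓL.σ h x))) (h.τσ x))
      ; additive = λ u v → trans (cong (ΓL.to g) (ΓL.additive h u v)) (ΓL.additive g _ _)
      ; semilinear = λ c v → trans (cong (ΓL.to g) (ΓL.semilinear h c v)) (ΓL.semilinear g _ _)
      ; bijective = (λ eq → proj₁ (ΓL.bijective h) (proj₁ (ΓL.bijective g) eq)) ,
          λ v → h.to⁻¹ (g.to⁻¹ v) , λ { refl → trans (cong (ΓL.to g) (h.to-to⁻¹ _)) (g.to-to⁻¹ v) } }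
      where
      module Aut (g : ΓL) where
        open Act g public
        open IsRingIsomorphism (ΓL.σ-automorphism g)
        τ : Carrier → Carrier
        τ x = proj₁ (surjective x)
        στ : ∀ x → ΓL.σ g (τ x) ≡ x
        στ x = proj₂ (surjective x) refl
        τσ : ∀ x → τ (ΓL.σ g x) ≡ x
        τσ x = injective (στ (ΓL.σ g x))
      module g = Aut g
      module h = Aut h

    _⁻¹ᴳ : ΓL → ΓL
    g ⁻¹ᴳ = record
      { to = to⁻¹
      ; σ = τ
      ; σ-automorphism = isRingIsomorphism {τ = σ}
          (λ x y → injective (trans (στ _) (sym (trans (+-homo _ _) (cong₂ _+_ (στ x) (στ y))))))
          (λ x y → injective (trans (στ _) (sym (trans (*-homo _ _) (cong₂ _*_ (στ x) (στ y))))))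
          (injective (trans (στ _) (sym 1#-homo)))
          (λ x → injective (στ (σ x)))
          στ
      ; additive = λ u v → proj₁ bijective (trans (to-to⁻¹ _) (sym (trans (additive _ _) (cong₂ _+ᵥ_ (to-to⁻¹ u) (to-to⁻¹ v)))))
      ; semilinear = λ c v → proj₁ bijective (trans (to-to⁻¹ _) (sym (trans (semilinear _ _) (cong₂ _·_ (στ c) (to-to⁻¹ v)))))
      ; bijective = (λ {u} {v} eq → trans (sym (to-to⁻¹ u)) (trans (cong to eq) (to-to⁻¹ v))) , λ v → to v , λ { refl → to⁻¹-to v } }
      where
      open ΓL g
      open Act g hiding (+-homo; *-homo; 0#-homo; 1#-homo)
      open IsRingIsomorphism σ-automorphism
      τ : Carrier → Carrier
      τ x = proj₁ (surjective x)
      στ : ∀ x → σ (τ x) ≡ x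
      στ x = proj₂ (surjective x) refl

    φ^-inverse : ∀ {k} → k ℕ.< 7 → ∀ x → φ^ k (φ^ (7 ℕ.∸ k) x) ≡ x × φ^ (7 ℕ.∸ k) (φ^ k x) ≡ x
    φ^-inverse {k} k<7 x =
      trans (sym (φ^-∘ k (7 ℕ.∸ k) x)) (trans (cong (λ n → φ^ n x) (ℕ.m+[n∸m]≡n (ℕ.<⇒≤ k<7))) (φ^-7 x)) ,
      trans (sym (φ^-∘ (7 ℕ.∸ k) k x)) (trans (cong (λ n → φ^ n x) (ℕ.m∸n+n≡m (ℕ.<⇒≤ k<7))) (φ^-7 x))

    -- The linear maps that fix the nucleus, normalized to have determinant 1 on the quotient plane.
    record Transformation : Set where
      field
        s t u v m n e : Carrier
        det : s * v + t * u ≡ 1#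
        e≢0 : e ≢ 0#

      apply : V → V
      apply (x ∷ y ∷ z ∷ []) = (s * x + t * y) ∷ (u * x + v * y) ∷ (m * x + n * y + e * z) ∷ []

    open Transformation using (apply)

    inverse : Transformation → Transformation
    inverse T = record { s = v ; t = t ; u = u ; v = s ; m = e ⁻¹ * (m * v + n * u) ; n = e ⁻¹ * (m * t + n * s) ; e = e ⁻¹
      ; det = trans (cong₂ _+_ (*-comm v s) refl) det ; e≢0 = ⁻¹-≢0 e≢0 }
      where open Transformation T

    module _ (T : Transformation) where
      open Transformation T hiding (apply)

      apply-inverse : ∀ w → apply T (apply (inverse T) w) ≡ w
      apply-inverse (x ∷ y ∷ z ∷ []) = vec≡
        (trans (solve 6 (λ s t u v x y → s :* (v :* x :+ t :* y) :+ t :* (u :* x :+ s :* y) := (s :* v :+ t :* u) :* x) refl s t u v x y)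
          (trans (cong (_* x) det) (*-identityˡ x)))
        (trans (solve 6 (λ s t u v x y → u :* (v :* x :+ t :* y) :+ v :* (u :* x :+ s :* y) := (s :* v :+ t :* u) :* y) refl s t u v x y)
          (trans (cong (_* y) det) (*-identityˡ y)))
        (trans (solve 11 (λ s t u v m n e f x y z → m :* (v :* x :+ t :* y) :+ n :* (u :* x :+ s :* y) :+
                  e :* (f :* (m :* v :+ n :* u) :* x :+ f :* (m :* t :+ n :* s) :* y :+ f :* z)
                := (m :* (v :* x :+ t :* y) :+ n :* (u :* x :+ s :* y)) :+ (e :* f) :* (m :* (v :* x :+ t :* y) :+ n :* (u :* x :+ s :* y) :+ z))
              refl s t u v m n e (e ⁻¹) x y z)
          (trans (cong (λ w → p + w * (p + z)) (*-inverseʳ e e≢0))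
            (solve 2 (λ p z → p :+ con true :* (p :+ z) := z) refl p z)))
        where p = m * (v * x + t * y) + n * (u * x + s * y)

      inverse-apply : ∀ w → apply (inverse T) (apply T w) ≡ w
      inverse-apply (x ∷ y ∷ z ∷ []) = vec≡
        (trans (solve 6 (λ s t u v x y → v :* (s :* x :+ t :* y) :+ t :* (u :* x :+ v :* y) := (s :* v :+ t :* u) :* x) refl s t u v x y)
          (trans (cong (_* x) det) (*-identityˡ x)))
        (trans (solve 6 (λ s t u v x y → u :* (s :* x :+ t :* y) :+ s :* (u :* x :+ v :* y) := (s :* v :+ t :* u) :* y) refl s t u v x y)
          (trans (cong (_* y) det) (*-identityˡ y)))
        (trans (solve 11 (λ s t u v m n e f x y z →
                  f :* (m :* v :+ n :* u) :* (s :* x :+ t :* y) :+ f :* (m :* t :+ n :* s) :* (u :* x :+ v :* y) :+ f :* (m :* x :+ n :* y :+ e :* z)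
                := f :* ((s :* v :+ t :* u) :* (m :* x :+ n :* y) :+ (m :* x :+ n :* y)) :+ (e :* f) :* z)
              refl s t u v m n e (e ⁻¹) x y z)
          (trans (cong₂ (λ w w′ → e ⁻¹ * (w * p + p) + w′ * z) det (*-inverseʳ e e≢0))
            (solve 3 (λ f p z → f :* (con true :* p :+ p) :+ con true :* z := z) refl (e ⁻¹) p z)))
        where p = m * x + n * y

      apply-· : ∀ c w → apply T (c · w) ≡ c · apply T w
      apply-· c (x ∷ y ∷ z ∷ []) = vec≡ (linear₂ s t) (linear₂ u v)
        (solve 7 (λ m n e c x y z → m :* (c :* x) :+ n :* (c :* y) :+ e :* (c :* z) := c :* (m :* x :+ n :* y :+ e :* z)) refl m n e c x y z)
        where
        linear₂ : ∀ s t → s * (c * x) + t * (c * y) ≡ c * (s * x + t * y)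
        linear₂ s t = solve 5 (λ s t c x y → s :* (c :* x) :+ t :* (c :* y) := c :* (s :* x :+ t :* y)) refl s t c x y

      apply-+ : ∀ w w′ → apply T (w +ᵥ w′) ≡ apply T w +ᵥ apply T w′
      apply-+ (x ∷ y ∷ z ∷ []) (x′ ∷ y′ ∷ z′ ∷ []) = vec≡ (linear₂ s t) (linear₂ u v)
        (solve 9 (λ m n e x y z x′ y′ z′ → m :* (x :+ x′) :+ n :* (y :+ y′) :+ e :* (z :+ z′) := m :* x :+ n :* y :+ e :* z :+ (m :* x′ :+ n :* y′ :+ e :* z′))
          refl m n e x y z x′ y′ z′)
        where
        linear₂ : ∀ s t → s * (x + x′) + t * (y + y′) ≡ s * x + t * y + (s * x′ + t * y′)
        linear₂ s t = solve 6 (λ s t x y x′ y′ → s :* (x :+ x′) :+ t :* (y :+ y′) := s :* x :+ t :* y :+ (s :* x′ :+ t :* y′)) refl s t x y x′ y′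

    φᵥ : ℕ → V → V
    φᵥ k = Vec.map (φ^ k)

    φᵥ-inverse : ∀ {k} → k ℕ.< 7 → ∀ w → φᵥ k (φᵥ (7 ℕ.∸ k) w) ≡ w × φᵥ (7 ℕ.∸ k) (φᵥ k w) ≡ w
    φᵥ-inverse k<7 (x ∷ y ∷ z ∷ []) =
      vec≡ (proj₁ (φ^-inverse k<7 x)) (proj₁ (φ^-inverse k<7 y)) (proj₁ (φ^-inverse k<7 z)) ,
      vec≡ (proj₂ (φ^-inverse k<7 x)) (proj₂ (φ^-inverse k<7 y)) (proj₂ (φ^-inverse k<7 z))

    φᵥ-+ : ∀ k w w′ → φᵥ k (w +ᵥ w′) ≡ φᵥ k w +ᵥ φᵥ k w′
    φᵥ-+ k (_ ∷ _ ∷ _ ∷ []) (_ ∷ _ ∷ _ ∷ []) = vec≡ (φ^-+ k _ _) (φ^-+ k _ _) (φ^-+ k _ _)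

    φᵥ-· : ∀ k c w → φᵥ k (c · w) ≡ φ^ k c · φᵥ k w
    φᵥ-· k c (_ ∷ _ ∷ _ ∷ []) = vec≡ (φ^-* k _ _) (φ^-* k _ _) (φ^-* k _ _)

    module _ {k} (k<7 : k ℕ.< 7) (M N : V → V) (MN : ∀ w → M (N w) ≡ w) (NM : ∀ w → N (M w) ≡ w)
             (M-+ : ∀ w w′ → M (w +ᵥ w′) ≡ M w +ᵥ M w′) (M-· : ∀ c w → M (c · w) ≡ c · M w) where

      semilinear : ΓL
      semilinear = record
        { to = M ∘ φᵥ k
        ; σ = φ^ k
        ; σ-automorphism = isRingIsomorphism {τ = φ^ (7 ℕ.∸ k)} (φ^-+ k) (φ^-* k) (φ^-1 k)
            (λ x → proj₁ (φ^-inverse k<7 x)) (λ x → proj₂ (φ^-inverse k<7 x))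
        ; additive = λ w w′ → trans (cong M (φᵥ-+ k w w′)) (M-+ (φᵥ k w) (φᵥ k w′))
        ; semilinear = λ c w → trans (cong M (φᵥ-· k c w)) (M-· (φ^ k c) (φᵥ k w))
        ; bijective = (λ {w} {w′} eq → trans (sym (proj₂ (φᵥ-inverse k<7 w))) (trans (cong (φᵥ (7 ℕ.∸ k))
              (trans (sym (NM (φᵥ k w))) (trans (cong N eq) (NM (φᵥ k w′))))) (proj₂ (φᵥ-inverse k<7 w′)))) ,
            λ w → φᵥ (7 ℕ.∸ k) (N w) , λ { refl → trans (cong M (proj₁ (φᵥ-inverse k<7 _))) (MN w) } }

    transform : Transformation → ∀ {k} → k ℕ.< 7 → ΓL
    transform T k<7 = semilinear k<7 (apply T) (apply (inverse T)) (apply-inverse T) (inverse-apply T) (apply-+ T) (apply-· T)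

    linear : Transformation → ΓL
    linear T = transform T {0} (s≤s z≤n)

    act-linear : Transformation → Point → Point
    act-linear T = ΓL.act (linear T)

    ⟨_,_⟩ : V → V → Carrier
    ⟨ a ∷ b ∷ c ∷ [] , x ∷ y ∷ z ∷ [] ⟩ = a * x + b * y + c * z

    ⟨⟩-· : ∀ l c w → ⟨ l , c · w ⟩ ≡ c * ⟨ l , w ⟩
    ⟨⟩-· (a ∷ b ∷ c ∷ []) d (x ∷ y ∷ z ∷ []) = solve 7 (λ a b c d x y z →
      a :* (d :* x) :+ b :* (d :* y) :+ c :* (d :* z) := d :* (a :* x :+ b :* y :+ c :* z)) refl a b c d x y z

    ⟨0,⟩ : ∀ w → ⟨ 0ᵥ , w ⟩ ≡ 0#
    ⟨0,⟩ (x ∷ y ∷ z ∷ []) = solve 3 (λ x y z → con false :* x :+ con false :* y :+ con false :* z := con false) refl x y z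

    ⟨⟩-nondegenerate : ∀ l → (∀ w → ⟨ l , w ⟩ ≡ 0#) → l ≡ 0ᵥ
    ⟨⟩-nondegenerate (a ∷ b ∷ c ∷ []) h = vec≡
      (trans (solve 3 (λ a b c → a := a :* con true :+ b :* con false :+ c :* con false) refl a b c) (h (1# ∷ 0# ∷ 0# ∷ [])))
      (trans (solve 3 (λ a b c → b := a :* con false :+ b :* con true :+ c :* con false) refl a b c) (h (0# ∷ 1# ∷ 0# ∷ [])))
      (trans (solve 3 (λ a b c → c := a :* con false :+ b :* con false :+ c :* con true) refl a b c) (h (0# ∷ 0# ∷ 1# ∷ [])))

    on⇒⟨⟩ : ∀ l {P} → pointsOn l P → ⟨ proj₁ l , proj₁ P ⟩ ≡ 0#
    on⇒⟨⟩ (_ ∷ _ ∷ _ ∷ [] , _) {_ ∷ _ ∷ _ ∷ [] , _} eq = eq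

    ⟨⟩⇒on : ∀ l {P} → ⟨ proj₁ l , proj₁ P ⟩ ≡ 0# → pointsOn l P
    ⟨⟩⇒on (_ ∷ _ ∷ _ ∷ [] , _) {_ ∷ _ ∷ _ ∷ [] , _} eq = eq

    collineation : Transformation → Collineation
    collineation T = record
      { to = act-linear T
      ; congruent = λ {P} {Q} → act-cong {P} {Q}
      ; bijective = (λ {P} {Q} (c , c≢0 , eq) → c , c≢0 , proj₁ (ΓL.bijective (linear T)) (trans eq (sym (ΓL.semilinear (linear T) c (proj₁ P))))) ,
          λ Q → act-linear (inverse T) Q , λ {R} R∼ → ∼-trans (act-linear T R) (act-linear T (act-linear (inverse T) Q)) Q
            (act-cong {R} {act-linear (inverse T) Q} R∼)
            (same-vector (act-linear T (act-linear (inverse T) Q)) Q (to-inverse (proj₁ Q)))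
      ; mapsLines = λ l → line l , (λ {Q} → onto l {Q}) , (λ {Q} → into l {Q}) }
      where
      open Act (linear T) using (act-cong)
      open Transformation T hiding (apply)

      id-map : ∀ (w : V) → φᵥ 0 w ≡ w
      id-map (_ ∷ _ ∷ _ ∷ []) = refl

      to-inverse : ∀ w → apply T (φᵥ 0 (apply (inverse T) (φᵥ 0 w))) ≡ w
      to-inverse w = trans (cong (apply T) (trans (id-map _) (cong (apply (inverse T)) (id-map w)))) (apply-inverse T w)

      module T⁻¹ = Transformation (inverse T)

      -- Lines are moved by the transpose of the inverse matrix, so that incidence is preserved.
      pull : V → V
      pull (a ∷ b ∷ c ∷ []) = (a * v + b * u + c * T⁻¹.m) ∷ (a * t + b * s + c * T⁻¹.n) ∷ (c * T⁻¹.e) ∷ []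

      pull-adjoint : ∀ l w → ⟨ pull l , w ⟩ ≡ ⟨ l , apply (inverse T) w ⟩
      pull-adjoint (a ∷ b ∷ c ∷ []) (x ∷ y ∷ z ∷ []) =
        solve 13 (λ a b c x y z s t u v m n e →
          (a :* v :+ b :* u :+ c :* m) :* x :+ (a :* t :+ b :* s :+ c :* n) :* y :+ (c :* e) :* z :=
          a :* (v :* x :+ t :* y) :+ b :* (u :* x :+ s :* y) :+ c :* (m :* x :+ n :* y :+ e :* z))
          refl a b c x y z s t u v T⁻¹.m T⁻¹.n T⁻¹.e

      pull-apply : ∀ l w → ⟨ pull l , apply T w ⟩ ≡ ⟨ l , w ⟩
      pull-apply l w = trans (pull-adjoint l (apply T w)) (cong ⟨ l ,_⟩ (inverse-apply T w))

      line : Line → Line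
      line (l , l≢0) = pull l , λ eq → l≢0 (⟨⟩-nondegenerate l λ w → trans (sym (pull-apply l w)) (trans (cong ⟨_, apply T w ⟩ eq) (⟨0,⟩ (apply T w))))

      onto : ∀ l {Q} → pointsOn (line l) Q → image (act-linear T) (pointsOn l) Q
      onto l {Q} Q∈ = act-linear (inverse T) Q ,
        ⟨⟩⇒on l {act-linear (inverse T) Q} (trans (cong (λ w → ⟨ proj₁ l , apply (inverse T) w ⟩) (id-map (proj₁ Q)))
          (trans (sym (pull-adjoint (proj₁ l) (proj₁ Q))) (on⇒⟨⟩ (line l) {Q} Q∈))) ,
        same-vector (act-linear T (act-linear (inverse T) Q)) Q (to-inverse (proj₁ Q))

      into : ∀ l {Q} → image (act-linear T) (pointsOn l) Q → pointsOn (line l) Q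
      into l {Q} (P , P∈ , c , _ , eq) = ⟨⟩⇒on (line l) {Q} (begin
        ⟨ pull (proj₁ l) , proj₁ Q ⟩ ≡⟨ cong ⟨ pull (proj₁ l) ,_⟩ eq ⟩
        ⟨ pull (proj₁ l) , c · apply T (φᵥ 0 (proj₁ P)) ⟩ ≡⟨ ⟨⟩-· (pull (proj₁ l)) c _ ⟩
        c * ⟨ pull (proj₁ l) , apply T (φᵥ 0 (proj₁ P)) ⟩ ≡⟨ cong (c *_) (pull-apply (proj₁ l) _) ⟩
        c * ⟨ proj₁ l , φᵥ 0 (proj₁ P) ⟩ ≡⟨ cong (λ w → c * ⟨ proj₁ l , w ⟩) (id-map (proj₁ P)) ⟩
        c * ⟨ proj₁ l , proj₁ P ⟩ ≡⟨ cong (c *_) (on⇒⟨⟩ l {P} P∈) ⟩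
        c * 0# ≡⟨ zeroʳ c ⟩
        0# ∎)

    infixr 9 _∘ᶜ_
    _∘ᶜ_ : Collineation → Collineation → Collineation
    φ ∘ᶜ ψ = record
      { to = to φ ∘ to ψ
      ; congruent = λ {P} {Q} P∼Q → congruent φ {to ψ P} {to ψ Q} (congruent ψ {P} {Q} P∼Q)
      ; bijective = (λ {P} {Q} eq → proj₁ (bijective ψ) {P} {Q} (proj₁ (bijective φ) {to ψ P} {to ψ Q} eq)) ,
          λ R → let (Q , hQ) = proj₂ (bijective φ) R ; (P , hP) = proj₂ (bijective ψ) Q in P , λ {P′} P′∼P → hQ {to ψ P′} (hP {P′} P′∼P)
      ; mapsLines = λ l → let (l′ , e) = mapsLines ψ l ; (l″ , e′) = mapsLines φ l′ in l″ ,
          ≐-trans {pointsOn l″} {image (to φ) (pointsOn l′)} {image (to φ ∘ to ψ) (pointsOn l)} e′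
            (≐-trans {image (to φ) (pointsOn l′)} {image (to φ) (image (to ψ) (pointsOn l))} {image (to φ ∘ to ψ) (pointsOn l)}
              (image-mono {to φ} {to φ} {pointsOn l′} {image (to ψ) (pointsOn l)} (λ P → ∼-refl (to φ P)) e)
              (≐-sym {image (to φ ∘ to ψ) (pointsOn l)} {image (to φ) (image (to ψ) (pointsOn l))}
                (image-∘ {to φ} {to ψ} {to φ ∘ to ψ} {pointsOn l} (λ {P} {Q} → congruent φ {P} {Q}) (λ P → ∼-refl (to φ (to ψ P)))))) }
      where open Collineation

  -- The fundamental theorem of projective geometry.

  module FundamentalTheorem where
    open Field
    open PG hiding (Tr)
    open Geometry

    det : V → V → V → Carrier
    det (a ∷ b ∷ c ∷ []) (d ∷ e ∷ f ∷ []) (g ∷ h ∷ i ∷ []) = a * (e * i + f * h) + b * (d * i + f * g) + c * (d * h + e * g)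

    infix 4 _∥_
    _∥_ : V → V → Set
    v ∥ w = ∃ λ c → c ≢ 0# × w ≡ c · v

    some-coordinate : ∀ {x y z} → (x ∷ y ∷ z ∷ []) ≢ 0ᵥ → x ≢ 0# ⊎ y ≢ 0# ⊎ z ≢ 0#
    some-coordinate {x} {y} {z} ≢0 with x ≟ 0# | y ≟ 0# | z ≟ 0#
    ... | no x≢0   | _        | _        = inj₁ x≢0
    ... | yes _    | no y≢0   | _        = inj₂ (inj₁ y≢0)
    ... | yes _    | yes _    | no z≢0   = inj₂ (inj₂ z≢0)
    ... | yes refl | yes refl | yes refl = contradiction refl ≢0

    linear-vanish : ∀ {x y z} u v w → x ≡ 0# → y ≡ 0# → z ≡ 0# → x * u + y * v + z * w ≡ 0#
    linear-vanish u v w refl refl refl = solve 3 (λ u v w → con false :* u :+ con false :* v :+ con false :* w := con false) refl u v w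

    -- Each coordinate of `l` times the determinant is a combination of the three incidences with
    -- minors as coefficients, and some coordinate of `l` is nonzero.
    collinear⇒det≡0 : ∀ l p q r → l ≢ 0ᵥ → ⟨ l , p ⟩ ≡ 0# → ⟨ l , q ⟩ ≡ 0# → ⟨ l , r ⟩ ≡ 0# → det p q r ≡ 0#
    collinear⇒det≡0 l@(l₁ ∷ l₂ ∷ l₃ ∷ []) p@(a ∷ b ∷ c ∷ []) q@(d ∷ e ∷ f ∷ []) r@(g ∷ h ∷ i ∷ []) l≢0 lp lq lr
      with some-coordinate l≢0
    ... | inj₁ ≢0 = zero-product (trans
      (solve 12 (λ l₁ l₂ l₃ a b c d e f g h i →
        l₁ :* (a :* (e :* i :+ f :* h) :+ b :* (d :* i :+ f :* g) :+ c :* (d :* h :+ e :* g)) :=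
        (l₁ :* a :+ l₂ :* b :+ l₃ :* c) :* (e :* i :+ f :* h) :+ (l₁ :* d :+ l₂ :* e :+ l₃ :* f) :* (b :* i :+ c :* h) :+ (l₁ :* g :+ l₂ :* h :+ l₃ :* i) :* (b :* f :+ c :* e))
        refl l₁ l₂ l₃ a b c d e f g h i) (linear-vanish (e * i + f * h) (b * i + c * h) (b * f + c * e) lp lq lr)) ≢0
    ... | inj₂ (inj₁ ≢0) = zero-product (trans
      (solve 12 (λ l₁ l₂ l₃ a b c d e f g h i →
        l₂ :* (a :* (e :* i :+ f :* h) :+ b :* (d :* i :+ f :* g) :+ c :* (d :* h :+ e :* g)) :=
        (l₁ :* a :+ l₂ :* b :+ l₃ :* c) :* (d :* i :+ f :* g) :+ (l₁ :* d :+ l₂ :* e :+ l₃ :* f) :* (a :* i :+ c :* g) :+ (l₁ :* g :+ l₂ :* h :+ l₃ :* i) :* (a :* f :+ c :* d))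
        refl l₁ l₂ l₃ a b c d e f g h i) (linear-vanish (d * i + f * g) (a * i + c * g) (a * f + c * d) lp lq lr)) ≢0
    ... | inj₂ (inj₂ ≢0) = zero-product (trans
      (solve 12 (λ l₁ l₂ l₃ a b c d e f g h i →
        l₃ :* (a :* (e :* i :+ f :* h) :+ b :* (d :* i :+ f :* g) :+ c :* (d :* h :+ e :* g)) :=
        (l₁ :* a :+ l₂ :* b :+ l₃ :* c) :* (d :* h :+ e :* g) :+ (l₁ :* d :+ l₂ :* e :+ l₃ :* f) :* (a :* h :+ b :* g) :+ (l₁ :* g :+ l₂ :* h :+ l₃ :* i) :* (a :* e :+ b :* d))
        refl l₁ l₂ l₃ a b c d e f g h i) (linear-vanish (d * h + e * g) (a * h + b * g) (a * e + b * d) lp lq lr)) ≢0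

    divide-by : ∀ {x} y → x ≢ 0# → y ≡ y * x ⁻¹ * x
    divide-by {x} y x≢0 = sym (trans (*-assoc y _ _) (trans (cong (y *_) (*-inverseˡ x x≢0)) (*-identityʳ y)))

    minor≡0 : ∀ {a b d e} → a ≢ 0# → a * e + b * d ≡ 0# → e ≡ d * a ⁻¹ * b
    minor≡0 {a} {b} {d} {e} a≢0 h = *-cancelˡ-≢0 a≢0 (trans (x+y≡0⇒x≡y h) (trans (cong (b *_) (divide-by d a≢0))
      (solve 4 (λ a b d a⁻¹ → b :* (d :* a⁻¹ :* a) := a :* (d :* a⁻¹ :* b)) refl a b d (a ⁻¹))))

    0·v : ∀ v → 0# · v ≡ 0ᵥ
    0·v (x ∷ y ∷ z ∷ []) = vec≡ (zeroˡ x) (zeroˡ y) (zeroˡ z)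

    ∥-intro : ∀ {p q} c → q ≢ 0ᵥ → q ≡ c · p → p ∥ q
    ∥-intro {p} c q≢0 eq = c , (λ { refl → q≢0 (trans eq (0·v p)) }) , eq

    cross : V → V → V
    cross (a ∷ b ∷ c ∷ []) (d ∷ e ∷ f ∷ []) = (b * f + c * e) ∷ (a * f + c * d) ∷ (a * e + b * d) ∷ []

    cross≡0⇒∥ : ∀ p q → p ≢ 0ᵥ → q ≢ 0ᵥ → cross p q ≡ 0ᵥ → p ∥ q
    cross≡0⇒∥ p@(a ∷ b ∷ c ∷ []) q@(d ∷ e ∷ f ∷ []) p≢0 q≢0 eq with coords eq | some-coordinate p≢0
    ... | bf , af , ae | inj₁ a≢0 = ∥-intro _ q≢0 (vec≡ (divide-by d a≢0) (minor≡0 a≢0 ae) (minor≡0 a≢0 af))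
    ... | bf , af , ae | inj₂ (inj₁ b≢0) = ∥-intro _ q≢0 (vec≡ (minor≡0 b≢0 (trans (+-comm _ _) ae)) (divide-by e b≢0) (minor≡0 b≢0 bf))
    ... | bf , af , ae | inj₂ (inj₂ c≢0) = ∥-intro _ q≢0
      (vec≡ (minor≡0 c≢0 (trans (+-comm _ _) af)) (minor≡0 c≢0 (trans (+-comm _ _) bf)) (divide-by f c≢0))

    -- The line through two distinct points is unique.
    line-unique : ∀ l p q r → p ≢ 0ᵥ → q ≢ 0ᵥ → ¬ p ∥ q → ⟨ l , p ⟩ ≡ 0# → ⟨ l , q ⟩ ≡ 0# → det p q r ≡ 0# → ⟨ l , r ⟩ ≡ 0#
    line-unique l@(l₁ ∷ l₂ ∷ l₃ ∷ []) p@(a ∷ b ∷ c ∷ []) q@(d ∷ e ∷ f ∷ []) r@(g ∷ h ∷ i ∷ []) p≢0 q≢0 ¬p∥q lp lq pqr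
      with some-coordinate (λ eq → ¬p∥q (cross≡0⇒∥ p q p≢0 q≢0 eq))
    ... | inj₁ ≢0 = zero-product (trans
      (solve 12 (λ l₁ l₂ l₃ a b c d e f g h i →
        (b :* f :+ c :* e) :* (l₁ :* g :+ l₂ :* h :+ l₃ :* i) :=
        (a :* (e :* i :+ f :* h) :+ b :* (d :* i :+ f :* g) :+ c :* (d :* h :+ e :* g)) :* l₁ :+ (l₁ :* a :+ l₂ :* b :+ l₃ :* c) :* (e :* i :+ f :* h) :+ (l₁ :* d :+ l₂ :* e :+ l₃ :* f) :* (b :* i :+ c :* h))
        refl l₁ l₂ l₃ a b c d e f g h i) (linear-vanish l₁ (e * i + f * h) (b * i + c * h) pqr lp lq)) ≢0
    ... | inj₂ (inj₁ ≢0) = zero-product (trans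
      (solve 12 (λ l₁ l₂ l₃ a b c d e f g h i →
        (a :* f :+ c :* d) :* (l₁ :* g :+ l₂ :* h :+ l₃ :* i) :=
        (a :* (e :* i :+ f :* h) :+ b :* (d :* i :+ f :* g) :+ c :* (d :* h :+ e :* g)) :* l₂ :+ (l₁ :* a :+ l₂ :* b :+ l₃ :* c) :* (d :* i :+ f :* g) :+ (l₁ :* d :+ l₂ :* e :+ l₃ :* f) :* (a :* i :+ c :* g))
        refl l₁ l₂ l₃ a b c d e f g h i) (linear-vanish l₂ (d * i + f * g) (a * i + c * g) pqr lp lq)) ≢0
    ... | inj₂ (inj₂ ≢0) = zero-product (trans
      (solve 12 (λ l₁ l₂ l₃ a b c d e f g h i →
        (a :* e :+ b :* d) :* (l₁ :* g :+ l₂ :* h :+ l₃ :* i) :=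
        (a :* (e :* i :+ f :* h) :+ b :* (d :* i :+ f :* g) :+ c :* (d :* h :+ e :* g)) :* l₃ :+ (l₁ :* a :+ l₂ :* b :+ l₃ :* c) :* (d :* h :+ e :* g) :+ (l₁ :* d :+ l₂ :* e :+ l₃ :* f) :* (a :* h :+ b :* g))
        refl l₁ l₂ l₃ a b c d e f g h i) (linear-vanish l₃ (d * h + e * g) (a * h + b * g) pqr lp lq)) ≢0

    point : ∀ x y z → x ≢ 0# ⊎ y ≢ 0# ⊎ z ≢ 0# → Point
    point x y z ≢0 = x ∷ y ∷ z ∷ [] , λ eq → let p , q , r = coords eq in [ (λ h → h p) , [ (λ h → h q) , (λ h → h r) ]′ ]′ ≢0

    affine : Carrier → Carrier → Point
    affine x y = point x y 1# (inj₂ (inj₂ 1≢0))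

    E₁ E₂ E₃ U : Point
    E₁ = point 1# 0# 0# (inj₁ 1≢0)
    E₂ = point 0# 1# 0# (inj₂ (inj₁ 1≢0))
    E₃ = affine 0# 0#
    U  = affine 1# 1#

    -- Coordinates with respect to the rescaled basis r·a, s·b, t·c, up to a common factor.
    module Frame (a b c : V) (r s t : Carrier) (abc≢0 : det a b c ≢ 0#) (r≢0 : r ≢ 0#) (s≢0 : s ≢ 0#) (t≢0 : t ≢ 0#) where

      -- `A` is the adjugate of `B`, given by Cramer's rule: both composites are multiplication by
      -- the determinant `D`. Images matter up to a factor, so `A` can stand for the inverse.
      B A : V → V
      B (x ∷ y ∷ z ∷ []) = x · (r · a) +ᵥ y · (s · b) +ᵥ z · (t · c)
      A p = det p (s · b) (t · c) ∷ det (r · a) p (t · c) ∷ det (r · a) (s · b) p ∷ []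

      D : Carrier
      D = det (r · a) (s · b) (t · c)

      det-scale : ∀ r s t (a b c : V) → det (r · a) (s · b) (t · c) ≡ r * s * t * det a b c
      det-scale r s t (a ∷ b ∷ c ∷ []) (d ∷ e ∷ f ∷ []) (g ∷ h ∷ i ∷ []) =
        solve 12 (λ r s t a b c d e f g h i →
          r :* a :* ((s :* e) :* (t :* i) :+ (s :* f) :* (t :* h)) :+ r :* b :* ((s :* d) :* (t :* i) :+ (s :* f) :* (t :* g)) :+ r :* c :* ((s :* d) :* (t :* h) :+ (s :* e) :* (t :* g))
          := r :* s :* t :* (a :* (e :* i :+ f :* h) :+ b :* (d :* i :+ f :* g) :+ c :* (d :* h :+ e :* g)))
        refl r s t a b c d e f g h i

      D≢0 : D ≢ 0#
      D≢0 eq = *-≢0 (*-≢0 (*-≢0 r≢0 s≢0) t≢0) abc≢0 (trans (sym (det-scale r s t a b c)) eq)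

      private
        a′ b′ c′ : V
        a′ = r · a
        b′ = s · b
        c′ = t · c

        cramer : ∀ (a b c p : V) → det p b c · a +ᵥ det a p c · b +ᵥ det a b p · c ≡ det a b c · p
        cramer (a ∷ b ∷ c ∷ []) (d ∷ e ∷ f ∷ []) (g ∷ h ∷ i ∷ []) (p ∷ q ∷ r ∷ []) = vec≡
          (solve 12 (λ a b c d e f g h i p q r →
            (p :* (e :* i :+ f :* h) :+ q :* (d :* i :+ f :* g) :+ r :* (d :* h :+ e :* g)) :* a :+ (a :* (q :* i :+ r :* h) :+ b :* (p :* i :+ r :* g) :+ c :* (p :* h :+ q :* g)) :* d :+ (a :* (e :* r :+ f :* q) :+ b :* (d :* r :+ f :* p) :+ c :* (d :* q :+ e :* p)) :* g
            := (a :* (e :* i :+ f :* h) :+ b :* (d :* i :+ f :* g) :+ c :* (d :* h :+ e :* g)) :* p) refl a b c d e f g h i p q r)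
          (solve 12 (λ a b c d e f g h i p q r →
            (p :* (e :* i :+ f :* h) :+ q :* (d :* i :+ f :* g) :+ r :* (d :* h :+ e :* g)) :* b :+ (a :* (q :* i :+ r :* h) :+ b :* (p :* i :+ r :* g) :+ c :* (p :* h :+ q :* g)) :* e :+ (a :* (e :* r :+ f :* q) :+ b :* (d :* r :+ f :* p) :+ c :* (d :* q :+ e :* p)) :* h
            := (a :* (e :* i :+ f :* h) :+ b :* (d :* i :+ f :* g) :+ c :* (d :* h :+ e :* g)) :* q) refl a b c d e f g h i p q r)
          (solve 12 (λ a b c d e f g h i p q r →
            (p :* (e :* i :+ f :* h) :+ q :* (d :* i :+ f :* g) :+ r :* (d :* h :+ e :* g)) :* c :+ (a :* (q :* i :+ r :* h) :+ b :* (p :* i :+ r :* g) :+ c :* (p :* h :+ q :* g)) :* f :+ (a :* (e :* r :+ f :* q) :+ b :* (d :* r :+ f :* p) :+ c :* (d :* q :+ e :* p)) :* i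
            := (a :* (e :* i :+ f :* h) :+ b :* (d :* i :+ f :* g) :+ c :* (d :* h :+ e :* g)) :* r) refl a b c d e f g h i p q r)

        det-combination : ∀ (a b c : V) x y z → let w = x · a +ᵥ y · b +ᵥ z · c in
                          det w b c ≡ det a b c * x × det a w c ≡ det a b c * y × det a b w ≡ det a b c * z
        det-combination (a ∷ b ∷ c ∷ []) (d ∷ e ∷ f ∷ []) (g ∷ h ∷ i ∷ []) x y z =
          solve 12 (λ a b c d e f g h i x y z → let X = x :* a :+ y :* d :+ z :* g ; Y = x :* b :+ y :* e :+ z :* h ; Z = x :* c :+ y :* f :+ z :* i in
            X :* (e :* i :+ f :* h) :+ Y :* (d :* i :+ f :* g) :+ Z :* (d :* h :+ e :* g)
            := (a :* (e :* i :+ f :* h) :+ b :* (d :* i :+ f :* g) :+ c :* (d :* h :+ e :* g)) :* x) refl a b c d e f g h i x y z ,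
          solve 12 (λ a b c d e f g h i x y z → let X = x :* a :+ y :* d :+ z :* g ; Y = x :* b :+ y :* e :+ z :* h ; Z = x :* c :+ y :* f :+ z :* i in
            a :* (Y :* i :+ Z :* h) :+ b :* (X :* i :+ Z :* g) :+ c :* (X :* h :+ Y :* g)
            := (a :* (e :* i :+ f :* h) :+ b :* (d :* i :+ f :* g) :+ c :* (d :* h :+ e :* g)) :* y) refl a b c d e f g h i x y z ,
          solve 12 (λ a b c d e f g h i x y z → let X = x :* a :+ y :* d :+ z :* g ; Y = x :* b :+ y :* e :+ z :* h ; Z = x :* c :+ y :* f :+ z :* i in
            a :* (e :* Z :+ f :* Y) :+ b :* (d :* Z :+ f :* X) :+ c :* (d :* Y :+ e :* X)
            := (a :* (e :* i :+ f :* h) :+ b :* (d :* i :+ f :* g) :+ c :* (d :* h :+ e :* g)) :* z) refl a b c d e f g h i x y z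

      A-B : ∀ w → A (B w) ≡ D · w
      A-B (x ∷ y ∷ z ∷ []) = let (p , q , r) = det-combination a′ b′ c′ x y z in vec≡ p q r

      B-A : ∀ p → B (A p) ≡ D · p
      B-A p = cramer a′ b′ c′ p

      B-combination : ∀ (a b c : V) e x y z x′ y′ z′ →
        (e * x + x′) · a +ᵥ (e * y + y′) · b +ᵥ (e * z + z′) · c ≡ e · (x · a +ᵥ y · b +ᵥ z · c) +ᵥ (x′ · a +ᵥ y′ · b +ᵥ z′ · c)
      B-combination (a₁ ∷ a₂ ∷ a₃ ∷ []) (b₁ ∷ b₂ ∷ b₃ ∷ []) (c₁ ∷ c₂ ∷ c₃ ∷ []) e x y z x′ y′ z′ = vec≡ (lemma a₁ b₁ c₁) (lemma a₂ b₂ c₂) (lemma a₃ b₃ c₃)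
        where
        lemma : ∀ a b c → (e * x + x′) * a + (e * y + y′) * b + (e * z + z′) * c ≡ e * (x * a + y * b + z * c) + (x′ * a + y′ * b + z′ * c)
        lemma a b c = solve 10 (λ a b c e x y z x′ y′ z′ →
          (e :* x :+ x′) :* a :+ (e :* y :+ y′) :* b :+ (e :* z :+ z′) :* c := e :* (x :* a :+ y :* b :+ z :* c) :+ (x′ :* a :+ y′ :* b :+ z′ :* c))
          refl a b c e x y z x′ y′ z′

      B-linear : ∀ e w w′ → B (e · w +ᵥ w′) ≡ e · B w +ᵥ B w′
      B-linear e (x ∷ y ∷ z ∷ []) (x′ ∷ y′ ∷ z′ ∷ []) = B-combination a′ b′ c′ e x y z x′ y′ z′

      B-+ : ∀ w w′ → B (w +ᵥ w′) ≡ B w +ᵥ B w′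
      B-+ w w′ = trans (cong (λ v → B (v +ᵥ w′)) (sym (1·v w))) (trans (B-linear 1# w w′) (cong (_+ᵥ B w′) (1·v (B w))))

      +-0ᵥ : ∀ v → v +ᵥ 0ᵥ ≡ v
      +-0ᵥ (x ∷ y ∷ z ∷ []) = vec≡ (+-identityʳ x) (+-identityʳ y) (+-identityʳ z)

      B-0 : B 0ᵥ ≡ 0ᵥ
      B-0 = zero-combination a′ b′ c′
        where
        zero-combination : ∀ (a b c : V) → 0# · a +ᵥ 0# · b +ᵥ 0# · c ≡ 0ᵥ
        zero-combination a b c = trans (cong₂ _+ᵥ_ (trans (cong₂ _+ᵥ_ (0·v a) (0·v b)) (+-0ᵥ 0ᵥ)) (0·v c)) (+-0ᵥ 0ᵥ)

      B-· : ∀ e w → B (e · w) ≡ e · B w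
      B-· e w = trans (cong B (sym (+-0ᵥ (e · w)))) (trans (B-linear e w 0ᵥ) (trans (cong (e · B w +ᵥ_) B-0) (+-0ᵥ _)))

      B⁻¹ : V → V
      B⁻¹ w = D ⁻¹ · A w

      D⁻¹·D· : ∀ w → D ⁻¹ · (D · w) ≡ w
      D⁻¹·D· w = trans (·-assoc (D ⁻¹) D w) (trans (cong (_· w) (*-inverseˡ D D≢0)) (1·v w))

      B-B⁻¹ : ∀ w → B (B⁻¹ w) ≡ w
      B-B⁻¹ w = trans (B-· (D ⁻¹) (A w)) (trans (cong (D ⁻¹ ·_) (B-A w)) (D⁻¹·D· w))

      B⁻¹-B : ∀ w → B⁻¹ (B w) ≡ w
      B⁻¹-B w = trans (cong (D ⁻¹ ·_) (A-B w)) (D⁻¹·D· w)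

      A-≢0 : ∀ {p} → p ≢ 0ᵥ → A p ≢ 0ᵥ
      A-≢0 {p} p≢0 eq = p≢0 (trans (sym (B-B⁻¹ p)) (trans (cong (λ w → B (D ⁻¹ · w)) eq) (trans (cong B (c·0 (D ⁻¹))) B-0)))

      B-injective : ∀ {v w} → B v ≡ B w → v ≡ w
      B-injective {v} {w} eq = trans (sym (B⁻¹-B v)) (trans (cong B⁻¹ eq) (B⁻¹-B w))

      A-· : ∀ e p → A (e · p) ≡ e · A p
      A-· e p = B-injective (trans (B-A (e · p)) (trans (·-assoc D e p)
        (trans (cong (_· p) (*-comm D e)) (trans (sym (·-assoc e D p)) (trans (cong (e ·_) (sym (B-A p))) (sym (B-· e (A p))))))))

      A-∥ : ∀ {p q} → p ∥ q → A p ∥ A q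
      A-∥ {p} (e , e≢0 , refl) = e , e≢0 , A-· e p

      A-∥⁻ : ∀ {p q} → A p ∥ A q → p ∥ q
      A-∥⁻ {p} {q} (e , e≢0 , eq) = e , e≢0 , trans (sym (B-B⁻¹ q)) (trans (cong (λ w → B (D ⁻¹ · w)) eq)
        (trans (cong B (trans (·-assoc (D ⁻¹) e (A p)) (trans (cong (_· A p) (*-comm _ _)) (sym (·-assoc e (D ⁻¹) (A p))))))
        (trans (B-· e (B⁻¹ p)) (cong (e ·_) (B-B⁻¹ p)))))

      ⟨⟩-combination : ∀ l (a b c : V) x y z → ⟨ l , x · a +ᵥ y · b +ᵥ z · c ⟩ ≡ ⟨ l , a ⟩ * x + ⟨ l , b ⟩ * y + ⟨ l , c ⟩ * z
      ⟨⟩-combination (l₁ ∷ l₂ ∷ l₃ ∷ []) (a ∷ b ∷ c ∷ []) (d ∷ e ∷ f ∷ []) (g ∷ h ∷ i ∷ []) x y z =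
        solve 15 (λ l₁ l₂ l₃ a b c d e f g h i x y z →
          l₁ :* (x :* a :+ y :* d :+ z :* g) :+ l₂ :* (x :* b :+ y :* e :+ z :* h) :+ l₃ :* (x :* c :+ y :* f :+ z :* i)
          := (l₁ :* a :+ l₂ :* b :+ l₃ :* c) :* x :+ (l₁ :* d :+ l₂ :* e :+ l₃ :* f) :* y :+ (l₁ :* g :+ l₂ :* h :+ l₃ :* i) :* z)
          refl l₁ l₂ l₃ a b c d e f g h i x y z

      A-line : ∀ (l : Line) {p q r} → ⟨ proj₁ l , p ⟩ ≡ 0# → ⟨ proj₁ l , q ⟩ ≡ 0# → ⟨ proj₁ l , r ⟩ ≡ 0# → det (A p) (A q) (A r) ≡ 0#
      A-line (l , l≢0) {p} {q} {r} lp lq lr = collinear⇒det≡0 L (A p) (A q) (A r) L≢0 (on-L p lp) (on-L q lq) (on-L r lr)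
        where
        L : V
        L = ⟨ l , a′ ⟩ ∷ ⟨ l , b′ ⟩ ∷ ⟨ l , c′ ⟩ ∷ []
        L-B : ∀ w → ⟨ l , B w ⟩ ≡ ⟨ L , w ⟩
        L-B (x ∷ y ∷ z ∷ []) = ⟨⟩-combination l a′ b′ c′ x y z
        on-L : ∀ p → ⟨ l , p ⟩ ≡ 0# → ⟨ L , A p ⟩ ≡ 0#
        on-L p lp = trans (sym (L-B (A p))) (trans (cong ⟨ l ,_⟩ (B-A p)) (trans (⟨⟩-· l D p) (trans (cong (D *_) lp) (zeroʳ D))))
        L≢0 : L ≢ 0ᵥ
        L≢0 eq = l≢0 (⟨⟩-nondegenerate l λ w → trans (cong ⟨ l ,_⟩ (sym (B-B⁻¹ w))) (trans (L-B (B⁻¹ w)) (trans (cong ⟨_, B⁻¹ w ⟩ eq) (⟨0,⟩ (B⁻¹ w)))))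

      A-multiple : ∀ e {p} w → e ≢ 0# → e · p ≡ B w → A p ≡ (e ⁻¹ * D) · w
      A-multiple e {p} w e≢0 eq = trans (cong A (·-cancel p (B w) e≢0 (sym eq)))
        (trans (A-· (e ⁻¹) (B w)) (trans (cong (e ⁻¹ ·_) (A-B w)) (·-assoc (e ⁻¹) D w)))

      private
        B-unit : ∀ (a b c : V) → a ≡ 1# · a +ᵥ 0# · b +ᵥ 0# · c × b ≡ 0# · a +ᵥ 1# · b +ᵥ 0# · c × c ≡ 0# · a +ᵥ 0# · b +ᵥ 1# · c
        B-unit (a ∷ b ∷ c ∷ []) (d ∷ e ∷ f ∷ []) (g ∷ h ∷ i ∷ []) =
          vec≡ (first a d g) (first b e h) (first c f i) , vec≡ (second a d g) (second b e h) (second c f i) , vec≡ (third a d g) (third b e h) (third c f i)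
          where
          first : ∀ x y z → x ≡ 1# * x + 0# * y + 0# * z
          first = solve 3 (λ x y z → x := con true :* x :+ con false :* y :+ con false :* z) refl
          second : ∀ x y z → y ≡ 0# * x + 1# * y + 0# * z
          second = solve 3 (λ x y z → y := con false :* x :+ con true :* y :+ con false :* z) refl
          third : ∀ x y z → z ≡ 0# * x + 0# * y + 1# * z
          third = solve 3 (λ x y z → z := con false :* x :+ con false :* y :+ con true :* z) refl

        det-cycle : ∀ (a b c : V) → det c a b ≡ det a b c
        det-cycle (a ∷ b ∷ c ∷ []) (d ∷ e ∷ f ∷ []) (g ∷ h ∷ i ∷ []) = solve 9 (λ a b c d e f g h i →
          g :* (b :* f :+ c :* e) :+ h :* (a :* f :+ c :* d) :+ i :* (a :* e :+ b :* d) := a :* (e :* i :+ f :* h) :+ b :* (d :* i :+ f :* g) :+ c :* (d :* h :+ e :* g))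
          refl a b c d e f g h i

        det-swap : ∀ (a b c : V) → det a c b ≡ det a b c
        det-swap (a ∷ b ∷ c ∷ []) (d ∷ e ∷ f ∷ []) (g ∷ h ∷ i ∷ []) = solve 9 (λ a b c d e f g h i →
          a :* (h :* f :+ i :* e) :+ b :* (g :* f :+ i :* d) :+ c :* (g :* e :+ h :* d) := a :* (e :* i :+ f :* h) :+ b :* (d :* i :+ f :* g) :+ c :* (d :* h :+ e :* g))
          refl a b c d e f g h i

      A-a : ∃ λ x → x ≢ 0# × A a ≡ x ∷ 0# ∷ 0# ∷ []
      A-a = r ⁻¹ * D , *-≢0 (⁻¹-≢0 r≢0) D≢0 ,
        trans (A-multiple r (1# ∷ 0# ∷ 0# ∷ []) r≢0 (proj₁ (B-unit a′ b′ c′))) (vec≡ (*-identityʳ _) (zeroʳ _) (zeroʳ _))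

      A-b : ∃ λ y → y ≢ 0# × A b ≡ 0# ∷ y ∷ 0# ∷ []
      A-b = s ⁻¹ * D , *-≢0 (⁻¹-≢0 s≢0) D≢0 ,
        trans (A-multiple s (0# ∷ 1# ∷ 0# ∷ []) s≢0 (proj₁ (proj₂ (B-unit a′ b′ c′)))) (vec≡ (zeroʳ _) (*-identityʳ _) (zeroʳ _))

      A-c : ∃ λ z → z ≢ 0# × A c ≡ 0# ∷ 0# ∷ z ∷ []
      A-c = t ⁻¹ * D , *-≢0 (⁻¹-≢0 t≢0) D≢0 ,
        trans (A-multiple t (0# ∷ 0# ∷ 1# ∷ []) t≢0 (proj₂ (proj₂ (B-unit a′ b′ c′)))) (vec≡ (zeroʳ _) (zeroʳ _) (*-identityʳ _))

      -- With these weights Cramer's rule says that the rescaled basis vectors add up to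
      -- `det a b c · u`; the fourth frame point therefore gets three equal coordinates.
      A-u : ∀ u → det b c u ≡ r → det a c u ≡ s → det a b u ≡ t → ∃ λ x → x ≢ 0# × A u ≡ x ∷ x ∷ x ∷ []
      A-u u p q o = det a b c ⁻¹ * D , *-≢0 (⁻¹-≢0 abc≢0) D≢0 ,
        trans (A-multiple (det a b c) (1# ∷ 1# ∷ 1# ∷ []) abc≢0 (trans (sym (cramer a b c u))
          (cong₂ _+ᵥ_ (cong₂ _+ᵥ_ (rescale (trans (det-cycle b c u) p)) (rescale (trans (det-swap a c u) q))) (rescale o))))
        (vec≡ (*-identityʳ _) (*-identityʳ _) (*-identityʳ _))
        where
        rescale : ∀ {e f v} → e ≡ f → e · v ≡ 1# · (f · v)
        rescale refl = sym (1·v _)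

    -- A map in coordinates in which the standard frame is fixed.
    module FrameFixing (ψ : Point → V) (ψ≢0 : ∀ P → ψ P ≢ 0ᵥ) (ψ-cong : ∀ P Q → P ∼ Q → ψ P ∥ ψ Q)
      (ψ-injective : ∀ P Q → ψ P ∥ ψ Q → P ∼ Q)
      (ψ-line : ∀ (l : Line) (P Q R : Point) → ⟨ proj₁ l , proj₁ P ⟩ ≡ 0# → ⟨ proj₁ l , proj₁ Q ⟩ ≡ 0# → ⟨ proj₁ l , proj₁ R ⟩ ≡ 0# → det (ψ P) (ψ Q) (ψ R) ≡ 0#)
      where

      module Normalized (ψE₁ : ∃ λ a → a ≢ 0# × ψ E₁ ≡ a ∷ 0# ∷ 0# ∷ []) (ψE₂ : ∃ λ b → b ≢ 0# × ψ E₂ ≡ 0# ∷ b ∷ 0# ∷ [])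
               (ψE₃ : ∃ λ c → c ≢ 0# × ψ E₃ ≡ 0# ∷ 0# ∷ c ∷ []) (ψU : ∃ λ d → d ≢ 0# × ψ U ≡ d ∷ d ∷ d ∷ []) where

        X Y Z : Point → Carrier
        X P = lookup (ψ P) zero
        Y P = lookup (ψ P) (suc zero)
        Z P = lookup (ψ P) (suc (suc zero))

        ψ≡ : ∀ P → ψ P ≡ X P ∷ Y P ∷ Z P ∷ []
        ψ≡ P with ψ P
        ... | _ ∷ _ ∷ _ ∷ [] = refl

        det-at : ∀ l P Q R {p q r} → ⟨ proj₁ l , proj₁ P ⟩ ≡ 0# → ⟨ proj₁ l , proj₁ Q ⟩ ≡ 0# → ⟨ proj₁ l , proj₁ R ⟩ ≡ 0# →
                 ψ P ≡ p → ψ Q ≡ q → ψ R ≡ r → det p q r ≡ 0#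
        det-at l P Q R lP lQ lR refl refl refl = ψ-line l P Q R lP lQ lR

        cancel₂ : ∀ {a b c y} → a ≢ 0# → b ≢ 0# → c ≡ a * b * y → c ≡ 0# → y ≡ 0#
        cancel₂ a≢0 b≢0 eq h = zero-product (trans (sym eq) h) (*-≢0 a≢0 b≢0)

        Y-axis : ∀ x → Y (affine x 0#) ≡ 0#
        Y-axis x = let (a , a≢0 , p) = ψE₁ ; (c , c≢0 , q) = ψE₃ ; P = affine x 0# in
          cancel₂ a≢0 c≢0
            (solve 5 (λ a c x y z → a :* (con false :* z :+ c :* y) :+ con false :* (con false :* z :+ c :* x) :+ con false :* (con false :* y :+ con false :* x) := a :* c :* y)
              refl a c (X P) (Y P) (Z P))
            (det-at (point 0# 1# 0# (inj₂ (inj₁ 1≢0))) E₁ E₃ P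
              (solve 0 (con false :* con true :+ con true :* con false :+ con false :* con false := con false) refl)
              (solve 0 (con false :* con false :+ con true :* con false :+ con false :* con true := con false) refl)
              (solve 1 (λ x → con false :* x :+ con true :* con false :+ con false :* con true := con false) refl x)
              p q (ψ≡ P))

        X-axis : ∀ y → X (affine 0# y) ≡ 0#
        X-axis y = let (b , b≢0 , p) = ψE₂ ; (c , c≢0 , q) = ψE₃ ; P = affine 0# y in
          cancel₂ b≢0 c≢0
            (solve 5 (λ b c x y z → con false :* (con false :* z :+ c :* y) :+ b :* (con false :* z :+ c :* x) :+ con false :* (con false :* y :+ con false :* x) := b :* c :* x)
              refl b c (X P) (Y P) (Z P))
            (det-at (point 1# 0# 0# (inj₁ 1≢0)) E₂ E₃ P
              (solve 0 (con true :* con false :+ con false :* con true :+ con false :* con false := con false) refl)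
              (solve 0 (con true :* con false :+ con false :* con false :+ con false :* con true := con false) refl)
              (solve 1 (λ y → con true :* con false :+ con false :* y :+ con false :* con true := con false) refl y)
              p q (ψ≡ P))

        affine≁infinite : ∀ {x y} v v≢0 → lookup v (suc (suc zero)) ≡ 0# → ¬ (v , v≢0) ∼ affine x y
        affine≁infinite (_ ∷ _ ∷ _ ∷ []) _ refl (c , _ , eq) = 1≢0 (trans (proj₂ (proj₂ (coords eq))) (zeroʳ c))

        Z-axis₁ : ∀ x → Z (affine x 0#) ≢ 0#
        Z-axis₁ x Z≡0 = let (a , a≢0 , p) = ψE₁ ; P = affine x 0# in
          affine≁infinite {x} {0#} (proj₁ E₁) (proj₂ E₁) refl (ψ-injective E₁ P
            (∥-intro (X P * a ⁻¹) (ψ≢0 P) (trans (ψ≡ P) (trans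
              (vec≡ (divide-by (X P) a≢0) (trans (Y-axis x) (sym (zeroʳ _))) (trans Z≡0 (sym (zeroʳ _)))) (cong ((X P * a ⁻¹) ·_) (sym p))))))

        Z-axis₂ : ∀ y → Z (affine 0# y) ≢ 0#
        Z-axis₂ y Z≡0 = let (b , b≢0 , p) = ψE₂ ; P = affine 0# y in
          affine≁infinite {0#} {y} (proj₁ E₂) (proj₂ E₂) refl (ψ-injective E₂ P
            (∥-intro (Y P * b ⁻¹) (ψ≢0 P) (trans (ψ≡ P) (trans
              (vec≡ (trans (X-axis y) (sym (zeroʳ _))) (divide-by (Y P) b≢0) (trans Z≡0 (sym (zeroʳ _)))) (cong ((Y P * b ⁻¹) ·_) (sym p))))))

        -- The maps induced on the two coordinate axes. Lines through `E₂` and through `E₁` carry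
        -- them to all affine points, and the line joining `E₃` to `U` shows that they agree.
        σ τ : Carrier → Carrier
        σ x = X (affine x 0#) * Z (affine x 0#) ⁻¹
        τ y = Y (affine 0# y) * Z (affine 0# y) ⁻¹

        X-affine : ∀ x y → X (affine x y) ≡ σ x * Z (affine x y)
        X-affine x y = let (b , b≢0 , p) = ψE₂ ; P = affine x 0# ; R = affine x y in
          x+y≡0⇒x≡y (cancel₂ b≢0 (Z-axis₁ x)
            (trans (cong (λ w → w * (b * Z R + 0# * Y R) + 0# * (0# * Z R + 0# * X R) + Z P * (0# * Y R + b * X R)) (divide-by (X P) (Z-axis₁ x)))
            (solve 6 (λ s z b x y w → s :* z :* (b :* w :+ con false :* y) :+ con false :* (con false :* w :+ con false :* x) :+ z :* (con false :* y :+ b :* x) := b :* z :* (x :+ s :* w))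
              refl (σ x) (Z P) b (X R) (Y R) (Z R)))
            (det-at (point 1# 0# x (inj₁ 1≢0)) P E₂ R
              (solve 1 (λ x → con true :* x :+ con false :* con false :+ x :* con true := con false) refl x)
              (solve 1 (λ x → con true :* con false :+ con false :* con true :+ x :* con false := con false) refl x)
              (solve 2 (λ x y → con true :* x :+ con false :* y :+ x :* con true := con false) refl x y)
              (trans (ψ≡ P) (vec≡ refl (Y-axis x) refl)) p (ψ≡ R)))

        Y-affine : ∀ x y → Y (affine x y) ≡ τ y * Z (affine x y)
        Y-affine x y = let (a , a≢0 , p) = ψE₁ ; P = affine 0# y ; R = affine x y in
          x+y≡0⇒x≡y (cancel₂ a≢0 (Z-axis₂ y)
            (trans (cong (λ w → 0# * (0# * Z R + 0# * Y R) + w * (a * Z R + 0# * X R) + Z P * (a * Y R + 0# * X R)) (divide-by (Y P) (Z-axis₂ y)))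
            (solve 6 (λ s z a x y w → con false :* (con false :* w :+ con false :* y) :+ s :* z :* (a :* w :+ con false :* x) :+ z :* (a :* y :+ con false :* x) := a :* z :* (y :+ s :* w))
              refl (τ y) (Z P) a (X R) (Y R) (Z R)))
            (det-at (point 0# 1# y (inj₂ (inj₁ 1≢0))) P E₁ R
              (solve 1 (λ y → con false :* con false :+ con true :* y :+ y :* con true := con false) refl y)
              (solve 1 (λ y → con false :* con true :+ con true :* con false :+ y :* con false := con false) refl y)
              (solve 2 (λ x y → con false :* x :+ con true :* y :+ y :* con true := con false) refl x y)
              (trans (ψ≡ P) (vec≡ (X-axis y) refl refl)) p (ψ≡ R)))

        Z-affine : ∀ x y → Z (affine x y) ≢ 0#
        Z-affine x y Z≡0 = ψ≢0 (affine x y) (trans (ψ≡ (affine x y)) (vec≡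
          (trans (X-affine x y) (trans (cong (σ x *_) Z≡0) (zeroʳ _))) (trans (Y-affine x y) (trans (cong (τ y *_) Z≡0) (zeroʳ _))) Z≡0))

        scale-1 : ∀ {s d} → d ≢ 0# → d ≡ s * d → s ≡ 1#
        scale-1 {s} {d} d≢0 eq = *-cancelˡ-≢0 d≢0 (trans (*-comm d s) (trans (sym eq) (sym (*-identityʳ d))))

        σ-1 : σ 1# ≡ 1#
        σ-1 = let (d , d≢0 , p) = ψU ; (x , y , z) = coords (trans (sym (ψ≡ U)) p) in
          scale-1 d≢0 (trans (sym x) (trans (X-affine 1# 1#) (cong (σ 1# *_) z)))

        σ≡τ : ∀ x → σ x ≡ τ x
        σ≡τ x = let (d , d≢0 , p) = ψU ; (c , c≢0 , q) = ψE₃ ; R = affine x x in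
          *-cancelˡ-≢0 (Z-affine x x) (trans (*-comm _ _) (trans (sym (X-affine x x)) (trans (sym (x+y≡0⇒x≡y (cancel₂ c≢0 d≢0
            (solve 5 (λ c d x y z → d :* (con false :* z :+ c :* y) :+ d :* (con false :* z :+ c :* x) :+ d :* (con false :* y :+ con false :* x) := c :* d :* (y :+ x))
              refl c d (X R) (Y R) (Z R))
            (det-at (point 1# 1# 0# (inj₁ 1≢0)) U E₃ R
              (solve 0 (con true :* con true :+ con true :* con true :+ con false :* con true := con false) refl)
              (solve 0 (con true :* con false :+ con true :* con false :+ con false :* con true := con false) refl)
              (solve 1 (λ x → con true :* x :+ con true :* x :+ con false :* con true := con false) refl x)
              p q (ψ≡ R))))) (trans (Y-affine x x) (*-comm _ _)))))

        ψ-affine : ∀ x y → ψ (affine x y) ≡ Z (affine x y) · (σ x ∷ σ y ∷ 1# ∷ [])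
        ψ-affine x y = trans (ψ≡ (affine x y)) (vec≡ (trans (X-affine x y) (*-comm _ _))
          (trans (Y-affine x y) (trans (cong (_* Z (affine x y)) (sym (σ≡τ y))) (*-comm _ _))) (sym (*-identityʳ _)))

        -- Collinearity of the images, tested on normalized coordinate vectors.
        det-affine : ∀ l x y Q x′ y′ {q} → ⟨ proj₁ l , x ∷ y ∷ 1# ∷ [] ⟩ ≡ 0# → ⟨ proj₁ l , proj₁ Q ⟩ ≡ 0# → ⟨ proj₁ l , x′ ∷ y′ ∷ 1# ∷ [] ⟩ ≡ 0# →
                     ψ Q ≡ q → det (σ x ∷ σ y ∷ 1# ∷ []) q (σ x′ ∷ σ y′ ∷ 1# ∷ []) ≡ 0#
        det-affine l x y Q x′ y′ {q₁ ∷ q₂ ∷ q₃ ∷ []} lP lQ lR eq =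
          cancel₂ (Z-affine x y) (Z-affine x′ y′)
            (solve 10 (λ z a b w c d p q r o →
              z :* a :* (q :* (w :* o) :+ r :* (w :* d)) :+ z :* b :* (p :* (w :* o) :+ r :* (w :* c)) :+ z :* o :* (p :* (w :* d) :+ q :* (w :* c))
              := z :* w :* (a :* (q :* o :+ r :* d) :+ b :* (p :* o :+ r :* c) :+ o :* (p :* d :+ q :* c)))
              refl (Z (affine x y)) (σ x) (σ y) (Z (affine x′ y′)) (σ x′) (σ y′) q₁ q₂ q₃ 1#)
            (det-at l (affine x y) Q (affine x′ y′) lP lQ lR (ψ-affine x y) eq (ψ-affine x′ y′))

        -- The points `(x , x * y)` and `(1 , y)` are collinear with the origin `E₃`.
        σ-* : ∀ x y → σ (x * y) ≡ σ x * σ y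
        σ-* x y = let (c , c≢0 , q) = ψE₃ in
          x+y≡0⇒x≡y (zero-product (trans
            (solve 4 (λ s t r c → c :* (r :+ s :* t) := s :* (con false :* con true :+ c :* t) :+ r :* (con false :* con true :+ c :* con true) :+ con true :* (con false :* t :+ con false :* con true))
              refl (σ x) (σ y) (σ (x * y)) c)
            (trans (cong (λ o → σ x * (0# * 1# + c * σ y) + σ (x * y) * (0# * 1# + c * o) + 1# * (0# * σ y + 0# * o)) (sym σ-1))
            (det-affine (point y 1# 0# (inj₂ (inj₁ 1≢0))) x (x * y) E₃ 1# y
              (solve 2 (λ x y → y :* x :+ con true :* (x :* y) :+ con false :* con true := con false) refl x y)
              (solve 1 (λ y → y :* con false :+ con true :* con false :+ con false :* con true := con false) refl y)
              (solve 1 (λ y → y :* con true :+ con true :* y :+ con false :* con true := con false) refl y) q))) c≢0)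

        D₁ : Point
        D₁ = point 1# 1# 0# (inj₁ 1≢0)

        Z-infinite : ∀ P → lookup (proj₁ P) (suc (suc zero)) ≡ 0# → Z P ≡ 0#
        Z-infinite P@(x ∷ y ∷ z ∷ [] , _) z≡0 = let (a , a≢0 , p) = ψE₁ ; (b , b≢0 , q) = ψE₂ in
          cancel₂ a≢0 b≢0
            (solve 5 (λ a b x y z → a :* (b :* z :+ con false :* y) :+ con false :* (con false :* z :+ con false :* x) :+ con false :* (con false :* y :+ b :* x) := a :* b :* z)
              refl a b (X P) (Y P) (Z P))
            (det-at (point 0# 0# 1# (inj₂ (inj₂ 1≢0))) E₁ E₂ P
              (solve 0 (con false :* con true :+ con false :* con false :+ con true :* con false := con false) refl)
              (solve 0 (con false :* con false :+ con false :* con true :+ con true :* con false := con false) refl)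
              (trans (solve 3 (λ x y z → con false :* x :+ con false :* y :+ con true :* z := z) refl x y z) z≡0)
              p q (ψ≡ P))

        -- The infinite point `(x , y , 0)` lies on the line joining the origin to the affine point
        -- `(x , y)`.
        XY-infinite : ∀ x y ≢0 → let P = point x y 0# ≢0 in X P * σ y ≡ Y P * σ x
        XY-infinite x y ≢0 = let P = point x y 0# ≢0 ; (c , c≢0 , q) = ψE₃ in
          x+y≡0⇒x≡y (cancel₂ c≢0 (Z-affine x y)
            (solve 7 (λ s t w c x y z → x :* (con false :* (w :* con true) :+ c :* (w :* t)) :+ y :* (con false :* (w :* con true) :+ c :* (w :* s)) :+ z :* (con false :* (w :* t) :+ con false :* (w :* s))
               := c :* w :* (x :* t :+ y :* s)) refl (σ x) (σ y) (Z (affine x y)) c (X P) (Y P) (Z P))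
            (det-at (point y x 0# (swap ≢0)) P E₃ (affine x y)
              (solve 2 (λ x y → y :* x :+ x :* y :+ con false :* con false := con false) refl x y)
              (solve 2 (λ x y → y :* con false :+ x :* con false :+ con false :* con true := con false) refl x y)
              (solve 2 (λ x y → y :* x :+ x :* y :+ con false :* con true := con false) refl x y)
              (ψ≡ P) q (ψ-affine x y)))
          where
          swap : x ≢ 0# ⊎ y ≢ 0# ⊎ 0# ≢ 0# → y ≢ 0# ⊎ x ≢ 0# ⊎ 0# ≢ 0#
          swap (inj₁ h) = inj₂ (inj₁ h)
          swap (inj₂ (inj₁ h)) = inj₁ h
          swap (inj₂ (inj₂ h)) = contradiction refl h

        ψD₁ : ψ D₁ ≡ X D₁ ∷ X D₁ ∷ 0# ∷ []
        ψD₁ = trans (ψ≡ D₁) (vec≡ refl (begin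
          Y D₁          ≡⟨ *-identityʳ _ ⟨
          Y D₁ * 1#     ≡⟨ cong (Y D₁ *_) σ-1 ⟨
          Y D₁ * σ 1#   ≡⟨ XY-infinite 1# 1# (inj₁ 1≢0) ⟨
          X D₁ * σ 1#   ≡⟨ cong (X D₁ *_) σ-1 ⟩
          X D₁ * 1#     ≡⟨ *-identityʳ _ ⟩
          X D₁          ∎) (Z-infinite D₁ refl))

        X-D₁ : X D₁ ≢ 0#
        X-D₁ eq = ψ≢0 D₁ (trans ψD₁ (vec≡ eq eq refl))

        σ-0 : σ 0# ≡ 0#
        σ-0 = let (c , c≢0 , q) = ψE₃ in trans (cong (_* Z E₃ ⁻¹) (cong (λ v → lookup v zero) q)) (zeroˡ _)

        -- The points `(0 , y)` and `(x , x + y)` lie on a line with direction `D₁`, whose image has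
        -- equal first two coordinates because `σ` fixes 1.
        σ-+ : ∀ x y → σ (x + y) ≡ σ x + σ y
        σ-+ x y = x+y≡0⇒x≡y (zero-product (trans
          (solve 4 (λ s t r d → d :* (r :+ (s :+ t)) := con false :* (d :* con true :+ con false :* r) :+ t :* (d :* con true :+ con false :* s) :+ con true :* (d :* r :+ d :* s))
            refl (σ x) (σ y) (σ (x + y)) (X D₁))
          (trans (cong (λ o → o * (X D₁ * 1# + 0# * σ (x + y)) + σ y * (X D₁ * 1# + 0# * σ x) + 1# * (X D₁ * σ (x + y) + X D₁ * σ x)) (sym σ-0))
          (det-affine (point 1# 1# y (inj₁ 1≢0)) 0# y D₁ x (x + y)
            (solve 1 (λ y → con true :* con false :+ con true :* y :+ y :* con true := con false) refl y)
            (solve 1 (λ y → con true :* con true :+ con true :* con true :+ y :* con false := con false) refl y)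
            (solve 2 (λ x y → con true :* x :+ con true :* (x :+ y) :+ y :* con true := con false) refl x y)
            ψD₁))) X-D₁)

        private
          frobenius : ∃ λ (k : Fin 7) → ∀ x → σ x ≡ φ^ (toℕ k) x
          frobenius = NormalBasis.endomorphism-frobenius σ σ-+ σ-* σ-0 σ-1

        exponent : Fin 7
        exponent = proj₁ frobenius

        private
          σ≡φ : ∀ x → σ x ≡ φ^ (toℕ exponent) x
          σ≡φ = proj₂ frobenius

          σ-≢0 : ∀ {x} → x ≢ 0# → σ x ≢ 0#
          σ-≢0 {x} x≢0 eq = x≢0 (φ^-injective (toℕ exponent) (trans (sym (σ≡φ x)) (trans eq (sym (φ^-0 (toℕ exponent))))))

          σᵥ : V → V
          σᵥ = Vec.map σ

          -- On the line at infinity the image is known up to the choice of a nonzero coordinate.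
          ψ-infinite : ∀ x y ≢0 → σᵥ (x ∷ y ∷ 0# ∷ []) ∥ ψ (point x y 0# ≢0)
          ψ-infinite x y ≢0 with some-coordinate (proj₂ (point x y 0# ≢0))
          ... | inj₁ x≢0 = let P = point x y 0# ≢0 in ∥-intro (X P * σ x ⁻¹) (ψ≢0 P) (trans (ψ≡ P) (vec≡
            (divide-by (X P) (σ-≢0 x≢0))
            (minor≡0 (σ-≢0 x≢0) (trans (cong₂ _+_ (trans (*-comm _ _) (sym (XY-infinite x y ≢0))) (*-comm _ _)) (x+x≡0 _)))
            (trans (Z-infinite P refl) (sym (trans (cong (X P * σ x ⁻¹ *_) σ-0) (zeroʳ _))))))
          ... | inj₂ (inj₁ y≢0) = let P = point x y 0# ≢0 in ∥-intro (Y P * σ y ⁻¹) (ψ≢0 P) (trans (ψ≡ P) (vec≡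
            (minor≡0 (σ-≢0 y≢0) (trans (cong₂ _+_ (trans (*-comm _ _) (XY-infinite x y ≢0)) (*-comm _ _)) (x+x≡0 _)))
            (divide-by (Y P) (σ-≢0 y≢0))
            (trans (Z-infinite P refl) (sym (trans (cong (Y P * σ y ⁻¹ *_) σ-0) (zeroʳ _))))))
          ... | inj₂ (inj₂ z≢0) = contradiction refl z≢0

          ∥-trans : ∀ {u v w} → u ∥ v → v ∥ w → u ∥ w
          ∥-trans {u} (c , c≢0 , p) (d , d≢0 , q) = d * c , *-≢0 d≢0 c≢0 , trans q (trans (cong (d ·_) p) (·-assoc d c u))

          σᵥ∥ψ : ∀ P → σᵥ (proj₁ P) ∥ ψ P
          σᵥ∥ψ P@(x ∷ y ∷ z ∷ [] , v≢0) with z ≟ 0#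
          ... | yes refl = ∥-trans (ψ-infinite x y (some-coordinate v≢0)) (ψ-cong (point x y 0# (some-coordinate v≢0)) P (same-vector (point x y 0# (some-coordinate v≢0)) P refl))
          ... | no z≢0 = ∥-trans {v = ψ Q} (Z Q * σ (z ⁻¹) , *-≢0 (Z-affine (z ⁻¹ * x) (z ⁻¹ * y)) (σ-≢0 (⁻¹-≢0 z≢0)) ,
              trans (ψ-affine (z ⁻¹ * x) (z ⁻¹ * y)) (trans (cong (Z Q ·_) (vec≡ (σ-* (z ⁻¹) x) (σ-* (z ⁻¹) y)
                (trans (sym σ-1) (trans (cong σ (sym (*-inverseˡ z z≢0))) (σ-* (z ⁻¹) z))))) (·-assoc (Z Q) (σ (z ⁻¹)) (σᵥ (proj₁ P)))))
            (ψ-cong Q P (z , z≢0 , vec≡ (unscale x) (unscale y) (sym (*-identityʳ z))))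
            where
            Q = affine (z ⁻¹ * x) (z ⁻¹ * y)
            unscale : ∀ w → w ≡ z * (z ⁻¹ * w)
            unscale w = sym (trans (sym (*-assoc z _ w)) (trans (cong (_* w) (*-inverseʳ z z≢0)) (*-identityˡ w)))

        frobenius-coordinates : ∀ P → φᵥ (toℕ exponent) (proj₁ P) ∥ ψ P
        frobenius-coordinates P = subst (_∥ ψ P) (Vec.map-cong σ≡φ (proj₁ P)) (σᵥ∥ψ P)

    module _ (φ : Collineation) where
      open Collineation φ

      private
        vec : Point → V
        vec P = proj₁ (to P)

        image-line : ∀ (l : Line) → ∃ λ (l′ : Line) → (∀ P → ⟨ proj₁ l , proj₁ P ⟩ ≡ 0# → ⟨ proj₁ l′ , vec P ⟩ ≡ 0#) ×
                     (∀ P → ⟨ proj₁ l′ , vec P ⟩ ≡ 0# → ∃ λ Q → ⟨ proj₁ l , proj₁ Q ⟩ ≡ 0# × Q ∼ P)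
        image-line l = let (l′ , l′⊆ , ⊆l′) = mapsLines l in l′ ,
          (λ P lP → on⇒⟨⟩ l′ {to P} (⊆l′ {to P} (P , ⟨⟩⇒on l {P} lP , ∼-refl (to P)))) ,
          λ P l′P → let (Q , lQ , Q∼P) = l′⊆ {to P} (⟨⟩⇒on l′ {to P} l′P) in Q , on⇒⟨⟩ l {Q} lQ , proj₁ bijective {Q} {P} Q∼P

        images-collinear : ∀ (l : Line) (P Q R : Point) → ⟨ proj₁ l , proj₁ P ⟩ ≡ 0# → ⟨ proj₁ l , proj₁ Q ⟩ ≡ 0# → ⟨ proj₁ l , proj₁ R ⟩ ≡ 0# →
                           ∃ λ (l′ : Line) → ⟨ proj₁ l′ , vec P ⟩ ≡ 0# × ⟨ proj₁ l′ , vec Q ⟩ ≡ 0# × ⟨ proj₁ l′ , vec R ⟩ ≡ 0#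
        images-collinear l P Q R p q r = let (l′ , h , _) = image-line l in l′ , h P p , h Q q , h R r

        -- The image of a line is a whole line. If the three images were collinear, the image of `R`
        -- would lie on the image of `l`, and injectivity would put `R` on `l`.
        images-noncollinear : ∀ (l : Line) (P Q R : Point) → ⟨ proj₁ l , proj₁ P ⟩ ≡ 0# → ⟨ proj₁ l , proj₁ Q ⟩ ≡ 0# → ⟨ proj₁ l , proj₁ R ⟩ ≢ 0# →
                              ¬ P ∼ Q → det (vec P) (vec Q) (vec R) ≢ 0#
        images-noncollinear l P Q R p q r P≁Q eq =
          let (l′ , h , h′) = image-line l
              (S , lS , c , _ , S∼R) = h′ R (line-unique (proj₁ l′) (vec P) (vec Q) (vec R) (proj₂ (to P)) (proj₂ (to Q))
                (λ P∥Q → P≁Q (proj₁ bijective {P} {Q} P∥Q)) (h P p) (h Q q) eq)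
          in r (trans (cong ⟨ proj₁ l ,_⟩ S∼R) (trans (⟨⟩-· (proj₁ l) c (proj₁ S)) (trans (cong (c *_) lS) (zeroʳ c))))

      private
        a b c u : V
        a = vec E₁
        b = vec E₂
        c = vec E₃
        u = vec U

        distinct : ∀ {P Q} i → lookup (proj₁ P) i ≡ 0# → lookup (proj₁ Q) i ≢ 0# → ¬ P ∼ Q
        distinct {v , _} {w , _} i p q (d , _ , refl) = q (trans (lookup-· v i) (trans (cong (d *_) p) (zeroʳ d)))
          where
          lookup-· : ∀ (v : V) i → lookup (d · v) i ≡ d * lookup v i
          lookup-· v i = Vec.lookup-map i (d *_) v

        abc≢0 : det a b c ≢ 0#
        abc≢0 = images-noncollinear E₃ E₁ E₂ E₃
          (solve 0 (con false :* con true :+ con false :* con false :+ con true :* con false := con false) refl)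
          (solve 0 (con false :* con false :+ con false :* con true :+ con true :* con false := con false) refl)
          (λ eq → 1≢0 (trans (solve 0 (con true := con false :* con false :+ con false :* con false :+ con true :* con true) refl) eq))
          (distinct {E₁} {E₂} (suc zero) refl 1≢0)

        bcu≢0 : det b c u ≢ 0#
        bcu≢0 = images-noncollinear E₁ E₂ E₃ U
          (solve 0 (con true :* con false :+ con false :* con true :+ con false :* con false := con false) refl)
          (solve 0 (con true :* con false :+ con false :* con false :+ con false :* con true := con false) refl)
          (λ eq → 1≢0 (trans (solve 0 (con true := con true :* con true :+ con false :* con true :+ con false :* con true) refl) eq))
          (distinct {E₂} {E₃} (suc (suc zero)) refl 1≢0)

        acu≢0 : det a c u ≢ 0#
        acu≢0 = images-noncollinear E₂ E₁ E₃ U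
          (solve 0 (con false :* con true :+ con true :* con false :+ con false :* con false := con false) refl)
          (solve 0 (con false :* con false :+ con true :* con false :+ con false :* con true := con false) refl)
          (λ eq → 1≢0 (trans (solve 0 (con true := con false :* con true :+ con true :* con true :+ con false :* con true) refl) eq))
          (distinct {E₁} {E₃} (suc (suc zero)) refl 1≢0)

        abu≢0 : det a b u ≢ 0#
        abu≢0 = images-noncollinear E₃ E₁ E₂ U
          (solve 0 (con false :* con true :+ con false :* con false :+ con true :* con false := con false) refl)
          (solve 0 (con false :* con false :+ con false :* con true :+ con true :* con false := con false) refl)
          (λ eq → 1≢0 (trans (solve 0 (con true := con false :* con true :+ con false :* con true :+ con true :* con true) refl) eq))
          (distinct {E₁} {E₂} (suc zero) refl 1≢0)

      -- A change of frame undoes the collineation on `E₁`, `E₂`, `E₃` and `U`. What remains acts on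
      -- coordinates by a field automorphism, which is a Frobenius power; `B` restores the original
      -- frame.
      fundamental-theorem : ∃ λ (g : ΓL) → ∀ P → ΓL.act g P ∼ to P
      fundamental-theorem = semilinear (Fin.toℕ<n k) B B⁻¹ B-B⁻¹ B⁻¹-B B-+ B-· , λ P →
        let (e , e≢0 , eq) = frobenius-coordinates P in
        D ⁻¹ * e , *-≢0 (⁻¹-≢0 D≢0) e≢0 , (begin
          vec P                                ≡⟨ B-B⁻¹ (vec P) ⟨
          B (D ⁻¹ · A (vec P))                 ≡⟨ cong (λ w → B (D ⁻¹ · w)) eq ⟩
          B (D ⁻¹ · (e · φᵥ (toℕ k) (proj₁ P)))  ≡⟨ cong B (·-assoc (D ⁻¹) e (φᵥ (toℕ k) (proj₁ P))) ⟩
          B ((D ⁻¹ * e) · φᵥ (toℕ k) (proj₁ P))  ≡⟨ B-· (D ⁻¹ * e) (φᵥ (toℕ k) (proj₁ P)) ⟩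
          (D ⁻¹ * e) · B (φᵥ (toℕ k) (proj₁ P))  ∎)
        where
        open Frame a b c (det b c u) (det a c u) (det a b u) abc≢0 bcu≢0 acu≢0 abu≢0
        ψ : Point → V
        ψ P = A (vec P)
        ψ-line : ∀ (l : Line) (P Q R : Point) → ⟨ proj₁ l , proj₁ P ⟩ ≡ 0# → ⟨ proj₁ l , proj₁ Q ⟩ ≡ 0# → ⟨ proj₁ l , proj₁ R ⟩ ≡ 0# → det (ψ P) (ψ Q) (ψ R) ≡ 0#
        ψ-line l P Q R p q r = let (l′ , p′ , q′ , r′) = images-collinear l P Q R p q r in A-line l′ p′ q′ r′
        open FrameFixing ψ (λ P → A-≢0 (proj₂ (to P))) (λ P Q P∼Q → A-∥ (congruent {P} {Q} P∼Q))
          (λ P Q ∥ → proj₁ bijective {P} {Q} (A-∥⁻ ∥)) ψ-line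
        open Normalized A-a A-b A-c (A-u u refl refl refl)
        k = exponent

  -- Conics, their intersections with lines, and disjointness.

  module Conics where
    open Field
    open PG hiding (Tr)
    open Geometry
    open NormalBasis using (lin; lin-⊞)
    open FundamentalTheorem using (divide-by; minor≡0)

    form : (α β μ x y z : Carrier) → Carrier
    form α β μ x y z = α * x ² + x * y + β * y ² + μ * z ²

    form≡ : ∀ α β μ x y z → α * x ^ 2 + x * y + β * y ^ 2 + μ * z ^ 2 ≡ form α β μ x y z
    form≡ = solve 6 (λ α β μ x y z → α :* (x :* (x :* con true)) :+ x :* y :+ β :* (y :* (y :* con true)) :+ μ :* (z :* (z :* con true)) :=
      α :* (x :* x) :+ x :* y :+ β :* (y :* y) :+ μ :* (z :* z)) refl

    binary : (α β x y : Carrier) → Carrier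
    binary α β x y = α * x ² + x * y + β * y ²

    1≢bit-0 : ∀ {x} → x ≡ 1# → x ≢ 0#
    1≢bit-0 p q = 1≢0 (trans (sym p) q)

    tr≢1 : ∀ {x} → tr x ≢ 1# → tr x ≡ 0#
    tr≢1 {x} h with tr-values x
    ... | inj₁ p = p
    ... | inj₂ p = contradiction p h

    -- For `x` nonzero, `w = β y / x` satisfies `α β = w² + w`, and elements of this shape have
    -- trace zero. For `x` zero, `β` vanishes.
    binary-root : ∀ {α β x y} → binary α β x y ≡ 0# → x ≢ 0# ⊎ y ≢ 0# → tr (α * β) ≡ 0#
    binary-root {α} {β} {x} {y} root ≢0 with x ≟ 0#
    ... | yes refl = trans (cong (λ β → tr (α * β)) β≡0) (trans (cong tr (zeroʳ α)) tr-0)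
      where
      y≢0 : y ≢ 0#
      y≢0 = [ (λ h → contradiction refl h) , (λ h → h) ]′ ≢0
      β≡0 : β ≡ 0#
      β≡0 = zero-product (trans (solve 3 (λ α β y → y :* y :* β := α :* (con false :* con false) :+ con false :* y :+ β :* (y :* y)) refl α β y) root) (*-≢0 y≢0 y≢0)
    ... | no x≢0 = begin
      tr (α * β)        ≡⟨ cong tr αβ≡ ⟩
      tr (w ² + w)      ≡⟨ tr-+ (w ²) w ⟩
      tr (w ²) + tr w   ≡⟨ cong (_+ tr w) (tr-² w) ⟩
      tr w + tr w       ≡⟨ x+x≡0 _ ⟩
      0#                ∎
      where
      w = β * y * x ⁻¹
      αβ≡ : α * β ≡ w ² + w
      αβ≡ = x+y≡0⇒x≡y (zero-product (trans (trans
        (solve 5 (λ α β y x w → x :* x :* (α :* β :+ (w :* w :+ w)) := α :* β :* (x :* x) :+ (w :* x) :* (w :* x) :+ (w :* x) :* x) refl α β y x w)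
        (trans (cong (λ v → α * β * x ² + v ² + v * x) (sym (divide-by (β * y) x≢0)))
        (solve 4 (λ α β x y → α :* β :* (x :* x) :+ (β :* y) :* (β :* y) :+ β :* y :* x := β :* (α :* (x :* x) :+ x :* y :+ β :* (y :* y))) refl α β x y)))
        (trans (cong (β *_) root) (zeroʳ β))) (*-≢0 x≢0 x≢0))

    record Split (α β : Carrier) : Set where
      field
        rootₓ rootᵧ : Bool → Carrier
        isRoot      : ∀ b → binary α β (rootₓ b) (rootᵧ b) ≡ 0#
        nonzero     : ∀ b → rootₓ b ≢ 0# ⊎ rootᵧ b ≢ 0#
        distinct    : ∀ b b′ c → rootₓ b′ ≡ c * rootₓ b → rootᵧ b′ ≡ c * rootᵧ b → b ≡ b′
        complete    : ∀ x y → x ≢ 0# ⊎ y ≢ 0# → binary α β x y ≡ 0# → ∃₂ λ b c → c ≢ 0# × x ≡ c * rootₓ b × y ≡ c * rootᵧ b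

    private
      coefficient≢0 : ∀ {x y c p q} → x ≢ 0# ⊎ y ≢ 0# → x ≡ c * p → y ≡ c * q → c ≢ 0#
      coefficient≢0 (inj₁ x≢0) eq _ refl = x≢0 (trans eq (zeroˡ _))
      coefficient≢0 (inj₂ y≢0) _ eq refl = y≢0 (trans eq (zeroˡ _))

      factors : ∀ {x y} → x * y ≡ 0# → x ≡ 0# ⊎ y ≡ 0#
      factors {x} eq with x ≟ 0#
      ... | yes p = inj₁ p
      ... | no x≢0 = inj₂ (zero-product eq x≢0)

      from-factors : ∀ {α β} κ x₁ y₁ x₀ y₀ → κ ≢ 0# → x₁ * y₀ + y₁ * x₀ ≢ 0# →
                     (∀ x y → κ * binary α β x y ≡ (x₁ * y + y₁ * x) * (x₀ * y + y₀ * x)) → Split α β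
      from-factors {α} {β} κ x₁ y₁ x₀ y₀ κ≢0 det≢0 factorization = record
        { rootₓ = rootₓ ; rootᵧ = rootᵧ
        ; isRoot = λ { true → zero-product (trans (factorization x₁ y₁) (trans (cong (_* (x₀ * y₁ + y₀ * x₁)) (x≡y⇒x+y≡0 (*-comm x₁ y₁))) (zeroˡ _))) κ≢0
                     ; false → zero-product (trans (factorization x₀ y₀) (trans (cong ((x₁ * y₀ + y₁ * x₀) *_) (x≡y⇒x+y≡0 (*-comm x₀ y₀))) (zeroʳ _))) κ≢0 }
        ; nonzero = nonzero
        ; distinct = λ { true true c _ _ → refl ; false false c _ _ → refl
                       ; true false c p q → contradiction (parallel c x₁ y₁ p q) det≢0
                       ; false true c p q → contradiction (trans (solve 4 (λ a b c d → a :* d :+ b :* c := c :* b :+ d :* a) refl x₁ y₁ x₀ y₀) (parallel c x₀ y₀ p q)) det≢0 }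
        ; complete = complete }
        where
        rootₓ rootᵧ : Bool → Carrier
        rootₓ b = if b then x₁ else x₀
        rootᵧ b = if b then y₁ else y₀

        parallel : ∀ c x y {x′ y′} → x′ ≡ c * x → y′ ≡ c * y → x * y′ + y * x′ ≡ 0#
        parallel c x y refl refl = solve 3 (λ c x y → x :* (c :* y) :+ y :* (c :* x) := con false) refl c x y

        nonzero : ∀ b → rootₓ b ≢ 0# ⊎ rootᵧ b ≢ 0#
        nonzero b with rootₓ b ≟ 0# | rootᵧ b ≟ 0#
        ... | no h | _ = inj₁ h
        ... | _ | no h = inj₂ h
        nonzero true | yes refl | yes refl = contradiction (solve 2 (λ x y → con false :* y :+ con false :* x := con false) refl x₀ y₀) det≢0
        nonzero false | yes refl | yes refl = contradiction (solve 2 (λ x y → x :* con false :+ y :* con false := con false) refl x₁ y₁) det≢0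

        on-factor : ∀ b x y → x ≢ 0# ⊎ y ≢ 0# → rootₓ b * y + rootᵧ b * x ≡ 0# → ∃ λ c → c ≢ 0# × x ≡ c * rootₓ b × y ≡ c * rootᵧ b
        on-factor b x y ≢0 eq with nonzero b
        ... | inj₁ h = let p = divide-by x h ; q = minor≡0 h eq in _ , coefficient≢0 ≢0 p q , p , q
        ... | inj₂ h = let p = minor≡0 h (trans (+-comm _ _) eq) ; q = divide-by y h in _ , coefficient≢0 ≢0 p q , p , q

        complete : ∀ x y → x ≢ 0# ⊎ y ≢ 0# → binary α β x y ≡ 0# → ∃₂ λ b c → c ≢ 0# × x ≡ c * rootₓ b × y ≡ c * rootᵧ b
        complete x y ≢0 root with factors (trans (sym (factorization x y)) (trans (cong (κ *_) root) (zeroʳ κ)))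
        ... | inj₁ eq = true , on-factor true x y ≢0 eq
        ... | inj₂ eq = false , on-factor false x y ≢0 eq

    opaque
      -- Artin-Schreier gives `w` with `w² + w = α β`, and `β` times the form is
      -- `(βy + wx)(βy + (w + 1)x)`. When `β` vanishes the form is `x(y + αx)`.
      split : ∀ {α β} → tr (α * β) ≡ 0# → Split α β
      split {α} {β} tr≡0 with β ≟ 0#
      ... | yes refl = from-factors 1# 0# 1# 1# α 1≢0
        (λ eq → 1≢0 (trans (solve 1 (λ α → con true := con false :* α :+ con true :* con true) refl α) eq))
        (solve 3 (λ α x y → con true :* (α :* (x :* x) :+ x :* y :+ con false :* (y :* y)) :=
           (con false :* y :+ con true :* x) :* (con true :* y :+ α :* x)) refl α)
      ... | no β≢0 = let (w , eq) = artin-schreier (α * β) in from-factors β β w β (w + 1#) β≢0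
        (λ eq → β≢0 (trans (solve 2 (λ β w → β := β :* (w :+ con true) :+ w :* β) refl β w) eq))
        λ x y → begin
          β * binary α β x y
            ≡⟨ solve 4 (λ α β x y → β :* (α :* (x :* x) :+ x :* y :+ β :* (y :* y)) := α :* β :* (x :* x) :+ β :* x :* y :+ β :* β :* (y :* y)) refl α β x y ⟩
          α * β * x ² + β * x * y + β * β * y ²
            ≡⟨ cong (λ v → v * x ² + β * x * y + β * β * y ²) (sym (trans eq (trans (cong (α * β +_) tr≡0) (+-identityʳ _)))) ⟩
          (w ² + w) * x ² + β * x * y + β * β * y ²
            ≡⟨ solve 4 (λ β w x y → (w :* w :+ w) :* (x :* x) :+ β :* x :* y :+ β :* β :* (y :* y) := (β :* y :+ w :* x) :* (β :* y :+ (w :+ con true) :* x)) refl β w x y ⟩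
          (β * y + w * x) * (β * y + (w + 1#) * x) ∎

    on-conic : ∀ α β μ {x y z} h → conicPoints (conic α β μ) (x ∷ y ∷ z ∷ [] , h) → form α β μ x y z ≡ 0#
    on-conic α β μ {x} {y} {z} h eq = trans (sym (form≡ α β μ x y z)) eq

    -- On the line z = px + qy the form becomes binary.
    form-on-line : ∀ α β μ x y p q → form α β μ x y (p * x + q * y) ≡ binary (α + μ * p ²) (β + μ * q ²) x y
    form-on-line = solve 7 (λ α β μ x y p q → let z = p :* x :+ q :* y in
      α :* (x :* x) :+ x :* y :+ β :* (y :* y) :+ μ :* (z :* z) :=
      (α :+ μ :* (p :* p)) :* (x :* x) :+ x :* y :+ (β :+ μ :* (q :* q)) :* (y :* y)) refl

    form-at-nucleus : ∀ {α β μ x y z} → μ ≢ 0# → (x ∷ y ∷ z ∷ []) ≢ 0ᵥ → form α β μ x y z ≡ 0# → x ≢ 0# ⊎ y ≢ 0#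
    form-at-nucleus {α} {β} {μ} {x} {y} {z} μ≢0 P≢0 eq with x ≟ 0# | y ≟ 0#
    ... | no h | _ = inj₁ h
    ... | _ | no h = inj₂ h
    ... | yes refl | yes refl = contradiction (vec≡ refl refl (square-zero (zero-product (trans
      (solve 4 (λ α β μ z → μ :* (z :* z) := α :* (con false :* con false) :+ con false :* con false :+ β :* (con false :* con false) :+ μ :* (z :* z)) refl α β μ z) eq) μ≢0))) P≢0

    line-through : ∀ {x y} z → x ≢ 0# ⊎ y ≢ 0# → ∃₂ λ p q → z ≡ p * x + q * y
    line-through {x} {y} z (inj₁ x≢0) = z * x ⁻¹ , 0# , trans (divide-by z x≢0) (solve 2 (λ p y → p := p :+ con false :* y) refl (z * x ⁻¹ * x) y)
    line-through {x} {y} z (inj₂ y≢0) = 0# , z * y ⁻¹ , trans (divide-by z y≢0) (solve 2 (λ p x → p := con false :* x :+ p) refl (z * y ⁻¹ * y) x)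

    -- On a common line the traces of three conics F, F′ and F ⊕ F′ have the same sum as at infinity,
    -- because the difference is additive in (μα , μβ , μ).
    conics-disjoint : ∀ {α β μ α′ β′ μ′ α″ β″ x y z} → μ ≢ 0# → μ + μ′ ≢ 0# →
      α″ * (μ + μ′) ≡ α * μ + α′ * μ′ → β″ * (μ + μ′) ≡ β * μ + β′ * μ′ →
      tr (α * β + α′ * β′ + α″ * β″) ≡ 1# → (x ∷ y ∷ z ∷ []) ≢ 0ᵥ →
      form α β μ x y z ≡ 0# → form α′ β′ μ′ x y z ≢ 0#
    conics-disjoint {α} {β} {μ} {α′} {β′} {μ′} {α″} {β″} {x} {y} {z} μ≢0 μ+μ′≢0 α″≡ β″≡ sum≡1 P≢0 F F′
      with form-at-nucleus {α} {β} {μ} μ≢0 P≢0 F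
    ... | xy≢0 with line-through z xy≢0
    ... | p , q , refl = 1≢bit-0 sum≡1 (begin
      tr (α * β + α′ * β′ + α″ * β″)
        ≡⟨ cong tr (trans (solve 12 (λ α β μ α′ β′ μ′ α″ β″ ν P Q zero′ →
             α :* β :+ α′ :* β′ :+ α″ :* β″ :=
             (α :+ μ :* P) :* (β :+ μ :* Q) :+ (α′ :+ μ′ :* P) :* (β′ :+ μ′ :* Q) :+ (α″ :+ (μ :+ μ′) :* P) :* (β″ :+ (μ :+ μ′) :* Q)
             :+ (α″ :* (μ :+ μ′) :+ (α :* μ :+ α′ :* μ′)) :* Q :+ (β″ :* (μ :+ μ′) :+ (β :* μ :+ β′ :* μ′)) :* P)
             refl α β μ α′ β′ μ′ α″ β″ 0# (p ²) (q ²) 0#)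
           (trans (cong₂ (λ u v → total + u * q ² + v * p ²) (x≡y⇒x+y≡0 α″≡) (x≡y⇒x+y≡0 β″≡))
             (solve 3 (λ t P Q → t :+ con false :* Q :+ con false :* P := t) refl total (p ²) (q ²)))) ⟩
      tr total ≡⟨ trans (tr-+ _ _) (cong₂ _+_ (trans (tr-+ _ _) (cong₂ _+_ (binary-root {α + μ * p ²} (trans (sym (form-on-line α β μ x y p q)) F) xy≢0)
                   (binary-root {α′ + μ′ * p ²} (trans (sym (form-on-line α′ β′ μ′ x y p q)) F′) xy≢0)))
                   (binary-root {α″ + (μ + μ′) * p ²} (trans (sym (form-on-line α″ β″ (μ + μ′) x y p q)) F″) xy≢0)) ⟩
      0# + 0# + 0# ≡⟨ solve 0 (con false :+ con false :+ con false := con false) refl ⟩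
      0# ∎)
      where
      z′ = p * x + q * y
      total = (α + μ * p ²) * (β + μ * q ²) + (α′ + μ′ * p ²) * (β′ + μ′ * q ²) + (α″ + (μ + μ′) * p ²) * (β″ + (μ + μ′) * q ²)
      F″ : form α″ β″ (μ + μ′) x y z′ ≡ 0#
      F″ = zero-product (trans
        (solve 11 (λ α β μ α′ β′ μ′ α″ β″ x y z →
          (μ :+ μ′) :* (α″ :* (x :* x) :+ x :* y :+ β″ :* (y :* y) :+ (μ :+ μ′) :* (z :* z)) :=
          α″ :* (μ :+ μ′) :* (x :* x) :+ β″ :* (μ :+ μ′) :* (y :* y) :+ (μ :+ μ′) :* (x :* y) :+ (μ :* μ :+ μ′ :* μ′) :* (z :* z))
          refl α β μ α′ β′ μ′ α″ β″ x y z′)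
        (trans (cong₂ (λ u v → u * x ² + v * y ² + (μ + μ′) * (x * y) + (μ ² + μ′ ²) * z′ ²) α″≡ β″≡)
        (trans (solve 9 (λ α β μ α′ β′ μ′ x y z →
          (α :* μ :+ α′ :* μ′) :* (x :* x) :+ (β :* μ :+ β′ :* μ′) :* (y :* y) :+ (μ :+ μ′) :* (x :* y) :+ (μ :* μ :+ μ′ :* μ′) :* (z :* z) :=
          μ :* (α :* (x :* x) :+ x :* y :+ β :* (y :* y) :+ μ :* (z :* z)) :+ μ′ :* (α′ :* (x :* x) :+ x :* y :+ β′ :* (y :* y) :+ μ′ :* (z :* z)))
          refl α β μ α′ β′ μ′ x y z′)
        (trans (cong₂ (λ u v → μ * u + μ′ * v) F F′) (solve 2 (λ a b → a :* con false :+ b :* con false := con false) refl μ μ′))))) μ+μ′≢0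

  -- The cubic arc of an isotropic 3-space is a maximal arc.

  module CubicArcs where
    open Field
    open PG hiding (Tr)
    open Geometry
    open NormalBasis using (lin; lin-⊞)
    open Conics
    open FundamentalTheorem using (divide-by; minor≡0)

    Basis : Set
    Basis = Vec Carrier 3

    IndependentF IsotropicF : Basis → Set
    IndependentF t = ∀ s → lin s t ≡ 0# → s ≡ 0ⱽ
    IsotropicF t   = ∀ r s → tr (lin r t ² * lin s t + lin r t * lin s t ²) ≡ 0#

    lin-injective : ∀ {t} → IndependentF t → ∀ {r s} → lin r t ≡ lin s t → r ≡ s
    lin-injective {t} ind {r} {s} eq = ⊞≡0⇒≡ (ind (r ⊞ s) (trans (lin-⊞ r s t) (x≡y⇒x+y≡0 eq)))

    opaque
      additive-functional : ∀ {n} (G : Vec Bool n → Carrier) → (∀ r s → G (r ⊞ s) ≡ G r + G s) → (∀ s → G s ≡ 0# ⊎ G s ≡ 1#) →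
                            ∃ λ w → ∀ s → G s ≡ bit (dot w s)
      additive-functional {zero} G G-+ G-bit = [] , λ { [] → trans (G-+ [] []) (x+x≡0 (G [])) }
      additive-functional {suc n} G G-+ G-bit
        with additive-functional (G ∘ (false ∷_)) (λ r s → G-+ (false ∷ r) (false ∷ s)) (λ s → G-bit (false ∷ s)) | G-bit (true ∷ 0ⱽ)
      ... | w , eq | inj₁ p = false ∷ w , λ
        { (false ∷ s) → eq s
        ; (true ∷ s)  → trans (cong (λ s → G (true ∷ s)) (sym (⊞-identityˡ s))) (trans (G-+ (true ∷ 0ⱽ) (false ∷ s))
            (trans (cong₂ _+_ p (eq s)) (+-identityˡ _))) }
      ... | w , eq | inj₂ p = true ∷ w , λ
        { (false ∷ s) → eq s
        ; (true ∷ s)  → trans (cong (λ s → G (true ∷ s)) (sym (⊞-identityˡ s))) (trans (G-+ (true ∷ 0ⱽ) (false ∷ s))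
            (trans (cong₂ _+_ p (eq s)) (sym (bit-+ true (dot w s))))) }

    α₃ : Carrier → Carrier
    α₃ l = 1# + l * l * l

    -- The normal form of a proper Mathon arc of degree 8. The trace of `α₃ l` may vanish, so these
    -- triples need not be admissible as they stand; `cubicArc-isMathonType` passes to admissible
    -- ones by a linear change of `z`.
    cubicConics : Basis → Pred Conic 0ℓ
    cubicConics t F = ∃ λ s → s ≢ 0ⱽ × F ≡ conic (α₃ (lin s t)) 1# (lin s t)

    cubicArc : Basis → PointSet
    cubicArc t = arcOf (cubicConics t)

    to-conic : ∀ α β μ {x y z} h → form α β μ x y z ≡ 0# → conicPoints (conic α β μ) (x ∷ y ∷ z ∷ [] , h)
    to-conic α β μ {x} {y} {z} h eq = trans (form≡ α β μ x y z) eq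

    nucleus∼⇒xy≡0 : ∀ {x y z} h → nucleus ∼ (x ∷ y ∷ z ∷ [] , h) → x ≡ 0# × y ≡ 0#
    nucleus∼⇒xy≡0 h (c , _ , eq) = let (p , q , _) = coords eq in trans p (zeroʳ c) , trans q (zeroʳ c)

    point-on-conic : (α β μ : Carrier) → Carrier → Carrier → Carrier
    point-on-conic α β μ x y = √ (binary α β x y * μ ⁻¹)

    point-on-conic-root : ∀ α β μ x y → μ ≢ 0# → form α β μ x y (point-on-conic α β μ x y) ≡ 0#
    point-on-conic-root α β μ x y μ≢0 = x≡y⇒x+y≡0 (sym (begin
      μ * point-on-conic α β μ x y ²   ≡⟨ cong (μ *_) (√-² _) ⟩
      μ * (binary α β x y * μ ⁻¹)      ≡⟨ *-comm μ _ ⟩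
      binary α β x y * μ ⁻¹ * μ        ≡⟨ divide-by (binary α β x y) μ≢0 ⟨
      binary α β x y                   ∎))

    -- Two points of a conic with the same nonzero (x , y) coincide.
    conic-z : ∀ {α β μ x y z z′} → μ ≢ 0# → form α β μ x y z ≡ 0# → form α β μ x y z′ ≡ 0# → z ≡ z′
    conic-z {α} {β} {μ} {x} {y} {z} {z′} μ≢0 p q = ²-injective (*-cancelˡ-≢0 μ≢0 (x+y≡0⇒x≡y (begin
      μ * z ² + μ * z′ ² ≡⟨ solve 4 (λ b m z z′ → m :* (z :* z) :+ m :* (z′ :* z′) := (b :+ m :* (z :* z)) :+ (b :+ m :* (z′ :* z′))) refl (binary α β x y) μ z z′ ⟩
      form α β μ x y z + form α β μ x y z′ ≡⟨ cong₂ _+_ p q ⟩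
      0# + 0# ≡⟨ x+x≡0 0# ⟩
      0# ∎)))

    form-· : ∀ α β μ c x y z → form α β μ (c * x) (c * y) (c * z) ≡ c * c * form α β μ x y z
    form-· = solve 7 (λ α β μ c x y z → α :* ((c :* x) :* (c :* x)) :+ (c :* x) :* (c :* y) :+ β :* ((c :* y) :* (c :* y)) :+ μ :* ((c :* z) :* (c :* z)) :=
             c :* c :* (α :* (x :* x) :+ x :* y :+ β :* (y :* y) :+ μ :* (z :* z))) refl

    arcOf-resp : ∀ {C} {P Q} → P ∼ Q → arcOf C P → arcOf C Q
    arcOf-resp {P = P} {Q} P∼Q (inj₁ N∼P) = inj₁ (∼-trans nucleus P Q N∼P P∼Q)
    arcOf-resp {P = x ∷ y ∷ z ∷ [] , h} {_ , h′} (c , c≢0 , refl) (inj₂ (conic α β μ , F∈ , eq)) =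
      inj₂ (conic α β μ , F∈ , to-conic α β μ h′ (trans (form-· α β μ c x y z) (trans (cong (c * c *_) (on-conic α β μ h eq)) (zeroʳ _))))

    form-cong : ∀ α μ {x y z x′ y′ z′} → x ≡ x′ → y ≡ y′ → z ≡ z′ → form α 1# μ x y z ≡ form α 1# μ x′ y′ z′
    form-cong α μ refl refl refl = refl

    module _ (t : Basis) (ind : IndependentF t) (iso : IsotropicF t) where
      private
        l : Vec Bool 3 → Carrier
        l s = lin s t

        l-≢0 : ∀ {s} → s ≢ 0ⱽ → l s ≢ 0#
        l-≢0 s≢0 eq = s≢0 (ind _ eq)

        -- The three cubes add up to `l²k + lk²`, whose trace vanishes by isotropy. This is the
        -- condition under which two of the conics are disjoint.
        cubic-sum : ∀ r s → tr (α₃ (l r) * 1# + α₃ (l s) * 1# + α₃ (l r + l s) * 1#) ≡ 1#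
        cubic-sum r s = trans (cong tr (solve 2 (λ a b →
            (con true :+ a :* a :* a) :* con true :+ (con true :+ b :* b :* b) :* con true :+ (con true :+ (a :+ b) :* (a :+ b) :* (a :+ b)) :* con true
            := con true :+ (a :* a :* b :+ a :* (b :* b))) refl (l r) (l s)))
          (trans (tr-+ 1# _) (trans (cong₂ _+_ tr-1 (iso r s)) (+-identityʳ 1#)))

        same-conic : ∀ {r s x y z} → r ≢ 0ⱽ → (x ∷ y ∷ z ∷ []) ≢ 0ᵥ → form (α₃ (l r)) 1# (l r) x y z ≡ 0# → form (α₃ (l s)) 1# (l s) x y z ≡ 0# → r ≡ s
        same-conic {r} {s} r≢0 P≢0 p q with l r + l s ≟ 0#
        ... | yes eq = lin-injective ind (x+y≡0⇒x≡y eq)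
        ... | no ≢0 = contradiction q (conics-disjoint (l-≢0 r≢0) ≢0
          (solve 2 (λ a b → (con true :+ (a :+ b) :* (a :+ b) :* (a :+ b)) :* (a :+ b) := (con true :+ a :* a :* a) :* a :+ (con true :+ b :* b :* b) :* b) refl (l r) (l s))
          (solve 2 (λ a b → con true :* (a :+ b) := con true :* a :+ con true :* b) refl (l r) (l s))
          (cubic-sum r s) P≢0 p)

        S : PointSet
        S = cubicArc t

        -- A line through the nucleus has one point on each of the seven conics, since squaring is
        -- bijective. The vector `0ⱽ` indexes the nucleus, which makes eight points.
        module ThroughNucleus (a b c : Carrier) (h : (a ∷ b ∷ c ∷ []) ≢ 0ᵥ) (c≡0 : c ≡ 0#) where
          ba≢0 : b ≢ 0# ⊎ a ≢ 0#
          ba≢0 with b ≟ 0# | a ≟ 0#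
          ... | no p | _ = inj₁ p
          ... | _ | no p = inj₂ p
          ... | yes p | yes q = contradiction (vec≡ q p c≡0) h

          z-at : Vec Bool 3 → Carrier
          z-at s = point-on-conic (α₃ (l s)) 1# (l s) b a

          nonzero : ∀ z → (b ∷ a ∷ z ∷ []) ≢ 0ᵥ
          nonzero z eq = let (p , q , _) = coords eq in [ (λ h → h p) , (λ h → h q) ]′ ba≢0

          L : Line
          L = a ∷ b ∷ c ∷ [] , h

          rep : Vec Bool 3 → ∃ (S ∩ pointsOn L)
          rep s with s ≟ⱽ 0ⱽ
          ... | yes _ = nucleus , inj₁ (∼-refl nucleus) , trans (solve 3 (λ a b c → a :* con false :+ b :* con false :+ c :* con true := c) refl a b c) c≡0
          ... | no s≢0 = (b ∷ a ∷ z-at s ∷ [] , nonzero (z-at s)) ,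
            inj₂ (conic (α₃ (l s)) 1# (l s) , (s , s≢0 , refl) , to-conic (α₃ (l s)) 1# (l s) (nonzero (z-at s)) (point-on-conic-root (α₃ (l s)) 1# (l s) b a (l-≢0 s≢0))) ,
            trans (cong (λ c → a * b + b * a + c * z-at s) c≡0) (solve 3 (λ a b z → a :* b :+ b :* a :+ con false :* z := con false) refl a b (z-at s))

          injective : ∀ {r s} → proj₁ (rep r) ∼ proj₁ (rep s) → r ≡ s
          injective {r} {s} r∼s with r ≟ⱽ 0ⱽ | s ≟ⱽ 0ⱽ
          ... | yes p | yes q = trans p (sym q)
          ... | yes _ | no _  = let (p , q) = nucleus∼⇒xy≡0 (nonzero (z-at s)) r∼s in contradiction (vec≡ q p c≡0) h
          ... | no _  | yes _ = let (p , q) = nucleus∼⇒xy≡0 (nonzero (z-at r)) (∼-sym (b ∷ a ∷ z-at r ∷ [] , nonzero (z-at r)) nucleus r∼s) in contradiction (vec≡ q p c≡0) h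
          ... | no r≢0 | no s≢0 = same-conic r≢0 (nonzero (z-at s))
            (trans (cong (form (α₃ (l r)) 1# (l r) b a) (same-z r∼s)) (point-on-conic-root (α₃ (l r)) 1# (l r) b a (l-≢0 r≢0)))
            (point-on-conic-root (α₃ (l s)) 1# (l s) b a (l-≢0 s≢0))
            where
            same-z : (∃ λ (c : Carrier) → c ≢ 0# × b ∷ a ∷ z-at s ∷ [] ≡ c · (b ∷ a ∷ z-at r ∷ [])) → z-at s ≡ z-at r
            same-z (c , _ , eq) = let (p , q , o) = coords eq in trans o (trans (cong (_* z-at r) ([ scalar-1 p , scalar-1 q ]′ ba≢0)) (*-identityˡ _))
              where
              scalar-1 : ∀ {x} → x ≡ c * x → x ≢ 0# → c ≡ 1#
              scalar-1 {x} p x≢0 = *-cancelˡ-≢0 x≢0 (trans (*-comm x c) (trans (sym p) (sym (*-identityʳ x))))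

          surjective : ∀ (P : ∃ (S ∩ pointsOn L)) → ∃ λ s → proj₁ (rep s) ∼ proj₁ P
          surjective (P , inj₁ N∼P , _) = 0ⱽ , N∼P
          surjective (P@(x ∷ y ∷ z ∷ [] , P≢0) , inj₂ (_ , (s , s≢0 , refl) , eq) , on) = s , result
            where
            on-form : form (α₃ (l s)) 1# (l s) x y z ≡ 0#
            on-form = on-conic (α₃ (l s)) 1# (l s) P≢0 eq
            ab : b * y + a * x ≡ 0#
            ab = trans (trans (+-comm _ _) (sym (trans (cong (λ c → a * x + b * y + c * z) c≡0) (solve 2 (λ p z → p :+ con false :* z := p) refl (a * x + b * y) z)))) on
            multiple-of : b ≢ 0# ⊎ a ≢ 0# → ∃ λ k → x ≡ k * b × y ≡ k * a
            multiple-of (inj₁ b≢0) = x * b ⁻¹ , divide-by x b≢0 , minor≡0 b≢0 ab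
            multiple-of (inj₂ a≢0) = y * a ⁻¹ , minor≡0 a≢0 (trans (+-comm _ _) ab) , divide-by y a≢0
            multiple = multiple-of ba≢0
            k = proj₁ multiple
            xk = proj₁ (proj₂ multiple)
            yk = proj₂ (proj₂ multiple)
            k≢0 : k ≢ 0#
            k≢0 k≡0 = [ (λ h → h (trans xk (trans (cong (_* b) k≡0) (zeroˡ b)))) , (λ h → h (trans yk (trans (cong (_* a) k≡0) (zeroˡ a)))) ]′
              (form-at-nucleus {α₃ (l s)} {1#} {l s} (l-≢0 s≢0) P≢0 on-form)
            zk : z ≡ k * z-at s
            zk = conic-z {α₃ (l s)} {1#} {l s} (l-≢0 s≢0) (trans (cong₂ (λ x y → form (α₃ (l s)) 1# (l s) x y z) (sym xk) (sym yk)) on-form)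
              (trans (form-· (α₃ (l s)) 1# (l s) k b a (z-at s)) (trans (cong (k * k *_) (point-on-conic-root (α₃ (l s)) 1# (l s) b a (l-≢0 s≢0))) (zeroʳ _)))
            result : proj₁ (rep s) ∼ P
            result with s ≟ⱽ 0ⱽ
            ... | yes s≡0 = contradiction s≡0 s≢0
            ... | no _ = k , k≢0 , vec≡ xk yk zk

          size : HasSize (S ∩ pointsOn L) 8
          size = hasCard {A = ∃ (S ∩ pointsOn L)} {λ P Q → proj₁ P ∼ proj₁ Q} 3 rep (λ {r} {s} → injective {r} {s}) surjective

        -- On a line `z = px + qy` a conic restricts to a binary quadratic form, with two zeros or
        -- none according to a trace. That trace is a linear functional of the parameter: if it is
        -- zero the line misses the arc, and otherwise four conics contribute two points each.
        module OffNucleus (a b c : Carrier) (h : (a ∷ b ∷ c ∷ []) ≢ 0ᵥ) (c≢0 : c ≢ 0#) where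
          p q : Carrier
          p = a * c ⁻¹
          q = b * c ⁻¹

          L : Line
          L = a ∷ b ∷ c ∷ [] , h

          on-line : ∀ x y → a * x + b * y + c * (p * x + q * y) ≡ 0#
          on-line x y = trans (cong₂ (λ a b → a * x + b * y + c * (p * x + q * y)) (divide-by a c≢0) (divide-by b c≢0))
            (solve 5 (λ p q c x y → p :* c :* x :+ q :* c :* y :+ c :* (p :* x :+ q :* y) := con false) refl p q c x y)

          z-on-line : ∀ {x y z} → a * x + b * y + c * z ≡ 0# → z ≡ p * x + q * y
          z-on-line {x} {y} {z} on = *-cancelˡ-≢0 c≢0 (x+y≡0⇒x≡y (trans
            (solve 5 (λ u c x y z → c :* z :+ c :* u := (u :* c :+ c :* z)) refl (p * x + q * y) c x y z)
            (trans (cong (_+ c * z) (trans (solve 5 (λ p q c x y → (p :* x :+ q :* y) :* c := p :* c :* x :+ q :* c :* y) refl p q c x y)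
              (cong₂ (λ a b → a * x + b * y) (sym (divide-by a c≢0)) (sym (divide-by b c≢0))))) on)))

          αₗ βₗ : Vec Bool 3 → Carrier
          αₗ s = α₃ (l s) + l s * p ²
          βₗ s = 1# + l s * q ²

          excess : Vec Bool 3 → Carrier
          excess s = l s * l s * l s + l s * p ² + l s * q ² + l s * l s * (l s * l s) * q ² + l s * l s * (p ² * q ²)

          tr-line : ∀ s → tr (αₗ s * βₗ s) ≡ 1# + tr (excess s)
          tr-line s = trans (cong tr (solve 3 (λ l P Q → (con true :+ l :* l :* l :+ l :* P) :* (con true :+ l :* Q) :=
            con true :+ (l :* l :* l :+ l :* P :+ l :* Q :+ l :* l :* (l :* l) :* Q :+ l :* l :* (P :* Q))) refl (l s) (p ²) (q ²)))
            (trans (tr-+ 1# (excess s)) (cong (_+ tr (excess s)) tr-1))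

          -- All terms except the cube are additive, and the failure of the cube, `l²k + lk²`, has
          -- trace zero by isotropy.
          excess-+ : ∀ r s → tr (excess (r ⊞ s)) ≡ tr (excess r) + tr (excess s)
          excess-+ r s = begin
            tr (excess (r ⊞ s))
              ≡⟨ cong (λ l → tr (l * l * l + l * p ² + l * q ² + l * l * (l * l) * q ² + l * l * (p ² * q ²))) (lin-⊞ r s t) ⟩
            tr (let m = l r + l s in m * m * m + m * p ² + m * q ² + m * m * (m * m) * q ² + m * m * (p ² * q ²))
              ≡⟨ cong tr (solve 4 (λ l k P Q → let m = l :+ k in
                   m :* m :* m :+ m :* P :+ m :* Q :+ m :* m :* (m :* m) :* Q :+ m :* m :* (P :* Q) :=
                   (l :* l :* l :+ l :* P :+ l :* Q :+ l :* l :* (l :* l) :* Q :+ l :* l :* (P :* Q)) :+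
                   (k :* k :* k :+ k :* P :+ k :* Q :+ k :* k :* (k :* k) :* Q :+ k :* k :* (P :* Q)) :+
                   (l :* l :* k :+ l :* (k :* k))) refl (l r) (l s) (p ²) (q ²)) ⟩
            tr (excess r + excess s + (l r ² * l s + l r * l s ²))
              ≡⟨ trans (tr-+ _ _) (cong₂ _+_ (tr-+ _ _) (iso r s)) ⟩
            tr (excess r) + tr (excess s) + 0#
              ≡⟨ +-identityʳ _ ⟩
            tr (excess r) + tr (excess s) ∎

          functional : ∃ λ w → ∀ s → tr (excess s) ≡ bit (dot w s)
          functional = additive-functional (tr ∘ excess) excess-+ (λ s → tr-values (excess s))

          w : Vec Bool 3
          w = proj₁ functional

          split-at : ∀ {s} → dot w s ≡ true → Split (αₗ s) (βₗ s)
          split-at {s} eq = split (trans (tr-line s) (trans (cong (1# +_) (trans (proj₂ functional s) (cong bit eq))) 1+1≡0))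

          form-line : ∀ s x y → form (α₃ (l s)) 1# (l s) x y (p * x + q * y) ≡ binary (αₗ s) (βₗ s) x y
          form-line s x y = form-on-line (α₃ (l s)) 1# (l s) x y p q

          member-line : ∀ {x y z} h → (S ∩ pointsOn L) (x ∷ y ∷ z ∷ [] , h) →
            ∃ λ s → dot w s ≡ true × (x ≢ 0# ⊎ y ≢ 0#) × binary (αₗ s) (βₗ s) x y ≡ 0# × z ≡ p * x + q * y
          member-line {x} {y} {z} P≢0 (inj₁ N∼P , on) = let (x≡0 , y≡0) = nucleus∼⇒xy≡0 P≢0 N∼P in
            contradiction (vec≡ x≡0 y≡0 (zero-product (trans (sym (trans (cong₂ (λ x y → a * x + b * y + c * z) x≡0 y≡0)
              (solve 4 (λ a b c z → a :* con false :+ b :* con false :+ c :* z := c :* z) refl a b c z))) on) c≢0)) P≢0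
          member-line {x} {y} {z} P≢0 (inj₂ (_ , (s , s≢0 , refl) , eq) , on) = s , dot≡true , xy≢0 , root , z≡
            where
            z≡ = z-on-line on
            on-form = on-conic (α₃ (l s)) 1# (l s) P≢0 eq
            xy≢0 = form-at-nucleus {α₃ (l s)} {1#} {l s} (l-≢0 s≢0) P≢0 on-form
            root : binary (αₗ s) (βₗ s) x y ≡ 0#
            root = trans (sym (form-line s x y)) (trans (cong (form (α₃ (l s)) 1# (l s) x y) (sym z≡)) on-form)
            dot≡true : dot w s ≡ true
            dot≡true = bit-injective {dot w s} {true} (trans (sym (proj₂ functional s)) (sym (x+y≡0⇒x≡y (trans (sym (tr-line s)) (binary-root {αₗ s} root xy≢0)))))

          none : w ≡ 0ⱽ → HasSize (S ∩ pointsOn L) 0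
          none w≡0 = (λ ()) , (λ {i} → λ {}) , λ { ((_ ∷ _ ∷ _ ∷ [] , h) , P∈) → let (s , eq , _) = member-line h P∈ in
            contradiction (trans (sym eq) (trans (cong (λ w → dot w s) w≡0) (dot-0 s))) λ () }
            where
            dot-0 : ∀ {n} (s : Vec Bool n) → dot 0ⱽ s ≡ false
            dot-0 []      = refl
            dot-0 (_ ∷ s) = dot-0 s

          module _ (w≢0 : w ≢ 0ⱽ) where
            at : Vec Bool 2 → Vec Bool 3
            at = solution w

            at-≢0 : ∀ u → at u ≢ 0ⱽ
            at-≢0 u eq = contradiction (trans (sym (solution-dot w w≢0 u)) (trans (cong (dot w) eq) (dot-0ʳ w))) λ ()
              where
              dot-0ʳ : ∀ {n} (w : Vec Bool n) → dot w 0ⱽ ≡ false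
              dot-0ʳ []          = refl
              dot-0ʳ (true ∷ w)  = dot-0ʳ w
              dot-0ʳ (false ∷ w) = dot-0ʳ w

            module Sp u = Split (split-at (solution-dot w w≢0 u))

            point-at : Vec Bool 2 → Bool → Point
            point-at u ε = Sp.rootₓ u ε ∷ Sp.rootᵧ u ε ∷ (p * Sp.rootₓ u ε + q * Sp.rootᵧ u ε) ∷ [] ,
              λ eq → let (x≡0 , y≡0 , _) = coords eq in [ (λ h → h x≡0) , (λ h → h y≡0) ]′ (Sp.nonzero u ε)

            root-at : ∀ u ε → form (α₃ (l (at u))) 1# (l (at u)) (Sp.rootₓ u ε) (Sp.rootᵧ u ε) (p * Sp.rootₓ u ε + q * Sp.rootᵧ u ε) ≡ 0#
            root-at u ε = trans (form-line (at u) (Sp.rootₓ u ε) (Sp.rootᵧ u ε)) (Sp.isRoot u ε)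

            rep : Vec Bool 3 → ∃ (S ∩ pointsOn L)
            rep (ε ∷ u) = point-at u ε ,
              inj₂ (conic (α₃ (l (at u))) 1# (l (at u)) , (at u , at-≢0 u , refl) , to-conic (α₃ (l (at u))) 1# (l (at u)) (proj₂ (point-at u ε)) (root-at u ε)) ,
              on-line (Sp.rootₓ u ε) (Sp.rootᵧ u ε)

            same-root : ∀ {u u′} ε ε′ k → u ≡ u′ → Sp.rootₓ u′ ε′ ≡ k * Sp.rootₓ u ε → Sp.rootᵧ u′ ε′ ≡ k * Sp.rootᵧ u ε → ε ∷ u ≡ ε′ ∷ u′
            same-root {u} ε ε′ k refl x≡ y≡ = cong (_∷ u) (Sp.distinct u ε ε′ k x≡ y≡)

            injective : ∀ {r s} → proj₁ (rep r) ∼ proj₁ (rep s) → r ≡ s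
            injective {ε ∷ u} {ε′ ∷ u′} (k , k≢0 , eq) = same-root {u} {u′} ε ε′ k same-u (proj₁ xyz) (proj₁ (proj₂ xyz))
              where
              X Y Z X′ Y′ Z′ : Carrier
              X = Sp.rootₓ u ε
              Y = Sp.rootᵧ u ε
              Z = p * X + q * Y
              X′ = Sp.rootₓ u′ ε′
              Y′ = Sp.rootᵧ u′ ε′
              Z′ = p * X′ + q * Y′
              xyz : X′ ≡ k * X × Y′ ≡ k * Y × Z′ ≡ k * Z
              xyz = coords eq
              on-u : form (α₃ (l (at u))) 1# (l (at u)) X′ Y′ Z′ ≡ 0#
              on-u = trans (form-cong (α₃ (l (at u))) (l (at u)) (proj₁ xyz) (proj₁ (proj₂ xyz)) (proj₂ (proj₂ xyz)))
                  (trans (form-· (α₃ (l (at u))) 1# (l (at u)) k X Y Z) (trans (cong (k * k *_) (root-at u ε)) (zeroʳ (k * k))))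
              same-u : u ≡ u′
              same-u = solution-injective w u u′ (same-conic {at u} {at u′} {X′} {Y′} {Z′} (at-≢0 u) (proj₂ (point-at u′ ε′)) on-u (root-at u′ ε′))

            surjective : ∀ (P : ∃ (S ∩ pointsOn L)) → ∃ λ s → proj₁ (rep s) ∼ proj₁ P
            surjective (P@(x ∷ y ∷ z ∷ [] , P≢0) , P∈) =
              let s , eq , xy≢0 , root , z≡ = member-line P≢0 P∈
                  u , at[u]≡s = solution-complete w s eq
                  ε , k , k≢0 , x≡ , y≡ = Sp.complete u x y xy≢0 (subst (λ s → binary (αₗ s) (βₗ s) x y ≡ 0#) (sym at[u]≡s) root)
              in ε ∷ u , k , k≢0 , vec≡ x≡ y≡
                (trans z≡ (trans (cong₂ (λ x y → p * x + q * y) x≡ y≡) (solve 5 (λ p q k x y → p :* (k :* x) :+ q :* (k :* y) := k :* (p :* x :+ q :* y)) refl p q k (Sp.rootₓ u ε) (Sp.rootᵧ u ε))))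

            eight : HasSize (S ∩ pointsOn L) 8
            eight = hasCard {A = ∃ (S ∩ pointsOn L)} {λ P Q → proj₁ P ∼ proj₁ Q} 3 rep (λ {r} {s} → injective {r} {s}) surjective

          size-by : Dec (w ≡ 0ⱽ) → HasSize (S ∩ pointsOn L) 0 ⊎ HasSize (S ∩ pointsOn L) 8
          size-by (yes w≡0) = inj₁ (none w≡0)
          size-by (no w≢0)  = inj₂ (eight w≢0)

          size : HasSize (S ∩ pointsOn L) 0 ⊎ HasSize (S ∩ pointsOn L) 8
          size = size-by (w ≟ⱽ 0ⱽ)

      cubicMaximalArc : MaximalArc 8
      cubicMaximalArc = record
        { points = S
        ; respects = λ {P} {Q} → arcOf-resp {cubicConics t} {P} {Q}
        ; nonEmpty = nucleus , inj₁ (∼-refl nucleus)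
        ; proper = outside , outside∉
        ; meets = meets }
        where
        outside : Point
        outside = 0# ∷ 1# ∷ 0# ∷ [] , λ eq → 1≢0 (proj₁ (proj₂ (coords eq)))
        outside∉ : ¬ S outside
        outside∉ (inj₁ N∼) = 1≢0 (proj₂ (nucleus∼⇒xy≡0 (proj₂ outside) N∼))
        outside∉ (inj₂ (_ , (s , _ , refl) , eq)) = 1≢0 (trans (solve 2 (λ α μ → con true := α :* (con false :* con false) :+ con false :* con true :+ con true :* (con true :* con true) :+ μ :* (con false :* con false)) refl (α₃ (l s)) (l s))
          (on-conic (α₃ (l s)) 1# (l s) (proj₂ outside) eq))
        meets : ∀ L → HasSize (S ∩ pointsOn L) 0 ⊎ HasSize (S ∩ pointsOn L) 8
        meets (a ∷ b ∷ c ∷ [] , h) with c ≟ 0#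
        ... | yes c≡0 = inj₂ (ThroughNucleus.size a b c h c≡0)
        ... | no c≢0  = OffNucleus.size a b c h c≢0

  -- Images of conics under semilinear maps.

  module ConicImages where
    open import Data.List.Base using ([]; _∷_)
    open import Data.List.Relation.Unary.AllPairs using ([]; _∷_)
    open import Data.List.Relation.Unary.All using ([]; _∷_)
    open Field
    open PG hiding (Tr)
    open Geometry hiding (semilinear)
    open Polynomials using (eval; too-many-roots)
    open NormalBasis using (lin)
    open Conics
    open CubicArcs
    open FundamentalTheorem using (divide-by)

    module _ {I : Set} (d : ℕ) (poly : I → Vec Carrier d) where

      root? : ∀ i x → Dec (eval (poly i) x ≡ 0#)
      root? i x = eval (poly i) x ≟ 0#

      length-split : ∀ i xs → List.length (List.filter (root? i) xs) ℕ.+ List.length (List.filter (¬? ∘ root? i) xs) ≡ List.length xs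
      length-split i [] = refl
      length-split i (x ∷ xs) with root? i x
      ... | yes _ = cong suc (length-split i xs)
      ... | no _  = trans (ℕ.+-suc _ _) (cong suc (length-split i xs))

      -- If every element of a large set is a root of one of finitely many polynomials, one of them vanishes identically.
      pigeonhole-roots : ∀ is xs → Unique xs → (∀ {x} → x ∈ xs → ∃ λ i → i ∈ is × eval (poly i) x ≡ 0#) →
                         List.length is ℕ.* d ℕ.< List.length xs → ∃ λ i → i ∈ is × poly i ≡ Vec.replicate d 0#
      pigeonhole-roots [] (x ∷ xs) u cover large with () ← proj₁ (proj₂ (cover (here refl)))
      pigeonhole-roots (i ∷ is) xs u cover large with Vec.≡-dec _≟_ (poly i) (Vec.replicate d 0#)
      ... | yes p = i , here refl , p
      ... | no ¬p =
        let j , j∈ , q = pigeonhole-roots is others (Unique.filter⁺ (¬? ∘ root? i) u) cover′ large′ in j , there j∈ , q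
        where
        roots others : List Carrier
        roots  = List.filter (root? i) xs
        others = List.filter (¬? ∘ root? i) xs
        few-roots : List.length roots ℕ.< d
        few-roots = ℕ.≰⇒> λ d≤ → ¬p (too-many-roots (poly i) (Unique.filter⁺ (root? i) u) (All.all-filter (root? i) xs) d≤)
        cover′ : ∀ {x} → x ∈ others → ∃ λ j → j ∈ is × eval (poly j) x ≡ 0#
        cover′ x∈ with List.∈-filter⁻ (¬? ∘ root? i) {xs = xs} x∈
        ... | x∈xs , ≢0 with cover x∈xs
        ...   | j , there j∈ , eq = j , j∈ , eq
        ...   | _ , here refl , eq = contradiction eq ≢0
        large′ : List.length is ℕ.* d ℕ.< List.length others
        large′ = ℕ.+-cancelˡ-< d _ _ (ℕ.<-≤-trans large (ℕ.≤-trans (ℕ.≤-reflexive (sym (length-split i xs)))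
          (ℕ.+-monoˡ-≤ (List.length others) (ℕ.<⇒≤ few-roots))))

    module Matrix (g : ΓL) where
      open ΓL g
      open Act g public using (frobenius)
      open RingMorphisms rawRing rawRing using (IsRingIsomorphism)
      open IsRingIsomorphism σ-automorphism public using (+-homo; *-homo; 0#-homo; 1#-homo)

      e₁ e₂ e₃ : V
      e₁ = 1# ∷ 0# ∷ 0# ∷ []
      e₂ = 0# ∷ 1# ∷ 0# ∷ []
      e₃ = 0# ∷ 0# ∷ 1# ∷ []

      -- The matrix of g has rows (a , b , i), (c , d , j), (m , n , e).
      a b c d e m n i j : Carrier
      a = lookup (to e₁) zero
      c = lookup (to e₁) (suc zero)
      m = lookup (to e₁) (suc (suc zero))
      b = lookup (to e₂) zero
      d = lookup (to e₂) (suc zero)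
      n = lookup (to e₂) (suc (suc zero))
      i = lookup (to e₃) zero
      j = lookup (to e₃) (suc zero)
      e = lookup (to e₃) (suc (suc zero))

      X Y Z : Carrier → Carrier → Carrier → Carrier
      X x y z = a * x + b * y + i * z
      Y x y z = c * x + d * y + j * z
      Z x y z = m * x + n * y + e * z

      η : ∀ (v : V) → v ≡ lookup v zero ∷ lookup v (suc zero) ∷ lookup v (suc (suc zero)) ∷ []
      η (_ ∷ _ ∷ _ ∷ []) = refl

      to-matrix : ∀ x y z → to (x ∷ y ∷ z ∷ []) ≡ X (σ x) (σ y) (σ z) ∷ Y (σ x) (σ y) (σ z) ∷ Z (σ x) (σ y) (σ z) ∷ []
      to-matrix x y z = begin
        to (x ∷ y ∷ z ∷ []) ≡⟨ cong to (vec≡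
          (solve 3 (λ x y z → x := x :* con true :+ y :* con false :+ z :* con false) refl x y z)
          (solve 3 (λ x y z → y := x :* con false :+ y :* con true :+ z :* con false) refl x y z)
          (solve 3 (λ x y z → z := x :* con false :+ y :* con false :+ z :* con true) refl x y z)) ⟩
        to (x · e₁ +ᵥ y · e₂ +ᵥ z · e₃) ≡⟨ trans (additive _ _) (cong₂ _+ᵥ_ (trans (additive _ _) (cong₂ _+ᵥ_ (semilinear x e₁) (semilinear y e₂))) (semilinear z e₃)) ⟩
        σ x · to e₁ +ᵥ σ y · to e₂ +ᵥ σ z · to e₃
          ≡⟨ cong₂ (λ u v → σ x · u +ᵥ σ y · v +ᵥ σ z · to e₃) (η (to e₁)) (η (to e₂)) ⟩
        _ ≡⟨ cong (λ w → σ x · (a ∷ c ∷ m ∷ []) +ᵥ σ y · (b ∷ d ∷ n ∷ []) +ᵥ σ z · w) (η (to e₃)) ⟩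
        σ x · (a ∷ c ∷ m ∷ []) +ᵥ σ y · (b ∷ d ∷ n ∷ []) +ᵥ σ z · (i ∷ j ∷ e ∷ [])
          ≡⟨ vec≡ (commute a b i) (commute c d j) (commute m n e) ⟩
        _ ∎
        where
        commute : ∀ p q r → σ x * p + σ y * q + σ z * r ≡ p * σ x + q * σ y + r * σ z
        commute p q r = cong₂ _+_ (cong₂ _+_ (*-comm _ _) (*-comm _ _)) (*-comm _ _)

      σ⁻¹ : Carrier → Carrier
      σ⁻¹ x = proj₁ (IsRingIsomorphism.surjective σ-automorphism x)

      σ-σ⁻¹ : ∀ x → σ (σ⁻¹ x) ≡ x
      σ-σ⁻¹ x = proj₂ (IsRingIsomorphism.surjective σ-automorphism x) refl

      -- A combination of the first two coordinates that vanishes on the image is trivial.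
      rows-independent : ∀ {p q} → (∀ x y z → p * X x y z + q * Y x y z ≡ 0#) → p ≡ 0# × q ≡ 0#
      rows-independent {p} {q} h = at (1# ∷ 0# ∷ 0# ∷ []) (solve 2 (λ p q → p :* con true :+ q :* con false := p) refl p q) ,
                                   at (0# ∷ 1# ∷ 0# ∷ []) (solve 2 (λ p q → p :* con false :+ q :* con true := q) refl p q)
        where
        at : ∀ w {r} → p * lookup w zero + q * lookup w (suc zero) ≡ r → r ≡ 0#
        at w eq with proj₁ (proj₂ bijective w) | proj₂ (proj₂ bijective w) refl
        ... | x ∷ y ∷ z ∷ [] | to≡w = trans (sym eq) (trans (cong (λ w → p * lookup w zero + q * lookup w (suc zero)) (trans (sym to≡w) (to-matrix x y z)))
          (h (σ x) (σ y) (σ z)))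

      σ-≢0 : ∀ {x} → x ≢ 0# → σ x ≢ 0#
      σ-≢0 = Act.σ-≢0 g

      σ-form : ∀ α β μ x y z → σ (form α β μ x y z) ≡ form (σ α) (σ β) (σ μ) (σ x) (σ y) (σ z)
      σ-form α β μ x y z = trans (+-homo _ _) (cong₂ _+_ (trans (+-homo _ _) (cong₂ _+_ (trans (+-homo _ _) (cong₂ _+_ (term α x) (*-homo x y))) (term β y))) (term μ z))
        where
        term : ∀ p q → σ (p * q ²) ≡ σ p * σ q ²
        term p q = trans (*-homo _ _) (cong (σ p *_) (*-homo q q))

      xz-minor yz-minor xy-minor : Carrier
      xz-minor = a * j + c * i
      yz-minor = b * j + d * i
      xy-minor = a * d + b * c

      module _ (t : Basis) (α β μ : Carrier) (μ≢0 : μ ≢ 0#) (maps : ∀ P → conicPoints (conic α β μ) P → cubicArc t (act P)) where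
        private
          κ p r : Carrier
          κ = √ (σ μ ⁻¹)
          p = √ (σ α)
          r = √ (σ β)

          μκ² : σ μ * κ ² ≡ 1#
          μκ² = trans (cong (σ μ *_) (√-² _)) (*-inverseʳ (σ μ) (σ-≢0 μ≢0))

          -- The conic is parametrized, after applying σ, by (w² , 1 , ζ w).
          ζ : Carrier → Carrier
          ζ w = κ * (p * w ² + w + r)

          param : Carrier → Point
          param w = σ⁻¹ (w ²) ∷ 1# ∷ σ⁻¹ (ζ w) ∷ [] , λ eq → 1≢0 (proj₁ (proj₂ (coords eq)))

          param-on-conic : ∀ w → conicPoints (conic α β μ) (param w)
          param-on-conic w = to-conic α β μ (proj₂ (param w)) (zero-if (begin
            σ (form α β μ (σ⁻¹ (w ²)) 1# (σ⁻¹ (ζ w)))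
              ≡⟨ σ-form α β μ _ _ _ ⟩
            form (σ α) (σ β) (σ μ) (σ (σ⁻¹ (w ²))) (σ 1#) (σ (σ⁻¹ (ζ w)))
              ≡⟨ trans (cong₂ (λ x y → form (σ α) (σ β) (σ μ) x y (σ (σ⁻¹ (ζ w)))) (σ-σ⁻¹ _) 1#-homo) (cong (form (σ α) (σ β) (σ μ) (w ²) 1#) (σ-σ⁻¹ _)) ⟩
            form (σ α) (σ β) (σ μ) (w ²) 1# (ζ w)
              ≡⟨ cong₂ (λ α β → form α β (σ μ) (w ²) 1# (ζ w)) (sym (√-² (σ α))) (sym (√-² (σ β))) ⟩
            form (p ²) (r ²) (σ μ) (w ²) 1# (ζ w)
              ≡⟨ solve 5 (λ p r m k w → let z = k :* (p :* (w :* w) :+ w :+ r) in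
                   (p :* p) :* ((w :* w) :* (w :* w)) :+ (w :* w) :* con true :+ (r :* r) :* (con true :* con true) :+ m :* (z :* z) :=
                   (con true :+ m :* (k :* k)) :* ((p :* p) :* ((w :* w) :* (w :* w)) :+ (w :* w) :+ (r :* r))) refl p r (σ μ) κ w ⟩
            (1# + σ μ * κ ²) * (p ² * (w ² * w ²) + w ² + r ²)
              ≡⟨ trans (cong (_* (p ² * (w ² * w ²) + w ² + r ²)) (x≡y⇒x+y≡0 (sym μκ²))) (zeroˡ _) ⟩
            0# ∎))
            where
            zero-if : ∀ {x} → σ x ≡ 0# → x ≡ 0#
            zero-if {x} eq with x ≟ 0#
            ... | yes x≡0 = x≡0
            ... | no x≢0  = contradiction eq (σ-≢0 x≢0)

          -- The conditions for the image of `param w` to be the nucleus (through its first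
          -- coordinate) or to lie on a given conic, as polynomials in `w` of degree at most four.
          -- In `poly` the index `0ⱽ` stands for the nucleus.
          nucleus-poly : Vec Carrier 5
          nucleus-poly = (b + i * κ * r) ∷ (i * κ) ∷ (a + i * κ * p) ∷ 0# ∷ 0# ∷ []

          conic-poly : Carrier → Vec Carrier 5
          conic-poly l = let C = form (α₃ l) 1# l i j e in
            (form (α₃ l) 1# l b d n + C * κ ² * r ² + yz-minor * κ * r) ∷ (yz-minor * κ) ∷
            (C * κ ² + xy-minor + xz-minor * κ * r + yz-minor * κ * p) ∷ (xz-minor * κ) ∷
            (form (α₃ l) 1# l a c m + C * κ ² * p ² + xz-minor * κ * p) ∷ []

          poly : Vec Bool 3 → Vec Carrier 5
          poly s = if does (s ≟ⱽ 0ⱽ) then nucleus-poly else conic-poly (lin s t)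

          eval-nucleus : ∀ w → eval nucleus-poly w ≡ X (w ²) 1# (ζ w)
          eval-nucleus w = solve 7 (λ a b i k p r w →
            b :+ i :* k :* r :+ w :* (i :* k :+ w :* (a :+ i :* k :* p :+ w :* (con false :+ w :* (con false :+ w :* con false)))) :=
            a :* (w :* w) :+ b :* con true :+ i :* (k :* (p :* (w :* w) :+ w :+ r))) refl a b i κ p r w

          eval-conic : ∀ l w → eval (conic-poly l) w ≡ form (α₃ l) 1# l (X (w ²) 1# (ζ w)) (Y (w ²) 1# (ζ w)) (Z (w ²) 1# (ζ w))
          eval-conic l w = solve 15 (λ a b c d e m n i j A l k p r w →
            let z = k :* (p :* (w :* w) :+ w :+ r)
                form x y z = A :* (x :* x) :+ x :* y :+ con true :* (y :* y) :+ l :* (z :* z)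
                C = form i j e ; E = a :* j :+ c :* i ; G = b :* j :+ d :* i ; D = a :* d :+ b :* c in
            form b d n :+ C :* (k :* k) :* (r :* r) :+ G :* k :* r :+ w :* (G :* k :+ w :* (C :* (k :* k) :+ D :+ E :* k :* r :+ G :* k :* p :+
              w :* (E :* k :+ w :* (form a c m :+ C :* (k :* k) :* (p :* p) :+ E :* k :* p :+ w :* con false)))) :=
            form (a :* (w :* w) :+ b :* con true :+ i :* z) (c :* (w :* w) :+ d :* con true :+ j :* z) (m :* (w :* w) :+ n :* con true :+ e :* z))
            refl a b c d e m n i j (α₃ l) l κ p r w

          act-param : ∀ w → to (proj₁ (param w)) ≡ X (w ²) 1# (ζ w) ∷ Y (w ²) 1# (ζ w) ∷ Z (w ²) 1# (ζ w) ∷ []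
          act-param w = trans (to-matrix _ _ _) (trans (cong₂ (λ x y → at-σ x y (σ (σ⁻¹ (ζ w)))) (σ-σ⁻¹ _) 1#-homo) (cong (at-σ (w ²) 1#) (σ-σ⁻¹ _)))
            where
            at-σ : Carrier → Carrier → Carrier → V
            at-σ x y z = X x y z ∷ Y x y z ∷ Z x y z ∷ []

          conic-at : ∀ l {v h x y z} → conicPoints (conic (α₃ l) 1# l) (v , h) → v ≡ x ∷ y ∷ z ∷ [] → form (α₃ l) 1# l x y z ≡ 0#
          conic-at l {h = h} eq refl = on-conic (α₃ l) 1# l h eq

          cover-by : ∀ w → cubicArc t (act (param w)) → ∃ λ s → s ∈ vectors 3 × eval (poly s) w ≡ 0#
          cover-by w (inj₁ (k , _ , eq)) = 0ⱽ , vectors-complete 3 0ⱽ ,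
            trans (eval-nucleus w) (trans (proj₁ (coords (trans (sym (act-param w)) eq))) (zeroʳ k))
          cover-by w (inj₂ (F′ , (s , s≢0 , F′≡) , P∈)) = s , vectors-complete 3 s , by-cases (s ≟ⱽ 0ⱽ)
            where
            by-cases : (d : Dec (s ≡ 0ⱽ)) → eval (if does d then nucleus-poly else conic-poly (lin s t)) w ≡ 0#
            by-cases (yes s≡0) = contradiction s≡0 s≢0
            by-cases (no _)    = trans (eval-conic (lin s t) w)
              (conic-at (lin s t) {to (proj₁ (param w))} {proj₂ (act (param w))} (subst (λ F′ → conicPoints F′ (act (param w))) F′≡ P∈) (act-param w))

          cover : ∀ w → ∃ λ s → s ∈ vectors 3 × eval (poly s) w ≡ 0#
          cover w = cover-by w (maps (param w) (param-on-conic w))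

          κ≢0 : κ ≢ 0#
          κ≢0 = √-≢0 (⁻¹-≢0 (σ-≢0 μ≢0))

        -- Equality of two quadratic forms, coefficient by coefficient: the form of a target conic
        -- composed with the matrix of `g` is `xy-minor` times the form of the source conic
        -- conjugated by `σ`.
        ConicImage : Set
        ConicImage = ∃ λ s → s ≢ 0ⱽ × (xz-minor ≡ 0# × yz-minor ≡ 0#) × let l = lin s t in
          form (α₃ l) 1# l a c m ≡ xy-minor * σ α × form (α₃ l) 1# l b d n ≡ xy-minor * σ β × form (α₃ l) 1# l i j e ≡ xy-minor * σ μ

        -- Five common points of two conics force them to coincide, and the image of a conic has 129 points on 7 conics.
        conic-image-exists : ConicImage
        conic-image-exists =
          let s , _ , poly≡0 = pigeonhole-roots 5 poly (vectors 3) elements elements-unique (λ {w} _ → cover w)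
                                 -- Eight polynomials with five coefficients each give the bound 40,
                                 -- and there are 128 values of `w`.
                                 (subst (40 ℕ.<_) (sym length-elements) (ℕ.m≤m+n 41 87))
          in s , by-cases s (s ≟ⱽ 0ⱽ) poly≡0
          where
          zeros : ∀ {c₀ c₁ c₂ c₃ c₄} → c₀ ∷ c₁ ∷ c₂ ∷ c₃ ∷ c₄ ∷ [] ≡ Vec.replicate 5 0# → c₀ ≡ 0# × c₁ ≡ 0# × c₂ ≡ 0# × c₃ ≡ 0# × c₄ ≡ 0#
          zeros refl = refl , refl , refl , refl , refl

          Relations : Vec Bool 3 → Set
          Relations s = s ≢ 0ⱽ × (xz-minor ≡ 0# × yz-minor ≡ 0#) × let l = lin s t in
            form (α₃ l) 1# l a c m ≡ xy-minor * σ α × form (α₃ l) 1# l b d n ≡ xy-minor * σ β × form (α₃ l) 1# l i j e ≡ xy-minor * σ μ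

          by-cases : ∀ s (d : Dec (s ≡ 0ⱽ)) → (if does d then nucleus-poly else conic-poly (lin s t)) ≡ Vec.replicate 5 0# → Relations s
          -- If `nucleus-poly` vanished identically, the first row of the matrix would be zero.
          by-cases s (yes _) eq = contradiction (proj₁ (rows-independent {1#} {0#} X≡0)) 1≢0
            where
            i≡0 : i ≡ 0#
            i≡0 = zero-product (trans (*-comm κ i) (proj₁ (proj₂ (zeros eq)))) κ≢0
            drop : ∀ {x k} → x + i * κ * k ≡ 0# → x ≡ 0#
            drop {x} {k} h = trans (sym (trans (cong (λ i → x + i * κ * k) i≡0) (solve 3 (λ x κ k → x :+ con false :* κ :* k := x) refl x κ k))) h
            X≡0 : ∀ x y z → 1# * X x y z + 0# * Y x y z ≡ 0#
            X≡0 x y z = trans (solve 2 (λ X Y → con true :* X :+ con false :* Y := X) refl (X x y z) (Y x y z))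
              (trans (cong₂ (λ a b → a * x + b * y + i * z) (drop (proj₁ (proj₂ (proj₂ (zeros eq))))) (drop (proj₁ (zeros eq))))
              (trans (cong (λ i → 0# * x + 0# * y + i * z) i≡0) (solve 3 (λ x y z → con false :* x :+ con false :* y :+ con false :* z := con false) refl x y z)))
          by-cases s (no s≢0) eq = s≢0 , (xz≡0 , yz≡0) , A≡ , B≡ , C≡
            where
            l = lin s t
            A B C : Carrier
            A = form (α₃ l) 1# l a c m
            B = form (α₃ l) 1# l b d n
            C = form (α₃ l) 1# l i j e
            zs = zeros eq
            xz≡0 : xz-minor ≡ 0#
            xz≡0 = zero-product (trans (*-comm κ _) (proj₁ (proj₂ (proj₂ (proj₂ zs))))) κ≢0
            yz≡0 : yz-minor ≡ 0#
            yz≡0 = zero-product (trans (*-comm κ _) (proj₁ (proj₂ zs))) κ≢0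
            Cκ² : C * κ ² ≡ xy-minor
            Cκ² = x+y≡0⇒x≡y (trans (sym (trans (cong₂ (λ u v → C * κ ² + xy-minor + u * κ * r + v * κ * p) xz≡0 yz≡0)
              (solve 4 (λ x k r p → x :+ con false :* k :* r :+ con false :* k :* p := x) refl (C * κ ² + xy-minor) κ r p))) (proj₁ (proj₂ (proj₂ zs))))
            last : ∀ {W minor} q → minor ≡ 0# → W + C * κ ² * q ² + minor * κ * q ≡ 0# → W ≡ xy-minor * q ²
            last {W} q refl h = x+y≡0⇒x≡y (trans (cong (λ u → W + u * q ²) (sym Cκ²))
              (trans (solve 4 (λ W u k q → W :+ u :* (q :* q) := W :+ u :* (q :* q) :+ con false :* k :* q) refl W (C * κ ²) κ q) h))
            A≡ : A ≡ xy-minor * σ α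
            A≡ = trans (last p xz≡0 (proj₂ (proj₂ (proj₂ (proj₂ zs))))) (cong (xy-minor *_) (√-² (σ α)))
            B≡ : B ≡ xy-minor * σ β
            B≡ = trans (last r yz≡0 (proj₁ zs)) (cong (xy-minor *_) (√-² (σ β)))
            C≡ : C ≡ xy-minor * σ μ
            C≡ = sym (trans (cong (_* σ μ) (sym Cκ²)) (trans (solve 3 (λ C k m → C :* k :* m := C :* (m :* k)) refl C (κ ²) (σ μ))
              (trans (cong (C *_) μκ²) (*-identityʳ C))))

        opaque
          conic-image : ConicImage
          conic-image = conic-image-exists

  -- Isomorphisms between cubic arcs.

  module CubicIsomorphisms where
    open import Data.List.Base using ([]; _∷_)
    open import Data.List.Relation.Unary.AllPairs using ([]; _∷_)
    open import Data.List.Relation.Unary.All using ([]; _∷_)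
    open Field
    open PG hiding (Tr)
    open Geometry hiding (semilinear)
    open Polynomials using (eval; too-many-roots)
    open NormalBasis using (lin)
    open Conics
    open CubicArcs
    open ConicImages
    open FundamentalTheorem using (divide-by)

    zeros₄ : ∀ {c₀ c₁ c₂ c₃ : Carrier} → c₀ ∷ c₁ ∷ c₂ ∷ c₃ ∷ [] ≡ Vec.replicate 4 0# → c₀ ≡ 0# × c₁ ≡ 0# × c₂ ≡ 0# × c₃ ≡ 0#
    zeros₄ refl = refl , refl , refl , refl

    -- For `ε` in GF(2) this fixes every conic with `β = 1`, because the coefficient of `x²` changes
    -- by `ε + ε² = 0`. It accounts for the factor two in all automorphism groups.
    shear : Bool → Transformation
    shear ε = record { s = 1# ; t = 0# ; u = bit ε ; v = 1# ; m = 0# ; n = 0# ; e = 1#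
      ; det = solve 1 (λ u → con true :* con true :+ con false :* u := con true) refl (bit ε) ; e≢0 = 1≢0 }

    module _ (g : ΓL) where
      open ΓL g using (to; σ; act)
      open Matrix g

      module _ (t : Basis) (αf : Carrier → Carrier) where

        -- The function `αf` covers two cases at once: `α₃` for isomorphisms of cubic arcs, and a
        -- constant for pencils of Denniston type.
        Source : Carrier → Set
        Source μ = μ ≢ 0# × (∀ P → conicPoints (conic (αf μ) 1# μ) P → cubicArc t (act P))

        module _ (μ₀ : Carrier) (source₀ : Source μ₀) where
          private
            conicImage : ∀ {μ} (source : Source μ) → ConicImage t (αf μ) 1# μ (proj₁ source) (proj₂ source)
            conicImage {μ} (μ≢0 , maps) = conic-image t (αf μ) 1# μ μ≢0 maps

            minors : xz-minor ≡ 0# × yz-minor ≡ 0#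
            minors = proj₁ (proj₂ (proj₂ (conicImage source₀)))

          -- The two vanishing minors make `j * X + i * Y` vanish identically, and the rows of the
          -- matrix are independent. Geometrically, the nucleus is fixed.
          ij≡0 : j ≡ 0# × i ≡ 0#
          ij≡0 = rows-independent λ x y z → trans
            (solve 9 (λ a b c d i j x y z → j :* (a :* x :+ b :* y :+ i :* z) :+ i :* (c :* x :+ d :* y :+ j :* z) := (a :* j :+ c :* i) :* x :+ (b :* j :+ d :* i) :* y)
              refl a b c d i j x y z)
            (trans (cong₂ (λ u v → u * x + v * y) (proj₁ minors) (proj₂ minors)) (solve 2 (λ x y → con false :* x :+ con false :* y := con false) refl x y))

          D : Carrier
          D = xy-minor

          combination : ∀ p q x y z → p * X x y z + q * Y x y z ≡ (p * a + q * c) * x + (p * b + q * d) * y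
          combination p q x y z = trans (cong₂ (λ i j → p * (a * x + b * y + i * z) + q * (c * x + d * y + j * z)) (proj₂ ij≡0) (proj₁ ij≡0))
            (solve 9 (λ a b c d p q x y z → p :* (a :* x :+ b :* y :+ con false :* z) :+ q :* (c :* x :+ d :* y :+ con false :* z) := (p :* a :+ q :* c) :* x :+ (p :* b :+ q :* d) :* y)
              refl a b c d p q x y z)

          D≢0 : D ≢ 0#
          D≢0 D≡0 = 1≢0 (proj₁ (rows-independent {1#} {0#} λ x y z → trans (combination 1# 0# x y z)
            (trans (cong₂ (λ a b → (1# * a + 0# * c) * x + (1# * b + 0# * d) * y) a≡0 b≡0)
              (solve 4 (λ c d x y → (con true :* con false :+ con false :* c) :* x :+ (con true :* con false :+ con false :* d) :* y := con false) refl c d x y))))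
            where
            b≡0 : b ≡ 0#
            b≡0 = proj₂ (rows-independent {d} {b} λ x y z → trans (combination d b x y z)
              (trans (solve 6 (λ a b c d x y → (d :* a :+ b :* c) :* x :+ (d :* b :+ b :* d) :* y := (a :* d :+ b :* c) :* x) refl a b c d x y) (trans (cong (_* x) D≡0) (zeroˡ x))))
            a≡0 : a ≡ 0#
            a≡0 = proj₂ (rows-independent {c} {a} λ x y z → trans (combination c a x y z)
              (trans (solve 6 (λ a b c d x y → (c :* a :+ a :* c) :* x :+ (c :* b :+ a :* d) :* y := (a :* d :+ b :* c) :* y) refl a b c d x y) (trans (cong (_* y) D≡0) (zeroˡ y))))

          le² : ∀ {μ} (source : Source μ) → lin (proj₁ (conicImage source)) t * e ² ≡ D * σ μ
          le² source = let (s , _ , _ , _ , _ , eq) = conicImage source ; l = lin s t in trans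
            (trans (solve 3 (λ A l e → l :* (e :* e) := A :* (con false :* con false) :+ con false :* con false :+ con true :* (con false :* con false) :+ l :* (e :* e)) refl (α₃ l) l e)
              (cong₂ (λ i j → form (α₃ l) 1# l i j e) (sym (proj₂ ij≡0)) (sym (proj₁ ij≡0)))) eq

          e≢0 : e ≢ 0#
          e≢0 e≡0 = *-≢0 D≢0 (σ-≢0 (proj₁ source₀)) (trans (sym (le² source₀))
            (trans (cong (λ e → lin (proj₁ (conicImage source₀)) t * e ²) e≡0) (solve 1 (λ l → l :* (con false :* con false) := con false) refl (lin (proj₁ (conicImage source₀)) t))))

          ρ : Carrier
          ρ = D * (e ²) ⁻¹

          ρ≢0 : ρ ≢ 0#
          ρ≢0 = *-≢0 D≢0 (⁻¹-≢0 (*-≢0 e≢0 e≢0))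

          ρe² : ρ * e ² ≡ D
          ρe² = sym (divide-by D (*-≢0 e≢0 e≢0))

          -- The image of the conic with parameter μ has parameter ρ σ(μ).
          image-parameter : ∀ {μ} (source : Source μ) → lin (proj₁ (conicImage source)) t ≡ ρ * σ μ
          image-parameter {μ} source = *-cancelˡ-≢0 (*-≢0 e≢0 e≢0) (trans (*-comm _ _) (trans (le² source)
            (trans (cong (_* σ μ) (sym ρe²)) (solve 3 (λ r e m → r :* e :* m := e :* (r :* m)) refl ρ (e ²) (σ μ)))))

          relations : ∀ {μ} → Source μ → let l = ρ * σ μ in
            form (α₃ l) 1# l a c m ≡ D * σ (αf μ) × form (α₃ l) 1# l b d n ≡ D
          relations source = let (_ , _ , _ , A , B , _) = conicImage source ; p = image-parameter source in
            trans (cong (λ l → form (α₃ l) 1# l a c m) (sym p)) A ,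
            trans (cong (λ l → form (α₃ l) 1# l b d n) (sym p)) (trans B (trans (cong (D *_) 1#-homo) (*-identityʳ D)))

          module _ (μs : List Carrier) (unique : Unique μs) (4≤ : 4 ℕ.≤ List.length μs) (sources : All Source μs) where

            -- A polynomial of degree 3 that vanishes at the parameters of all image conics.
            cubic-vanishes : ∀ (p : Vec Carrier 4) → (∀ {μ} → Source μ → eval p (ρ * σ μ) ≡ 0#) → p ≡ Vec.replicate 4 0#
            cubic-vanishes p root = too-many-roots p {List.map (λ μ → ρ * σ μ) μs}
              (Unique.map⁺ (λ eq → σ-injective (*-cancelˡ-≢0 ρ≢0 eq)) unique)
              (All.map⁺ (All.map root sources))
              (subst (4 ℕ.≤_) (sym (List.length-map (λ μ → ρ * σ μ) μs)) 4≤)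
              where
              σ-injective : ∀ {x y} → σ x ≡ σ y → x ≡ y
              σ-injective {x} {y} eq = φ^-injective (toℕ (proj₁ frobenius)) (trans (sym (proj₂ frobenius x)) (trans eq (proj₂ frobenius y)))

            form-cubic : ∀ x y z w l → form (α₃ l) 1# l x y z + w ≡ x ² + x * y + y ² + w + l * (z ² + l * (0# + l * (x ² + l * 0#)))
            form-cubic = solve 5 (λ x y z w l → (con true :+ l :* l :* l) :* (x :* x) :+ x :* y :+ con true :* (y :* y) :+ l :* (z :* z) :+ w :=
              x :* x :+ x :* y :+ y :* y :+ w :+ l :* (z :* z :+ l :* (con false :+ l :* (x :* x :+ l :* con false)))) refl

            -- The value of the target form at the second column is a cubic polynomial in the
            -- parameter with coefficients `b²` of `l³`, `n²` of `l` and constant term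
            -- `b² + bd + d²`. It equals `D` at four parameters or more, so the coefficients can be
            -- compared.
            second-row : b ≡ 0# × n ≡ 0# × d ² ≡ D
            second-row =
              let p₀ , p₁ , _ , p₃ = zeros₄ (cubic-vanishes ((b ² + b * d + d ² + D) ∷ n ² ∷ 0# ∷ b ² ∷ [])
                    λ {μ} source → trans (sym (form-cubic b d n D (ρ * σ μ))) (x≡y⇒x+y≡0 (proj₂ (relations source))))
                  b≡0 = square-zero p₃
              in b≡0 , square-zero p₁ , x+y≡0⇒x≡y (trans
                (trans (solve 2 (λ d D → d :* d :+ D := con false :* con false :+ con false :* d :+ d :* d :+ D) refl d D) (cong (λ b → b ² + b * d + d ² + D) (sym b≡0))) p₀)

            ad≡D : a * d ≡ D
            ad≡D = trans (solve 3 (λ a c d → a :* d := a :* d :+ con false :* c) refl a c d) (cong (λ b → a * d + b * c) (sym (proj₁ second-row)))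

            d≢0 : d ≢ 0#
            d≢0 d≡0 = D≢0 (trans (sym (proj₂ (proj₂ second-row))) (trans (cong _² d≡0) (zeroˡ 0#)))

            a≡d : a ≡ d
            a≡d = *-cancelˡ-≢0 d≢0 (trans (*-comm d a) (trans ad≡D (sym (proj₂ (proj₂ second-row)))))

      -- A pencil of conics with constant α cannot be mapped into a cubic arc.
      no-constant-source : ∀ t α₀ μs → Unique μs → 4 ℕ.≤ List.length μs → ¬ All (Source t (λ _ → α₀)) μs
      no-constant-source t α₀ μs@(μ₀ ∷ _) unique 4≤ sources@(source₀ ∷ _) = D≢0′ (trans (sym ad≡D′) (trans (cong (_* d) a≡0) (zeroˡ d)))
        where
        D≢0′ = D≢0 t (λ _ → α₀) μ₀ source₀
        ad≡D′ = ad≡D t (λ _ → α₀) μ₀ source₀ μs unique 4≤ sources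
        w : Carrier
        w = xy-minor * σ α₀
        a≡0 : a ≡ 0#
        a≡0 = square-zero (proj₂ (proj₂ (proj₂ (zeros₄ (cubic-vanishes t (λ _ → α₀) μ₀ source₀ μs unique 4≤ sources
          ((a ² + a * c + c ² + w) ∷ m ² ∷ 0# ∷ a ² ∷ [])
          λ {μ} source → trans (sym (form-cubic t (λ _ → α₀) μ₀ source₀ μs unique 4≤ sources a c m w (ρ t (λ _ → α₀) μ₀ source₀ * σ μ)))
            (x≡y⇒x+y≡0 (proj₁ (relations t (λ _ → α₀) μ₀ source₀ source))))))))

      module _ (t₀ t : Basis) (ind₀ : IndependentF t₀) (maps : ∀ P → cubicArc t₀ P → cubicArc t (act P)) where
        private
          -- Four of the seven conics suffice, because the polynomials to be compared have degree
          -- three.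
          ss : List (Vec Bool 3)
          ss = (true ∷ true ∷ true ∷ []) ∷ (true ∷ true ∷ false ∷ []) ∷ (true ∷ false ∷ true ∷ []) ∷ (true ∷ false ∷ false ∷ []) ∷ []

          ss-unique : Unique ss
          ss-unique = ((λ ()) ∷ (λ ()) ∷ (λ ()) ∷ []) ∷ ((λ ()) ∷ (λ ()) ∷ []) ∷ ((λ ()) ∷ []) ∷ [] ∷ []

          source : ∀ {s} → s ≢ 0ⱽ → Source t α₃ (lin s t₀)
          source {s} s≢0 = (λ eq → s≢0 (ind₀ s eq)) , λ P P∈ → maps P (inj₂ (conic (α₃ (lin s t₀)) 1# (lin s t₀) , (s , s≢0 , refl) , P∈))

          source₀ : Source t α₃ (lin (true ∷ true ∷ true ∷ []) t₀)
          source₀ = source {true ∷ true ∷ true ∷ []} λ ()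

          μ₀ = lin (true ∷ true ∷ true ∷ []) t₀
          μs = List.map (λ s → lin s t₀) ss

          unique : Unique μs
          unique = Unique.map⁺ (lin-injective ind₀) ss-unique

          sources : All (Source t α₃) μs
          sources = source {true ∷ true ∷ true ∷ []} (λ ()) ∷ source {true ∷ true ∷ false ∷ []} (λ ()) ∷
            source {true ∷ false ∷ true ∷ []} (λ ()) ∷ source {true ∷ false ∷ false ∷ []} (λ ()) ∷ []

          4≤ : 4 ℕ.≤ 4
          4≤ = ℕ.≤-refl

          D′ ρ′ τ : Carrier
          D′ = xy-minor
          ρ′ = ρ t α₃ μ₀ source₀
          τ = ρ′ ⁻¹

          ρ′≢0 : ρ′ ≢ 0#
          ρ′≢0 = ρ≢0 t α₃ μ₀ source₀

          τρ : τ * ρ′ ≡ 1#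
          τρ = *-inverseˡ ρ′ ρ′≢0

          -- The right side is rewritten in the parameter `ρ′ * σ x` of the image conic, so that
          -- both sides become polynomials in the same variable.
          rhs : ∀ x → xy-minor * σ (α₃ x) ≡ D′ + D′ * (τ * τ * τ) * (ρ′ * σ x * (ρ′ * σ x) * (ρ′ * σ x))
          rhs x = begin
            D′ * σ (α₃ x) ≡⟨ cong (D′ *_) (trans (+-homo _ _) (cong₂ _+_ 1#-homo (trans (*-homo _ _) (cong (_* σ x) (*-homo x x))))) ⟩
            D′ * (1# + σ x * σ x * σ x) ≡⟨ cong (λ y → D′ * (1# + y * y * y)) (trans (sym (*-identityˡ (σ x))) (cong (_* σ x) (sym τρ))) ⟩
            D′ * (1# + τ * ρ′ * σ x * (τ * ρ′ * σ x) * (τ * ρ′ * σ x))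
              ≡⟨ solve 4 (λ D u r x → let y = u :* r :* x in D :* (con true :+ y :* y :* y) := D :+ D :* (u :* u :* u) :* (r :* x :* (r :* x) :* (r :* x))) refl D′ τ ρ′ (σ x) ⟩
            D′ + D′ * (τ * τ * τ) * (ρ′ * σ x * (ρ′ * σ x) * (ρ′ * σ x)) ∎

          first-row : a ² + a * c + c ² + D′ ≡ 0# × m ² ≡ 0# × 0# ≡ 0# × a ² + D′ * (τ * τ * τ) ≡ 0#
          first-row = zeros₄ (cubic-vanishes t α₃ μ₀ source₀ μs unique 4≤ sources
            ((a ² + a * c + c ² + D′) ∷ m ² ∷ 0# ∷ (a ² + D′ * (τ * τ * τ)) ∷ [])
            λ {μ} source → trans
              (solve 6 (λ a c m D K l → a :* a :+ a :* c :+ c :* c :+ D :+ l :* (m :* m :+ l :* (con false :+ l :* (a :* a :+ D :* K :+ l :* con false))) :=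
                (con true :+ l :* l :* l) :* (a :* a) :+ a :* c :+ con true :* (c :* c) :+ l :* (m :* m) :+ (D :+ D :* K :* (l :* l :* l))) refl a c m D′ (τ * τ * τ) (ρ′ * σ μ))
              (x≡y⇒x+y≡0 (trans (proj₁ (relations t α₃ μ₀ source₀ source)) (rhs μ))))

          second = second-row t α₃ μ₀ source₀ μs unique 4≤ sources

          d≢0′ : d ≢ 0#
          d≢0′ = d≢0 t α₃ μ₀ source₀ μs unique 4≤ sources

          a≡d′ : a ≡ d
          a≡d′ = a≡d t α₃ μ₀ source₀ μs unique 4≤ sources

          a²≡D : a ² ≡ D′
          a²≡D = trans (cong _² a≡d′) (proj₂ (proj₂ second))

          -- The coefficient of `l³` in `first-row` gives `a² = D τ³`, while `a² = D`; the only cube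
          -- root of unity in the field is 1.
          τ≡1 : τ ≡ 1#
          τ≡1 = cube≡1 (*-cancelˡ-≢0 (D≢0 t α₃ μ₀ source₀) (trans (sym (x+y≡0⇒x≡y (proj₂ (proj₂ (proj₂ first-row))))) (trans a²≡D (sym (*-identityʳ D′)))))

          ρ≡1 : ρ′ ≡ 1#
          ρ≡1 = trans (sym (*-identityˡ ρ′)) (trans (cong (_* ρ′) (sym τ≡1)) τρ)

          e≡d : e ≡ d
          e≡d = ²-injective (trans (sym (*-identityˡ (e ²))) (trans (cong (_* e ²) (sym ρ≡1)) (trans (ρe² t α₃ μ₀ source₀) (sym (proj₂ (proj₂ second))))))

          u : Carrier
          u = c * d ⁻¹

          c≡ud : c ≡ u * d
          c≡ud = divide-by c d≢0′

          c²+dc : c ² + d * c ≡ 0#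
          c²+dc = trans (solve 3 (λ a c A → c :* c :+ a :* c := A :+ a :* c :+ c :* c :+ A) refl d c (a ²))
            (trans (cong₂ (λ x w → a ² + x * c + c ² + w) (sym a≡d′) a²≡D) (proj₁ first-row))

          -- The constant coefficient leaves `c² + dc = 0`, so the ratio of `c` to `d` lies in
          -- GF(2). This ratio is the parameter of the shear.
          u²≡u : u ² ≡ u
          u²≡u = *-cancelˡ-≢0 (*-≢0 d≢0′ d≢0′) (begin
            d ² * u ²        ≡⟨ solve 2 (λ d u → (d :* d) :* (u :* u) := (u :* d) :* (u :* d)) refl d u ⟩
            (u * d) ²        ≡⟨ cong _² c≡ud ⟨
            c ²              ≡⟨ x+y≡0⇒x≡y c²+dc ⟩
            d * c            ≡⟨ cong (d *_) c≡ud ⟩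
            d * (u * d)      ≡⟨ solve 2 (λ d u → d :* (u :* d) := (d :* d) :* u) refl d u ⟩
            d ² * u          ∎)

          c-by : u ≡ 0# ⊎ u ≡ 1# → ∃ λ ε → c ≡ d * bit ε
          c-by (inj₁ p) = false , trans c≡ud (trans (cong (_* d) p) (*-comm 0# d))
          c-by (inj₂ p) = true , trans c≡ud (trans (cong (_* d) p) (*-comm 1# d))

          c-values : ∃ λ ε → c ≡ d * bit ε
          c-values = c-by (x²≡x u²≡u)

        -- Up to a scalar, an isomorphism of cubic arcs is a Frobenius power followed by a shear.
        isomorphism-normal-form : ∃ λ κ → κ ≢ 0# × ∃ λ ε → ∀ v → to v ≡ κ · Transformation.apply (shear ε) (Vec.map σ v)
        isomorphism-normal-form = d , d≢0′ , proj₁ c-values , λ { (x ∷ y ∷ z ∷ []) → trans (to-matrix x y z) (vec≡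
            (trans (trans (cong (λ b → a * σ x + b * σ y + i * σ z) (proj₁ second)) (cong₂ (λ a i → a * σ x + 0# * σ y + i * σ z) a≡d′ (proj₂ ij)))
              (solve 4 (λ d x y z → d :* x :+ con false :* y :+ con false :* z := d :* (con true :* x :+ con false :* y)) refl d (σ x) (σ y) (σ z)))
            (trans (cong₂ (λ c j → c * σ x + d * σ y + j * σ z) (proj₂ c-values) (proj₁ ij))
              (solve 5 (λ d u x y z → d :* u :* x :+ d :* y :+ con false :* z := d :* (u :* x :+ con true :* y)) refl d (bit (proj₁ c-values)) (σ x) (σ y) (σ z)))
            (trans (trans (cong₂ (λ m n → m * σ x + n * σ y + e * σ z) (square-zero (proj₁ (proj₂ first-row))) (proj₁ (proj₂ second))) (cong (λ e → 0# * σ x + 0# * σ y + e * σ z) e≡d))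
              (solve 4 (λ d x y z → con false :* x :+ con false :* y :+ d :* z := d :* (con false :* x :+ con false :* y :+ con true :* z)) refl d (σ x) (σ y) (σ z)))) }
          where
          ij = ij≡0 t α₃ μ₀ source₀

        -- With `ρ′` equal to 1, image parameters are obtained from the source parameters by `σ`
        -- alone; so one subspace is carried into the other by a field automorphism.
        isomorphism-parameters : ∀ s₀ → ∃ λ s → lin s t ≡ σ (lin s₀ t₀)
        isomorphism-parameters s₀ = by-cases (s₀ ≟ⱽ 0ⱽ)
          where
          lin-0 : ∀ (t : Basis) → lin 0ⱽ t ≡ 0#
          lin-0 (a ∷ b ∷ c ∷ []) = solve 3 (λ a b c → con false :* a :+ (con false :* b :+ (con false :* c :+ con false)) := con false) refl a b c
          by-cases : Dec (s₀ ≡ 0ⱽ) → ∃ λ s → lin s t ≡ σ (lin s₀ t₀)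
          by-cases (yes eq)  = 0ⱽ , trans (lin-0 t) (trans (sym 0#-homo) (cong σ (trans (sym (lin-0 t₀)) (cong (λ s → lin s t₀) (sym eq)))))
          by-cases (no s₀≢0) = proj₁ (conic-image t (α₃ (lin s₀ t₀)) 1# (lin s₀ t₀) (proj₁ (source s₀≢0)) (proj₂ (source s₀≢0))) ,
            trans (image-parameter t α₃ μ₀ source₀ (source s₀≢0)) (trans (cong (_* σ (lin s₀ t₀)) ρ≡1) (*-identityˡ _))

  -- Sets of conics closed under composition.

  module ClosedSets where
    open Field
    open PG hiding (Tr)
    open Geometry hiding (semilinear)
    open NormalBasis using (lin)
    open Conics
    open CubicArcs
    open FundamentalTheorem using (divide-by)
    open Conic

    φ-conic : ℕ → Conic → Conic
    φ-conic k (conic α β μ) = conic (φ^ k α) (φ^ k β) (φ^ k μ)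

    -- Substitution of `T` into the quadratic form. The determinant 1 on the coordinates `x` and `y`
    -- keeps the coefficient of `xy` equal to 1, so the result is again a triple.
    pull : Transformation → Conic → Conic
    pull T (conic α β μ) = conic (α * s ² + s * u + β * u ² + μ * m ²) (α * t ² + t * v + β * v ² + μ * n ²) (μ * e ²)
      where open Transformation T

    formAt : Conic → V → Carrier
    formAt (conic α β μ) (x ∷ y ∷ z ∷ []) = form α β μ x y z

    conicPoints⇒ : ∀ F P → conicPoints F P → formAt F (proj₁ P) ≡ 0#
    conicPoints⇒ (conic α β μ) (_ ∷ _ ∷ _ ∷ [] , h) = on-conic α β μ h

    ⇒conicPoints : ∀ F P → formAt F (proj₁ P) ≡ 0# → conicPoints F P
    ⇒conicPoints (conic α β μ) (_ ∷ _ ∷ _ ∷ [] , h) = to-conic α β μ h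

    formAt-pull : ∀ T F w → formAt F (Transformation.apply T w) ≡ formAt (pull T F) w
    formAt-pull T (conic α β μ) (x ∷ y ∷ z ∷ []) = trans
      (solve 13 (λ α β μ s t u v m n e x y z →
        let X = s :* x :+ t :* y ; Y = u :* x :+ v :* y ; Z = m :* x :+ n :* y :+ e :* z in
        α :* (X :* X) :+ X :* Y :+ β :* (Y :* Y) :+ μ :* (Z :* Z) :=
        (α :* (s :* s) :+ s :* u :+ β :* (u :* u) :+ μ :* (m :* m)) :* (x :* x) :+ (s :* v :+ t :* u) :* (x :* y) :+
        (α :* (t :* t) :+ t :* v :+ β :* (v :* v) :+ μ :* (n :* n)) :* (y :* y) :+ (μ :* (e :* e)) :* (z :* z))
        refl α β μ s t u v m n e x y z)
      (trans (cong (λ d → A * x ² + d * (x * y) + B * y ² + μ * e ² * z ²) det)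
        (cong (λ w → A * x ² + w + B * y ² + μ * e ² * z ²) (*-identityˡ (x * y))))
      where
      open Transformation T
      A B : Carrier
      A = α * s ² + s * u + β * u ² + μ * m ²
      B = α * t ² + t * v + β * v ² + μ * n ²

    φ^-form : ∀ k F w → φ^ k (formAt F w) ≡ formAt (φ-conic k F) (φᵥ k w)
    φ^-form k (conic α β μ) (x ∷ y ∷ z ∷ []) =
      trans (φ^-+ k _ _) (cong₂ _+_ (trans (φ^-+ k _ _) (cong₂ _+_ (trans (φ^-+ k _ _) (cong₂ _+_ (term α x) (φ^-* k x y))) (term β y))) (term μ z))
      where
      term : ∀ p q → φ^ k (p * q ²) ≡ φ^ k p * φ^ k q ²
      term p q = trans (φ^-* k p (q ²)) (cong (φ^ k p *_) (φ^-* k q q))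

    -- The image of an arc under a semilinear map fixing the nucleus, read off from the conics.
    module _ (T : Transformation) {k : ℕ} (k<7 : k ℕ.< 7) {C C′ : Pred Conic 0ℓ}
             (C⇒C′ : ∀ {F} → C F → ∃ λ F′ → C′ F′ × pull T F ≡ φ-conic k F′)
             (C′⇒C : ∀ {F′} → C′ F′ → ∃ λ F → C F × pull T F ≡ φ-conic k F′) where
      private
        g : ΓL
        g = transform T k<7
        module T = Transformation T

        form-g : ∀ F F′ w → pull T F ≡ φ-conic k F′ → formAt F (ΓL.to g w) ≡ φ^ k (formAt F′ w)
        form-g F F′ w eq = trans (formAt-pull T F (φᵥ k w)) (trans (cong (λ F → formAt F (φᵥ k w)) eq) (sym (φ^-form k F′ w)))

        g-nucleus : ΓL.act g nucleus ∼ nucleus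
        g-nucleus = ∼-sym nucleus (ΓL.act g nucleus) (T.e , T.e≢0 , vec≡ (linear₂ T.s T.t) (linear₂ T.u T.v)
          (trans (cong₂ (λ x z → T.m * x + T.n * x + T.e * z) (φ^-0 k) (φ^-1 k))
            (solve 3 (λ m n e → m :* con false :+ n :* con false :+ e :* con true := e :* con true) refl T.m T.n T.e)))
          where
          linear₂ : ∀ p q → p * φ^ k 0# + q * φ^ k 0# ≡ T.e * 0#
          linear₂ p q = trans (cong (λ x → p * x + q * x) (φ^-0 k)) (solve 3 (λ p q e → p :* con false :+ q :* con false := e :* con false) refl p q T.e)

        open Act g using (act-cong; to⁻¹; to-to⁻¹)

        preimage : Point → Point
        preimage (v , v≢0) = to⁻¹ v , λ eq → v≢0 (trans (sym (to-to⁻¹ v)) (trans (cong (ΓL.to g) eq) to-0))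
          where
          to-0 : ΓL.to g 0ᵥ ≡ 0ᵥ
          to-0 = trans (cong (ΓL.to g) (sym (c·0 0#))) (trans (ΓL.semilinear g 0# 0ᵥ)
            (trans (cong (_· ΓL.to g 0ᵥ) (φ^-0 k)) (zero-· (ΓL.to g 0ᵥ))))
            where
            zero-· : ∀ v → 0# · v ≡ 0ᵥ
            zero-· (x ∷ y ∷ z ∷ []) = vec≡ (zeroˡ x) (zeroˡ y) (zeroˡ z)

        act-preimage : ∀ P → ΓL.act g (preimage P) ∼ P
        act-preimage P = same-vector (ΓL.act g (preimage P)) P (to-to⁻¹ (proj₁ P))

      arc-image : arcOf C ≐ image (ΓL.act g) (arcOf C′)
      arc-image = (λ {P} → onto P) , (λ {P} → into P)
        where
        onto : ∀ P → arcOf C P → image (ΓL.act g) (arcOf C′) P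
        onto P (inj₁ N∼P) = nucleus , inj₁ (∼-refl nucleus) , ∼-trans (ΓL.act g nucleus) nucleus P g-nucleus N∼P
        onto P (inj₂ (F , F∈ , P∈)) = let F′ , F′∈ , eq = C⇒C′ F∈ in
          preimage P , inj₂ (F′ , F′∈ , ⇒conicPoints F′ (preimage P) (φ^-injective k (trans (sym (form-g F F′ (proj₁ (preimage P)) eq))
            (trans (cong (formAt F) (to-to⁻¹ (proj₁ P))) (trans (conicPoints⇒ F P P∈) (sym (φ^-0 k))))))) , act-preimage P
        into : ∀ P → image (ΓL.act g) (arcOf C′) P → arcOf C P
        into P (Q , inj₁ N∼Q , gQ∼P) = inj₁ (∼-trans nucleus (ΓL.act g Q) P
          (∼-trans nucleus (ΓL.act g nucleus) (ΓL.act g Q) (∼-sym (ΓL.act g nucleus) nucleus g-nucleus) (act-cong {nucleus} {Q} N∼Q)) gQ∼P)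
        into P (Q , inj₂ (F′ , F′∈ , Q∈) , gQ∼P) = let F , F∈ , eq = C′⇒C F′∈ in
          arcOf-resp {C} {ΓL.act g Q} {P} gQ∼P (inj₂ (F , F∈ , ⇒conicPoints F (ΓL.act g Q)
            (trans (form-g F F′ (proj₁ Q) eq) (trans (cong (φ^ k) (conicPoints⇒ F′ Q Q∈)) (φ^-0 k)))))

    infix 4 _≟ᶜ_
    _≟ᶜ_ : (F F′ : Conic) → Dec (F ≡ F′)
    conic α β μ ≟ᶜ conic α′ β′ μ′ with α ≟ α′ | β ≟ β′ | μ ≟ μ′
    ... | yes refl | yes refl | yes refl = yes refl
    ... | no h     | _        | _        = no λ { refl → h refl }
    ... | _        | no h     | _        = no λ { refl → h refl }
    ... | _        | _        | no h     = no λ { refl → h refl }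

    module Closed {C : Pred Conic 0ℓ} (closed-C : IsClosed C) where
      open IsClosed closed-C

      tr≡1 : ∀ {F} → C F → tr (α F * β F) ≡ 1#
      tr≡1 {F} F∈ = trans (sym (Tr≡tr _)) (proj₁ (admissible F∈))

      μ≢0 : ∀ {F} → C F → μ F ≢ 0#
      μ≢0 F∈ = proj₂ (admissible F∈)

      μ+μ≢0 : ∀ {F F′} → C F → C F′ → F ≢ F′ → μ F + μ F′ ≢ 0#
      μ+μ≢0 F∈ F′∈ F≢F′ eq = composable F∈ F′∈ F≢F′ (x+y≡0⇒x≡y eq)

      -- For distinct members `F ⊕ F′` is also a member, so three traces equal to one add up to one.
      -- This is the hypothesis of `conics-disjoint`.
      same-conic : ∀ {F F′} P → C F → C F′ → conicPoints F P → conicPoints F′ P → F ≡ F′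
      same-conic {F@(conic α₁ β₁ μ₁)} {F′@(conic α₂ β₂ μ₂)} P@(_ ∷ _ ∷ _ ∷ [] , h) F∈ F′∈ P∈F P∈F′ with F ≟ᶜ F′
      ... | yes eq = eq
      ... | no F≢F′ = contradiction (conicPoints⇒ F′ P P∈F′) (conics-disjoint (μ≢0 F∈) μ₁+μ₂≢0
        (sym (divide-by′ _)) (sym (divide-by′ _))
        (trans (tr-+ _ _) (trans (cong₂ _+_ (trans (tr-+ _ _) (cong₂ _+_ (tr≡1 F∈) (tr≡1 F′∈))) (tr≡1 (closed F∈ F′∈ F≢F′)))
          (solve 0 (con true :+ con true :+ con true := con true) refl))) h (conicPoints⇒ F P P∈F))
        where
        μ₁+μ₂≢0 : μ₁ + μ₂ ≢ 0#
        μ₁+μ₂≢0 = μ+μ≢0 F∈ F′∈ F≢F′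
        divide-by′ : ∀ y → y ≡ y * (μ₁ + μ₂) ⁻¹ * (μ₁ + μ₂)
        divide-by′ y = divide-by y μ₁+μ₂≢0

      -- A line through the nucleus, hence with one point on each conic; its points in the arc count
      -- the conics.
      axis : Line
      axis = 0# ∷ 1# ∷ 0# ∷ [] , λ eq → 1≢0 (proj₁ (proj₂ (coords eq)))

      axis-y : ∀ {x y z} h → pointsOn axis (x ∷ y ∷ z ∷ [] , h) → y ≡ 0#
      axis-y {x} {y} {z} h eq = trans (solve 3 (λ x y z → y := con false :* x :+ con true :* y :+ con false :* z) refl x y z) eq

      axis-point : ∀ {F} P P′ → C F → conicPoints F P → conicPoints F P′ → pointsOn axis P → pointsOn axis P′ → P ∼ P′
      axis-point {F@(conic α β μ)} (x ∷ y ∷ z ∷ [] , h) (x′ ∷ y′ ∷ z′ ∷ [] , h′) F∈ P∈ P′∈ on on′ = k , k≢0 ,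
        vec≡ x′≡ (trans y′≡0 (sym (trans (cong (k *_) y≡0) (zeroʳ k)))) z′≡
        where
        y≡0 = axis-y h on
        y′≡0 = axis-y h′ on′
        x-only : ∀ {x y} → x ≢ 0# ⊎ y ≢ 0# → y ≡ 0# → x ≢ 0#
        x-only (inj₁ x≢0) _ = x≢0
        x-only (inj₂ y≢0) y≡0 = contradiction y≡0 y≢0
        x≢0 = x-only (form-at-nucleus {α} {β} {μ} (μ≢0 F∈) h (conicPoints⇒ F (_ , h) P∈)) y≡0
        x′≢0 = x-only (form-at-nucleus {α} {β} {μ} (μ≢0 F∈) h′ (conicPoints⇒ F (_ , h′) P′∈)) y′≡0
        k : Carrier
        k = x′ * x ⁻¹
        k≢0 : k ≢ 0#
        k≢0 = *-≢0 x′≢0 (⁻¹-≢0 x≢0)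
        x′≡ : x′ ≡ k * x
        x′≡ = divide-by x′ x≢0
        z′≡ : z′ ≡ k * z
        z′≡ = conic-z {α} {β} {μ} (μ≢0 F∈) (conicPoints⇒ F (_ , h′) P′∈)
          (trans (cong₂ (λ x y → form α β μ x y (k * z)) x′≡ (trans y′≡0 (sym (trans (cong (k *_) y≡0) (zeroʳ k)))))
            (trans (form-· α β μ k x y z) (trans (cong (k * k *_) (conicPoints⇒ F (_ , h) P∈)) (zeroʳ (k * k)))))

      nucleus-not-on-conic : ∀ {F} P → C F → conicPoints F P → ¬ nucleus ∼ P
      nucleus-not-on-conic {F@(conic α β μ)} P@(_ ∷ _ ∷ _ ∷ [] , h) F∈ P∈ N∼P =
        let x≡0 , y≡0 = nucleus∼⇒xy≡0 h N∼P
        in [ (λ x≢0 → x≢0 x≡0) , (λ y≢0 → y≢0 y≡0) ]′ (form-at-nucleus {α} {β} {μ} (μ≢0 F∈) h (conicPoints⇒ F P P∈))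

      conic-resp : ∀ F P P′ → P ∼ P′ → conicPoints F P → conicPoints F P′
      conic-resp F@(conic α β μ) P@(x ∷ y ∷ z ∷ [] , h) P′@(_ , _) (k , _ , refl) P∈ =
        ⇒conicPoints F P′ (trans (form-· α β μ k x y z) (trans (cong (k * k *_) (conicPoints⇒ F P P∈)) (zeroʳ (k * k))))

      pointOf : Conic → Point
      pointOf (conic α β μ) = 1# ∷ 0# ∷ point-on-conic α β μ 1# 0# ∷ [] , λ eq → 1≢0 (proj₁ (coords eq))

      pointOf-on : ∀ {F} → C F → conicPoints F (pointOf F)
      pointOf-on {F@(conic α β μ)} F∈ = ⇒conicPoints F (pointOf F) (point-on-conic-root α β μ 1# 0# (μ≢0 F∈))

      pointOf-axis : ∀ F → pointsOn axis (pointOf F)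
      pointOf-axis (conic α β μ) = solve 1 (λ z → con false :* con true :+ con true :* con false :+ con false :* z := con false) refl (point-on-conic α β μ 1# 0#)

      -- A closed set whose arc has eight points on the axis.
      module Eight (Q : Fin 8 → Point) (Q∈ : ∀ i → arcOf C (Q i)) (Q-axis : ∀ i → pointsOn axis (Q i))
                   (Q-injective : ∀ i j → Q i ∼ Q j → i ≡ j) (Q-surjective : ∀ P → arcOf C P → pointsOn axis P → ∃ λ i → Q i ∼ P) where

        -- The point `Q i` is accounted for, either by the nucleus, with index `zero`, or by a conic
        -- already listed.
        Old : ∀ {m} → Vec Conic m → Fin 8 → Fin (suc m) → Set
        Old L i zero    = nucleus ∼ Q i
        Old L i (suc k) = C (lookup L k) × conicPoints (lookup L k) (Q i)

        Fresh : ∀ {m} → Vec Conic m → Set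
        Fresh {m} L = ∃ λ F → C F × (∀ k → F ≢ lookup L k)

        status : ∀ {m} (L : Vec Conic m) i → (∃ λ k → Old L i k) ⊎ Fresh L
        status L i with Q∈ i
        ... | inj₁ N∼Q = inj₁ (zero , N∼Q)
        ... | inj₂ (F , F∈ , Q∈F) with Fin.any? (λ k → F ≟ᶜ lookup L k)
        ...   | yes (k , refl) = inj₁ (suc k , F∈ , Q∈F)
        ...   | no ¬k = inj₂ (F , F∈ , λ k eq → ¬k (k , eq))

        sequence : ∀ {n} {A : Fin n → Set} {B : Set} → (∀ i → A i ⊎ B) → (∀ i → A i) ⊎ B
        sequence {zero} f = inj₁ λ ()
        sequence {suc n} f with f zero | sequence (f ∘ suc)
        ... | inj₂ b | _ = inj₂ b
        ... | inj₁ _ | inj₂ b = inj₂ b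
        ... | inj₁ a | inj₁ g = inj₁ λ { zero → a ; (suc i) → g i }

        old-injective : ∀ {m} (L : Vec Conic m) i j k → Old L i k → Old L j k → i ≡ j
        old-injective L i j zero    p q = Q-injective i j (∼-trans (Q i) nucleus (Q j) (∼-sym nucleus (Q i) p) q)
        old-injective L i j (suc k) (F∈ , p) (_ , q) = Q-injective i j (axis-point (Q i) (Q j) F∈ p q (Q-axis i) (Q-axis j))

        -- The nucleus and the `m` listed conics carry one axis point each, so they cannot account
        -- for all eight when `suc m` is below 8.
        fresh-by : ∀ {m} (L : Vec Conic m) → suc m ℕ.< 8 → (∀ i → ∃ (Old L i)) ⊎ Fresh L → Fresh L
        fresh-by L m<8 (inj₂ found) = found
        fresh-by L m<8 (inj₁ old)   = contradiction (Fin.injective⇒≤ {f = proj₁ ∘ old}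
          λ {i} {j} eq → old-injective L i j (proj₁ (old j)) (subst (Old L i) eq (proj₂ (old i))) (proj₂ (old j))) (ℕ.<⇒≱ m<8)

        opaque
          fresh : ∀ {m} (L : Vec Conic m) → suc m ℕ.< 8 → Fresh L
          fresh L m<8 = fresh-by L m<8 (sequence (status L))

        fresh₁ : Fresh []
        fresh₁ = fresh [] (s≤s (s≤s z≤n))
        F₁ = proj₁ fresh₁
        F₁∈ : C F₁
        F₁∈ = proj₁ (proj₂ fresh₁)

        fresh₂ : Fresh (F₁ ∷ [])
        fresh₂ = fresh (F₁ ∷ []) (s≤s (s≤s (s≤s z≤n)))
        F₂ = proj₁ fresh₂
        F₂∈ : C F₂
        F₂∈ = proj₁ (proj₂ fresh₂)
        F₁≢F₂ : F₁ ≢ F₂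
        F₁≢F₂ eq = proj₂ (proj₂ fresh₂) zero (sym eq)

        -- Avoiding `F₁ ⊕ F₂` as well makes the third conic independent of the first two.
        fresh₃ : Fresh (F₁ ∷ F₂ ∷ F₁ ⊕ F₂ ∷ [])
        fresh₃ = fresh (F₁ ∷ F₂ ∷ F₁ ⊕ F₂ ∷ []) (s≤s (s≤s (s≤s (s≤s (s≤s z≤n)))))
        F₃ = proj₁ fresh₃
        F₃∈ : C F₃
        F₃∈ = proj₁ (proj₂ fresh₃)

        -- In the quantities `μ`, `α * μ` and `β * μ` the operation `⊕` is addition; this is what
        -- makes a closed set linear over GF(2).
        t A B : Basis
        t = μ F₁ ∷ μ F₂ ∷ μ F₃ ∷ []
        A = α F₁ * μ F₁ ∷ α F₂ * μ F₂ ∷ α F₃ * μ F₃ ∷ []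
        B = β F₁ * μ F₁ ∷ β F₂ * μ F₂ ∷ β F₃ * μ F₃ ∷ []

        -- The combined of C with coordinate vector s.
        Member : Vec Bool 3 → Conic → Set
        Member s F = C F × μ F ≡ lin s t × α F * μ F ≡ lin s A × β F * μ F ≡ lin s B

        private
          unit₁ unit₂ unit₃ : Vec Bool 3
          unit₁ = true ∷ false ∷ false ∷ []
          unit₂ = false ∷ true ∷ false ∷ []
          unit₃ = false ∷ false ∷ true ∷ []

          lin₁ : ∀ x y z → x ≡ lin unit₁ (x ∷ y ∷ z ∷ [])
          lin₁ = solve 3 (λ x y z → x := con true :* x :+ (con false :* y :+ (con false :* z :+ con false))) refl
          lin₂ : ∀ x y z → y ≡ lin unit₂ (x ∷ y ∷ z ∷ [])
          lin₂ = solve 3 (λ x y z → y := con false :* x :+ (con true :* y :+ (con false :* z :+ con false))) refl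
          lin₃ : ∀ x y z → z ≡ lin unit₃ (x ∷ y ∷ z ∷ [])
          lin₃ = solve 3 (λ x y z → z := con false :* x :+ (con false :* y :+ (con true :* z :+ con false))) refl

          ⊕-combined : ∀ {r s F F′} → Member r F → Member s F′ → F ≢ F′ → Member (r ⊞ s) (F ⊕ F′)
          ⊕-combined {r} {s} {F} {F′} (F∈ , p , q , o) (F′∈ , p′ , q′ , o′) F≢F′ = closed F∈ F′∈ F≢F′ ,
            trans (cong₂ _+_ p p′) (sym (NormalBasis.lin-⊞ r s t)) ,
            trans (sym (divide-by _ (μ+μ≢0 F∈ F′∈ F≢F′))) (trans (cong₂ _+_ q q′) (sym (NormalBasis.lin-⊞ r s A))) ,
            trans (sym (divide-by _ (μ+μ≢0 F∈ F′∈ F≢F′))) (trans (cong₂ _+_ o o′) (sym (NormalBasis.lin-⊞ r s B)))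

          m₁ : Member unit₁ F₁
          m₁ = F₁∈ , lin₁ _ _ _ , lin₁ _ _ _ , lin₁ _ _ _
          m₂ : Member unit₂ F₂
          m₂ = F₂∈ , lin₂ _ _ _ , lin₂ _ _ _ , lin₂ _ _ _
          m₃ : Member unit₃ F₃
          m₃ = F₃∈ , lin₃ _ _ _ , lin₃ _ _ _ , lin₃ _ _ _

        combined : ∀ s → s ≢ 0ⱽ → ∃ (Member s)
        combined (false ∷ false ∷ false ∷ []) s≢0 = contradiction refl s≢0
        combined (true ∷ false ∷ false ∷ []) _ = F₁ , m₁
        combined (false ∷ true ∷ false ∷ []) _ = F₂ , m₂
        combined (false ∷ false ∷ true ∷ []) _ = F₃ , m₃
        combined (true ∷ true ∷ false ∷ []) _ = F₁ ⊕ F₂ , ⊕-combined {unit₁} {unit₂} m₁ m₂ F₁≢F₂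
        combined (true ∷ false ∷ true ∷ []) _ = F₁ ⊕ F₃ , ⊕-combined {unit₁} {unit₃} m₁ m₃ (λ eq → proj₂ (proj₂ fresh₃) zero (sym eq))
        combined (false ∷ true ∷ true ∷ []) _ = F₂ ⊕ F₃ , ⊕-combined {unit₂} {unit₃} m₂ m₃ (λ eq → proj₂ (proj₂ fresh₃) (suc zero) (sym eq))
        combined (true ∷ true ∷ true ∷ []) _ = F₁ ⊕ F₂ ⊕ F₃ , ⊕-combined {unit₁ ⊞ unit₂} {unit₃} (⊕-combined {unit₁} {unit₂} m₁ m₂ F₁≢F₂) m₃ (λ eq → proj₂ (proj₂ fresh₃) (suc (suc zero)) (sym eq))

        independent : IndependentF t
        independent s eq = by-cases (s ≟ⱽ 0ⱽ)
          where
          by-cases : Dec (s ≡ 0ⱽ) → s ≡ 0ⱽ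
          by-cases (yes s≡0) = s≡0
          by-cases (no s≢0) = let (F , F∈ , μ≡ , _) = combined s s≢0 in contradiction (trans μ≡ eq) (μ≢0 F∈)

        private
          point-at : ∀ s → Dec (s ≡ 0ⱽ) → Point
          point-at s (yes _)  = nucleus
          point-at s (no s≢0) = pointOf (proj₁ (combined s s≢0))

          index : ∀ s (d : Dec (s ≡ 0ⱽ)) → ∃ λ i → Q i ∼ point-at s d
          index s (yes _)  = Q-surjective nucleus (inj₁ (∼-refl nucleus))
            (solve 0 (con false :* con false :+ con true :* con false :+ con false :* con true := con false) refl)
          index s (no s≢0) = let (F , F∈ , _) = combined s s≢0 in Q-surjective (pointOf F) (inj₂ (F , F∈ , pointOf-on F∈)) (pointOf-axis F)

          point-injective : ∀ r s (d : Dec (r ≡ 0ⱽ)) (d′ : Dec (s ≡ 0ⱽ)) → point-at r d ∼ point-at s d′ → r ≡ s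
          point-injective r s (yes p) (yes q) _ = trans p (sym q)
          point-injective r s (yes _) (no s≢0) N∼ = let (F , F∈ , _) = combined s s≢0 in contradiction N∼ (nucleus-not-on-conic (pointOf F) F∈ (pointOf-on F∈))
          point-injective r s (no r≢0) (yes _) ∼N = let (F , F∈ , _) = combined r r≢0 in
            contradiction (∼-sym (pointOf F) nucleus ∼N) (nucleus-not-on-conic (pointOf F) F∈ (pointOf-on F∈))
          point-injective r s (no r≢0) (no s≢0) P∼P′ = let (F , F∈ , μ≡ , _) = combined r r≢0 ; (F′ , F′∈ , μ≡′ , _) = combined s s≢0 in
            lin-injective {t} independent (trans (sym μ≡) (trans (cong μ (same-conic (pointOf F′) F∈ F′∈ (conic-resp F (pointOf F) (pointOf F′) P∼P′ (pointOf-on F∈)) (pointOf-on F′∈))) μ≡′))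

          i-of : Vec Bool 3 → Fin 8
          i-of s = proj₁ (index s (s ≟ⱽ 0ⱽ))

          i-of-injective : ∀ {r s} → i-of r ≡ i-of s → r ≡ s
          i-of-injective {r} {s} eq = point-injective r s (r ≟ⱽ 0ⱽ) (s ≟ⱽ 0ⱽ)
            (∼-trans (point-at r (r ≟ⱽ 0ⱽ)) (Q (i-of s)) (point-at s (s ≟ⱽ 0ⱽ))
              (∼-sym (Q (i-of s)) (point-at r (r ≟ⱽ 0ⱽ)) (subst (λ i → Q i ∼ point-at r (r ≟ⱽ 0ⱽ)) eq (proj₂ (index r (r ≟ⱽ 0ⱽ)))))
              (proj₂ (index s (s ≟ⱽ 0ⱽ))))

          i-of-surjective : ∀ i → ∃ λ s → i-of s ≡ i
          i-of-surjective i = let j , eq = injective⇒surjective (i-of ∘ fromFin 3) (λ eq → fromFin-injective 3 (i-of-injective eq)) i in fromFin 3 j , eq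

        -- The conics of C are exactly its seven combinations.
        complete : ∀ {F} → C F → ∃ λ s → s ≢ 0ⱽ × Member s F
        complete {F} F∈ = let i , Qi∼P = Q-surjective (pointOf F) (inj₂ (F , F∈ , pointOf-on F∈)) (pointOf-axis F) ; s , eq = i-of-surjective i in
          s , by-cases s (s ≟ⱽ 0ⱽ) (∼-trans (point-at s (s ≟ⱽ 0ⱽ)) (Q i) (pointOf F)
            (∼-sym (Q i) (point-at s (s ≟ⱽ 0ⱽ)) (subst (λ i → Q i ∼ point-at s (s ≟ⱽ 0ⱽ)) eq (proj₂ (index s (s ≟ⱽ 0ⱽ))))) Qi∼P)
          where
          by-cases : ∀ s (d : Dec (s ≡ 0ⱽ)) → point-at s d ∼ pointOf F → s ≢ 0ⱽ × Member s F
          by-cases s (yes _) N∼P = contradiction N∼P (nucleus-not-on-conic (pointOf F) F∈ (pointOf-on F∈))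
          by-cases s (no s≢0) P∼P′ = let (F′ , m@(F′∈ , _)) = combined s s≢0 in s≢0 ,
            subst (Member s) (same-conic (pointOf F′) F′∈ F∈ (pointOf-on F′∈)
              (conic-resp F (pointOf F) (pointOf F′) (∼-sym (pointOf F′) (pointOf F) P∼P′) (pointOf-on F∈))) m

  -- Reduction of a closed set to the cubic normal form.

  module NormalForm where
    open import Data.List.Base using ([]; _∷_)
    open Field
    open PG hiding (Tr)
    open Geometry hiding (semilinear)
    open NormalBasis using (lin; lin-map; lin-⊞)
    open Conics
    open CubicArcs
    open FundamentalTheorem using (divide-by)
    open ClosedSets using (pull)

    quartic : (p₀ p₁ p₂ l : Carrier) → Carrier
    quartic p₀ p₁ p₂ l = p₀ * l + p₁ * (l * l) + p₂ * (l * l * (l * l))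

    -- Additive maps on a 3-dimensional 𝔽₂-subspace are given by linearized polynomials of degree 4 (Newton interpolation).
    opaque
      interpolate : ∀ t → IndependentF t → ∀ U → ∃ λ p₀ → ∃ λ p₁ → ∃ λ p₂ → ∀ s → lin s U ≡ quartic p₀ p₁ p₂ (lin s t)
      interpolate t@(x ∷ y ∷ z ∷ []) ind (u ∷ v ∷ w ∷ []) = p₀ , p₁ , p₂ , λ s → sym (trans
        (lin-map f f-+ f-0 s t) (cong (lin s) (vec≡ at-x at-y at-z)))
        where
        nonzero : ∀ s {k} → lin s t ≡ k → s ≢ 0ⱽ → k ≢ 0#
        nonzero s eq s≢0 k≡0 = s≢0 (ind s (trans eq k≡0))
        x≢0 : x ≢ 0#
        x≢0 = nonzero (true ∷ false ∷ false ∷ []) (solve 3 (λ x y z → con true :* x :+ (con false :* y :+ (con false :* z :+ con false)) := x) refl x y z) λ ()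
        y≢0 : y ≢ 0#
        y≢0 = nonzero (false ∷ true ∷ false ∷ []) (solve 3 (λ x y z → con false :* x :+ (con true :* y :+ (con false :* z :+ con false)) := y) refl x y z) λ ()
        y+x≢0 : y + x ≢ 0#
        y+x≢0 = nonzero (true ∷ true ∷ false ∷ []) (solve 3 (λ x y z → con true :* x :+ (con true :* y :+ (con false :* z :+ con false)) := y :+ x) refl x y z) λ ()
        z≢0 : z ≢ 0#
        z≢0 = nonzero (false ∷ false ∷ true ∷ []) (solve 3 (λ x y z → con false :* x :+ (con false :* y :+ (con true :* z :+ con false)) := z) refl x y z) λ ()
        z+x≢0 : z + x ≢ 0#
        z+x≢0 = nonzero (true ∷ false ∷ true ∷ []) (solve 3 (λ x y z → con true :* x :+ (con false :* y :+ (con true :* z :+ con false)) := z :+ x) refl x y z) λ ()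
        z+y≢0 : z + y ≢ 0#
        z+y≢0 = nonzero (false ∷ true ∷ true ∷ []) (solve 3 (λ x y z → con false :* x :+ (con true :* y :+ (con true :* z :+ con false)) := z :+ y) refl x y z) λ ()
        z+y+x≢0 : z + y + x ≢ 0#
        z+y+x≢0 = nonzero (true ∷ true ∷ true ∷ []) (solve 3 (λ x y z → con true :* x :+ (con true :* y :+ (con true :* z :+ con false)) := z :+ y :+ x) refl x y z) λ ()

        -- Additive Newton polynomials: `L` vanishes on the span of `x`, and `M` on the span of `x`
        -- and `y`.
        L M : Carrier → Carrier
        L l = l * (l + x)
        M l = L l * (L l + L y)

        Ly≢0 : L y ≢ 0#
        Ly≢0 = *-≢0 y≢0 y+x≢0

        Mz≢0 : M z ≢ 0#
        Mz≢0 = *-≢0 (*-≢0 z≢0 z+x≢0) λ eq → *-≢0 z+y≢0 z+y+x≢0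
          (trans (solve 3 (λ x y z → (z :+ y) :* (z :+ y :+ x) := z :* (z :+ x) :+ y :* (y :+ x)) refl x y z) eq)

        c₀ c₁ c₂ p₀ p₁ p₂ : Carrier
        c₀ = u * x ⁻¹
        c₁ = (v + c₀ * y) * L y ⁻¹
        c₂ = (w + c₀ * z + c₁ * L z) * M z ⁻¹
        p₀ = c₀ + c₁ * x + c₂ * L y * x
        p₁ = c₁ + c₂ * (x * x) + c₂ * L y
        p₂ = c₂

        f : Carrier → Carrier
        f = quartic p₀ p₁ p₂

        f-+ : ∀ l k → f (l + k) ≡ f l + f k
        f-+ l k = solve 5 (λ p q r l k → p :* (l :+ k) :+ q :* ((l :+ k) :* (l :+ k)) :+ r :* ((l :+ k) :* (l :+ k) :* ((l :+ k) :* (l :+ k))) :=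
          p :* l :+ q :* (l :* l) :+ r :* (l :* l :* (l :* l)) :+ (p :* k :+ q :* (k :* k) :+ r :* (k :* k :* (k :* k)))) refl p₀ p₁ p₂ l k

        f-0 : f 0# ≡ 0#
        f-0 = solve 3 (λ p q r → p :* con false :+ q :* (con false :* con false) :+ r :* (con false :* con false :* (con false :* con false)) := con false) refl p₀ p₁ p₂

        newton : ∀ l → f l ≡ c₀ * l + c₁ * L l + c₂ * M l
        newton l = solve 6 (λ a b c x m l → let L = l :* (l :+ x) in
          (a :+ b :* x :+ c :* m :* x) :* l :+ (b :+ c :* (x :* x) :+ c :* m) :* (l :* l) :+ c :* (l :* l :* (l :* l)) :=
          a :* l :+ b :* L :+ c :* (L :* (L :+ m))) refl c₀ c₁ c₂ x (L y) l

        at-x : f x ≡ u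
        at-x = trans (newton x) (trans (solve 5 (λ a b c x m → let L = x :* (x :+ x) in a :* x :+ b :* L :+ c :* (L :* (L :+ m)) := a :* x) refl c₀ c₁ c₂ x (L y))
          (sym (divide-by u x≢0)))
        at-y : f y ≡ v
        at-y = trans (newton y) (trans (solve 5 (λ a b c y m → a :* y :+ b :* m :+ c :* (m :* (m :+ m)) := a :* y :+ b :* m) refl c₀ c₁ c₂ y (L y))
          (trans (cong (c₀ * y +_) (sym (divide-by (v + c₀ * y) Ly≢0))) (solve 2 (λ p v → p :+ (v :+ p) := v) refl (c₀ * y) v)))
        at-z : f z ≡ w
        at-z = trans (newton z) (trans (cong (c₀ * z + c₁ * L z +_) (sym (divide-by (w + c₀ * z + c₁ * L z) Mz≢0)))
          (solve 3 (λ p q w → p :+ q :+ (w :+ p :+ q) := w) refl (c₀ * z) (c₁ * L z) w))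

    -- The quotient of `quartic` by `l`. It expresses `α` and `β` themselves in terms of the
    -- parameter.
    cubic : (p₀ p₁ p₂ l : Carrier) → Carrier
    cubic p₀ p₁ p₂ l = p₀ + p₁ * l + p₂ * (l * l * l)

    cubic-quartic : ∀ {p₀ p₁ p₂ l α} → l ≢ 0# → α * l ≡ quartic p₀ p₁ p₂ l → α ≡ cubic p₀ p₁ p₂ l
    cubic-quartic {p₀} {p₁} {p₂} {l} {α} l≢0 eq = *-cancelˡ-≢0 l≢0 (trans (*-comm l α) (trans eq
      (solve 4 (λ p q r l → p :* l :+ q :* (l :* l) :+ r :* (l :* l :* (l :* l)) := l :* (p :+ q :* l :+ r :* (l :* l :* l))) refl p₀ p₁ p₂ l)))

    module _ (t : Basis) (ind : IndependentF t) (p₀ p₁ p₂ r₀ r₁ r₂ : Carrier)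
             (tr≡1 : ∀ s → s ≢ 0ⱽ → tr (cubic p₀ p₁ p₂ (lin s t) * cubic r₀ r₁ r₂ (lin s t)) ≡ 1#) where
      private
        f : Carrier → Carrier
        f l = cubic p₀ p₁ p₂ l * cubic r₀ r₁ r₂ l

        q₁ q₂ q₃ q₄ q₆ : Carrier
        q₁ = p₀ * r₁ + p₁ * r₀
        q₂ = p₁ * r₁
        q₃ = p₀ * r₂ + p₂ * r₀
        q₄ = p₁ * r₂ + p₂ * r₁
        q₆ = p₂ * r₂

        expanded : Carrier → Carrier
        expanded l = p₀ * r₀ + q₁ * l + q₂ * (l * l) + q₃ * (l * l * l) + q₄ * (l * l * (l * l)) + q₆ * (l * l * l * (l * l * l))

        expand : ∀ l → f l ≡ expanded l
        expand l = solve 7 (λ p₀ p₁ p₂ r₀ r₁ r₂ l → (p₀ :+ p₁ :* l :+ p₂ :* (l :* l :* l)) :* (r₀ :+ r₁ :* l :+ r₂ :* (l :* l :* l)) :=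
          p₀ :* r₀ :+ (p₀ :* r₁ :+ p₁ :* r₀) :* l :+ (p₁ :* r₁) :* (l :* l) :+ (p₀ :* r₂ :+ p₂ :* r₀) :* (l :* l :* l) :+
          (p₁ :* r₂ :+ p₂ :* r₁) :* (l :* l :* (l :* l)) :+ (p₂ :* r₂) :* (l :* l :* l :* (l :* l :* l))) refl p₀ p₁ p₂ r₀ r₁ r₂ l

        tr-at : ∀ s {l} → s ≢ 0ⱽ → lin s t ≡ l → tr (expanded l) ≡ 1#
        tr-at s s≢0 refl = trans (cong tr (sym (expand (lin s t)))) (tr≡1 s s≢0)

      -- A quadratic form on 𝔽₂³ sums to zero, so the values at the seven nonzero vectors sum to the value at zero.
      tr-constant : tr (p₀ * r₀) ≡ 1#
      tr-constant = sum t refl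
        where
        sum : ∀ t′ → t′ ≡ t → tr (p₀ * r₀) ≡ 1#
        sum (x ∷ y ∷ z ∷ []) refl = begin
          tr (p₀ * r₀)
            ≡⟨ cong tr (solve 9 (λ c q₁ q₂ q₃ q₄ q₆ x y z →
                 let E l = c :+ q₁ :* l :+ q₂ :* (l :* l) :+ q₃ :* (l :* l :* l) :+ q₄ :* (l :* l :* (l :* l)) :+ q₆ :* (l :* l :* l :* (l :* l :* l)) in
                 c := E x :+ (E y :+ (E z :+ (E (x :+ y) :+ (E (x :+ z) :+ (E (y :+ z) :+ E (x :+ y :+ z)))))))
                 refl (p₀ * r₀) q₁ q₂ q₃ q₄ q₆ x y z) ⟩
          tr (expanded x + (expanded y + (expanded z + (expanded (x + y) + (expanded (x + z) + (expanded (y + z) + expanded (x + y + z)))))))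
            ≡⟨ one-more (true ∷ false ∷ false ∷ []) (solve 3 (λ x y z → con true :* x :+ (con false :* y :+ (con false :* z :+ con false)) := x) refl x y z) (λ ())
               (one-more (false ∷ true ∷ false ∷ []) (solve 3 (λ x y z → con false :* x :+ (con true :* y :+ (con false :* z :+ con false)) := y) refl x y z) (λ ())
               (one-more (false ∷ false ∷ true ∷ []) (solve 3 (λ x y z → con false :* x :+ (con false :* y :+ (con true :* z :+ con false)) := z) refl x y z) (λ ())
               (one-more (true ∷ true ∷ false ∷ []) (solve 3 (λ x y z → con true :* x :+ (con true :* y :+ (con false :* z :+ con false)) := x :+ y) refl x y z) (λ ())
               (one-more (true ∷ false ∷ true ∷ []) (solve 3 (λ x y z → con true :* x :+ (con false :* y :+ (con true :* z :+ con false)) := x :+ z) refl x y z) (λ ())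
               (one-more (false ∷ true ∷ true ∷ []) (solve 3 (λ x y z → con false :* x :+ (con true :* y :+ (con true :* z :+ con false)) := y :+ z) refl x y z) (λ ())
               (tr-at (true ∷ true ∷ true ∷ []) (λ ()) (solve 3 (λ x y z → con true :* x :+ (con true :* y :+ (con true :* z :+ con false)) := x :+ y :+ z) refl x y z))))))) ⟩
          1# + (1# + (1# + (1# + (1# + (1# + 1#)))))
            ≡⟨ solve 0 (let I = con true in I :+ (I :+ (I :+ (I :+ (I :+ (I :+ I))))) := I) refl ⟩
          1# ∎
          where
          one-more : ∀ s {l u v} → lin s t ≡ l → s ≢ 0ⱽ → tr u ≡ v → tr (expanded l + u) ≡ 1# + v
          one-more s eq s≢0 p = trans (tr-+ _ _) (cong₂ _+_ (tr-at s s≢0 eq) p)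

      private
        -- The part of the trace condition that is not additive comes from the terms of degree 3 and
        -- 6 and is the trace of `q₃ W + q₆ W²` with `W = l²k + lk²`. Since `q₆ = (PR)²` and the
        -- trace is invariant under squaring, this is the trace of `D W`.
        P R D : Carrier
        P = √ p₂
        R = √ r₂
        D = p₀ * R ² + R * P + r₀ * P ²

      -- The cubic part of the trace condition is additive on the subspace.
      tr-isotropic : ∀ r s → tr (D * (lin r t ² * lin s t + lin r t * lin s t ²)) ≡ 0#
      tr-isotropic r s = by-cases (r ≟ⱽ 0ⱽ) (s ≟ⱽ 0ⱽ) (r ⊞ s ≟ⱽ 0ⱽ)
        where
        l k W : Carrier
        l = lin r t
        k = lin s t
        W = l ² * k + l * k ²

        lin-0 : ∀ (t : Basis) → lin 0ⱽ t ≡ 0#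
        lin-0 (a ∷ b ∷ c ∷ []) = solve 3 (λ a b c → con false :* a :+ (con false :* b :+ (con false :* c :+ con false)) := con false) refl a b c

        vanish : W ≡ 0# → tr (D * W) ≡ 0#
        vanish eq = trans (cong tr (trans (cong (D *_) eq) (zeroʳ D))) tr-0

        at-0 : ∀ {s} → s ≡ 0ⱽ → lin s t ≡ 0#
        at-0 refl = lin-0 t

        by-cases : Dec (r ≡ 0ⱽ) → Dec (s ≡ 0ⱽ) → Dec (r ⊞ s ≡ 0ⱽ) → tr (D * W) ≡ 0#
        by-cases (yes r≡0) _ _ = vanish (trans (cong (λ l → l ² * k + l * k ²) (at-0 r≡0)) (solve 1 (λ k → (con false :* con false) :* k :+ con false :* (k :* k) := con false) refl k))
        by-cases _ (yes s≡0) _ = vanish (trans (cong (λ k → l ² * k + l * k ²) (at-0 s≡0)) (solve 1 (λ l → (l :* l) :* con false :+ l :* (con false :* con false) := con false) refl l))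
        by-cases _ _ (yes r⊞s≡0) = vanish (trans (cong (λ k → l ² * k + l * k ²) (sym (x+y≡0⇒x≡y (trans (sym (lin-⊞ r s t)) (at-0 r⊞s≡0)))))
          (solve 1 (λ l → (l :* l) :* l :+ l :* (l :* l) := con false) refl l))
        by-cases (no r≢0) (no s≢0) (no r⊞s≢0) = x+y≡0⇒x≡y (trans (+-identityʳ _) (begin
          tr (D * W)
            ≡⟨ cong tr (solve 5 (λ p R P r W → (p :* (R :* R) :+ R :* P :+ r :* (P :* P)) :* W := (p :* (R :* R) :+ (P :* P) :* r) :* W :+ P :* R :* W) refl p₀ R P r₀ W) ⟩
          tr ((p₀ * R ² + P ² * r₀) * W + P * R * W)
            ≡⟨ trans (tr-+ _ _) (cong (tr ((p₀ * R ² + P ² * r₀) * W) +_) (sym (tr-² (P * R * W)))) ⟩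
          tr ((p₀ * R ² + P ² * r₀) * W) + tr ((P * R * W) ²)
            ≡⟨ trans (sym (tr-+ _ _)) (cong tr (cong₂ _+_ (cong₂ (λ p r → (p₀ * r + p * r₀) * W) (√-² p₂) (√-² r₂))
                 (trans (solve 3 (λ P R W → (P :* R :* W) :* (P :* R :* W) := (P :* P) :* (R :* R) :* (W :* W)) refl P R W) (cong₂ (λ p r → p * r * W ²) (√-² p₂) (√-² r₂))))) ⟩
          tr (q₃ * W + q₆ * W ²)
            ≡⟨ cong tr (solve 8 (λ c q₁ q₂ q₃ q₄ q₆ x y →
                 let E l = c :+ q₁ :* l :+ q₂ :* (l :* l) :+ q₃ :* (l :* l :* l) :+ q₄ :* (l :* l :* (l :* l)) :+ q₆ :* (l :* l :* l :* (l :* l :* l)) 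
                     W = (x :* x) :* y :+ x :* (y :* y) in
                 q₃ :* W :+ q₆ :* (W :* W) := c :+ (E x :+ (E y :+ E (x :+ y)))) refl (p₀ * r₀) q₁ q₂ q₃ q₄ q₆ l k) ⟩
          tr (p₀ * r₀ + (expanded l + (expanded k + expanded (l + k))))
            ≡⟨ trans (tr-+ _ _) (cong₂ _+_ tr-constant (trans (tr-+ _ _) (cong₂ _+_ (tr-at r r≢0 refl) (trans (tr-+ _ _) (cong₂ _+_ (tr-at s s≢0 refl) (tr-at (r ⊞ s) r⊞s≢0 (lin-⊞ r s t))))))) ⟩
          1# + (1# + (1# + 1#)) ≡⟨ solve 0 (con true :+ (con true :+ (con true :+ con true)) := con false) refl ⟩
          0# ∎))

      conicAt : Carrier → Conic
      conicAt l = conic (cubic p₀ p₁ p₂ l) (cubic r₀ r₁ r₂ l) l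

      conic≡ : ∀ {α β μ α′ β′ μ′ : Carrier} → α ≡ α′ → β ≡ β′ → μ ≡ μ′ → conic α β μ ≡ conic α′ β′ μ′
      conic≡ refl refl refl = refl

      r₀≢0 : r₀ ≢ 0#
      r₀≢0 r₀≡0 = 1≢0 (trans (sym tr-constant) (trans (cong tr (trans (cong (p₀ *_) r₀≡0) (zeroʳ p₀))) tr-0))

      -- If both cubic coefficients vanish, the linear terms are absorbed by a change of the coordinate z.
      denniston-form : p₂ ≡ 0# → r₂ ≡ 0# → ∃ λ T → ∀ l → pull T (conicAt l) ≡ conic (p₀ * r₀) 1# l
      denniston-form p₂≡0 r₂≡0 = T , λ l → conic≡ (first l) (second l) (solve 1 (λ l → l :* (con true :* con true) := l) refl l)
        where
        g h : Carrier
        g = √ r₀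
        h = g ⁻¹
        g≢0 : g ≢ 0#
        g≢0 = √-≢0 r₀≢0
        gh≡1 : g * h ≡ 1#
        gh≡1 = *-inverseʳ g g≢0
        T : Transformation
        T = record { s = g ; t = 0# ; u = 0# ; v = h ; m = g * √ p₁ ; n = h * √ r₁ ; e = 1#
          ; det = trans (solve 2 (λ g h → g :* h :+ con false :* con false := g :* h) refl g h) gh≡1 ; e≢0 = 1≢0 }
        first : ∀ l → cubic p₀ p₁ p₂ l * g ² + g * 0# + cubic r₀ r₁ r₂ l * 0# ² + l * (g * √ p₁) ² ≡ p₀ * r₀
        first l = begin
          cubic p₀ p₁ p₂ l * g ² + g * 0# + cubic r₀ r₁ r₂ l * 0# ² + l * (g * √ p₁) ²
            ≡⟨ solve 6 (λ a b q g p l → a :* (g :* g) :+ g :* con false :+ b :* (con false :* con false) :+ l :* ((g :* q) :* (g :* q)) := (a :+ l :* (q :* q)) :* (g :* g))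
                 refl (cubic p₀ p₁ p₂ l) (cubic r₀ r₁ r₂ l) (√ p₁) g p₁ l ⟩
          (p₀ + p₁ * l + p₂ * (l * l * l) + l * √ p₁ ²) * g ²
            ≡⟨ cong₂ (λ x y → (p₀ + p₁ * l + x * (l * l * l) + l * y) * g ²) p₂≡0 (√-² p₁) ⟩
          (p₀ + p₁ * l + 0# * (l * l * l) + l * p₁) * g ²
            ≡⟨ solve 4 (λ p q l G → (p :+ q :* l :+ con false :* (l :* l :* l) :+ l :* q) :* G := p :* G) refl p₀ p₁ l (g ²) ⟩
          p₀ * g ²
            ≡⟨ cong (p₀ *_) (√-² r₀) ⟩
          p₀ * r₀ ∎
        second : ∀ l → cubic p₀ p₁ p₂ l * 0# ² + 0# * h + cubic r₀ r₁ r₂ l * h ² + l * (h * √ r₁) ² ≡ 1#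
        second l = begin
          cubic p₀ p₁ p₂ l * 0# ² + 0# * h + cubic r₀ r₁ r₂ l * h ² + l * (h * √ r₁) ²
            ≡⟨ solve 5 (λ a b q h l → a :* (con false :* con false) :+ con false :* h :+ b :* (h :* h) :+ l :* ((h :* q) :* (h :* q)) := (b :+ l :* (q :* q)) :* (h :* h))
                 refl (cubic p₀ p₁ p₂ l) (cubic r₀ r₁ r₂ l) (√ r₁) h l ⟩
          (r₀ + r₁ * l + r₂ * (l * l * l) + l * √ r₁ ²) * h ²
            ≡⟨ cong₂ (λ x y → (r₀ + r₁ * l + x * (l * l * l) + l * y) * h ²) r₂≡0 (√-² r₁) ⟩
          (r₀ + r₁ * l + 0# * (l * l * l) + l * r₁) * h ²
            ≡⟨ solve 4 (λ p q l H → (p :+ q :* l :+ con false :* (l :* l :* l) :+ l :* q) :* H := p :* H) refl r₀ r₁ l (h ²) ⟩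
          r₀ * h ²
            ≡⟨ cong (_* h ²) (sym (√-² r₀)) ⟩
          g ² * h ²
            ≡⟨ trans (sym (²-* g h)) (trans (cong _² gh≡1) (*-identityˡ 1#)) ⟩
          1# ∎

      -- Otherwise the form x², …, is brought to y² by sending (√r₂ , √p₂) to a coordinate vector.
      module Cubic (nondegenerate : p₂ ≢ 0# ⊎ r₂ ≢ 0#) where
        private
          PR≢0 : P ≢ 0# ⊎ R ≢ 0#
          PR≢0 = [ (λ h → inj₁ (√-≢0 h)) , (λ h → inj₂ (√-≢0 h)) ]′ nondegenerate

          q₀ : Carrier → Carrier → Carrier
          q₀ x y = binary p₀ r₀ x y

          D≡q₀ : D ≡ q₀ R P
          D≡q₀ = refl

          -- The binary form `q₀` is anisotropic because `p₀ * r₀` has trace 1, and `D` is its value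
          -- at the nonzero vector `(R , P)`.
          D≢0 : D ≢ 0#
          D≢0 D≡0 = 1≢0 (trans (sym tr-constant) (binary-root {p₀} {r₀} {R} {P} D≡0 (swap PR≢0)))
            where
            swap : P ≢ 0# ⊎ R ≢ 0# → R ≢ 0# ⊎ P ≢ 0#
            swap (inj₁ h) = inj₂ h
            swap (inj₂ h) = inj₁ h

          -- The map scales parameters by `e²`, so `l³` is scaled by `e⁶`; a sixth root of `D` turns
          -- the coefficient `D` of the cube into 1.
          e d τ : Carrier
          e = proj₁ (sixth-root D)
          d = e * e * e
          τ = d ⁻¹

          d²≡D : d ² ≡ D
          d²≡D = proj₂ (sixth-root D)

          d≢0 : d ≢ 0#
          d≢0 d≡0 = D≢0 (trans (sym d²≡D) (trans (cong _² d≡0) (zeroˡ 0#)))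

          e≢0 : e ≢ 0#
          e≢0 e≡0 = d≢0 (trans (cong (λ e → e * e * e) e≡0) (zeroʳ _))

          τd≡1 : τ * d ≡ 1#
          τd≡1 = *-inverseˡ d d≢0

          start : P ≢ 0# ⊎ R ≢ 0# → ∃₂ λ s u → s * P + u * R ≡ d
          start (inj₁ P≢0) = d * P ⁻¹ , 0# , trans (solve 2 (λ p R → p :+ con false :* R := p) refl (d * P ⁻¹ * P) R) (sym (divide-by d P≢0))
          start (inj₂ R≢0) = 0# , d * R ⁻¹ , trans (solve 2 (λ p P → con false :* P :+ p := p) refl (d * R ⁻¹ * R) P) (sym (divide-by d R≢0))

          -- The second column is `(R , P)` divided by `d`, which gives it the `q₀`-value 1; the
          -- first column completes it to determinant 1.
          s₀ u₀ t₁ v₁ : Carrier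
          s₀ = proj₁ (start PR≢0)
          u₀ = proj₁ (proj₂ (start PR≢0))
          t₁ = τ * R
          v₁ = τ * P

          s₀P+u₀R : s₀ * P + u₀ * R ≡ d
          s₀P+u₀R = proj₂ (proj₂ (start PR≢0))

          det₀ : s₀ * v₁ + t₁ * u₀ ≡ 1#
          det₀ = trans (solve 5 (λ s u τ P R → s :* (τ :* P) :+ (τ :* R) :* u := τ :* (s :* P :+ u :* R)) refl s₀ u₀ τ P R) (trans (cong (τ *_) s₀P+u₀R) τd≡1)

          q₀-tv : q₀ t₁ v₁ ≡ 1#
          q₀-tv = trans (solve 5 (λ p r τ P R → p :* ((τ :* R) :* (τ :* R)) :+ (τ :* R) :* (τ :* P) :+ r :* ((τ :* P) :* (τ :* P)) := (τ :* τ) :* (p :* (R :* R) :+ R :* P :+ r :* (P :* P)))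
            refl p₀ r₀ τ P R) (trans (cong (τ ² *_) (sym d²≡D)) (trans (sym (²-* τ d)) (trans (cong _² τd≡1) (*-identityˡ 1#))))

          -- The Arf invariant: q₀(X) q₀(Y) is congruent to p₀ r₀ modulo elements w² + w.
          tr-q₀ : tr (q₀ s₀ u₀) ≡ 1#
          tr-q₀ = begin
            tr (q₀ s₀ u₀)
              ≡⟨ cong tr (trans (sym (*-identityʳ _)) (cong (q₀ s₀ u₀ *_) (sym q₀-tv))) ⟩
            tr (q₀ s₀ u₀ * q₀ t₁ v₁)
              ≡⟨ cong tr (solve 6 (λ p r s u t v →
                   (p :* (s :* s) :+ s :* u :+ r :* (u :* u)) :* (p :* (t :* t) :+ t :* v :+ r :* (v :* v)) :=
                   let D = s :* v :+ t :* u ; w = p :* s :* t :+ u :* t :+ r :* u :* v in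
                   p :* r :* (D :* D) :+ (w :* w :+ w :* D)) refl p₀ r₀ s₀ u₀ t₁ v₁) ⟩
            tr (let Δ = s₀ * v₁ + t₁ * u₀ in p₀ * r₀ * Δ ² + (w ² + w * Δ))
              ≡⟨ cong (λ Δ → tr (p₀ * r₀ * Δ ² + (w ² + w * Δ))) det₀ ⟩
            tr (p₀ * r₀ * 1# ² + (w ² + w * 1#))
              ≡⟨ cong tr (solve 2 (λ p w → p :* (con true :* con true) :+ (w :* w :+ w :* con true) := p :+ (w :* w :+ w)) refl (p₀ * r₀) w) ⟩
            tr (p₀ * r₀ + (w ² + w))
              ≡⟨ trans (tr-+ _ _) (cong₂ _+_ tr-constant (trans (tr-+ _ _) (trans (cong (_+ tr w) (tr-² w)) (x+x≡0 _)))) ⟩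
            1# + 0#
              ≡⟨ +-identityʳ 1# ⟩
            1# ∎
            where
            w : Carrier
            w = p₀ * s₀ * t₁ + u₀ * t₁ + r₀ * u₀ * v₁

          -- Adding `w` times the second column to the first keeps the determinant and changes the
          -- `q₀`-value by `w² + w`. The Artin-Schreier equation is solvable because `tr-q₀` gives
          -- the first value trace 1, and it makes the new value 1.
          w s₁ u₁ : Carrier
          w = proj₁ (artin-schreier (q₀ s₀ u₀ + 1#))
          s₁ = s₀ + w * t₁
          u₁ = u₀ + w * v₁

          w²+w : w ² + w ≡ q₀ s₀ u₀ + 1#
          w²+w = trans (proj₂ (artin-schreier (q₀ s₀ u₀ + 1#)))
            (trans (cong (q₀ s₀ u₀ + 1# +_) (trans (tr-+ _ _) (trans (cong₂ _+_ tr-q₀ tr-1) 1+1≡0))) (+-identityʳ _))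

          det₁ : s₁ * v₁ + t₁ * u₁ ≡ 1#
          det₁ = trans (solve 5 (λ s u t v w → (s :+ w :* t) :* v :+ t :* (u :+ w :* v) := s :* v :+ t :* u) refl s₀ u₀ t₁ v₁ w) det₀

          q₀-su : q₀ s₁ u₁ ≡ 1#
          q₀-su = begin
            q₀ s₁ u₁
              ≡⟨ solve 7 (λ p r s u t v w → let X = s :+ w :* t ; Y = u :+ w :* v in
                   p :* (X :* X) :+ X :* Y :+ r :* (Y :* Y) :=
                   (p :* (s :* s) :+ s :* u :+ r :* (u :* u)) :+ w :* (s :* v :+ t :* u) :+ w :* w :* (p :* (t :* t) :+ t :* v :+ r :* (v :* v)))
                   refl p₀ r₀ s₀ u₀ t₁ v₁ w ⟩
            q₀ s₀ u₀ + w * (s₀ * v₁ + t₁ * u₀) + w * w * q₀ t₁ v₁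
              ≡⟨ cong₂ (λ x y → q₀ s₀ u₀ + w * x + w * w * y) det₀ q₀-tv ⟩
            q₀ s₀ u₀ + w * 1# + w * w * 1#
              ≡⟨ solve 2 (λ q w → q :+ w :* con true :+ w :* w :* con true := q :+ (w :* w :+ w)) refl (q₀ s₀ u₀) w ⟩
            q₀ s₀ u₀ + (w ² + w)
              ≡⟨ cong (q₀ s₀ u₀ +_) w²+w ⟩
            q₀ s₀ u₀ + (q₀ s₀ u₀ + 1#)
              ≡⟨ solve 1 (λ q → q :+ (q :+ con true) := con true) refl (q₀ s₀ u₀) ⟩
            1# ∎

          s₁P+u₁R : s₁ * P + u₁ * R ≡ d
          s₁P+u₁R = trans (solve 6 (λ s u τ w P R → (s :+ w :* (τ :* R)) :* P :+ (u :+ w :* (τ :* P)) :* R := s :* P :+ u :* R) refl s₀ u₀ τ w P R) s₀P+u₀R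

          -- The coefficient of x² or y² after a substitution, with the z-coordinate absorbing the linear term.
          coefficient : ∀ x y l → cubic p₀ p₁ p₂ l * x ² + x * y + cubic r₀ r₁ r₂ l * y ² + l * √ (p₁ * x ² + r₁ * y ²) ² ≡
                        q₀ x y + (x * P + y * R) ² * (l * l * l)
          coefficient x y l = trans (cong₂ (λ c w → (p₀ + p₁ * l + c * (l * l * l)) * x ² + x * y + cubic r₀ r₁ r₂ l * y ² + l * w) (sym (√-² p₂)) (√-² _))
            (trans (cong (λ c → (p₀ + p₁ * l + P ² * (l * l * l)) * x ² + x * y + (r₀ + r₁ * l + c * (l * l * l)) * y ² + l * (p₁ * x ² + r₁ * y ²)) (sym (√-² r₂)))
            (solve 9 (λ p₀ p₁ P r₀ r₁ R x y l →
              (p₀ :+ p₁ :* l :+ P :* P :* (l :* l :* l)) :* (x :* x) :+ x :* y :+ (r₀ :+ r₁ :* l :+ R :* R :* (l :* l :* l)) :* (y :* y) :+ l :* (p₁ :* (x :* x) :+ r₁ :* (y :* y)) :=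
              p₀ :* (x :* x) :+ x :* y :+ r₀ :* (y :* y) :+ (x :* P :+ y :* R) :* (x :* P :+ y :* R) :* (l :* l :* l)) refl p₀ p₁ P r₀ r₁ R x y l))

        T : Transformation
        T = record { s = s₁ ; t = t₁ ; u = u₁ ; v = v₁ ; m = √ (p₁ * s₁ ² + r₁ * u₁ ²) ; n = √ (p₁ * t₁ ² + r₁ * v₁ ²) ; e = e ; det = det₁ ; e≢0 = e≢0 }

        scaled : Basis
        scaled = Vec.map (_* e ²) t

        lin-scaled : ∀ s → lin s scaled ≡ lin s t * e ²
        lin-scaled s = sym (lin-map (_* e ²) (λ x y → distribʳ (e ²) x y) (zeroˡ _) s t)

        pull-T : ∀ s → pull T (conicAt (lin s t)) ≡ conic (α₃ (lin s scaled)) 1# (lin s scaled)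
        pull-T s = conic≡
          (trans (coefficient s₁ u₁ l) (trans (cong₂ (λ x y → x + y ² * (l * l * l)) q₀-su s₁P+u₁R)
            (trans (solve 2 (λ e l → con true :+ e :* e :* e :* (e :* e :* e) :* (l :* l :* l) := con true :+ l :* (e :* e) :* (l :* (e :* e)) :* (l :* (e :* e))) refl e l)
              (cong α₃ (sym (lin-scaled s))))))
          -- For the second column the two products in `t₁ * P + v₁ * R` cancel, so no cubic term is
          -- left in `β`.
          (trans (coefficient t₁ v₁ l) (trans (cong (_+ (t₁ * P + v₁ * R) ² * (l * l * l)) q₀-tv)
            (solve 4 (λ τ P R l → con true :+ (τ :* R :* P :+ τ :* P :* R) :* (τ :* R :* P :+ τ :* P :* R) :* (l :* l :* l) := con true) refl τ P R l)))
          (sym (lin-scaled s))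
          where
          l = lin s t

        scaled-independent : IndependentF scaled
        scaled-independent s eq = ind s (zero-product (trans (*-comm _ _) (trans (sym (lin-scaled s)) eq)) (*-≢0 e≢0 e≢0))

        -- Scaling both arguments by `e²` multiplies `l²k + lk²` by `e⁶ = D`, which is the factor
        -- present in `tr-isotropic`.
        scaled-isotropic : IsotropicF scaled
        scaled-isotropic r s = trans (cong tr (trans
          (cong₂ (λ l k → l ² * k + l * k ²) (lin-scaled r) (lin-scaled s))
          (trans (solve 3 (λ l k e → let E = e :* e in (l :* E) :* (l :* E) :* (k :* E) :+ l :* E :* ((k :* E) :* (k :* E)) :=
              e :* e :* e :* (e :* e :* e) :* ((l :* l) :* k :+ l :* (k :* k))) refl (lin r t) (lin s t) e)
            (cong (_* (lin r t ² * lin s t + lin r t * lin s t ²)) d²≡D)))) (tr-isotropic r s)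

  -- Translation between subspaces of the field and bit vectors.

  module Coordinates where
    open Field
    open NormalBasis
    open CubicArcs

    basisOf : Triple → Basis
    basisOf = Vec.map elem

    elem-0 : elem 0ⱽ ≡ 0#
    elem-0 = trans (cong elem (sym (⊞-self 0ⱽ))) (trans (elem-⊞ 0ⱽ 0ⱽ) (x+x≡0 _))

    lin-elem : ∀ {k} (s : Vec Bool k) (t : Vec (Vec Bool 7) k) → lin s (Vec.map elem t) ≡ elem (combine s t)
    lin-elem []          []      = sym elem-0
    lin-elem (true ∷ s)  (v ∷ t) = trans (cong₂ _+_ (*-identityˡ _) (lin-elem s t)) (sym (elem-⊞ v (combine s t)))
    lin-elem (false ∷ s) (v ∷ t) = trans (cong₂ _+_ (zeroˡ _) (lin-elem s t)) (+-identityˡ _)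

    basisOf-surjective : ∀ t → ∃ λ T → basisOf T ≡ t
    basisOf-surjective (x ∷ y ∷ z ∷ []) =
      let u , p = elem-surjective x ; v , q = elem-surjective y ; w , o = elem-surjective z
      in u ∷ v ∷ w ∷ [] , cong₂ _∷_ p (cong₂ _∷_ q (cong₂ _∷_ o refl))

    lin-rot : ∀ k s (t : Triple) → lin s (basisOf (rotᵗ k t)) ≡ φ^ k (lin s (basisOf t))
    lin-rot k s t = trans (cong (lin s) (trans (sym (Vec.map-∘ elem (rot^ k) t)) (trans (Vec.map-cong (elem-rot^ k) t) (Vec.map-∘ (φ^ k) elem t))))
      (sym (lin-map (φ^ k) (φ^-+ k) (φ^-0 k) s (basisOf t)))

    combine-≡ : ∀ {r s} {t u : Triple} → lin r (basisOf t) ≡ lin s (basisOf u) → combine r t ≡ combine s u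
    combine-≡ {r} {s} {t} {u} eq = elem-injective (trans (sym (lin-elem r t)) (trans eq (lin-elem s u)))

    ⊑⇒lin : ∀ {t u : Triple} → t ⊑ u → ∀ s → ∃ λ r → lin r (basisOf u) ≡ lin s (basisOf t)
    ⊑⇒lin {t} {u} t⊑u s = let r , eq = t⊑u s in r , trans (lin-elem r u) (trans (cong elem eq) (sym (lin-elem s t)))

    lin⇒⊑ : ∀ {t u : Triple} → (∀ s → ∃ λ r → lin r (basisOf u) ≡ lin s (basisOf t)) → t ⊑ u
    lin⇒⊑ {t} {u} h s = let r , eq = h s in r , combine-≡ {r} {s} {u} {t} eq

    independentF : ∀ {t} → Independent t → IndependentF (basisOf t)
    independentF {t} ind s eq = ind s (elem-injective (trans (sym (lin-elem s t)) (trans eq (sym elem-0))))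

    independent : ∀ {t} → IndependentF (basisOf t) → Independent t
    independent {t} ind s eq = ind s (trans (lin-elem s t) (trans (cong elem eq) elem-0))

    tr-symplectic : ∀ u v → tr (elem u ² * elem v + elem u * elem v ²) ≡ bit (symplectic u v)
    tr-symplectic u v = trans (tr-+ _ _) (trans (cong₂ _+_
      (trans (cong (λ x → tr (x * elem v)) (sym (elem-rot u))) (trace-form (rot u) v))
      (trans (cong (λ x → tr (elem u * x)) (sym (elem-rot v))) (trace-form u (rot v)))) (sym (bit-+ (dot (rot u) v) (dot u (rot v)))))

    isotropicF : ∀ {t : Triple} → Isotropic t → IsotropicF (basisOf t)
    isotropicF {t} iso r s = trans (cong₂ (λ l k → tr (l ² * k + l * k ²)) (lin-elem r t) (lin-elem s t))
      (trans (tr-symplectic (combine r t) (combine s t)) (cong bit (iso r s)))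

    isotropic : ∀ {t : Triple} → IsotropicF (basisOf t) → Isotropic t
    isotropic {t} iso r s = bit-injective {symplectic (combine r t) (combine s t)} {false}
      (trans (sym (tr-symplectic (combine r t) (combine s t)))
        (trans (cong₂ (λ l k → tr (l ² * k + l * k ²)) (sym (lin-elem r t)) (sym (lin-elem s t))) (iso r s)))

  -- Cubic arcs are of Mathon type and not of Denniston type.

  module MathonArcs where
    open import Data.List.Base using ([]; _∷_)
    open import Data.List.Relation.Unary.AllPairs using ([]; _∷_)
    open import Data.List.Relation.Unary.All using ([]; _∷_)
    open Field
    open PG hiding (Tr)
    open Geometry hiding (semilinear)
    open NormalBasis using (lin; lin-⊞)
    open Conics
    open CubicArcs
    open ConicImages
    open CubicIsomorphisms
    open FundamentalTheorem using (divide-by; fundamental-theorem)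
    open ClosedSets
    open NormalForm
    open Conic

    divide-≡ : ∀ {x y z} → y ≢ 0# → x ≡ z * y → x * y ⁻¹ ≡ z
    divide-≡ {x} {y} {z} y≢0 eq = *-cancelˡ-≢0 y≢0 (trans (*-comm y _) (trans (sym (divide-by x y≢0)) (trans eq (*-comm z y))))

    conic-cong : ∀ {α β μ α′ β′ μ′ : Carrier} → α ≡ α′ → β ≡ β′ → μ ≡ μ′ → conic α β μ ≡ conic α′ β′ μ′
    conic-cong refl refl refl = refl

    -- The element `π` represents, through the trace, the function `tr (l³)` on the subspace.
    -- Replacing `z` by `z + √ π * x` adds `l * π` to `α₃ l`, so that all traces become 1 and the
    -- set of conics is closed.
    module _ (t : Basis) (ind : IndependentF t) (π : Carrier) (π-linear : ∀ s → tr (π * lin s t) ≡ tr (lin s t * lin s t * lin s t)) where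
      private
        α₁ : Carrier → Carrier
        α₁ l = 1# + l * l * l + l * π

        mathonConics : Pred Conic 0ℓ
        mathonConics F = ∃ λ s → s ≢ 0ⱽ × F ≡ conic (α₁ (lin s t)) 1# (lin s t)

        mathon-closed : IsClosed mathonConics
        mathon-closed = record
          { admissible = λ { (s , s≢0 , refl) → trans (Tr≡tr _) (admissible s) , λ eq → s≢0 (ind s eq) }
          ; composable = λ { (r , _ , refl) (s , _ , refl) F≢F′ eq → F≢F′ (cong (λ l → conic (α₁ l) 1# l) eq) }
          ; closed = λ { (r , _ , refl) (s , _ , refl) F≢F′ → r ⊞ s , (λ eq → F≢F′ (cong (λ s → conic (α₁ (lin s t)) 1# (lin s t)) (⊞≡0⇒≡ eq))) ,
              closed (lin r t) (lin s t) (lin-⊞ r s t) λ eq → F≢F′ (cong (λ l → conic (α₁ l) 1# l) (x+y≡0⇒x≡y eq)) } }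
          where
          admissible : ∀ s → tr (α₁ (lin s t) * 1#) ≡ 1#
          admissible s = let l = lin s t in trans (cong tr (solve 2 (λ l p → (con true :+ l :* l :* l :+ l :* p) :* con true := con true :+ (l :* l :* l :+ p :* l)) refl l π))
            (trans (tr-+ _ _) (trans (cong₂ _+_ tr-1 (trans (tr-+ _ _) (trans (cong (tr (l * l * l) +_) (π-linear s)) (x+x≡0 _)))) (+-identityʳ 1#)))
          closed : ∀ l k {m} → m ≡ l + k → l + k ≢ 0# → conic (α₁ l) 1# l ⊕ conic (α₁ k) 1# k ≡ conic (α₁ m) 1# m
          closed l k refl ≢0 = conic-cong
            (divide-≡ ≢0 (solve 3 (λ l k p → (con true :+ l :* l :* l :+ l :* p) :* l :+ (con true :+ k :* k :* k :+ k :* p) :* k :=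
               (con true :+ (l :+ k) :* (l :+ k) :* (l :+ k) :+ (l :+ k) :* p) :* (l :+ k)) refl l k π))
            (divide-≡ ≢0 (solve 2 (λ l k → con true :* l :+ con true :* k := con true :* (l :+ k)) refl l k)) refl

        T : Transformation
        T = record { s = 1# ; t = 0# ; u = 0# ; v = 1# ; m = √ π ; n = 0# ; e = 1#
          ; det = solve 0 (con true :* con true :+ con false :* con false := con true) refl ; e≢0 = 1≢0 }

        pull-T : ∀ l → pull T (conic (α₃ l) 1# l) ≡ φ-conic 0 (conic (α₁ l) 1# l)
        pull-T l = conic-cong
          (trans (solve 3 (λ A l q → A :* (con true :* con true) :+ con true :* con false :+ con true :* (con false :* con false) :+ l :* (q :* q) := A :+ l :* (q :* q)) refl (α₃ l) l (√ π))
            (cong (λ w → α₃ l + l * w) (√-² π)))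
          (solve 2 (λ A l → A :* (con false :* con false) :+ con false :* con true :+ con true :* (con true :* con true) :+ l :* (con false :* con false) := con true) refl (α₃ l) l)
          (solve 1 (λ l → l :* (con true :* con true) := l) refl l)

      cubicArc-isMathonType : IsMathonType (cubicArc t)
      cubicArc-isMathonType = mathonConics , mathon-closed , collineation T , arc-image T {0} (s≤s z≤n) {cubicConics t} {mathonConics}
        (λ { (s , s≢0 , refl) → conic (α₁ (lin s t)) 1# (lin s t) , (s , s≢0 , refl) , pull-T (lin s t) })
        (λ { (s , s≢0 , refl) → conic (α₃ (lin s t)) 1# (lin s t) , (s , s≢0 , refl) , pull-T (lin s t) })

    -- The seven conics of an arc of degree 8 are found on the image of a line through the nucleus.
    module OfDegree8 (K : MaximalArc 8) {C : Pred Conic 0ℓ} (closed-C : IsClosed C) (φ : Collineation)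
                     (K≐ : MaximalArc.points K ≐ image (Collineation.to φ) (arcOf C)) where
      open Collineation φ
      open Closed closed-C using (axis)
      open MaximalArc K using (points; meets)

      private
        l′ : Line
        l′ = proj₁ (mapsLines axis)

        S : PointSet
        S = points ∩ pointsOn l′

        l′⊆ : ∀ P → pointsOn l′ P → image to (pointsOn axis) P
        l′⊆ P = proj₁ (proj₂ (mapsLines axis)) {P}

        ⊆l′ : ∀ P → image to (pointsOn axis) P → pointsOn l′ P
        ⊆l′ P = proj₂ (proj₂ (mapsLines axis)) {P}

        to-S : ∀ P → arcOf C P → pointsOn axis P → S (to P)
        to-S P P∈ on = proj₂ K≐ {to P} (P , P∈ , ∼-refl (to P)) , ⊆l′ (to P) (P , on , ∼-refl (to P))

        empty⇒⊥ : ¬ HasSize S 0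
        empty⇒⊥ (_ , _ , surj) with () ← proj₁ (surj (to nucleus , to-S nucleus (inj₁ (∼-refl nucleus))
          (solve 0 (con false :* con false :+ con true :* con false :+ con false :* con true := con false) refl)))

        eight : HasSize S 8
        eight = [ (λ h → contradiction h empty⇒⊥) , id ]′ (meets l′)

        R : Fin 8 → Point
        R i = proj₁ (proj₁ eight i)

        pre : ∀ i → image to (arcOf C) (R i)
        pre i = proj₁ K≐ {R i} (proj₁ (proj₂ (proj₁ eight i)))

        Q : Fin 8 → Point
        Q i = proj₁ (pre i)

        Q↦R : ∀ i → to (Q i) ∼ R i
        Q↦R i = proj₂ (proj₂ (pre i))

        axis-resp : ∀ P P′ → P ∼ P′ → pointsOn axis P → pointsOn axis P′
        axis-resp P P′ (c , _ , eq) on = ⟨⟩⇒on axis {P′} (trans (cong ⟨ proj₁ axis ,_⟩ eq) (trans (⟨⟩-· (proj₁ axis) c (proj₁ P)) (trans (cong (c *_) (on⇒⟨⟩ axis {P} on)) (zeroʳ c))))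

        Q-axis : ∀ i → pointsOn axis (Q i)
        Q-axis i = let P , on , P↦R = l′⊆ (R i) (proj₂ (proj₂ (proj₁ eight i))) in
          axis-resp P (Q i) (proj₁ bijective {P} {Q i} (∼-trans (to P) (R i) (to (Q i)) P↦R (∼-sym (to (Q i)) (R i) (Q↦R i)))) on

        Q-injective : ∀ i j → Q i ∼ Q j → i ≡ j
        Q-injective i j Qi∼Qj = proj₁ (proj₂ eight) (∼-trans (R i) (to (Q i)) (R j) (∼-sym (to (Q i)) (R i) (Q↦R i))
          (∼-trans (to (Q i)) (to (Q j)) (R j) (congruent {Q i} {Q j} Qi∼Qj) (Q↦R j)))

        Q-surjective : ∀ P → arcOf C P → pointsOn axis P → ∃ λ i → Q i ∼ P
        Q-surjective P P∈ on = let i , h = proj₂ (proj₂ eight) (to P , to-S P P∈ on) in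
          i , proj₁ bijective {Q i} {P} (∼-trans (to (Q i)) (R i) (to P) (Q↦R i) (h refl))

      open Closed.Eight closed-C Q (λ i → proj₁ (proj₂ (pre i))) Q-axis Q-injective Q-surjective public

    -- A Denniston presentation would, by the fundamental theorem, give a semilinear map taking
    -- conics with a common `α` into the cubic arc, and four of them already contradict
    -- `no-constant-source`.
    cubicArc-not-Denniston : ∀ t (ind : IndependentF t) (iso : IsotropicF t) → ¬ IsDennistonType (cubicArc t)
    cubicArc-not-Denniston t₀ ind₀ iso₀ (C , closed-C , (α₀ , _ , constant) , φ , K≐) =
      no-constant-source g t₀ α₀ μs unique (ℕ.≤-refl {4}) sources
      where
      open OfDegree8 (cubicMaximalArc t₀ ind₀ iso₀) closed-C φ K≐
      g = proj₁ (fundamental-theorem φ)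
      ss : List (Vec Bool 3)
      ss = (true ∷ true ∷ true ∷ []) ∷ (true ∷ true ∷ false ∷ []) ∷ (true ∷ false ∷ true ∷ []) ∷ (true ∷ false ∷ false ∷ []) ∷ []
      ss-unique : Unique ss
      ss-unique = ((λ ()) ∷ (λ ()) ∷ (λ ()) ∷ []) ∷ ((λ ()) ∷ (λ ()) ∷ []) ∷ ((λ ()) ∷ []) ∷ [] ∷ []
      μs : List Carrier
      μs = List.map (λ s → lin s t) ss
      unique : Unique μs
      unique = Unique.map⁺ (lin-injective {t} independent) ss-unique
      source : ∀ s → s ≢ 0ⱽ → Source g t₀ (λ _ → α₀) (lin s t)
      source s s≢0 = (λ eq → s≢0 (independent s eq)) , λ P P∈ →
        let F , F∈ , μ≡ , _ = combined s s≢0 ; α≡ , β≡ = constant F∈ in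
        arcOf-resp {cubicConics t₀} {Collineation.to φ P} {ΓL.act g P}
          (∼-sym (ΓL.act g P) (Collineation.to φ P) (proj₂ (fundamental-theorem φ) P))
          (proj₂ K≐ {Collineation.to φ P} (P , inj₂ (F , F∈ , subst (λ F → conicPoints F P) (sym (conic-cong α≡ β≡ μ≡)) P∈) , ∼-refl (Collineation.to φ P)))
      sources : All (Source g t₀ (λ _ → α₀)) μs
      sources = source (true ∷ true ∷ true ∷ []) (λ ()) ∷ source (true ∷ true ∷ false ∷ []) (λ ()) ∷
        source (true ∷ false ∷ true ∷ []) (λ ()) ∷ source (true ∷ false ∷ false ∷ []) (λ ()) ∷ []

  -- Frobenius images of cubic arcs.

  module FrobeniusImages where
    open Field
    open PG hiding (Tr)
    open Geometry hiding (semilinear)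
    open NormalBasis using (lin)
    open CubicArcs
    open CubicIsomorphisms using (shear)
    open ClosedSets
    open Coordinates
    open MathonArcs using (conic-cong)

    pull-shear : ∀ ε k {l l′} → l ≡ φ^ k l′ → pull (shear ε) (conic (α₃ l) 1# l) ≡ φ-conic k (conic (α₃ l′) 1# l′)
    pull-shear ε k {l} {l′} refl = conic-cong
      (trans (trans (solve 3 (λ A u l → A :* (con true :* con true) :+ con true :* u :+ con true :* (u :* u) :+ l :* (con false :* con false) := A :+ (u :+ u :* u)) refl (α₃ l) (bit ε) l)
        (trans (cong (α₃ l +_) (bit-² ε)) (+-identityʳ (α₃ l))))
        (sym (trans (φ^-+ k 1# _) (cong₂ _+_ (φ^-1 k) (trans (φ^-* k _ l′) (cong (_* l) (φ^-* k l′ l′)))))))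
      (trans (solve 2 (λ A l → A :* (con false :* con false) :+ con false :* con true :+ con true :* (con true :* con true) :+ l :* (con false :* con false) := con true) refl (α₃ l) l) (sym (φ^-1 k)))
      (trans (cong (l *_) (*-identityˡ 1#)) (*-identityʳ l))
      where
      bit-² : ∀ ε → bit ε + bit ε ² ≡ 0#
      bit-² true  = solve 0 (con true :+ con true :* con true := con false) refl
      bit-² false = solve 0 (con false :+ con false :* con false := con false) refl

    -- Frobenius images of subspaces correspond to Frobenius images of cubic arcs.
    frobenius-shear-image : ∀ ε {k} (k<7 : k ℕ.< 7) (t u : Triple) → Independent t → Independent u → t ⊑ rotᵗ k u → rotᵗ k u ⊑ t →
                            cubicArc (basisOf t) ≐ image (ΓL.act (transform (shear ε) k<7)) (cubicArc (basisOf u))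
    frobenius-shear-image ε {k} k<7 t u ind-t ind-u t⊑ ⊑t = arc-image (shear ε) k<7 {cubicConics (basisOf t)} {cubicConics (basisOf u)}
      (λ { (s , s≢0 , refl) → let r , eq = ⊑⇒lin t⊑ s ; eq′ = trans (sym eq) (lin-rot k r u) in
           conic (α₃ (lin r (basisOf u))) 1# (lin r (basisOf u)) ,
           (r , (λ r≡0 → s≢0 (independentF ind-t s (trans eq′ (trans (cong (φ^ k) (lin-at-0 u r≡0)) (φ^-0 k))))) , refl) , pull-shear ε k eq′ })
      (λ { (r , r≢0 , refl) → let s , eq = ⊑⇒lin ⊑t r ; eq′ = trans eq (lin-rot k r u) in
           conic (α₃ (lin s (basisOf t))) 1# (lin s (basisOf t)) ,
           (s , (λ s≡0 → r≢0 (independentF ind-u r (φ^-injective k (trans (sym eq′) (trans (lin-at-0 t s≡0) (sym (φ^-0 k))))))) , refl) , pull-shear ε k eq′ })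
      where
      lin-at-0 : ∀ (t : Triple) {s} → s ≡ 0ⱽ → lin s (basisOf t) ≡ 0#
      lin-at-0 t refl = trans (lin-elem 0ⱽ t) (trans (cong (NormalBasis.elem) (combine-0 t)) elem-0)

    ∘ᴳ-image : ∀ g h {S : PointSet} → image (ΓL.act (g ∘ᴳ h)) S ≐ image (ΓL.act g) (image (ΓL.act h) S)
    ∘ᴳ-image g h {S} = image-∘ {ΓL.act g} {ΓL.act h} {ΓL.act (g ∘ᴳ h)} {S} (λ {P} {Q} → Act.act-cong g {P} {Q})
      (λ P → same-vector (ΓL.act (g ∘ᴳ h) P) (ΓL.act g (ΓL.act h P)) refl)

  -- Every proper Mathon arc of degree 8 is isomorphic to a listed cubic arc.

  module Classification {n : ℕ} (reps : Fin n → Triple)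
    (reps-classify : ∀ (t : Triple) → Independent t → Isotropic t → ∃₂ λ i k → k ℕ.< 7 × t ⊑ rotᵗ k (reps i) × rotᵗ k (reps i) ⊑ t)
    where
    open Field
    open PG hiding (Tr)
    open Geometry hiding (semilinear)
    open NormalBasis using (lin; lin-⊞)
    open Conics
    open CubicArcs
    open CubicIsomorphisms using (shear)
    open FundamentalTheorem using (divide-by; fundamental-theorem)
    open ClosedSets
    open NormalForm
    open Coordinates
    open MathonArcs hiding (module OfDegree8)
    open FrobeniusImages
    open Conic

    private
      -- A closed set whose conics are given by cubic polynomials in the parameter.
      module Parametrized (K : PointSet) {C : Pred Conic 0ℓ} (closed-C : IsClosed C) (φ : Collineation)
             (K≐ : K ≐ image (Collineation.to φ) (arcOf C)) (t : Basis) (ind : IndependentF t) (p₀ p₁ p₂ r₀ r₁ r₂ : Carrier)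
             (parameter : ∀ {F} → C F → ∃ λ s → s ≢ 0ⱽ × F ≡ conic (cubic p₀ p₁ p₂ (lin s t)) (cubic r₀ r₁ r₂ (lin s t)) (lin s t))
             (conic-of : ∀ s → s ≢ 0ⱽ → C (conic (cubic p₀ p₁ p₂ (lin s t)) (cubic r₀ r₁ r₂ (lin s t)) (lin s t)))
             where
        trace : ∀ s → s ≢ 0ⱽ → tr (cubic p₀ p₁ p₂ (lin s t) * cubic r₀ r₁ r₂ (lin s t)) ≡ 1#
        trace s s≢0 = Closed.tr≡1 closed-C (conic-of s s≢0)

        at : Carrier → Conic
        at l = conic (cubic p₀ p₁ p₂ l) (cubic r₀ r₁ r₂ l) l

        pulled : ∀ T {C′ : Pred Conic 0ℓ} (f : Vec Bool 3 → Conic) → (∀ s → s ≢ 0ⱽ → C′ (f s)) → (∀ {F} → C′ F → ∃ λ s → s ≢ 0ⱽ × F ≡ f s) →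
                 (∀ s → pull T (at (lin s t)) ≡ f s) → arcOf C ≐ image (act-linear T) (arcOf C′)
        pulled T {C′} f f∈ f-complete eq = arc-image T {0} (s≤s z≤n) {C} {C′}
          (λ F∈ → let s , s≢0 , F≡ = parameter F∈ in f s , f∈ s s≢0 , trans (cong (pull T) F≡) (eq s))
          (λ F′∈ → let s , s≢0 , F′≡ = f-complete F′∈ in at (lin s t) , conic-of s s≢0 , trans (eq s) (sym F′≡))

        denniston : p₂ ≡ 0# → r₂ ≡ 0# → IsDennistonType K
        denniston p₂≡0 r₂≡0 = C′ , closed-C′ , (p₀ * r₀ , trans (Tr≡tr _) (tr-constant t ind p₀ p₁ p₂ r₀ r₁ r₂ trace) , λ { (_ , _ , refl) → refl , refl }) ,
          φ ∘ᶜ collineation T , ≐-trans {K} {image to (arcOf C)} {image (to ∘ act-linear T) (arcOf C′)} K≐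
            (≐-trans {image to (arcOf C)} {image to (image (act-linear T) (arcOf C′))} {image (to ∘ act-linear T) (arcOf C′)}
              (image-mono {to} {to} {arcOf C} {image (act-linear T) (arcOf C′)} (λ P → ∼-refl (to P))
                (pulled T (λ s → conic (p₀ * r₀) 1# (lin s t)) (λ s s≢0 → s , s≢0 , refl) id (λ s → T-pull (lin s t))))
              (≐-sym {image (to ∘ act-linear T) (arcOf C′)} {image to (image (act-linear T) (arcOf C′))}
                (image-∘ {to} {act-linear T} {to ∘ act-linear T} {arcOf C′} (λ {P} {Q} → congruent {P} {Q}) (λ P → ∼-refl (to (act-linear T P))))))
          where
          open Collineation φ using (to; congruent)
          tr-p₀r₀ : tr (p₀ * r₀ * 1#) ≡ 1#
          tr-p₀r₀ = trans (cong tr (*-identityʳ _)) (tr-constant t ind p₀ p₁ p₂ r₀ r₁ r₂ trace)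
          T = proj₁ (denniston-form t ind p₀ p₁ p₂ r₀ r₁ r₂ trace p₂≡0 r₂≡0)
          T-pull = proj₂ (denniston-form t ind p₀ p₁ p₂ r₀ r₁ r₂ trace p₂≡0 r₂≡0)
          C′ : Pred Conic 0ℓ
          C′ F = ∃ λ s → s ≢ 0ⱽ × F ≡ conic (p₀ * r₀) 1# (lin s t)
          closed-C′ : IsClosed C′
          closed-C′ = record
            { admissible = λ { (s , s≢0 , refl) → trans (Tr≡tr _) tr-p₀r₀ , λ eq → s≢0 (ind s eq) }
            ; composable = λ { (_ , _ , refl) (_ , _ , refl) F≢F′ eq → F≢F′ (cong (conic (p₀ * r₀) 1#) eq) }
            ; closed = λ { (r , _ , refl) (s , _ , refl) F≢F′ → r ⊞ s , (λ eq → F≢F′ (cong (λ s → conic (p₀ * r₀) 1# (lin s t)) (⊞≡0⇒≡ eq))) ,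
                (let ≢0 = λ eq → F≢F′ (cong (conic (p₀ * r₀) 1#) (x+y≡0⇒x≡y eq)) in conic-cong
                  (divide-≡ ≢0 (sym (distribˡ _ _ _))) (divide-≡ ≢0 (sym (distribˡ _ _ _))) (sym (lin-⊞ r s t))) } }

        decide : Dec (p₂ ≡ 0#) → Dec (r₂ ≡ 0#) → ¬ IsDennistonType K → p₂ ≢ 0# ⊎ r₂ ≢ 0#
        decide (no h) _ _ = inj₁ h
        decide _ (no h) _ = inj₂ h
        decide (yes p) (yes q) ¬den = contradiction (denniston p q) ¬den

        -- Three maps are composed: the Frobenius power from the listed subspace to the one found,
        -- the normalizing transformation `N.T`, and the semilinear map underlying the given
        -- collineation.
        classify : (∀ i → Independent (reps i)) → ¬ IsDennistonType K → ∃₂ λ i g → K ≐ image (ΓL.act g) (cubicArc (basisOf (reps i)))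
        classify reps-independent ¬den = i , g , K≐′
          where
          module N = Cubic t ind p₀ p₁ p₂ r₀ r₁ r₂ trace (decide (p₂ ≟ 0#) (r₂ ≟ 0#) ¬den)
          u : Triple
          u = proj₁ (basisOf-surjective N.scaled)
          u≡ : basisOf u ≡ N.scaled
          u≡ = proj₂ (basisOf-surjective N.scaled)
          u-independent : Independent u
          u-independent = independent (subst IndependentF (sym u≡) N.scaled-independent)
          found = reps-classify u u-independent (isotropic (subst IsotropicF (sym u≡) N.scaled-isotropic))
          i = proj₁ found
          k = proj₁ (proj₂ found)
          k<7 = proj₁ (proj₂ (proj₂ found))
          v : Basis
          v = basisOf (reps i)
          g₁ g₂ g₃ g : ΓL
          g₁ = proj₁ (fundamental-theorem φ)
          g₂ = linear N.T
          g₃ = transform (shear false) k<7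
          g = g₁ ∘ᴳ g₂ ∘ᴳ g₃
          step₂ : arcOf C ≐ image (ΓL.act g₂) (cubicArc (basisOf u))
          step₂ = subst (λ w → arcOf C ≐ image (ΓL.act g₂) (cubicArc w)) (sym u≡)
            (pulled N.T {cubicConics N.scaled} (λ s → conic (α₃ (lin s N.scaled)) 1# (lin s N.scaled)) (λ s s≢0 → s , s≢0 , refl) id N.pull-T)
          step₃ : cubicArc (basisOf u) ≐ image (ΓL.act g₃) (cubicArc v)
          step₃ = frobenius-shear-image false k<7 u (reps i) u-independent (reps-independent i)
            (proj₁ (proj₂ (proj₂ (proj₂ found)))) (proj₂ (proj₂ (proj₂ (proj₂ found))))
          step₂₃ : arcOf C ≐ image (ΓL.act (g₂ ∘ᴳ g₃)) (cubicArc v)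
          step₂₃ = ≐-trans {arcOf C} {image (ΓL.act g₂) (image (ΓL.act g₃) (cubicArc v))} {image (ΓL.act (g₂ ∘ᴳ g₃)) (cubicArc v)}
            (≐-trans {arcOf C} {image (ΓL.act g₂) (cubicArc (basisOf u))} {image (ΓL.act g₂) (image (ΓL.act g₃) (cubicArc v))} step₂
              (image-mono {ΓL.act g₂} {ΓL.act g₂} {cubicArc (basisOf u)} {image (ΓL.act g₃) (cubicArc v)} (λ P → ∼-refl (ΓL.act g₂ P)) step₃))
            (≐-sym {image (ΓL.act (g₂ ∘ᴳ g₃)) (cubicArc v)} {image (ΓL.act g₂) (image (ΓL.act g₃) (cubicArc v))} (∘ᴳ-image g₂ g₃ {cubicArc v}))
          K≐′ : K ≐ image (ΓL.act g) (cubicArc v)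
          K≐′ = ≐-trans {K} {image (Collineation.to φ) (arcOf C)} {image (ΓL.act g) (cubicArc v)} K≐
            (≐-trans {image (Collineation.to φ) (arcOf C)} {image (ΓL.act g₁) (image (ΓL.act (g₂ ∘ᴳ g₃)) (cubicArc v))} {image (ΓL.act g) (cubicArc v)}
              (image-mono {Collineation.to φ} {ΓL.act g₁} {arcOf C} {image (ΓL.act (g₂ ∘ᴳ g₃)) (cubicArc v)} (proj₂ (fundamental-theorem φ)) step₂₃)
              (≐-sym {image (ΓL.act g) (cubicArc v)} {image (ΓL.act g₁) (image (ΓL.act (g₂ ∘ᴳ g₃)) (cubicArc v))} (∘ᴳ-image g₁ (g₂ ∘ᴳ g₃) {cubicArc v})))

    -- Both `α * μ` and `β * μ` are linear on the space of parameters, so interpolation supplies the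
    -- six coefficients on which the normal form is built.
    classify-arc : (∀ i → Independent (reps i)) → ∀ (K : ProperMathonArc 8) → ∃₂ λ i g → pointsOf K ≐ image (ΓL.act g) (cubicArc (basisOf (reps i)))
    classify-arc reps-independent (K , (C , closed-C , φ , K≐) , ¬den) =
      from-coefficients (interpolate O.t O.independent O.A) (interpolate O.t O.independent O.B)
      where
      module O = MathonArcs.OfDegree8 K closed-C φ K≐

      from-coefficients : (∃ λ p₀ → ∃ λ p₁ → ∃ λ p₂ → ∀ s → lin s O.A ≡ quartic p₀ p₁ p₂ (lin s O.t)) →
                          (∃ λ r₀ → ∃ λ r₁ → ∃ λ r₂ → ∀ s → lin s O.B ≡ quartic r₀ r₁ r₂ (lin s O.t)) →
                          ∃₂ λ i g → MaximalArc.points K ≐ image (ΓL.act g) (cubicArc (basisOf (reps i)))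
      from-coefficients (p₀ , p₁ , p₂ , p) (r₀ , r₁ , r₂ , r) =
        Parametrized.classify (MaximalArc.points K) closed-C φ K≐ O.t O.independent p₀ p₁ p₂ r₀ r₁ r₂
          (λ F∈ → let s , s≢0 , m = O.complete F∈ in s , s≢0 , member-conic {s} m)
          (λ s s≢0 → let F , m = O.combined s s≢0 in subst C (member-conic {s} m) (proj₁ m))
          reps-independent ¬den
        where
        member-conic : ∀ {s F} → O.Member s F → F ≡ conic (cubic p₀ p₁ p₂ (lin s O.t)) (cubic r₀ r₁ r₂ (lin s O.t)) (lin s O.t)
        member-conic {s} {F} (F∈ , μ≡ , A≡ , B≡) = conic-cong
          (trans (cubic-quartic (Closed.μ≢0 closed-C F∈) (trans A≡ (trans (p s) (cong (quartic p₀ p₁ p₂) (sym μ≡))))) (cong (cubic p₀ p₁ p₂) μ≡))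
          (trans (cubic-quartic (Closed.μ≢0 closed-C F∈) (trans B≡ (trans (r s) (cong (quartic r₀ r₁ r₂) (sym μ≡))))) (cong (cubic r₀ r₁ r₂) μ≡))
          μ≡

  -- Automorphism groups of cubic arcs.

  module Automorphisms where
    open Field
    open PG hiding (Tr)
    open Geometry hiding (semilinear)
    open NormalBasis
    open CubicArcs
    open CubicIsomorphisms
    open Coordinates
    open FrobeniusImages

    ≈ₚ-sym : ∀ {g h} → g ≈ₚ h → h ≈ₚ g
    ≈ₚ-sym {g} {h} (c , c≢0 , eq) = c ⁻¹ , ⁻¹-≢0 c≢0 , λ v → ·-cancel (ΓL.to g v) (ΓL.to h v) c≢0 (eq v)

    ≈ₚ-trans : ∀ {g h k} → g ≈ₚ h → h ≈ₚ k → g ≈ₚ k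
    ≈ₚ-trans (c , c≢0 , p) (d , d≢0 , q) = d * c , *-≢0 d≢0 c≢0 , λ v → trans (q v) (trans (cong (d ·_) (p v)) (·-assoc d c _))

    FrobeniusShear : ΓL → ℕ → Bool → Set
    FrobeniusShear g k ε = ∃ λ c → c ≢ 0# × ∀ v → ΓL.to g v ≡ c · Transformation.apply (shear ε) (φᵥ k v)

    -- The normal form of `g` and the action on parameters carry the same exponent `k`; this ties
    -- isomorphisms of arcs to cyclic shifts of subspaces.
    isomorphism : ∀ g (t u : Triple) → Independent t → (∀ P → cubicArc (basisOf t) P → cubicArc (basisOf u) (ΓL.act g P)) →
                  ∃₂ λ (k : Fin 7) ε → rotᵗ (toℕ k) t ⊑ u × FrobeniusShear g (toℕ k) ε
    isomorphism g t u ind maps =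
      let k , σ≡ = Act.frobenius g
          c , c≢0 , ε , eq = isomorphism-normal-form g (basisOf t) (basisOf u) (independentF ind) maps
      in k , ε ,
        lin⇒⊑ {rotᵗ (toℕ k) t} {u} (λ s → let r , p = isomorphism-parameters g (basisOf t) (basisOf u) (independentF ind) maps s in
          r , trans p (trans (σ≡ _) (sym (lin-rot (toℕ k) s t)))) ,
        c , c≢0 , λ v → trans (eq v) (cong (λ w → c · Transformation.apply (shear ε) w) (Vec.map-cong σ≡ v))

    image-points : ∀ g {S T : PointSet} → T ≐ image (ΓL.act g) S → ∀ P → S P → T (ΓL.act g P)
    image-points g (_ , ⊇) P P∈ = ⊇ {ΓL.act g P} (P , P∈ , ∼-refl (ΓL.act g P))

    opaque
      rot-unit-injective : ∀ (j k : Fin 7) → rot^ (toℕ j) (unit zero) ≡ rot^ (toℕ k) (unit zero) → j ≡ k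
      rot-unit-injective = from-yes (Fin.all? λ (j : Fin 7) → Fin.all? λ (k : Fin 7) →
        (rot^ (toℕ j) (unit zero) ≟ⱽ rot^ (toℕ k) (unit zero)) →-dec (j Fin.≟ k))

    -- The shifts that preserve the subspace are those with exponent below `m`. As 7 is prime, the
    -- relevant values are 1 and 7, and the two shears double the count.
    module _ (t : Triple) (ind : Independent t) {m : ℕ} (m≤7 : m ℕ.≤ 7) (fixed : ∀ {k} → k ℕ.< m → rotᵗ k t ⊑ t)
             (only : ∀ (k : Fin 7) → rotᵗ (toℕ k) t ⊑ t → toℕ k ℕ.< m) (reverse : ∀ {k} → k ℕ.< m → t ⊑ rotᵗ k t) where
      private
        S : PointSet
        S = cubicArc (basisOf t)

        <7 : ∀ (k : Fin m) → toℕ k ℕ.< 7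
        <7 k = ℕ.<-≤-trans (Fin.toℕ<n k) m≤7

        element : Fin m × Fin 2 → ΓL
        element (k , ε) = transform (shear (does (ε Fin.≟ zero))) (<7 k)

        stabilizer : ∀ kε → S ≐ image (ΓL.act (element kε)) S
        stabilizer (k , ε) = frobenius-shear-image (does (ε Fin.≟ zero)) (<7 k) t t ind ind (reverse (Fin.toℕ<n k)) (fixed (Fin.toℕ<n k))

        rep : Fin (m ℕ.* 2) → Stabilizer S
        rep i = element (Fin.remQuot 2 i) , stabilizer (Fin.remQuot 2 i)

        -- The third coordinate at `z = 1` forces the scalar to be 1, the image of `(1 , 0 , 0)`
        -- then shows `ε`, and the action on a normal basis generator shows the exponent.
        element-injective : ∀ kε lδ → element kε ≈ₚ element lδ → kε ≡ lδ
        element-injective (k , ε) (l , δ) (c , c≢0 , eq) = cong₂ _,_ k≡l ε≡δ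
          where
          toBool : Fin 2 → Bool
          toBool ε = does (ε Fin.≟ zero)
          toBool-injective : ∀ {ε δ} → toBool ε ≡ toBool δ → ε ≡ δ
          toBool-injective {zero}     {zero}     _ = refl
          toBool-injective {suc zero} {suc zero} _ = refl
          at : ∀ x y z → _
          at x y z = coords (eq (x ∷ y ∷ z ∷ []))
          third : ∀ z → φ^ (toℕ l) z ≡ c * φ^ (toℕ k) z
          third z = trans (reduce (toℕ l)) (trans (proj₂ (proj₂ (at 0# 0# z))) (cong (c *_) (sym (reduce (toℕ k)))))
            where
            reduce : ∀ k → φ^ k z ≡ 0# * φ^ k 0# + 0# * φ^ k 0# + 1# * φ^ k z
            reduce k = solve 2 (λ a b → b := con false :* a :+ con false :* a :+ con true :* b) refl (φ^ k 0#) (φ^ k z)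
          c≡1 : c ≡ 1#
          c≡1 = sym (trans (sym (φ^-1 (toℕ l))) (trans (third 1#) (trans (cong (c *_) (φ^-1 (toℕ k))) (*-identityʳ c))))
          ε≡δ : ε ≡ δ
          ε≡δ = toBool-injective (bit-injective {toBool ε} {toBool δ} (sym (trans (reduce (toBool δ) (toℕ l)) (trans (proj₁ (proj₂ (at 1# 0# 0#)))
            (trans (cong₂ _*_ c≡1 (sym (reduce (toBool ε) (toℕ k)))) (*-identityˡ _))))))
            where
            reduce : ∀ b k → bit b ≡ bit b * φ^ k 1# + 1# * φ^ k 0#
            reduce b k = sym (trans (cong₂ (λ x y → bit b * x + 1# * y) (φ^-1 k) (φ^-0 k)) (solve 1 (λ b → b :* con true :+ con true :* con false := b) refl (bit b)))
          φ≡ : ∀ z → φ^ (toℕ l) z ≡ φ^ (toℕ k) z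
          φ≡ z = trans (third z) (trans (cong (_* φ^ (toℕ k) z) c≡1) (*-identityˡ _))
          k≡l : k ≡ l
          k≡l = Fin.toℕ-injective (trans (sym (Fin.toℕ-fromℕ< (<7 k))) (trans (cong toℕ (rot-unit-injective (Fin.fromℕ< (<7 k)) (Fin.fromℕ< (<7 l))
            (elem-injective (trans (elem-at k) (trans (sym (φ≡ (elem (unit zero)))) (sym (elem-at l))))))) (Fin.toℕ-fromℕ< (<7 l))))
            where
            elem-at : ∀ k → elem (rot^ (toℕ (Fin.fromℕ< (<7 k))) (unit zero)) ≡ φ^ (toℕ k) (elem (unit zero))
            elem-at k = trans (cong (λ k → elem (rot^ k (unit zero))) (Fin.toℕ-fromℕ< (<7 k))) (elem-rot^ (toℕ k) (unit zero))

        element-to : ∀ k ε {k′ ε′} → toℕ k ≡ k′ → does (ε Fin.≟ zero) ≡ ε′ → ∀ v →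
                     ΓL.to (element (k , ε)) v ≡ Transformation.apply (shear ε′) (φᵥ k′ v)
        element-to k ε refl refl v = refl

        from-shear : ∀ h {k} → k ℕ.< m → ∀ ε → FrobeniusShear h k ε → ∃ λ i → proj₁ (rep i) ≈ₚ h
        from-shear h {k} k<m ε (c , c≢0 , eq) = Fin.combine k′ (fromBool ε) ,
          subst (_≈ₚ h) (cong element (sym (Fin.remQuot-combine {m} {2} k′ (fromBool ε))))
            (c , c≢0 , λ v → trans (eq v) (cong (c ·_) (sym (element-to k′ (fromBool ε) (Fin.toℕ-fromℕ< k<m) (toBool-fromBool ε) v))))
          where
          k′ : Fin m
          k′ = Fin.fromℕ< k<m
          fromBool : Bool → Fin 2
          fromBool true  = zero
          fromBool false = suc zero
          toBool-fromBool : ∀ ε → does (fromBool ε Fin.≟ zero) ≡ ε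
          toBool-fromBool true  = refl
          toBool-fromBool false = refl

        surjective : ∀ (h : Stabilizer S) → ∃ λ i → proj₁ (rep i) ≈ₚ proj₁ h
        surjective (h , S≐) =
          let k , ε , kt⊑t , shear-form = isomorphism h t t ind (image-points h {S} {S} S≐)
          in from-shear h (only k kt⊑t) ε shear-form

      automorphism-order : AutOrder S (m ℕ.* 2)
      automorphism-order = rep ,
        (λ {i} {j} eq → trans (sym (Fin.combine-remQuot {m} 2 i)) (trans (cong (uncurry Fin.combine) (element-injective (Fin.remQuot 2 i) (Fin.remQuot 2 j) eq)) (Fin.combine-remQuot {m} 2 j))) ,
        λ h → let i , p = surjective h in i , λ { refl → p }

    module _ (g : ΓL) {K K′ : PointSet} (K-resp : ∀ {P Q} → P ∼ Q → K P → K Q) (K′≐ : K′ ≐ image (ΓL.act g) K) where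
      private
        open Act g
        g⁻¹ = g ⁻¹ᴳ

      K≐⁻¹ : K ≐ image (ΓL.act g⁻¹) K′
      K≐⁻¹ = image-flip {ΓL.act g} {ΓL.act g⁻¹} {K} {K′} (λ {P} {Q} → Act.act-cong g⁻¹ {P} {Q})
        (λ P → same-vector (ΓL.act g⁻¹ (ΓL.act g P)) P (to⁻¹-to (proj₁ P))) (λ P → same-vector (ΓL.act g (ΓL.act g⁻¹ P)) P (to-to⁻¹ (proj₁ P)))
        (λ {P} {Q} → K-resp {P} {Q}) K′≐

      private
        compose : ∀ g h {S T U : PointSet} → U ≐ image (ΓL.act g) T → T ≐ image (ΓL.act h) S → U ≐ image (ΓL.act (g ∘ᴳ h)) S
        compose g h {S} {T} {U} p q = ≐-trans {U} {image (ΓL.act g) T} {image (ΓL.act (g ∘ᴳ h)) S} p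
          (≐-trans {image (ΓL.act g) T} {image (ΓL.act g) (image (ΓL.act h) S)} {image (ΓL.act (g ∘ᴳ h)) S}
            (image-mono {ΓL.act g} {ΓL.act g} {T} {image (ΓL.act h) S} (λ P → ∼-refl (ΓL.act g P)) q)
            (≐-sym {image (ΓL.act (g ∘ᴳ h)) S} {image (ΓL.act g) (image (ΓL.act h) S)} (∘ᴳ-image g h {S})))

        conjugate : Stabilizer K → Stabilizer K′
        conjugate (h , K≐) = g ∘ᴳ h ∘ᴳ g⁻¹ , compose g (h ∘ᴳ g⁻¹) {K′} {K} {K′} K′≐ (compose h g⁻¹ {K′} {K} {K} K≐ K≐⁻¹)

        conjugate-injective : ∀ h h′ → proj₁ (conjugate h) ≈ₚ proj₁ (conjugate h′) → proj₁ h ≈ₚ proj₁ h′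
        conjugate-injective (h , _) (h′ , _) (c , c≢0 , eq) = ΓL.σ g⁻¹ c , Act.σ-≢0 g⁻¹ c≢0 , λ v → begin
          ΓL.to h′ v                                          ≡⟨ to⁻¹-to _ ⟨
          to⁻¹ (ΓL.to g (ΓL.to h′ v))                         ≡⟨ cong (λ w → to⁻¹ (ΓL.to g (ΓL.to h′ w))) (to⁻¹-to v) ⟨
          to⁻¹ (ΓL.to g (ΓL.to h′ (to⁻¹ (ΓL.to g v))))        ≡⟨ cong to⁻¹ (eq (ΓL.to g v)) ⟩
          to⁻¹ (c · ΓL.to g (ΓL.to h (to⁻¹ (ΓL.to g v))))     ≡⟨ ΓL.semilinear g⁻¹ c _ ⟩
          ΓL.σ g⁻¹ c · to⁻¹ (ΓL.to g (ΓL.to h (to⁻¹ (ΓL.to g v)))) ≡⟨ cong (ΓL.σ g⁻¹ c ·_) (trans (to⁻¹-to _) (cong (ΓL.to h) (to⁻¹-to v))) ⟩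
          ΓL.σ g⁻¹ c · ΓL.to h v                              ∎

      order-≤ : ∀ {m n} → AutOrder K m → AutOrder K′ n → m ℕ.≤ n
      order-≤ (rep , inj , _) (rep′ , _ , surj′) = Fin.injective⇒≤ {f = λ i → proj₁ (surj′ (conjugate (rep i)))} λ {i} {j} eq →
        inj (conjugate-injective (rep i) (rep j) (≈ₚ-trans {proj₁ (conjugate (rep i))} {proj₁ (rep′ (proj₁ (surj′ (conjugate (rep j)))))} {proj₁ (conjugate (rep j))}
          (≈ₚ-sym {proj₁ (rep′ (proj₁ (surj′ (conjugate (rep j)))))} {proj₁ (conjugate (rep i))} (proj₂ (surj′ (conjugate (rep i))) (sym eq)))
          (proj₂ (surj′ (conjugate (rep j))) refl)))

    -- Conjugation by `g` maps one stabilizer injectively into the other, and its inverse gives the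
    -- converse bound. The order is thus an isomorphism invariant, which separates the Singer arcs
    -- from the normal ones.
    order-unique : ∀ g {K K′ : PointSet} → (∀ {P Q} → P ∼ Q → K P → K Q) → (∀ {P Q} → P ∼ Q → K′ P → K′ Q) → K′ ≐ image (ΓL.act g) K →
                   ∀ {m n} → AutOrder K m → AutOrder K′ n → m ≡ n
    order-unique g {K} {K′} K-resp K′-resp K′≐ p q = ℕ.≤-antisym (order-≤ g {K} {K′} (λ {P} {Q} → K-resp {P} {Q}) K′≐ p q)
      (order-≤ (g ⁻¹ᴳ) {K′} {K} (λ {P} {Q} → K′-resp {P} {Q}) (K≐⁻¹ g {K} {K′} (λ {P} {Q} → K-resp {P} {Q}) K′≐) q p)

  -- From representatives of subspaces to the three cardinalities.

  module Counting {n : ℕ} (reps : Fin (2 ℕ.+ n) → Triple)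
    (reps-independent : ∀ i → Independent (reps i)) (reps-isotropic : ∀ i → Isotropic (reps i))
    (reps-linearizable : ∀ i → ∃ λ p → ∀ s → dot p (combine s (reps i)) ≡ dot (rot (combine s (reps i))) (combine s (reps i)))
    (reps-classify : ∀ (t : Triple) → Independent t → Isotropic t → ∃₂ λ i k → k ℕ.< 7 × t ⊑ rotᵗ k (reps i) × rotᵗ k (reps i) ⊑ t)
    (singer? : Fin (2 ℕ.+ n) → Bool) (singer₀ : singer? zero ≡ true) (singer₁ : singer? (suc zero) ≡ true)
    (normal : ∀ i → singer? (suc (suc i)) ≡ false)
    (reps-distinct : ∀ i j (k : Fin 7) → rotᵗ (toℕ k) (reps j) ⊑ reps i → j ≡ i × (k ≡ zero ⊎ singer? i ≡ true))
    (singer-fixed : ∀ i → singer? i ≡ true → ∀ (k : Fin 7) → rotᵗ (toℕ k) (reps i) ⊑ reps i)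
    where
    open Field
    open PG hiding (Tr)
    open Geometry hiding (semilinear)
    open NormalBasis
    open CubicArcs
    open Coordinates
    open MathonArcs using (cubicArc-isMathonType; cubicArc-not-Denniston)
    open Automorphisms
    open Classification reps reps-classify using (classify-arc)

    private
      ind : ∀ i → IndependentF (basisOf (reps i))
      ind i = independentF (reps-independent i)

      iso : ∀ i → IsotropicF (basisOf (reps i))
      iso i = isotropicF (reps-isotropic i)

      mathon : ∀ i → IsMathonType (cubicArc (basisOf (reps i)))
      mathon i = let p , eq = reps-linearizable i in cubicArc-isMathonType (basisOf (reps i)) (ind i) (elem p) λ s →
        let v = combine s (reps i) in begin
          tr (elem p * lin s (basisOf (reps i)))   ≡⟨ cong (λ l → tr (elem p * l)) (lin-elem s (reps i)) ⟩
          tr (elem p * elem v)                     ≡⟨ trace-form p v ⟩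
          bit (dot p v)                            ≡⟨ cong bit (eq s) ⟩
          bit (dot (rot v) v)                      ≡⟨ trace-form (rot v) v ⟨
          tr (elem (rot v) * elem v)               ≡⟨ cong (λ x → tr (x * elem v)) (elem-rot v) ⟩
          tr (elem v * elem v * elem v)            ≡⟨ cong (λ l → tr (l * l * l)) (lin-elem s (reps i)) ⟨
          tr (let l = lin s (basisOf (reps i)) in l * l * l) ∎

      opaque
        arc : Fin (2 ℕ.+ n) → ProperMathonArc 8
        arc i = cubicMaximalArc (basisOf (reps i)) (ind i) (iso i) , mathon i , cubicArc-not-Denniston (basisOf (reps i)) (ind i) (iso i)

        points-arc : ∀ i → pointsOf (arc i) ≡ cubicArc (basisOf (reps i))
        points-arc i = refl

      arc-resp : ∀ (K : ProperMathonArc 8) {P Q} → P ∼ Q → pointsOf K P → pointsOf K Q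
      arc-resp K {P} {Q} = MaximalArc.respects (proj₁ K) {P} {Q}

      arc-injective : ∀ {i j} → arc i ≅ arc j → i ≡ j
      arc-injective {i} {j} (g , Kj≐) =
        let k , _ , ki⊑j , _ = isomorphism g (reps i) (reps j) (reps-independent i)
                                 (image-points g {cubicArc (basisOf (reps i))} {cubicArc (basisOf (reps j))}
                                   (subst₂ (λ S T → T ≐ image (ΓL.act g) S) (points-arc i) (points-arc j) Kj≐))
        in proj₁ (reps-distinct j i k ki⊑j)

      arc-surjective : ∀ K → ∃ λ i → arc i ≅ K
      arc-surjective K = let i , g , K≐ = classify-arc reps-independent K in
        i , g , subst (λ S → pointsOf K ≐ image (ΓL.act g) S) (sym (points-arc i)) K≐

      singer-order : ∀ i → singer? i ≡ true → AutOrder (pointsOf (arc i)) 14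
      singer-order i special = subst (λ S → AutOrder S 14) (sym (points-arc i))
        (automorphism-order (reps i) (reps-independent i) {7} ℕ.≤-refl
          (λ k<7 → subst (λ k → rotᵗ k (reps i) ⊑ reps i) (Fin.toℕ-fromℕ< k<7) (singer-fixed i special (Fin.fromℕ< k<7)))
          (λ k _ → Fin.toℕ<n k)
          (λ {k} k<7 → reverse {k} (subst (λ k → rotᵗ k (reps i) ⊑ reps i) (Fin.toℕ-fromℕ< k<7) (singer-fixed i special (Fin.fromℕ< k<7)))))
        where
        reverse : ∀ {k} → rotᵗ k (reps i) ⊑ reps i → reps i ⊑ rotᵗ k (reps i)
        reverse {k} = ⊑-reverse {us = rotᵗ k (reps i)} {vs = reps i} (independent λ s eq →
          ind i s (φ^-injective k (trans (sym (lin-rot k s (reps i))) (trans eq (sym (φ^-0 k))))))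

      normal-order : ∀ i → singer? i ≡ false → AutOrder (pointsOf (arc i)) 2
      normal-order i ordinary = subst (λ S → AutOrder S 2) (sym (points-arc i))
        (automorphism-order (reps i) (reps-independent i) {1} (s≤s z≤n)
          (λ { (s≤s z≤n) → unrotated })
          (λ k ki⊑i → zero-only (proj₂ (reps-distinct i i k ki⊑i)))
          (λ { (s≤s z≤n) → reverse-unrotated }))
        where
        rot-0 : rotᵗ 0 (reps i) ≡ reps i
        rot-0 = Vec.map-id (reps i)
        unrotated : rotᵗ 0 (reps i) ⊑ reps i
        unrotated = subst (_⊑ reps i) (sym rot-0) (⊑-refl {vs = reps i})
        reverse-unrotated : reps i ⊑ rotᵗ 0 (reps i)
        reverse-unrotated = subst (reps i ⊑_) (sym rot-0) (⊑-refl {vs = reps i})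
        zero-only : ∀ {k : Fin 7} → k ≡ zero ⊎ singer? i ≡ true → toℕ k ℕ.< 1
        zero-only (inj₁ refl) = s≤s z≤n
        zero-only (inj₂ special) = contradiction (trans (sym special) ordinary) λ ()

      order-of : ∀ {K i m k} → arc i ≅ K → AutOrder (pointsOf K) m → AutOrder (pointsOf (arc i)) k → k ≡ m
      order-of {K} {i} (g , K≐) p q = order-unique g {pointsOf (arc i)} {pointsOf K} (λ {P} {Q} → arc-resp (arc i) {P} {Q}) (λ {P} {Q} → arc-resp K {P} {Q}) K≐ q p

    counts : HasCard {A = ProperMathonArc 8} _≅_ (2 ℕ.+ n) ×
             HasCard {A = Singer8Arc 𝔽} (_≅_ on proj₁) 2 ×
             HasCard {A = Normal8Arc 𝔽} (_≅_ on proj₁) n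
    counts =
      (arc , arc-injective , λ K → proj₁ (arc-surjective K) , λ { refl → proj₂ (arc-surjective K) }) ,
      (singer-arc , (λ {i} {j} eq → singer-index-injective i j (arc-injective eq)) , singer-surjective) ,
      (normal-arc , (λ eq → Fin.suc-injective (Fin.suc-injective (arc-injective eq))) , normal-surjective)
      where
      singer-index : Fin 2 → Fin (2 ℕ.+ n)
      singer-index zero       = zero
      singer-index (suc zero) = suc zero

      singer-index-injective : ∀ i j → singer-index i ≡ singer-index j → i ≡ j
      singer-index-injective zero       zero       _ = refl
      singer-index-injective (suc zero) (suc zero) _ = refl
      singer-index-injective zero       (suc zero) ()
      singer-index-injective (suc zero) zero       ()

      singer-special : ∀ i → singer? (singer-index i) ≡ true
      singer-special zero       = singer₀
      singer-special (suc zero) = singer₁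

      singer-arc : Fin 2 → Singer8Arc 𝔽
      singer-arc i = arc (singer-index i) , singer-order (singer-index i) (singer-special i)

      normal-arc : Fin n → Normal8Arc 𝔽
      normal-arc i = arc (suc (suc i)) , normal-order (suc (suc i)) (normal i)

      singer-match : ∀ (K : Singer8Arc 𝔽) i → arc i ≅ proj₁ K → ∃ λ j → ∀ {z} → z ≡ j → proj₁ (singer-arc z) ≅ proj₁ K
      singer-match K zero          p = zero , λ { refl → p }
      singer-match K (suc zero)    p = suc zero , λ { refl → p }
      singer-match K (suc (suc i)) p =
        contradiction (order-of {proj₁ K} {suc (suc i)} p (proj₂ K) (normal-order (suc (suc i)) (normal i))) λ ()

      singer-surjective : ∀ (K : Singer8Arc 𝔽) → ∃ λ i → ∀ {z} → z ≡ i → proj₁ (singer-arc z) ≅ proj₁ K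
      singer-surjective K = singer-match K (proj₁ (arc-surjective (proj₁ K))) (proj₂ (arc-surjective (proj₁ K)))

      normal-match : ∀ (K : Normal8Arc 𝔽) i → arc i ≅ proj₁ K → ∃ λ j → ∀ {z} → z ≡ j → proj₁ (normal-arc z) ≅ proj₁ K
      normal-match K zero          p = contradiction (order-of {proj₁ K} {zero} p (proj₂ K) (singer-order zero singer₀)) λ ()
      normal-match K (suc zero)    p = contradiction (order-of {proj₁ K} {suc zero} p (proj₂ K) (singer-order (suc zero) singer₁)) λ ()
      normal-match K (suc (suc i)) p = i , λ { refl → p }

      normal-surjective : ∀ (K : Normal8Arc 𝔽) → ∃ λ i → ∀ {z} → z ≡ i → proj₁ (normal-arc z) ≅ proj₁ K
      normal-surjective K = normal-match K (proj₁ (arc-surjective (proj₁ K))) (proj₂ (arc-surjective (proj₁ K)))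

-- The 201 orbits and the computations that verify them.

open import Data.List.Base using ([]; _∷_)

-- Bases of one subspace from each orbit, a vector being coded by the number with these binary digits.
-- The first two subspaces are the ones that are fixed by the cyclic shift.
codes : Vec (ℕ × ℕ × ℕ) 201
codes =
  (23 , 46 , 75) ∷ (29 , 39 , 78) ∷ (1 , 4 , 16) ∷ (1 , 4 , 48) ∷ (1 , 4 , 74) ∷ (1 , 4 , 90) ∷ (1 , 4 , 106) ∷ (1 , 4 , 122) ∷
  (1 , 8 , 20) ∷ (1 , 8 , 52) ∷ (1 , 8 , 66) ∷ (1 , 8 , 86) ∷ (1 , 8 , 98) ∷ (1 , 8 , 118) ∷ (1 , 12 , 20) ∷ (1 , 12 , 52) ∷
  (1 , 12 , 70) ∷ (1 , 12 , 82) ∷ (1 , 12 , 102) ∷ (1 , 12 , 114) ∷ (1 , 20 , 98) ∷ (1 , 20 , 102) ∷ (1 , 20 , 106) ∷ (1 , 20 , 110) ∷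
  (1 , 24 , 36) ∷ (1 , 24 , 40) ∷ (1 , 24 , 66) ∷ (1 , 24 , 78) ∷ (1 , 24 , 102) ∷ (1 , 24 , 106) ∷ (1 , 28 , 36) ∷ (1 , 28 , 44) ∷
  (1 , 28 , 70) ∷ (1 , 28 , 78) ∷ (1 , 28 , 98) ∷ (1 , 28 , 106) ∷ (1 , 36 , 66) ∷ (1 , 36 , 70) ∷ (1 , 36 , 90) ∷ (1 , 36 , 94) ∷
  (1 , 40 , 70) ∷ (1 , 40 , 78) ∷ (1 , 40 , 86) ∷ (1 , 40 , 94) ∷ (1 , 44 , 66) ∷ (1 , 44 , 78) ∷ (1 , 44 , 82) ∷ (1 , 44 , 94) ∷
  (1 , 48 , 74) ∷ (1 , 48 , 78) ∷ (1 , 48 , 82) ∷ (1 , 48 , 86) ∷ (1 , 52 , 66) ∷ (1 , 52 , 70) ∷ (1 , 52 , 74) ∷ (1 , 52 , 78) ∷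
  (1 , 56 , 70) ∷ (1 , 56 , 74) ∷ (1 , 56 , 86) ∷ (1 , 56 , 90) ∷ (1 , 60 , 66) ∷ (1 , 60 , 74) ∷ (1 , 60 , 82) ∷ (1 , 60 , 90) ∷
  (3 , 5 , 48) ∷ (3 , 5 , 73) ∷ (3 , 5 , 89) ∷ (3 , 5 , 105) ∷ (3 , 5 , 121) ∷ (3 , 13 , 21) ∷ (3 , 13 , 53) ∷ (3 , 13 , 68) ∷
  (3 , 13 , 81) ∷ (3 , 13 , 100) ∷ (3 , 13 , 113) ∷ (3 , 21 , 97) ∷ (3 , 21 , 100) ∷ (3 , 21 , 105) ∷ (3 , 21 , 108) ∷ (3 , 24 , 37) ∷
  (3 , 24 , 76) ∷ (3 , 24 , 100) ∷ (3 , 24 , 105) ∷ (3 , 29 , 37) ∷ (3 , 29 , 68) ∷ (3 , 29 , 76) ∷ (3 , 29 , 97) ∷ (3 , 29 , 105) ∷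
  (3 , 37 , 68) ∷ (3 , 37 , 89) ∷ (3 , 37 , 92) ∷ (3 , 40 , 68) ∷ (3 , 40 , 76) ∷ (3 , 40 , 84) ∷ (3 , 40 , 92) ∷ (3 , 45 , 76) ∷
  (3 , 45 , 81) ∷ (3 , 45 , 92) ∷ (3 , 53 , 68) ∷ (3 , 53 , 73) ∷ (3 , 53 , 76) ∷ (3 , 56 , 68) ∷ (3 , 56 , 73) ∷ (3 , 56 , 84) ∷
  (3 , 56 , 89) ∷ (3 , 61 , 73) ∷ (3 , 61 , 81) ∷ (3 , 61 , 89) ∷ (5 , 17 , 34) ∷ (5 , 17 , 35) ∷ (5 , 17 , 72) ∷ (5 , 17 , 73) ∷
  (5 , 17 , 106) ∷ (5 , 17 , 107) ∷ (5 , 18 , 35) ∷ (5 , 18 , 73) ∷ (5 , 18 , 75) ∷ (5 , 18 , 104) ∷ (5 , 18 , 106) ∷ (5 , 19 , 34) ∷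
  (5 , 19 , 72) ∷ (5 , 19 , 75) ∷ (5 , 19 , 105) ∷ (5 , 19 , 106) ∷ (5 , 34 , 73) ∷ (5 , 34 , 75) ∷ (5 , 34 , 88) ∷ (5 , 34 , 90) ∷
  (5 , 35 , 72) ∷ (5 , 35 , 75) ∷ (5 , 35 , 89) ∷ (5 , 35 , 90) ∷ (5 , 49 , 74) ∷ (5 , 49 , 75) ∷ (5 , 49 , 88) ∷ (5 , 49 , 89) ∷
  (5 , 50 , 72) ∷ (5 , 50 , 74) ∷ (5 , 50 , 89) ∷ (5 , 50 , 91) ∷ (5 , 51 , 73) ∷ (5 , 51 , 74) ∷ (5 , 51 , 88) ∷ (5 , 51 , 91) ∷
  (7 , 9 , 18) ∷ (7 , 9 , 50) ∷ (7 , 9 , 81) ∷ (7 , 9 , 99) ∷ (7 , 9 , 113) ∷ (7 , 18 , 97) ∷ (7 , 18 , 99) ∷ (7 , 18 , 104) ∷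
  (7 , 18 , 106) ∷ (7 , 25 , 34) ∷ (7 , 25 , 72) ∷ (7 , 25 , 97) ∷ (7 , 25 , 106) ∷ (7 , 27 , 34) ∷ (7 , 27 , 106) ∷ (7 , 34 , 88) ∷
  (7 , 34 , 90) ∷ (7 , 41 , 81) ∷ (7 , 41 , 88) ∷ (7 , 43 , 72) ∷ (7 , 43 , 83) ∷ (7 , 43 , 88) ∷ (7 , 50 , 72) ∷ (7 , 50 , 74) ∷
  (7 , 57 , 74) ∷ (7 , 57 , 81) ∷ (7 , 57 , 90) ∷ (7 , 59 , 74) ∷ (7 , 59 , 83) ∷ (9 , 18 , 38) ∷ (9 , 18 , 69) ∷ (9 , 18 , 99) ∷
  (9 , 18 , 100) ∷ (9 , 19 , 39) ∷ (9 , 19 , 101) ∷ (9 , 39 , 69) ∷ (9 , 39 , 81) ∷ (9 , 39 , 86) ∷ (9 , 50 , 87) ∷ (9 , 51 , 69) ∷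
  (9 , 51 , 81) ∷ (9 , 51 , 87) ∷ (9 , 52 , 81) ∷ (11 , 21 , 98) ∷ (11 , 21 , 102) ∷ (11 , 22 , 39) ∷ (11 , 22 , 98) ∷ (11 , 49 , 87) ∷
  (11 , 50 , 70) ∷ (11 , 50 , 87) ∷ (11 , 53 , 70) ∷ (13 , 23 , 35) ∷ (13 , 23 , 101) ∷ (13 , 35 , 82) ∷ (13 , 54 , 71) ∷ (13 , 54 , 83) ∷
  (13 , 55 , 83) ∷ []

rep : Fin 201 → Triple
rep i = let (a , b , c) = lookup codes i in bits 7 a ∷ bits 7 b ∷ bits 7 c ∷ []

opaque
  -- Here the search is evaluated: each echelon basis of a totally isotropic 3-space spans a cyclic
  -- shift of a listed space.
  complete : Complete rep (memo 7 necklace)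
  complete = Enumerate.exhausted refl

open Classify rep (memo 7 necklace) complete public using (classify)

-- Opaque, so that unification never runs a check.
opaque
  all? : ∀ {n} → (Fin n → Bool) → Bool
  all? {n} p = all p (List.allFin n)

  all?-sound : ∀ {n} (p : Fin n → Bool) → all? p ≡ true → ∀ i → p i ≡ true
  all?-sound {n} p eq i = go (List.allFin n) eq (List.∈-allFin i)
    where
    go : ∀ is → all p is ≡ true → i ∈ is → p i ≡ true
    go (j ∷ is) eq (here refl) = proj₁ (∧-elim eq)
    go (j ∷ is) eq (there i∈)  = go is (proj₂ (∧-elim {p j} eq)) i∈

any-sound : ∀ {A : Set} (p : A → Bool) xs → any p xs ≡ true → ∃ λ x → x ∈ xs × p x ≡ true
any-sound p xs eq = any-map-sound p id xs (trans (cong (any p) (List.map-id xs)) eq)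

all-map-sound : ∀ {n} {B : Set} (p : B → Bool) (f : Fin n → B) → all p (List.map f (List.allFin n)) ≡ true → ∀ i → p (f i) ≡ true
all-map-sound {n} p f eq i = go (List.allFin n) eq (List.∈-allFin i)
  where
  go : ∀ is → all p (List.map f is) ≡ true → i ∈ is → p (f i) ≡ true
  go (j ∷ is) eq (here refl) = proj₁ (∧-elim eq)
  go (j ∷ is) eq (there i∈)  = go is (proj₂ (∧-elim {p (f j)} eq)) i∈

not-sound : ∀ {b} → not b ≡ true → b ≡ false
not-sound {false} _ = refl

isotropic? : Triple → Bool
isotropic? t = every 3 λ r → every 3 λ s → not (symplectic (combine r t) (combine s t))

independent? : Triple → Bool
independent? t = every 3 λ r → r ≡ⱽ 0ⱽ ∨ not (combine r t ≡ⱽ 0ⱽ)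

cubic : Vec Bool 7 → Bool
cubic v = dot (rot v) v

linearizes : Triple → Vec Bool 7 → Bool
linearizes t p = every 3 λ s → not (dot p (combine s t) xor cubic (combine s t))

opaque
  unfolding all?
  isotropic-table : all? (isotropic? ∘ rep) ≡ true
  isotropic-table = refl

  independent-table : all? (independent? ∘ rep) ≡ true
  independent-table = refl

  linearizable-table : all? (λ i → any (linearizes (rep i)) (vectors 7)) ≡ true
  linearizable-table = refl

isotropic?-sound : ∀ t → isotropic? t ≡ true → Isotropic t
isotropic?-sound t eq r s = not-sound (every-sound 3 (λ s → not (symplectic (combine r t) (combine s t)))
  (every-sound 3 (λ r → every 3 λ s → not (symplectic (combine r t) (combine s t))) eq r) s)

rep-isotropic : ∀ i → Isotropic (rep i)
rep-isotropic i = isotropic?-sound (rep i) (all?-sound (isotropic? ∘ rep) isotropic-table i)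

independent?-sound : ∀ t → independent? t ≡ true → Independent t
independent?-sound t eq s s≡0 with s ≡ⱽ 0ⱽ in p | every-sound 3 (λ r → r ≡ⱽ 0ⱽ ∨ not (combine r t ≡ⱽ 0ⱽ)) eq s
... | true  | _ = ≡ⱽ-sound s 0ⱽ p
... | false | q = contradiction (trans (sym (not-sound q)) (cong (_≡ⱽ 0ⱽ) s≡0)) λ ()

rep-independent : ∀ i → Independent (rep i)
rep-independent i = independent?-sound (rep i) (all?-sound (independent? ∘ rep) independent-table i)

-- On an isotropic subspace the cubic symplectic is additive, hence represented by a vector.
linearizable-sound : ∀ t → any (linearizes t) (vectors 7) ≡ true →
                     ∃ λ p → ∀ s → dot p (combine s t) ≡ cubic (combine s t)
linearizable-sound t eq =
  let p , _ , eq′ = any-sound (linearizes t) (vectors 7) eq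
  in p , λ s → xor≡0 (not-sound (every-sound 3 (λ s → not (dot p (combine s t) xor cubic (combine s t))) eq′ s))
  where
  xor≡0 : ∀ {a b} → a xor b ≡ false → a ≡ b
  xor≡0 {true}  {true}  _ = refl
  xor≡0 {false} {false} _ = refl

rep-linearizable : ∀ i → ∃ λ p → ∀ s → dot p (combine s (rep i)) ≡ cubic (combine s (rep i))
rep-linearizable i = linearizable-sound (rep i)
  (all?-sound (λ i → any (linearizes (rep i)) (vectors 7)) linearizable-table i)

singer? : Fin 201 → Bool
singer? i = toℕ i ℕ.<ᵇ 2

module Clashes {n} (reps : Fin n → Triple) (special? : Fin n → Bool) where

  no-clash : Fin n → Fin 7 → Triple → Fin n × List (Vec Bool 7) → Bool
  no-clash j k t (i , s) = not (members t s) ∨ (does (j Fin.≟ i) ∧ (does (k Fin.≟ zero) ∨ special? i))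

  clash-free : List (Fin n × List (Vec Bool 7)) → Bool
  clash-free table = all? λ j → all? λ k → all (no-clash j k (rotᵗ (toℕ k) (reps j))) table

  with-span : Fin n → Fin n × List (Vec Bool 7)
  with-span i = i , span (reps i)

  -- The one check has two uses: different entries lie in different orbits, so their arcs are not
  -- isomorphic, and an entry that is not special is preserved by no nontrivial shift, which bounds
  -- its automorphism group.
  clash-free-sound : clash-free (List.map with-span (List.allFin n)) ≡ true → ∀ i j (k : Fin 7) →
                     rotᵗ (toℕ k) (reps j) ⊑ reps i → j ≡ i × (k ≡ zero ⊎ special? i ≡ true)
  clash-free-sound eq i j k j⊑i
    with members (rotᵗ (toℕ k) (reps j)) (span (reps i)) | members-complete {us = rotᵗ (toℕ k) (reps j)} j⊑i
       | all-map-sound (no-clash j k (rotᵗ (toℕ k) (reps j))) with-span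
           (all?-sound (λ k → all (no-clash j k (rotᵗ (toℕ k) (reps j))) (List.map with-span (List.allFin n)))
             (all?-sound (λ j → all? λ k → all (no-clash j k (rotᵗ (toℕ k) (reps j))) (List.map with-span (List.allFin n))) eq j) k) i
  ... | _ | refl | q with j Fin.≟ i | k Fin.≟ zero | q
  ...   | yes j≡i | yes k≡0 | _ = j≡i , inj₁ k≡0
  ...   | yes j≡i | no _    | s = j≡i , inj₂ s
  ...   | no _    | yes _   | ()
  ...   | no _    | no _    | ()

  fixed? : Fin n → Bool
  fixed? i = not (special? i) ∨ all? λ (k : Fin 7) → members (rotᵗ (toℕ k) (reps i)) (span (reps i))

  fixed-sound : all? fixed? ≡ true → ∀ i → special? i ≡ true → ∀ (k : Fin 7) → rotᵗ (toℕ k) (reps i) ⊑ reps i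
  fixed-sound eq i special k with special? i | special | all?-sound fixed? eq i
  ... | _ | refl | q = members-sound (rotᵗ (toℕ k) (reps i)) (reps i)
    (all?-sound (λ (k : Fin 7) → members (rotᵗ (toℕ k) (reps i)) (span (reps i))) q k)

open Clashes rep singer?

opaque
  unfolding all?
  clash-free-table : clash-free (List.map with-span (List.allFin 201)) ≡ true
  clash-free-table = refl

  fixed-table : all? fixed? ≡ true
  fixed-table = refl

rep-distinct : ∀ i j (k : Fin 7) → rotᵗ (toℕ k) (rep j) ⊑ rep i → j ≡ i × (k ≡ zero ⊎ singer? i ≡ true)
rep-distinct = clash-free-sound clash-free-table

singer-fixed : ∀ i → singer? i ≡ true → ∀ (k : Fin 7) → rotᵗ (toℕ k) (rep i) ⊑ rep i
singer-fixed = fixed-sound fixed-table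

open import Data.Nat.Base using (_^_)

theorem4 : (F : FiniteField (2 ^ 7)) → let open Plane 7 F in
    HasCard {A = ProperMathonArc 8} _≅_ 201 ×
    HasCard {A = Singer8Arc F} (_≅_ on proj₁) 2 ×
    HasCard {A = Normal8Arc F} (_≅_ on proj₁) 199
theorem4 F = Arcs.Counting.counts F rep rep-independent rep-isotropic rep-linearizable classify
  singer? refl refl (λ _ → refl) rep-distinct singer-fixed
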